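{- Let $b\ge1$ and let $E_b\equiv F_{2b}(x_{2b},0,x_{2b+2},0,x_{2b+4},\ldots)$ be the generating function of rooted bipartite maps of girth $2b$ with outer degree $2b$, where each variable $x_{2i}$ marks the number of inner faces of degree $2i$. Then $$E_b=V_{b-1}-\sum_{j=-1}^{b-2}V_jV_{b-j-1},$$ where $V_{ -1}=1,V_0,\ldots,V_b$ are the unique formal power series satisfying $$V_j=h_{j+1}(V_1,\ldots,V_{b-1})\quad\text{for all } j\in\{ -1,0,\ldots,b-2\},$$ $$V_j=\sum_{i\ge b}x_{2i}\binom{2i-1}{i-j-1}(1+V_0)^{i+j}\quad\text{for all } j\in\{b-1,b\}.$$
   Context: A planar map is a connected graph (loops and multiple edges allowed) embedded in the oriented sphere up to continuous deformation; the degree of a face is its number of incident corners (angular sections between consecutive half-edges around a vertex). The girth is the minimal length of a cycle; bipartite means the vertices can be properly 2-colored. A rooted map is a planar map with a marked corner; the root-face is the face containing it, its degree is the outer degree, and the other faces are inner faces. For $j\ge0$, $h_j(w_1,w_2,\ldots):=[t^j]\frac{1}{1-\sum_{i>0}t^iw_i}=\sum_{r\ge0}\sum_{i_1,\ldots,i_r>0,\ i_1+\cdots+i_r=j}w_{i_1}\cdots w_{i_r}$ (so $h_0=1$). $F_{2b}(x_{2b},x_{2b+1},\ldots)$ denotes the generating function of rooted maps of girth $2b$ and outer degree $2b$ where $x_i$ counts inner faces of degree $i$.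
   Formalization: Uniqueness of V_0,…,V_b is claimed among integer power series with zero constant term (without this it fails, e.g. for b=3); the statement is given for every finite set of variables x_{2b},…,x_{2(b+k-1)}, the others set to 0. -}

module Defs where

open import Data.Bool using (Bool; true; false; _∧_; _∨_; not; if_then_else_)
open import Data.Nat using (ℕ; zero; suc; _+_; _*_; _∸_; _≡ᵇ_; _≤ᵇ_; _<ᵇ_)
open import Data.Nat.Combinatorics using (_C_)
open import Data.Fin using (Fin; toℕ)
open import Data.List using (List; []; _∷_; map; concatMap; allFin; upTo; foldr; length)
open import Data.Bool.ListAction using (all; any)
open import Data.Vec using (Vec; []; _∷_; lookup; zipWith; tabulate)
open import Data.Nat using (_≤_; _<_)
open import Relation.Binary.PropositionalEquality using (_≡_)
open import Data.Product using (_×_; _,_; proj₁; proj₂)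
import Data.Fin
open import Data.Integer using (ℤ; +_; -[1+_]) renaming (_+_ to _+ℤ_; _*_ to _*ℤ_; _-_ to _-ℤ_)

count : {A : Set} → (A → Bool) → List A → ℕ
count p []       = 0
count p (x ∷ xs) = if p x then suc (count p xs) else count p xs

sumℤ : List ℤ → ℤ
sumℤ = foldr _+ℤ_ (+ 0)

productℤ : List ℤ → ℤ
productℤ = foldr _*ℤ_ (+ 1)

allVecs : {A : Set} → List A → (l : ℕ) → List (Vec A l)
allVecs xs zero    = [] ∷ []
allVecs xs (suc l) = concatMap (λ x → map (x ∷_) (allVecs xs l)) xs

_==_ : {d : ℕ} → Fin d → Fin d → Bool
i == j = toℕ i ≡ᵇ toℕ j

-- Formal power series in the k variables x_{2b}, x_{2b+2}, ..., x_{2(b+k-1)}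
-- (all other variables set to 0).  A monomial is its exponent vector
-- m : Vec ℕ k, where m[r] is the exponent of x_{2(b+r)}.
-- A series is its coefficient function, with integer coefficients.

Ser : ℕ → Set
Ser k = Vec ℕ k → ℤ

below : {k : ℕ} → Vec ℕ k → List (Vec ℕ k)
below []       = [] ∷ []
below (x ∷ xs) = concatMap (λ a → map (a ∷_) (below xs)) (upTo (suc x))

isZeroMono : {k : ℕ} → Vec ℕ k → Bool
isZeroMono []       = true
isZeroMono (x ∷ xs) = (x ≡ᵇ 0) ∧ isZeroMono xs

sameMono : {k : ℕ} → Vec ℕ k → Vec ℕ k → Bool
sameMono []       []       = true
sameMono (x ∷ xs) (y ∷ ys) = (x ≡ᵇ y) ∧ sameMono xs ys

zeroS : {k : ℕ} → Ser k
zeroS m = + 0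

constS : {k : ℕ} → ℤ → Ser k
constS c m = if isZeroMono m then c else + 0

oneS : {k : ℕ} → Ser k
oneS = constS (+ 1)

_⊕_ : {k : ℕ} → Ser k → Ser k → Ser k
(A ⊕ B) m = A m +ℤ B m

_⊖_ : {k : ℕ} → Ser k → Ser k → Ser k
(A ⊖ B) m = A m -ℤ B m

_⊛_ : {k : ℕ} → Ser k → Ser k → Ser k
(A ⊛ B) m = sumℤ (map (λ e → A e *ℤ B (zipWith _∸_ m e)) (below m))

powS : {k : ℕ} → Ser k → ℕ → Ser k
powS A zero    = oneS
powS A (suc n) = A ⊛ powS A n

ΣS : {k : ℕ} → List (Ser k) → Ser k
ΣS = foldr _⊕_ zeroS

ΠS : {k : ℕ} → List (Ser k) → Ser k
ΠS = foldr _⊛_ oneS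

varS : {k : ℕ} → Fin k → Ser k
varS r m = if sameMono m (tabulate (λ s → if r == s then 1 else 0)) then + 1 else + 0

compositions : ℕ → List (List ℕ)
compositions zero    = [] ∷ []
compositions (suc n) = map (1 ∷_) (compositions n) ++' concatMap inc (compositions n)
  where
  _++'_ : List (List ℕ) → List (List ℕ) → List (List ℕ)
  []       ++' ys = ys
  (x ∷ xs) ++' ys = x ∷ (xs ++' ys)
  inc : List ℕ → List (List ℕ)
  inc []       = []
  inc (x ∷ xs) = (suc x ∷ xs) ∷ []

hS : {k : ℕ} → ℕ → (ℕ → Ser k) → Ser k
hS j w = ΣS (map (λ c → ΠS (map w c)) (compositions j))

binomℤ : ℕ → ℤ → ℤ
binomℤ n (+ r)    = + (n C r)
binomℤ n -[1+ _ ] = + 0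

-- The system of the theorem.  We index V by t = j+1, so V t stands for
-- V_{t-1}, t ∈ {0,...,b+1}  (i.e. V_{-1},...,V_b).

hArgs : {k : ℕ} → ℕ → (ℕ → Ser k) → ℕ → Ser k
hArgs b V i = if (1 ≤ᵇ i) ∧ (i <ᵇ b) then V (suc i) else zeroS

-- Σ_{i ≥ b} x_{2i} binom(2i-1, i-j-1) (1+V_0)^{i+j}   with j = t-1,
-- i = b + r (variables x_{2i} with i ≥ b+k are set to 0)
rhsHigh : {k : ℕ} → ℕ → (ℕ → Ser k) → ℕ → Ser k
rhsHigh {k} b V t = ΣS (map term (allFin k))
  where
  term : Fin k → Ser k
  term r = varS r ⊛ (constS (binomℤ (2 * i ∸ 1) ((+ i) -ℤ (+ t)))
                     ⊛ powS (oneS ⊕ V 1) (i + t ∸ 1))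
    where i = b + toℕ r

IsSolution : {k : ℕ} → ℕ → (ℕ → Ser k) → Set
IsSolution {k} b V =
    (∀ t → t < b → ∀ m → V t m ≡ hS t (hArgs b V) m)
  × (∀ m → V b m ≡ rhsHigh b V b m)
  × (∀ m → V (suc b) m ≡ rhsHigh b V (suc b) m)
  × (∀ t → 1 ≤ t → t ≤ suc b → V t (tabulate (λ _ → 0)) ≡ + 0)

formula : {k : ℕ} → ℕ → (ℕ → Ser k) → Ser k
formula b V = V b ⊖ ΣS (map (λ t → V t ⊛ V (suc b ∸ t)) (upTo b))

-- Rooted planar maps as labelled combinatorial maps.
-- A map with n edges on half-edges Fin (2n): σ (rotation around vertices)
-- and α (fixed-point-free involution pairing half-edges into edges),
-- generating a transitive group.  Vertices = cycles of σ, edges = cycles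
-- of α, and the corner following half-edge h (between h and σ h) lies on
-- the face given by the cycle of φ = α∘σ containing h; faces = cycles of φ,
-- degree of a face = number of corners = cycle length.
-- Rooted: the root corner is the one following half-edge 0.

Perm : ℕ → Set
Perm d = Vec (Fin d) d

app : {d : ℕ} → Perm d → Fin d → Fin d
app f i = lookup f i

iter : {d : ℕ} → Perm d → ℕ → Fin d → Fin d
iter f zero    i = i
iter f (suc t) i = app f (iter f t i)

compose : {d : ℕ} → Perm d → Perm d → Perm d
compose g f = tabulate (λ i → app g (app f i))

isBij : {d : ℕ} → Perm d → Bool
isBij {d} f = all (λ i → all (λ j → not (app f i == app f j) ∨ (i == j)) (allFin d)) (allFin d)

isFPFInvolution : {d : ℕ} → Perm d → Bool
isFPFInvolution {d} a = all (λ i → (app a (app a i) == i) ∧ not (app a i == i)) (allFin d)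

sameCycle : {d : ℕ} → Perm d → Fin d → Fin d → Bool
sameCycle {d} f i j = any (λ t → iter f t i == j) (upTo d)

-- transitivity of ⟨σ,α⟩: every subset containing 0 and closed under σ and α is everything
connectedB : {d : ℕ} → Perm d → Perm d → Bool
connectedB {d} s a = all ok (allVecs (true ∷ false ∷ []) d)
  where
  ok : Vec Bool d → Bool
  ok S = not (closed S) ∨ all (lookup S) (allFin d)
    where
    closed : Vec Bool d → Bool
    closed S = (any (λ i → (toℕ i ≡ᵇ 0) ∧ lookup S i) (allFin d) ∨ (d ≡ᵇ 0))
             ∧ all (λ i → not (lookup S i) ∨ (lookup S (app s i) ∧ lookup S (app a i))) (allFin d)

isCycleMin : {d : ℕ} → Perm d → Fin d → Bool
isCycleMin {d} f i = all (λ t → toℕ i ≤ᵇ toℕ (iter f t i)) (upTo d)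

numCycles : {d : ℕ} → Perm d → ℕ
numCycles {d} f = count (isCycleMin f) (allFin d)

cycleLength : {d : ℕ} → Perm d → Fin d → ℕ
cycleLength {d} f i = count (sameCycle f i) (allFin d)

-- a cycle of length l in the underlying graph, given by half-edges
-- h_0..h_{l-1}: edge {h_r, α h_r} goes from vertex(h_r) to vertex(h_{r+1 mod l});
-- the l edges are pairwise distinct and the l vertices pairwise distinct.
isGraphCycle : {d l : ℕ} → Perm d → Perm d → Vec (Fin d) l → Bool
isGraphCycle {d} {l} s a hs =
     all (λ r → all (λ q → not (isNext r q) ∨
          sameCycle s (app a (lookup hs r)) (lookup hs q)) (allFin l)) (allFin l)
   ∧ all (λ r → all (λ q → (r == q) ∨
          (not (lookup hs q == lookup hs r) ∧ not (lookup hs q == app a (lookup hs r))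
           ∧ not (sameCycle s (lookup hs r) (lookup hs q)))) (allFin l)) (allFin l)
  where
  isNext : Fin l → Fin l → Bool
  isNext r q = (toℕ q ≡ᵇ suc (toℕ r)) ∨ ((toℕ q ≡ᵇ 0) ∧ (suc (toℕ r) ≡ᵇ l))

hasCycleOfLength : {d : ℕ} → Perm d → Perm d → ℕ → Bool
hasCycleOfLength {d} s a l = any (isGraphCycle s a) (allVecs (allFin d) l)

hasGirth : {d : ℕ} → Perm d → Perm d → ℕ → Bool
hasGirth s a g = hasCycleOfLength s a g ∧ all (λ l → not (hasCycleOfLength s a l)) (map suc (upTo (g ∸ 1)))

-- (σ, α) is a planar map with n edges on half-edges Fin (2n)
-- (planarity via Euler's formula  #V - #E + #F = 2)
isPlanarMap : (n : ℕ) → Perm (2 * n) → Perm (2 * n) → Bool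
isPlanarMap n s a = isBij s ∧ isFPFInvolution a ∧ connectedB s a
                  ∧ (numCycles s + numCycles (compose a s) ≡ᵇ n + 2)

innerFaces : {d : ℕ} → Perm d → Perm d → List (Fin d)
innerFaces {d} s a = go (allFin d)
  where
  φ = compose a s
  go : List (Fin d) → List (Fin d)
  go [] = []
  go (i ∷ is) = if isCycleMin φ i ∧ not (any (λ j → (toℕ j ≡ᵇ 0) ∧ sameCycle φ i j) (allFin d))
                then i ∷ go is else go is

rootFaceDegree : {d : ℕ} → Perm d → Perm d → ℕ
rootFaceDegree {zero}  s a = 0
rootFaceDegree {suc d} s a = cycleLength (compose a s) Data.Fin.zero

-- number of edges of a map counted by the monomial m with outer degree 2b:
-- 2n = 2b + Σ_r 2(b+r) m_r
edgesOf : {k : ℕ} → ℕ → Vec ℕ k → ℕ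
edgesOf {k} b m = b + foldr _+_ 0 (map (λ r → (b + toℕ r) * lookup m r) (allFin k))

goodMap : {k : ℕ} → (b : ℕ) → (m : Vec ℕ k) → Perm (2 * edgesOf b m) → Perm (2 * edgesOf b m) → Bool
goodMap {k} b m s a =
    isPlanarMap (edgesOf b m) s a
  ∧ hasGirth s a (2 * b)
  ∧ (rootFaceDegree s a ≡ᵇ 2 * b)
  ∧ all (λ r → count (λ i → cycleLength φ i ≡ᵇ 2 * (b + toℕ r)) (innerFaces s a) ≡ᵇ lookup m r) (allFin k)
  ∧ all (λ i → any (λ r → cycleLength φ i ≡ᵇ 2 * (b + toℕ r)) (allFin k)) (innerFaces s a)
  where φ = compose a s

labelledCount : {k : ℕ} → ℕ → Vec ℕ k → ℕ
labelledCount b m = count (λ p → goodMap b m (proj₁ p) (proj₂ p))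
  (concatMap (λ s → map (s ,_) (allVecs (allFin d) d)) (allVecs (allFin d) d))
  where d = 2 * edgesOf b m

{-# OPTIONS --safe #-}
-- Rooted planar maps are coded by the terms of their root-edge decomposition; a rooted map has no automorphisms, so a
-- map with 2n half-edges has (2n - 1)! labellings. Let A_n count the maps with boundary length n and no cycle shorter
-- than 2b. Removing a non-bridge root edge that borders an inner face of degree 1 + q leaves a map in which the corners
-- 0 and q are at distance at least 2b - 1. Cutting along the leftmost geodesic between these corners gives a
-- unitriangular system, A_{p+q} = Σ_{l<q} B_{p,l} Y_{l,q} + B_{p,q}, by which the geodesic series are eliminated. Hence the
-- A_n satisfy Tutte's equation for bipartite maps without girth constraint, for new face weights g_i that agree with
-- x_{2i} for i ≥ b. Its unique solution is explicit in z = u + R/u, and the condition that root faces of degree less than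
-- 2b bound only trees determines the g_i with i < b; read on the coefficients of the solution, it is the system for the V_j.
module Submission where

open import Defs
open import Data.Bool using (Bool; true; false; _∧_; _∨_; not; if_then_else_)
open import Data.Nat using (ℕ; zero; suc; _+_; _*_; _∸_; _≤_; _<_; z≤n; s≤s; _≡ᵇ_; _≤ᵇ_; _<ᵇ_; _!; _≤?_; _<?_)
open import Data.Nat.Properties as ℕP using (≤-refl; ≤-trans; ≤-reflexive; ≤-antisym; m≤m+n; m≤n+m; +-comm; +-assoc; +-suc; +-identityʳ; +-mono-≤; n≤1+n; ≤-pred; ≰⇒>; ≮⇒≥; m∸n≤m; m+n∸m≡n; m+[n∸m]≡n; *-comm; *-assoc; suc-injective; 1+n≰n; <-irrefl; ≤-<-trans; +-cancelˡ-≡; +-cancelʳ-≡)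
open import Data.Integer using (ℤ; +_) renaming (_+_ to _+ℤ_; _*_ to _*ℤ_; _-_ to _-ℤ_; -_ to -ℤ_)
import Data.Integer.Properties as ℤP
open import Data.Fin using (Fin; toℕ; fromℕ<; zero; suc)
import Data.Fin.Properties as FinP
open import Data.List using (List; []; _∷_; map; concatMap; concat; allFin; upTo; foldr; length; _++_; take; drop; filter; [_])
open import Data.Nat.ListAction using (sum)
open import Data.List.Properties as LP using (map-++; map-∘; map-cong; map-id; length-map; length-++; take++drop≡id; ++-assoc; ++-identityʳ; ∷-injective; length-take; length-drop)
open import Data.List.Membership.Propositional using (_∈_; _∉_)
open import Data.List.Membership.Propositional.Properties using (∈-map⁺; ∈-map⁻; ∈-++⁺ˡ; ∈-++⁺ʳ; ∈-++⁻; ∈-∃++; ∈-concat⁺′; ∈-concat⁻′; ∈-filter⁺; ∈-filter⁻; ∈-upTo⁺; ∈-upTo⁻; ∈-allFin; ∈-insert)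
open import Data.List.Relation.Unary.Any as Any using (Any; here; there; any?)
open import Data.List.Relation.Unary.All as All using (All; []; _∷_)
import Data.List.Relation.Unary.All.Properties as AllP
open import Data.List.Relation.Unary.AllPairs as AllPairs using (AllPairs; []; _∷_)
import Data.List.Relation.Unary.AllPairs.Properties as AllPairsP
open import Data.List.Relation.Unary.Unique.Propositional using (Unique)
import Data.List.Relation.Unary.Unique.Propositional.Properties as UP
open import Data.List.Relation.Binary.Permutation.Propositional using (_↭_; ↭-refl; ↭-sym; ↭-trans; ↭-reflexive; prep; swap)
import Data.List.Relation.Binary.Permutation.Propositional.Properties as PP
open import Data.List.Relation.Binary.Pointwise using (Pointwise; []; _∷_)
open import Data.Product using (Σ; ∃; _×_; _,_; proj₁; proj₂)
open import Data.Sum using (_⊎_; inj₁; inj₂)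
open import Data.Empty using (⊥; ⊥-elim)
open import Data.Unit using (⊤; tt)
open import Data.Vec as Vec using (Vec; []; _∷_; lookup)
import Data.Vec.Properties as VecP
open import Relation.Nullary using (¬_; Dec; yes; no; does)
open import Relation.Nullary.Decidable using (_×-dec_; ¬?; map′)
open import Relation.Binary.PropositionalEquality using (_≡_; _≢_; refl; sym; trans; cong; cong₂; subst; subst₂; module ≡-Reasoning)
open import Relation.Binary.Definitions using (DecidableEquality)
open import Function using (_∘_; id; case_of_)
import Data.Sum.Properties as SumP
import Data.Bool.Properties as BoolP
import Data.Nat.Tactic.RingSolver as ℕR
import Algebra.Solver.CommutativeMonoid as CMSolver
open import Data.Bool.ListAction using (all; any)
open import Data.Nat.Combinatorics using (nCk≡nC[n∸k]; nCk+nC[k+1]≡[n+1]C[k+1]; nCn≡1) renaming (_C_ to _choose_)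
open import Data.Integer using () renaming (_⊖_ to _⊖ℤ_)
open import Data.List using (applyUpTo; tabulate)
open import Relation.Binary.Definitions using (tri<; tri≈; tri>)
open import Algebra.Bundles using (CommutativeRing)
open import Level using (0ℓ)
import Algebra.Properties.Ring as RingP
import Algebra.Solver.Ring.NaturalCoefficients.Default as NatSolver
import Data.Integer.Tactic.RingSolver as ℤR
import Relation.Binary.Reasoning.Setoid as SetoidR

-- The geodesic series factor as B_{p,l} Y_{l,q} because distances between corners of the near side
-- do not depend on what lies beyond the geodesic: any far side and a bare path of the same length
-- admit 1-Lipschitz maps to each other along it. Following a geodesic moves the root, whereas a
-- term describes a map from its root; so a rerooted map is explored afresh, and Euler's formula
-- excludes handles. The same exploration decodes labelled maps. The explicit solution: let z - Σ
-- g_i z^(2i+1) = Σ y_l (u^(2l+1) + (R/u)^(2l+1)), where g_i weighs faces of degree 2i + 2, and let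
-- F be the half with the powers of R/u. The product of both halves is symmetric in u and R/u, hence
-- a polynomial in z; comparing negative powers of z gives Tutte's equation for F. V_l is minus the
-- coefficient of u^(-2l-1) in F for l ≥ 1, and V_0 = R - 1. The unknown g_i with 2i + 2 < 2b do not
-- enter V_{b-1} and V_b, where their binomial coefficients vanish; in exchange the coefficients of
-- u^(-2), ..., u^(2-2b) in F² - zF vanish, and these equations are the system for the lower V_j.

-- Finite cardinalities witnessed by duplicate-free lists

unique-⊆-length : {X : Set} {xs ys : List X} → Unique xs → (∀ {x} → x ∈ xs → x ∈ ys) → length xs ≤ length ys
unique-⊆-length {xs = []} u sub = z≤n
unique-⊆-length {X} {x ∷ xs} {ys} (px ∷ u) sub with ∈-∃++ (sub (here refl))
... | as , bs , refl = subst (suc (length xs) ≤_) eq (s≤s (unique-⊆-length u sub′))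
  where
  eq : suc (length (as ++ bs)) ≡ length (as ++ x ∷ bs)
  eq = trans (cong suc (length-++ as)) (trans (sym (+-suc (length as) (length bs))) (sym (length-++ as)))
  sub′ : ∀ {z} → z ∈ xs → z ∈ as ++ bs
  sub′ {z} z∈ with ∈-++⁻ as (sub (there z∈))
  ... | inj₁ p = ∈-++⁺ˡ p
  ... | inj₂ (here refl) = ⊥-elim (All.lookup px z∈ refl)
  ... | inj₂ (there p) = ∈-++⁺ʳ as p

HasCard : {X : Set} → (X → Set) → ℕ → Set
HasCard {X} P n = Σ (List X) λ xs →
  Unique xs × (∀ {x} → x ∈ xs → P x) × (∀ {x} → P x → x ∈ xs) × length xs ≡ n

mapAll : {X Y : Set} {P : X → Set} → (∀ x → P x → Y) → (xs : List X) → All P xs → List Y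
mapAll f [] [] = []
mapAll f (x ∷ xs) (p ∷ ps) = f x p ∷ mapAll f xs ps

mapAll-length : {X Y : Set} {P : X → Set} (f : ∀ x → P x → Y) (xs : List X) (ps : All P xs) → length (mapAll f xs ps) ≡ length xs
mapAll-length f [] [] = refl
mapAll-length f (x ∷ xs) (p ∷ ps) = cong suc (mapAll-length f xs ps)

mapAll-∈ : {X Y : Set} {P : X → Set} (f : ∀ x → P x → Y) (xs : List X) (ps : All P xs) {y : Y} →
  y ∈ mapAll f xs ps → Σ X λ x → Σ (P x) λ p → x ∈ xs × y ≡ f x p
mapAll-∈ f (x ∷ xs) (p ∷ ps) (here eq) = x , p , here refl , eq
mapAll-∈ f (x ∷ xs) (p ∷ ps) (there y∈) with mapAll-∈ f xs ps y∈
... | x′ , p′ , m , eq = x′ , p′ , there m , eq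

mapAll-unique : {X Y : Set} {P : X → Set} (f : ∀ x → P x → Y) →
  (∀ x p x′ p′ → f x p ≡ f x′ p′ → x ≡ x′) →
  (xs : List X) (ps : All P xs) → Unique xs → Unique (mapAll f xs ps)
mapAll-unique f inj [] [] u = []
mapAll-unique f inj (x ∷ xs) (p ∷ ps) (nx ∷ u) =
  All.tabulate (λ y∈ eq → case mapAll-∈ f xs ps y∈ of λ where
    (x′ , p′ , m , eq′) → All.lookup nx m (inj x p x′ p′ (trans eq eq′)))
  ∷ mapAll-unique f inj xs ps u

-- The map `f` may use the proof of `P x`, while injectivity is required across all proofs; so the
-- predicates need not be propositions.
card-≤ : {X Y : Set} {P : X → Set} {Q : Y → Set} {n m : ℕ} → HasCard P n → HasCard Q m →
  (f : ∀ x → P x → Y) → (∀ x p → Q (f x p)) → (∀ x p x′ p′ → f x p ≡ f x′ p′ → x ≡ x′) → n ≤ m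
card-≤ {P = P} (xs , ux , sx , cx , refl) (ys , uy , sy , cy , refl) f q inj =
  subst (_≤ length ys) (mapAll-length f xs ps)
    (unique-⊆-length (mapAll-unique f inj xs ps ux)
      (λ y∈ → case mapAll-∈ f xs ps y∈ of λ where (x , p , _ , eq) → subst (_∈ ys) (sym eq) (cy (q x p))))
  where
  ps : All P xs
  ps = All.tabulate sx

card-≡ : {X Y : Set} {P : X → Set} {Q : Y → Set} {n m : ℕ} → HasCard P n → HasCard Q m →
  (f : ∀ x → P x → Y) → (∀ x p → Q (f x p)) → (∀ x p x′ p′ → f x p ≡ f x′ p′ → x ≡ x′) →
  (g : ∀ y → Q y → X) → (∀ y q → P (g y q)) → (∀ y q y′ q′ → g y q ≡ g y′ q′ → y ≡ y′) → n ≡ m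
card-≡ cp cq f fq fi g gp gi = ≤-antisym (card-≤ cp cq f fq fi) (card-≤ cq cp g gp gi)

card-unique : {X : Set} {P : X → Set} {n m : ℕ} → HasCard P n → HasCard P m → n ≡ m
card-unique c d = card-≡ c d (λ x _ → x) (λ _ p → p) (λ _ _ _ _ e → e) (λ x _ → x) (λ _ p → p) (λ _ _ _ _ e → e)

card-cong : {X : Set} {P Q : X → Set} {n : ℕ} → (∀ {x} → P x → Q x) → (∀ {x} → Q x → P x) → HasCard P n → HasCard Q n
card-cong f g (xs , u , s , c , l) = xs , u , (λ m → f (s m)) , (λ q → c (g q)) , l

-- Surjectivity asks for `f x p ≡ y` for every proof `p`, because the list that enumerates `P`
-- carries proofs of its own choice.
card-image : {X Y : Set} {P : X → Set} {Q : Y → Set} {n : ℕ} → HasCard P n →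
  (f : ∀ x → P x → Y) → (∀ x p → Q (f x p)) → (∀ x p x′ p′ → f x p ≡ f x′ p′ → x ≡ x′) →
  (∀ y → Q y → Σ X λ x → P x × (∀ p → f x p ≡ y)) → HasCard Q n
card-image {P = P} {Q} (xs , u , s , c , l) f q inj sur =
  mapAll f xs ps , mapAll-unique f inj xs ps u ,
  (λ y∈ → case mapAll-∈ f xs ps y∈ of λ where (x , p , _ , eq) → subst Q (sym eq) (q x p)) ,
  (λ {y} qy → case sur y qy of λ where
     (x , p , eq) → case onto xs ps (c p) of λ where (p′ , m) → subst (_∈ mapAll f xs ps) (eq p′) m) ,
  trans (mapAll-length f xs ps) l
  where
  ps : All P xs
  ps = All.tabulate s
  onto : ∀ {x} xs ps → x ∈ xs → Σ (P x) λ p → f x p ∈ mapAll f xs ps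
  onto (x ∷ xs) (p ∷ ps) (here refl) = p , here refl
  onto (x ∷ xs) (p ∷ ps) (there m) = case onto xs ps m of λ where (p′ , m′) → p′ , there m′

card-filter : {X : Set} {P Q : X → Set} {n : ℕ} → HasCard P n → (∀ x → Dec (Q x)) → ∃ λ m → HasCard (λ x → P x × Q x) m
card-filter (xs , u , s , c , l) Q? = _ , filter Q? xs , UP.filter⁺ Q? u ,
  (λ m → case ∈-filter⁻ Q? m of λ where (m′ , q) → s m′ , q) ,
  (λ where (p , q) → ∈-filter⁺ Q? (c p) q) , refl

card-⊎ : {X : Set} {P Q : X → Set} {n m : ℕ} → HasCard P n → HasCard Q m → (∀ {x} → P x → Q x → ⊥) →
  HasCard (λ x → P x ⊎ Q x) (n + m)
card-⊎ (xs , u , s , c , l) (ys , u′ , s′ , c′ , l′) dis =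
  xs ++ ys , UP.++⁺ u u′ (λ where (a , b) → dis (s a) (s′ b)) ,
  (λ m → case ∈-++⁻ xs m of λ where (inj₁ a) → inj₁ (s a) ; (inj₂ a) → inj₂ (s′ a)) ,
  (λ where (inj₁ p) → ∈-++⁺ˡ (c p) ; (inj₂ q) → ∈-++⁺ʳ xs (c′ q)) ,
  trans (length-++ xs) (cong₂ _+_ l l′)

card-⊥ : {X : Set} {P : X → Set} → (∀ {x} → P x → ⊥) → HasCard P 0
card-⊥ f = [] , [] , (λ ()) , (λ p → ⊥-elim (f p)) , refl

card-1 : {X : Set} {P : X → Set} (x : X) → P x → (∀ {y} → P y → y ≡ x) → HasCard P 1
card-1 {P = P} x p uq = [ x ] , [] ∷ [] , (λ where (here e) → subst P (sym e) p) , (λ q → here (uq q)) , refl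

card-Σ : {I X : Set} {P : I → X → Set} {c : I → ℕ} (is : List I) → Unique is → (∀ i → HasCard (P i) (c i)) →
  HasCard {I × X} (λ ix → proj₁ ix ∈ is × P (proj₁ ix) (proj₂ ix)) (sum (map c is))
card-Σ [] u h = card-⊥ (λ ())
card-Σ {P = P} (i ∷ is) (ni ∷ u) h =
  card-cong (λ where (inj₁ (refl , p)) → here refl , p
                     (inj₂ (m , p)) → there m , p)
            (λ where (here e , p) → inj₁ (e , p)
                     (there m , p) → inj₂ (m , p))
    (card-⊎ {P = λ ix → proj₁ ix ≡ i × P (proj₁ ix) (proj₂ ix)}
      (card-image (h i) (λ x _ → i , x) (λ x p → refl , p) (λ where x _ _ _ refl → refl)
        (λ where (_ , x) (refl , p) → x , p , (λ _ → refl)))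
      (card-Σ is u h)
      (λ where (refl , _) (m , _) → All.lookup ni m refl))

card-× : {X Y : Set} {P : X → Set} {Q : Y → Set} {n m : ℕ} → HasCard P n → HasCard Q m →
  HasCard {X × Y} (λ xy → P (proj₁ xy) × Q (proj₂ xy)) (n * m)
card-× {P = P} {Q} {m = m} (xs , u , s , c , refl) cq =
  card-cong (λ where (m′ , q) → s m′ , q) (λ where (p , q) → c p , q)
    (subst (HasCard _) (sumconst xs) (card-Σ {P = λ _ → Q} {c = λ _ → m} xs u (λ _ → cq)))
  where
  sumconst : ∀ xs → sum (map (λ _ → m) xs) ≡ length xs * m
  sumconst [] = refl
  sumconst (x ∷ xs) = cong (λ z → m + z) (sumconst xs)

-- Walks

-- A walk: `o` is the origin of a side and `β` its reversal, so that `o (β x)` is its end. Both are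
-- parameters because walks are also read through labellings other than the vertices of a term.
Chain : {H V : Set} → (H → V) → (H → H) → V → List H → V → Set
Chain o β v [] u = v ≡ u
Chain o β v (x ∷ w) u = o x ≡ v × Chain o β (o (β x)) w u

chain-++ : {H V : Set} {o : H → V} {β : H → H} {v u z : V} (w : List H) {w′ : List H} →
  Chain o β v w u → Chain o β u w′ z → Chain o β v (w ++ w′) z
chain-++ [] refl d = d
chain-++ (x ∷ w) (e , c) d = e , chain-++ w c d

chain-split : {H V : Set} {o : H → V} {β : H → H} {v z : V} (w : List H) {w′ : List H} →
  Chain o β v (w ++ w′) z → Σ V λ u → Chain o β v w u × Chain o β u w′ z
chain-split [] c = _ , refl , c
chain-split (x ∷ w) (e , c) with chain-split w c
... | u , c₁ , c₂ = u , (e , c₁) , c₂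

chain-end : {H V : Set} {o : H → V} {β : H → H} {v u z : V} (w : List H) →
  Chain o β v w u → Chain o β v w z → u ≡ z
chain-end [] refl refl = refl
chain-end (x ∷ w) (_ , c) (_ , d) = chain-end w c d

chain-map : {H V H′ V′ : Set} {o : H → V} {β : H → H} {o′ : H′ → V′} {β′ : H′ → H′} (p : H → H′) (f : V → V′) →
  (∀ h → o′ (p h) ≡ f (o h)) → (∀ h → β′ (p h) ≡ p (β h)) →
  {v u : V} (w : List H) → Chain o β v w u → Chain o′ β′ (f v) (map p w) (f u)
chain-map p f po pb [] refl = refl
chain-map {o = o} {β} {o′} {β′} p f po pb {u = u} (x ∷ w) (e , c) = trans (po x) (cong f e) ,
  subst (λ z → Chain o′ β′ z (map p w) (f u)) (sym (trans (cong o′ (pb x)) (po (β x)))) (chain-map p f po pb w c)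

chain-rot : {H V : Set} {o : H → V} {β : H → H} {v : V} (w : List H) {w′ : List H} →
  Chain o β v (w ++ w′) v → Σ V λ u → Chain o β u (w′ ++ w) u
chain-rot w {w′} c with chain-split w c
... | u , c₁ , c₂ = u , chain-++ w′ c₂ c₁

nth : {A : Set} → A → List A → ℕ → A
nth d [] k = d
nth d (x ∷ xs) zero = x
nth d (x ∷ xs) (suc k) = nth d xs k

nth-map : {A B : Set} (f : A → B) (d : A) (xs : List A) (k : ℕ) → nth (f d) (map f xs) k ≡ f (nth d xs k)
nth-map f d [] k = refl
nth-map f d (x ∷ xs) zero = refl
nth-map f d (x ∷ xs) (suc k) = nth-map f d xs k

nth-end : {A : Set} (d : A) (xs : List A) (k : ℕ) → length xs ≤ k → nth d xs k ≡ d
nth-end d [] k le = refl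
nth-end d (x ∷ xs) (suc k) (s≤s le) = nth-end d xs k le

nth-drop : {A : Set} (d : A) (i : ℕ) (xs : List A) (k : ℕ) → nth d (drop i xs) k ≡ nth d xs (i + k)
nth-drop d zero xs k = refl
nth-drop d (suc i) [] k = refl
nth-drop d (suc i) (x ∷ xs) k = nth-drop d i xs k

nth-++ˡ : {A : Set} (d : A) (xs ys : List A) (k : ℕ) → k < length xs → nth d (xs ++ ys) k ≡ nth d xs k
nth-++ˡ d (x ∷ xs) ys zero lt = refl
nth-++ˡ d (x ∷ xs) ys (suc k) (s≤s lt) = nth-++ˡ d xs ys k lt

chain-take : {H V : Set} {o : H → V} {β : H → H} {v u : V} (w : List H) (i : ℕ) → Chain o β v w u →
  Chain o β v (take i w) (nth u (map o w) i) × Chain o β (nth u (map o w) i) (drop i w) u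
chain-take [] zero refl = refl , refl
chain-take [] (suc i) refl = refl , refl
chain-take (x ∷ w) zero (e , c) = sym e , refl , c
chain-take (x ∷ w) (suc i) (e , c) with chain-take w i c
... | c₁ , c₂ = (e , c₁) , c₂

-- Terms for rooted planar maps

-- Terms of the root-edge decomposition of rooted planar maps: deleting the root edge either disconnects
-- the map (loop t u, with t the part seen first) or merges the root face with an inner face of degree 1 + i.
data Tm : Set where
  pt    : Tm
  loop  : Tm → Tm → Tm
  split : ℕ → Tm → Tm

-- The two sides of every edge; side h runs from vertex org t h to vertex org t (opp t h).
Half : Tm → Set
Half pt = ⊥
Half (loop t u) = Bool ⊎ (Half t ⊎ Half u)
Half (split i t) = Bool ⊎ Half t

Vert : Tm → Set
Vert pt = ⊤
Vert (loop t u) = Vert t ⊎ Vert u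
Vert (split i t) = Vert t

root : (t : Tm) → Vert t
root pt = tt
root (loop t u) = inj₂ (root u)
root (split i t) = root t

-- The boundary word lists the sides around the root face from the root corner on. In `loop t u` it
-- crosses the bridge, goes around `t`, returns and goes around `u`; in `split i t` the root edge
-- joins corners 0 and `i` of `t`, and the first `i` sides pass to the new inner face.
bw : (t : Tm) → List (Half t)
bw pt = []
bw (loop t u) = inj₁ true ∷ map (inj₂ ∘ inj₁) (bw t) ++ inj₁ false ∷ map (inj₂ ∘ inj₂) (bw u)
bw (split i t) = inj₁ true ∷ map inj₂ (drop i (bw t))

opp : (t : Tm) → Half t → Half t
opp (loop t u) (inj₁ x) = inj₁ (not x)
opp (loop t u) (inj₂ (inj₁ h)) = inj₂ (inj₁ (opp t h))
opp (loop t u) (inj₂ (inj₂ h)) = inj₂ (inj₂ (opp u h))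
opp (split i t) (inj₁ x) = inj₁ (not x)
opp (split i t) (inj₂ h) = inj₂ (opp t h)

org : (t : Tm) → Half t → Vert t
org (loop t u) (inj₁ true) = inj₂ (root u)
org (loop t u) (inj₁ false) = inj₁ (root t)
org (loop t u) (inj₂ (inj₁ h)) = inj₁ (org t h)
org (loop t u) (inj₂ (inj₂ h)) = inj₂ (org u h)
org (split i t) (inj₁ true) = root t
org (split i t) (inj₁ false) = nth (root t) (map (org t) (bw t)) i
org (split i t) (inj₂ h) = org t h

-- The default value of `nth` is the root, so that corner `bd t` is corner 0 again.
crn : (t : Tm) → ℕ → Vert t
crn t k = nth (root t) (map (org t) (bw t)) k

fcs : (t : Tm) → List (List (Half t))
fcs pt = []
fcs (loop t u) = map (map (inj₂ ∘ inj₁)) (fcs t) ++ map (map (inj₂ ∘ inj₂)) (fcs u)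
fcs (split i t) = (inj₁ false ∷ map inj₂ (take i (bw t))) ∷ map (map inj₂) (fcs t)

bd : Tm → ℕ
bd t = length (bw t)

WF : Tm → Set
WF pt = ⊤
WF (loop t u) = WF t × WF u
WF (split i t) = WF t × i ≤ bd t

halves : (t : Tm) → List (Half t)
halves pt = []
halves (loop t u) = inj₁ true ∷ inj₁ false ∷ map (inj₂ ∘ inj₁) (halves t) ++ map (inj₂ ∘ inj₂) (halves u)
halves (split i t) = inj₁ true ∷ inj₁ false ∷ map inj₂ (halves t)

verts : (t : Tm) → List (Vert t)
verts pt = tt ∷ []
verts (loop t u) = map inj₁ (verts t) ++ map inj₂ (verts u)
verts (split i t) = verts t

edges : Tm → ℕ
edges pt = 0
edges (loop t u) = suc (edges t + edges u)
edges (split i t) = suc (edges t)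

degs : Tm → List ℕ
degs pt = []
degs (loop t u) = degs t ++ degs u
degs (split i t) = suc i ∷ degs t

TChain : (t : Tm) → Vert t → List (Half t) → Vert t → Set
TChain t = Chain (org t) (opp t)

opp-opp : ∀ t h → opp t (opp t h) ≡ h
opp-opp (loop t u) (inj₁ true) = refl
opp-opp (loop t u) (inj₁ false) = refl
opp-opp (loop t u) (inj₂ (inj₁ h)) = cong (inj₂ ∘ inj₁) (opp-opp t h)
opp-opp (loop t u) (inj₂ (inj₂ h)) = cong (inj₂ ∘ inj₂) (opp-opp u h)
opp-opp (split i t) (inj₁ true) = refl
opp-opp (split i t) (inj₁ false) = refl
opp-opp (split i t) (inj₂ h) = cong inj₂ (opp-opp t h)

inj₁-inj : {A B : Set} {x y : A} → inj₁ {B = B} x ≡ inj₁ y → x ≡ y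
inj₁-inj refl = refl

inj₂-inj : {A B : Set} {x y : B} → inj₂ {A = A} x ≡ inj₂ y → x ≡ y
inj₂-inj refl = refl

opp-≢ : ∀ t h → opp t h ≢ h
opp-≢ (loop t u) (inj₁ true) ()
opp-≢ (loop t u) (inj₁ false) ()
opp-≢ (loop t u) (inj₂ (inj₁ h)) e = opp-≢ t h (inj₁-inj (inj₂-inj e))
opp-≢ (loop t u) (inj₂ (inj₂ h)) e = opp-≢ u h (inj₂-inj (inj₂-inj e))
opp-≢ (split i t) (inj₁ true) ()
opp-≢ (split i t) (inj₁ false) ()
opp-≢ (split i t) (inj₂ h) e = opp-≢ t h (inj₂-inj e)

∈-halves : ∀ t h → h ∈ halves t
∈-halves (loop t u) (inj₁ true) = here refl
∈-halves (loop t u) (inj₁ false) = there (here refl)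
∈-halves (loop t u) (inj₂ (inj₁ h)) = there (there (∈-++⁺ˡ (∈-map⁺ _ (∈-halves t h))))
∈-halves (loop t u) (inj₂ (inj₂ h)) = there (there (∈-++⁺ʳ _ (∈-map⁺ _ (∈-halves u h))))
∈-halves (split i t) (inj₁ true) = here refl
∈-halves (split i t) (inj₁ false) = there (here refl)
∈-halves (split i t) (inj₂ h) = there (there (∈-map⁺ _ (∈-halves t h)))

∈-verts : ∀ t v → v ∈ verts t
∈-verts pt tt = here refl
∈-verts (loop t u) (inj₁ v) = ∈-++⁺ˡ (∈-map⁺ _ (∈-verts t v))
∈-verts (loop t u) (inj₂ v) = ∈-++⁺ʳ _ (∈-map⁺ _ (∈-verts u v))
∈-verts (split i t) v = ∈-verts t v

unique-⊎ : {A B : Set} {xs : List A} {ys : List B} → Unique xs → Unique ys → Unique (map inj₁ xs ++ map inj₂ ys)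
unique-⊎ u v = UP.++⁺ (UP.map⁺ inj₁-inj u) (UP.map⁺ inj₂-inj v)
  (λ where (p , q) → case ∈-map⁻ _ p , ∈-map⁻ _ q of λ where ((_ , _ , refl) , (_ , _ , ())))

unique-bool : {B : Set} {ys : List B} → Unique ys → Unique (inj₁ true ∷ inj₁ false ∷ map inj₂ ys)
unique-bool u = ((λ ()) ∷ AllP.map⁺ (All.tabulate (λ _ ()))) ∷ AllP.map⁺ (All.tabulate (λ _ ())) ∷ UP.map⁺ inj₂-inj u

halves-loop : ∀ t u → halves (loop t u) ≡ inj₁ true ∷ inj₁ false ∷ map inj₂ (map inj₁ (halves t) ++ map inj₂ (halves u))
halves-loop t u = cong (λ z → inj₁ true ∷ inj₁ false ∷ z)
  (trans (cong₂ _++_ (map-∘ (halves t)) (map-∘ (halves u))) (sym (map-++ inj₂ (map inj₁ (halves t)) _)))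

halves-unique : ∀ t → Unique (halves t)
halves-unique pt = []
halves-unique (loop t u) = subst Unique (sym (halves-loop t u)) (unique-bool (unique-⊎ (halves-unique t) (halves-unique u)))
halves-unique (split i t) = unique-bool (halves-unique t)

verts-unique : ∀ t → Unique (verts t)
verts-unique pt = [] ∷ []
verts-unique (loop t u) = unique-⊎ (verts-unique t) (verts-unique u)
verts-unique (split i t) = verts-unique t

halves-length : ∀ t → length (halves t) ≡ 2 * edges t
halves-length pt = refl
halves-length (loop t u) = trans (cong (λ (z : ℕ) → suc (suc z)) (trans (length-++ (map (inj₂ ∘ inj₁) (halves t)))
  (cong₂ _+_ (trans (length-map _ (halves t)) (halves-length t)) (trans (length-map (inj₂ ∘ inj₂) (halves u)) (halves-length u)))))
  (lem (edges t) (edges u))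
  where
  lem : ∀ a c → suc (suc (2 * a + 2 * c)) ≡ 2 * suc (a + c)
  lem a c = sym (trans (ℕP.*-suc 2 (a + c)) (cong (λ z → 2 + z) (ℕP.*-distribˡ-+ 2 a c)))
halves-length (split i t) = trans (cong (λ (z : ℕ) → suc (suc z)) (trans (length-map _ (halves t)) (halves-length t))) (sym (ℕP.*-suc 2 (edges t)))

+-interchange : ∀ m n o p → (m + n) + (o + p) ≡ (m + o) + (n + p)
+-interchange = ℕR.solve-∀

euler : ∀ t → length (verts t) + length (degs t) ≡ suc (edges t)
euler pt = refl
euler (loop t u) = begin
  length (map inj₁ (verts t) ++ map inj₂ (verts u)) + length (degs t ++ degs u)
    ≡⟨ cong₂ _+_ (trans (length-++ (map inj₁ (verts t))) (cong₂ _+_ (length-map inj₁ (verts t)) (length-map inj₂ (verts u)))) (length-++ (degs t)) ⟩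
  (length (verts t) + length (verts u)) + (length (degs t) + length (degs u))
    ≡⟨ +-interchange (length (verts t)) (length (verts u)) (length (degs t)) (length (degs u)) ⟩
  (length (verts t) + length (degs t)) + (length (verts u) + length (degs u))
    ≡⟨ cong₂ _+_ (euler t) (euler u) ⟩
  suc (edges t) + suc (edges u) ≡⟨ cong suc (+-suc (edges t) (edges u)) ⟩
  suc (suc (edges t + edges u)) ∎
  where open ≡-Reasoning
euler (split i t) = trans (+-suc (length (verts t)) (length (degs t))) (cong suc (euler t))

Half-≟ : ∀ t → DecidableEquality (Half t)
Half-≟ (loop t u) = SumP.≡-dec BoolP._≟_ (SumP.≡-dec (Half-≟ t) (Half-≟ u))
Half-≟ (split i t) = SumP.≡-dec BoolP._≟_ (Half-≟ t)

Vert-≟ : ∀ t → DecidableEquality (Vert t)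
Vert-≟ pt tt tt = yes refl
Vert-≟ (loop t u) = SumP.≡-dec (Vert-≟ t) (Vert-≟ u)
Vert-≟ (split i t) = Vert-≟ t

Tm-≟ : DecidableEquality Tm
Tm-≟ pt pt = yes refl
Tm-≟ pt (loop _ _) = no λ ()
Tm-≟ pt (split _ _) = no λ ()
Tm-≟ (loop _ _) pt = no λ ()
Tm-≟ (loop t u) (loop t′ u′) = map′ (λ where (refl , refl) → refl) (λ where refl → refl , refl) (Tm-≟ t t′ ×-dec Tm-≟ u u′)
Tm-≟ (loop _ _) (split _ _) = no λ ()
Tm-≟ (split _ _) pt = no λ ()
Tm-≟ (split _ _) (loop _ _) = no λ ()
Tm-≟ (split i t) (split i′ t′) = map′ (λ where (refl , refl) → refl) (λ where refl → refl , refl) (ℕP._≟_ i i′ ×-dec Tm-≟ t t′)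

chain-bw : ∀ t → WF t → TChain t (root t) (bw t) (root t)
chain-bw pt _ = refl
chain-bw (loop t u) (wt , wu) = refl ,
  chain-++ (map (inj₂ ∘ inj₁) (bw t)) (chain-map (inj₂ ∘ inj₁) inj₁ (λ _ → refl) (λ _ → refl) (bw t) (chain-bw t wt))
    (refl , chain-map (inj₂ ∘ inj₂) inj₂ (λ _ → refl) (λ _ → refl) (bw u) (chain-bw u wu))
chain-bw (split i t) (wt , _) = refl ,
  chain-map inj₂ id (λ _ → refl) (λ _ → refl) (drop i (bw t)) (proj₂ (chain-take (bw t) i (chain-bw t wt)))

Closed : {H V : Set} → (H → V) → (H → H) → List H → Set
Closed {V = V} o β w = Σ V λ v → Chain o β v w v

chain-fcs : ∀ t → WF t → All (Closed (org t) (opp t)) (fcs t)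
chain-fcs pt _ = []
chain-fcs (loop t u) (wt , wu) = AllP.++⁺
  (AllP.map⁺ (All.map (λ {f} → λ where (v , c) → inj₁ v , chain-map (inj₂ ∘ inj₁) inj₁ (λ _ → refl) (λ _ → refl) f c) (chain-fcs t wt)))
  (AllP.map⁺ (All.map (λ {f} → λ where (v , c) → inj₂ v , chain-map (inj₂ ∘ inj₂) inj₂ (λ _ → refl) (λ _ → refl) f c) (chain-fcs u wu)))
chain-fcs (split i t) (wt , _) =
  (_ , refl , chain-map inj₂ id (λ _ → refl) (λ _ → refl) (take i (bw t)) (proj₁ (chain-take (bw t) i (chain-bw t wt))))
  ∷ AllP.map⁺ (All.map (λ {f} → λ where (v , c) → v , chain-map inj₂ id (λ _ → refl) (λ _ → refl) f c) (chain-fcs t wt))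

chain-unmap : {H V H′ : Set} {o : H′ → V} {β′ : H′ → H′} {β : H → H} (p : H → H′) → (∀ h → β′ (p h) ≡ p (β h)) →
  {v u : V} (w : List H) → Chain o β′ v (map p w) u → Chain (o ∘ p) β v w u
chain-unmap p pb [] c = c
chain-unmap {o = o} {β = β} p pb {u = u} (x ∷ w) (e , c) = e ,
  chain-unmap {β = β} p pb w (subst (λ z → Chain o _ z (map p w) u) (cong o (pb x)) c)

-- The vertices of a term are the freest labelling of sides by origins that closes up along the
-- boundary and along every inner face: any other such labelling is a function of `org`. This is
-- where the sphere enters; it later identifies vertices with cycles of permutations.
factor : ∀ t → WF t → {X : Set} (g : Half t → X) {v : X} → Chain g (opp t) v (bw t) v → All (Closed g (opp t)) (fcs t) →
  Σ (Vert t → X) λ ḡ → ḡ (root t) ≡ v × (∀ h → g h ≡ ḡ (org t h))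
factor pt _ g {v} _ _ = (λ _ → v) , refl , λ ()
factor (loop t u) (wt , wu) g {v} (e , c) ca with chain-split (map (inj₂ ∘ inj₁) (bw t)) c
... | z , c₁ , (e′ , c₂) with factor t wt (g ∘ inj₂ ∘ inj₁) {z} (chain-unmap (inj₂ ∘ inj₁) (λ _ → refl) (bw t) (subst (λ y → Chain g _ y _ z) e′ c₁))
                              (All.map (λ {f} → λ where (y , d) → y , chain-unmap (inj₂ ∘ inj₁) (λ _ → refl) f d) (AllP.map⁻ (AllP.++⁻ˡ _ ca)))
                            | factor u wu (g ∘ inj₂ ∘ inj₂) {v} (chain-unmap (inj₂ ∘ inj₂) (λ _ → refl) (bw u) (subst (λ y → Chain g _ y _ v) e c₂))
                              (All.map (λ {f} → λ where (y , d) → y , chain-unmap (inj₂ ∘ inj₂) (λ _ → refl) f d) (AllP.map⁻ (AllP.++⁻ʳ (map (map (inj₂ ∘ inj₁)) (fcs t)) ca)))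
... | g₁ , r₁ , h₁ | g₂ , r₂ , h₂ = (λ where (inj₁ y) → g₁ y ; (inj₂ y) → g₂ y) , r₂ , λ where
  (inj₁ true) → trans e (sym r₂)
  (inj₁ false) → trans e′ (sym r₁)
  (inj₂ (inj₁ h)) → h₁ h
  (inj₂ (inj₂ h)) → h₂ h
factor (split i t) (wt , _) g {v} (e , c) ((z , e′ , d) ∷ ca) = ḡ , r , hh
  where
  -- The new face and the new boundary both pass through the two ends of the root edge; joined
  -- there, they give back the boundary of `t`.
  d′ : Chain (g ∘ inj₂) (opp t) v (take i (bw t)) (g (inj₁ false))
  d′ = chain-unmap {o = g} inj₂ (λ _ → refl) (take i (bw t))
    (subst₂ (λ y y′ → Chain g (opp (split i t)) y (map inj₂ (take i (bw t))) y′) e (sym e′) d)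
  rec : Σ (Vert t → _) λ ḡ → ḡ (root t) ≡ v × (∀ h → g (inj₂ h) ≡ ḡ (org t h))
  rec = factor t wt (g ∘ inj₂) {v}
         (subst (λ w → Chain (g ∘ inj₂) (opp t) v w v) (take++drop≡id i (bw t))
           (chain-++ (take i (bw t)) d′ (chain-unmap inj₂ (λ _ → refl) (drop i (bw t)) c)))
         (All.map (λ {f} → λ where (y , d) → y , chain-unmap inj₂ (λ _ → refl) f d) (AllP.map⁻ ca))
  ḡ = proj₁ rec
  r = proj₁ (proj₂ rec)
  h = proj₂ (proj₂ rec)
  hh : ∀ x → g x ≡ ḡ (org (split i t) x)
  hh (inj₁ true) = trans e (sym r)
  hh (inj₁ false) = chain-end (take i (bw t)) d′
    (subst₂ (λ y w → Chain (g ∘ inj₂) (opp t) y w (ḡ (crn t i))) r (map-id (take i (bw t)))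
      (chain-map id ḡ h (λ _ → refl) (take i (bw t)) (proj₁ (chain-take (bw t) i (chain-bw t wt)))))
  hh (inj₂ x) = h x

-- Exploring a map from its root face and decoding it as a term

allPairs-↭ : {A : Set} {R : A → A → Set} → (∀ {x y} → R x y → R y x) → {xs ys : List A} → xs ↭ ys → AllPairs R xs → AllPairs R ys
allPairs-↭ s _↭_.refl p = p
allPairs-↭ s (prep x e) (a ∷ p) = PP.All-resp-↭ e a ∷ allPairs-↭ s e p
allPairs-↭ s (swap x y e) ((r ∷ a) ∷ a′ ∷ p) = (s r ∷ PP.All-resp-↭ e a′) ∷ PP.All-resp-↭ e a ∷ allPairs-↭ s e p
allPairs-↭ s (_↭_.trans e e′) p = allPairs-↭ s e′ (allPairs-↭ s e p)

unique-↭ : {A : Set} {xs ys : List A} → xs ↭ ys → Unique xs → Unique ys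
unique-↭ = allPairs-↭ (λ n e → n (sym e))

Seg : {H : Set} → (H → H) → H → List H → H → Set
Seg φ a [] b = a ≡ b
Seg φ a (x ∷ w) b = x ≡ a × Seg φ (φ x) w b

seg-++ : {H : Set} {φ : H → H} {a b c : H} (w : List H) {w′ : List H} → Seg φ a w b → Seg φ b w′ c → Seg φ a (w ++ w′) c
seg-++ [] refl s = s
seg-++ (x ∷ w) (e , s) s′ = e , seg-++ w s s′

seg-split : {H : Set} {φ : H → H} {a c : H} (w : List H) {w′ : List H} → Seg φ a (w ++ w′) c →
  Σ H λ b → Seg φ a w b × Seg φ b w′ c
seg-split [] s = _ , refl , s
seg-split (x ∷ w) (e , s) with seg-split w s
... | b , s₁ , s₂ = b , (e , s₁) , s₂

seg-chain : {H V : Set} {φ β : H → H} {o : H → V} → (∀ h → o (φ h) ≡ o (β h)) → {a b : H} (w : List H) →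
  Seg φ a w b → Chain o β (o a) w (o b)
seg-chain oe [] refl = refl
seg-chain {φ = φ} {β} {o} oe {b = b} (x ∷ w) (refl , s) = refl ,
  subst (λ z → Chain o β z w (o b)) (oe x) (seg-chain oe w s)

-- Membership of `h` excludes the empty word. Winding several times around a cycle is excluded where
-- it matters by the uniqueness of all letters.
IsCyc : {H : Set} → (H → H) → List H → Set
IsCyc {H} φ f = Σ H λ h → Seg φ h f h × h ∈ f

isCyc-rot : {H : Set} {φ : H → H} (p r : List H) {y : H} → IsCyc φ (p ++ y ∷ r) → IsCyc φ (y ∷ r ++ p)
isCyc-rot p r (h , s , m) with seg-split p s
... | b , s₁ , (refl , s₂) = b , (refl , seg-++ r s₂ s₁) , here refl

isCyc-closed : {H : Set} {φ : H → H} {f : List H} → IsCyc φ f → ∀ {h} → h ∈ f → φ h ∈ f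
isCyc-closed {φ = φ} {f} (a , s , m) h∈ with ∈-∃++ h∈
... | p , [] , refl with seg-split p s
...   | b , s₁ , (refl , refl) = m
isCyc-closed {φ = φ} {f} (a , s , m) h∈ | p , z ∷ r , refl with seg-split p s
...   | b , s₁ , (refl , refl , s₂) = ∈-++⁺ʳ p (there (here refl))

LL : {H : Set} → List (List H) → List (List H) → List H
LL ws fs = concat ws ++ concat fs

concat-mid : {A : Set} (g₁ : List (List A)) (c : List A) (g₂ : List (List A)) → concat (g₁ ++ c ∷ g₂) ↭ c ++ concat (g₁ ++ g₂)
concat-mid g₁ c g₂ = ↭-trans (↭-reflexive (sym (LP.concat-++ g₁ (c ∷ g₂))))
  (↭-trans (PP.shifts (concat g₁) c) (PP.++⁺ˡ c (↭-reflexive (LP.concat-++ g₁ g₂))))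

perm-loop : {H : Set} (x y : H) (w₁ w₂ : List H) (ws fs : List (List H)) →
  LL ((x ∷ w₁ ++ y ∷ w₂) ∷ ws) fs ↭ x ∷ y ∷ LL (w₁ ∷ w₂ ∷ ws) fs
perm-loop {H} x y w₁ w₂ ws fs = prep x (S.solve 5 (λ a v c d e → ((a S.⊕ (v S.⊕ c)) S.⊕ d) S.⊕ e S.⊜ v S.⊕ ((a S.⊕ (c S.⊕ d)) S.⊕ e))
  ↭-refl w₁ [ y ] w₂ (concat ws) (concat fs))
  where module S = CMSolver (PP.++-commutativeMonoid {A = H})

perm-handle : {H : Set} (x y : H) (w p r : List H) (g₁ g₂ fs : List (List H)) →
  LL ((x ∷ w) ∷ g₁ ++ (p ++ y ∷ r) ∷ g₂) fs ↭ x ∷ y ∷ LL ((r ++ p ++ w) ∷ g₁ ++ g₂) fs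
perm-handle {H} x y w p r g₁ g₂ fs = prep x (↭-trans (PP.++⁺ʳ (concat fs) (PP.++⁺ˡ w (concat-mid g₁ (p ++ y ∷ r) g₂)))
  (S.solve 6 (λ w p y r c f → (w S.⊕ ((p S.⊕ (y S.⊕ r)) S.⊕ c)) S.⊕ f S.⊜ y S.⊕ (((r S.⊕ (p S.⊕ w)) S.⊕ c) S.⊕ f))
  ↭-refl w p [ y ] r (concat (g₁ ++ g₂)) (concat fs)))
  where module S = CMSolver (PP.++-commutativeMonoid {A = H})

perm-absorb : {H : Set} (x y : H) (w p r : List H) (ws f₁ f₂ : List (List H)) →
  LL ((x ∷ w) ∷ ws) (f₁ ++ (p ++ y ∷ r) ∷ f₂) ↭ x ∷ y ∷ LL ((r ++ p ++ w) ∷ ws) (f₁ ++ f₂)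
perm-absorb {H} x y w p r ws f₁ f₂ = prep x (↭-trans (PP.++⁺ˡ (w ++ concat ws) (concat-mid f₁ (p ++ y ∷ r) f₂))
  (S.solve 6 (λ w p y r c f → (w S.⊕ c) S.⊕ ((p S.⊕ (y S.⊕ r)) S.⊕ f) S.⊜ y S.⊕ (((r S.⊕ (p S.⊕ w)) S.⊕ c) S.⊕ f))
  ↭-refl w p [ y ] r (concat ws) (concat (f₁ ++ f₂))))
  where module S = CMSolver (PP.++-commutativeMonoid {A = H})

-- A run of the exploration of a (not necessarily planar) map: ws are the current boundary words, fs the faces not yet
-- reached, P the number of exhausted words, g the number of handles found and E the number of edges.
data Explore {H : Set} (β : H → H) : List (List H) → List (List H) → ℕ → ℕ → ℕ → Set where
  done   : Explore β [] [] 0 0 0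
  pop    : ∀ {ws fs P g E} → Explore β ws fs P g E → Explore β ([] ∷ ws) fs (suc P) g E
  arc    : ∀ {x y w₁ w₂ ws fs P g E} → β x ≡ y → Explore β (w₁ ∷ w₂ ∷ ws) fs P g E →
           Explore β ((x ∷ w₁ ++ y ∷ w₂) ∷ ws) fs P g (suc E)
  handle : ∀ {x y w p r g₁ g₂ fs P g E} → β x ≡ y → Explore β ((r ++ p ++ w) ∷ g₁ ++ g₂) fs P g E →
           Explore β ((x ∷ w) ∷ g₁ ++ (p ++ y ∷ r) ∷ g₂) fs P (suc g) (suc E)
  absorb : ∀ {x y w p r ws f₁ f₂ P g E} → β x ≡ y → Explore β ((r ++ p ++ w) ∷ ws) (f₁ ++ f₂) P g E →
           Explore β ((x ∷ w) ∷ ws) (f₁ ++ (p ++ y ∷ r) ∷ f₂) P g (suc E)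

length-mid : {A : Set} (xs : List A) {y : A} {ys : List A} → length (xs ++ y ∷ ys) ≡ suc (length (xs ++ ys))
length-mid xs {y} {ys} = trans (length-++ xs) (trans (+-suc (length xs) (length ys)) (cong suc (sym (length-++ xs))))

-- Euler's relation, kept by every step: `pop` trades a word for a vertex, `arc` spends an edge on a
-- new word, `absorb` removes an edge together with a face, and `handle` loses an edge and a word at
-- once, which is why it counts twice.
explore-count : {H : Set} {β : H → H} {ws fs : List (List H)} {P g E : ℕ} → Explore β ws fs P g E →
  P + length fs + 2 * g ≡ length ws + E
explore-count done = refl
explore-count (pop e) = cong suc (explore-count e)
explore-count {ws = _ ∷ ws} {E = suc E} (arc _ e) = trans (explore-count e) (cong suc (sym (+-suc (length ws) E)))
explore-count {fs = fs} {P} {suc g} {suc E} (handle {g₁ = g₁} {g₂} _ e) = trans (lem P (length fs) g)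
  (cong suc (trans (cong suc (explore-count e)) (trans (cong suc (sym (+-suc (length (g₁ ++ g₂)) E))) (cong (λ z → z + suc E) (sym (length-mid g₁))))))
  where
  lem : ∀ a c g → a + c + 2 * suc g ≡ 2 + (a + c + 2 * g)
  lem = ℕR.solve-∀
explore-count {ws = _ ∷ ws} {P = P} {g} {suc E} (absorb {f₁ = f₁} {f₂} _ e) = trans (cong (λ z → P + z + 2 * g) (length-mid f₁))
  (trans (cong (λ z → z + 2 * g) (+-suc P _)) (trans (cong suc (explore-count e)) (sym (+-suc (suc (length ws)) E))))

explore-length : {H : Set} {β : H → H} {ws fs : List (List H)} {P g E : ℕ} → Explore β ws fs P g E → length (LL ws fs) ≡ 2 * E
explore-length done = refl
explore-length (pop e) = explore-length e
explore-length {E = suc E} (arc {x} {y} {w₁} {w₂} {ws} {fs} _ e) = trans (PP.↭-length (perm-loop x y w₁ w₂ ws fs))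
  (trans (cong (λ z → 2 + z) (explore-length e)) (sym (ℕP.*-suc 2 E)))
explore-length {E = suc E} (handle {x} {y} {w} {p} {r} {g₁} {g₂} {fs} _ e) = trans (PP.↭-length (perm-handle x y w p r g₁ g₂ fs))
  (trans (cong (λ z → 2 + z) (explore-length e)) (sym (ℕP.*-suc 2 E)))
explore-length {E = suc E} (absorb {x} {y} {w} {p} {r} {ws} {f₁} {f₂} _ e) = trans (PP.↭-length (perm-absorb x y w p r ws f₁ f₂))
  (trans (cong (λ z → 2 + z) (explore-length e)) (sym (ℕP.*-suc 2 E)))

ClosedUnder : {H : Set} → (H → H) → List H → Set
ClosedUnder β L = ∀ {h} → h ∈ L → β h ∈ L

peel-pair : {H : Set} {β : H → H} → (∀ h → β (β h) ≡ h) → {x y : H} {L L′ : List H} → β x ≡ y → L ↭ x ∷ y ∷ L′ →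
  Unique L → ClosedUnder β L → Unique L′ × ClosedUnder β L′
peel-pair {β = β} ββ {x} {y} {L} {L′} refl e u c with unique-↭ e u
... | (x∉ ∷ (y∉ ∷ u′)) = u′ , cl
  where
  cl : ClosedUnder β L′
  cl {h} h∈ with PP.∈-resp-↭ e (c (PP.∈-resp-↭ (↭-sym e) (there (there h∈))))
  ... | here eq = ⊥-elim (All.lookup y∉ h∈ (trans (cong β (sym eq)) (ββ h)))
  ... | there (here eq) = ⊥-elim (All.lookup (All.tail x∉) h∈ (trans (sym (ββ x)) (trans (cong β (sym eq)) (ββ h))))
  ... | there (there m) = m

-- The opposite of the first letter lies in the same word (`arc`), in another word (`handle`) or in
-- a face not yet reached (`absorb`). Each of these steps removes two letters and adds at most one
-- word, and `pop` removes a word, so the number of words plus letters decreases.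
explore : {H : Set} {β : H → H} (Q : List H → Set) → (∀ h → β (β h) ≡ h) → (∀ h → β h ≢ h) →
  (∀ fs → All Q fs → ClosedUnder β (concat fs) → fs ≡ []) →
  (n : ℕ) (ws fs : List (List H)) → length ws + length (LL ws fs) ≤ n →
  Unique (LL ws fs) → ClosedUnder β (LL ws fs) → All Q fs →
  Σ ℕ λ P → Σ ℕ λ g → Σ ℕ λ E → Explore β ws fs P g E
-- With no boundary word left, the remaining faces are closed under `β`; connectedness then leaves
-- none.
explore Q ββ β≢ conn n [] fs le u c q with conn fs q c
... | refl = 0 , 0 , 0 , done
explore Q ββ β≢ conn (suc n) ([] ∷ ws) fs (s≤s le) u c q with explore Q ββ β≢ conn n ws fs le u c q
... | P , g , E , e = suc P , g , E , pop e
explore {H} {β} Q ββ β≢ conn (suc n) ((x ∷ w) ∷ ws) fs (s≤s le) u c q with c (here refl)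
... | here eq = ⊥-elim (β≢ x eq)
... | there m with ∈-++⁻ (w ++ concat ws) m
...   | inj₂ m₂ with ∈-concat⁻′ fs m₂
...     | f , y∈f , f∈fs with ∈-∃++ f∈fs | ∈-∃++ y∈f
...       | f₁ , f₂ , refl | p , r , refl with peel-pair ββ refl (perm-absorb x (β x) w p r ws f₁ f₂) u c
...         | u′ , c′ with explore Q ββ β≢ conn n ((r ++ p ++ w) ∷ ws) (f₁ ++ f₂) le′ u′ c′ (AllP.++⁺ (AllP.++⁻ˡ f₁ q) (All.tail (AllP.++⁻ʳ f₁ q)))
  where
  le′ : suc (length ws) + length (LL ((r ++ p ++ w) ∷ ws) (f₁ ++ f₂)) ≤ n
  le′ = ≤-trans (≤-trans (≤-reflexive (trans (sym (+-suc (length ws) _)) (cong (λ z → length ws + z) refl))) (ℕP.+-monoʳ-≤ (length ws) (≤-trans (n≤1+n _) (≤-reflexive (sym (PP.↭-length (perm-absorb x (β x) w p r ws f₁ f₂))))))) le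
...           | P , g , E , e = P , g , suc E , absorb refl e
explore {H} {β} Q ββ β≢ conn (suc n) ((x ∷ w) ∷ ws) fs (s≤s le) u c q | there m | inj₁ m₁ with ∈-++⁻ w m₁
... | inj₁ m₂ with ∈-∃++ m₂
...   | w₁ , w₂ , refl with peel-pair ββ refl (perm-loop x (β x) w₁ w₂ ws fs) u c
...     | u′ , c′ with explore Q ββ β≢ conn n (w₁ ∷ w₂ ∷ ws) fs le′ u′ c′ q
  where
  le′ : suc (suc (length ws)) + length (LL (w₁ ∷ w₂ ∷ ws) fs) ≤ n
  le′ = ≤-trans (≤-reflexive (trans (cong suc (sym (+-suc (length ws) _))) (trans (sym (+-suc (length ws) _)) (cong (λ z → length ws + z) (sym (PP.↭-length (perm-loop x (β x) w₁ w₂ ws fs))))))) le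
...       | P , g , E , e = P , g , suc E , arc refl e
explore {H} {β} Q ββ β≢ conn (suc n) ((x ∷ w) ∷ ws) fs (s≤s le) u c q | there m | inj₁ m₁ | inj₂ m₂ with ∈-concat⁻′ ws m₂
... | f , y∈f , f∈ws with ∈-∃++ f∈ws | ∈-∃++ y∈f
...   | g₁ , g₂ , refl | p , r , refl with peel-pair ββ refl (perm-handle x (β x) w p r g₁ g₂ fs) u c
...     | u′ , c′ with explore Q ββ β≢ conn n ((r ++ p ++ w) ∷ g₁ ++ g₂) fs le′ u′ c′ q
  where
  le′ : suc (length (g₁ ++ g₂)) + length (LL ((r ++ p ++ w) ∷ g₁ ++ g₂) fs) ≤ n
  le′ = ≤-trans (+-mono-≤ (≤-reflexive (sym (length-mid g₁))) (≤-trans (≤-trans (n≤1+n _) (n≤1+n _)) (≤-reflexive (sym (PP.↭-length (perm-handle x (β x) w p r g₁ g₂ fs)))))) le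
...       | P , g , E , e = P , suc g , suc E , handle refl e

closed-glue : {H V : Set} {β : H → H} {o : H → V} → (∀ h → β (β h) ≡ h) → {x y : H} {v : V} (w p r : List H) → β x ≡ y →
  Chain o β v (x ∷ w) v → Closed o β (p ++ y ∷ r) → Chain o β v (r ++ p ++ w) v
closed-glue {β = β} {o} ββ {x} {v = v} w p r refl (e , c) (z , d) with chain-split p d
... | u , d₁ , (e′ , d₂) = chain-++ r (subst (λ a → Chain o β a r z) (trans (cong o (ββ x)) e) d₂)
  (chain-++ p (subst (λ a → Chain o β z p a) (sym e′) d₁) c)

∈-pair : {H : Set} {x y h : H} {L : List H} → h ∈ x ∷ y ∷ L → h ≡ x ⊎ h ≡ y ⊎ h ∈ L
∈-pair (here e) = inj₁ e
∈-pair (there (here e)) = inj₂ (inj₁ e)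
∈-pair (there (there m)) = inj₂ (inj₂ m)

chain-start-∈ : {H V : Set} {β : H → H} {o : H → V} {u v : V} {pv : List V} (w : List H) → Chain o β u w v → v ∈ pv →
  (∀ {h} → h ∈ w → o h ∈ pv) → u ∈ pv
chain-start-∈ [] refl v∈ _ = v∈
chain-start-∈ {pv = pv} (x ∷ w) (e , _) _ d = subst (_∈ pv) e (d (here refl))

-- Every vertex of the explored part is exhausted at some point, so there are at most P vertices.
popped : {H V : Set} {β : H → H} (o : H → V) → (∀ h → β (β h) ≡ h) → {ws fs : List (List H)} {P g E : ℕ} →
  Explore β ws fs P g E → {vs : List V} → Pointwise (λ v w → Chain o β v w v) vs ws → All (Closed o β) fs →
  Σ (List V) λ pv → length pv ≡ P × (∀ {v} → v ∈ vs → v ∈ pv) × (∀ {h} → h ∈ LL ws fs → o h ∈ pv)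
popped o ββ done [] [] = [] , refl , (λ ()) , (λ ())
popped o ββ (pop e) (_∷_ {x = v} c cs) q with popped o ββ e cs q
... | pv , l , a , d = v ∷ pv , cong suc l , (λ where (here refl) → here refl ; (there m) → there (a m)) , λ m → there (d m)
popped {β = β} o ββ (arc {x} {y} {w₁} {w₂} {ws} {fs} refl e) (_∷_ {x = v} (ex , c) cs) q with chain-split w₁ c
... | z , c₁ , (ey , c₂) with popped o ββ e
        (subst (λ a → Chain o β (o (β x)) w₁ a) (sym ey) c₁ ∷ subst (λ a → Chain o β a w₂ v) (trans (cong o (ββ x)) ex) c₂ ∷ cs) q
...   | pv , l , a , d = pv , l , (λ where (here refl) → a (there (here refl)) ; (there m) → a (there (there m))) ,
        λ m → case ∈-pair (PP.∈-resp-↭ (perm-loop x y w₁ w₂ ws fs) m) of λ where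
          (inj₁ refl) → subst (_∈ pv) (sym ex) (a (there (here refl)))
          (inj₂ (inj₁ refl)) → a (here refl)
          (inj₂ (inj₂ m′)) → d m′
popped {β = β} o ββ (absorb {x} {y} {w} {p} {r} {ws} {f₁} {f₂} refl e) (_∷_ {x = v} c cs) q
  with popped o ββ e (closed-glue ββ w p r refl c (All.head (AllP.++⁻ʳ f₁ q)) ∷ cs) (AllP.++⁺ (AllP.++⁻ˡ f₁ q) (All.tail (AllP.++⁻ʳ f₁ q)))
... | pv , l , a , d = pv , l , (λ where (here refl) → a (here refl) ; (there m) → a (there m)) ,
        λ m → case ∈-pair (PP.∈-resp-↭ (perm-absorb x y w p r ws f₁ f₂) m) of λ where
          (inj₁ refl) → subst (_∈ pv) (sym (proj₁ c)) (a (here refl))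
          (inj₂ (inj₁ refl)) → oy
          (inj₂ (inj₂ m′)) → d m′
  where
  oy : o y ∈ pv
  oy = chain-start-∈ w (proj₂ c) (a (here refl)) (λ m → d (∈-++⁺ˡ (∈-++⁺ˡ (∈-++⁺ʳ r (∈-++⁺ʳ p m)))))
popped {β = β} o ββ (handle {x} {y} {w} {p} {r} {g₁} {g₂} {fs} refl e) {vs = v ∷ vs} (c ∷ cs) q = body
  where
  pw-split : ∀ {A B : Set} {R : A → B → Set} {as : List A} (bs : List B) {b : B} {bs′ : List B} → Pointwise R as (bs ++ b ∷ bs′) →
    Σ (List A) λ as₁ → Σ A λ a → Σ (List A) λ as₂ → as ≡ as₁ ++ a ∷ as₂ × R a b × Pointwise R (as₁ ++ as₂) (bs ++ bs′)
  pw-split [] (r ∷ rs) = [] , _ , _ , refl , r , rs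
  pw-split (b ∷ bs) (r ∷ rs) with pw-split bs rs
  ... | as₁ , a , as₂ , refl , r′ , rs′ = _ ∷ as₁ , a , as₂ , refl , r′ , r ∷ rs′
  body : Σ (List _) λ pv → length pv ≡ _ × (∀ {u} → u ∈ v ∷ vs → u ∈ pv) × (∀ {h} → h ∈ LL ((x ∷ w) ∷ g₁ ++ (p ++ y ∷ r) ∷ g₂) fs → o h ∈ pv)
  body with pw-split g₁ cs
  ... | v₁ , u , v₂ , refl , c′ , cs′ with popped o ββ e (closed-glue ββ w p r refl c (u , c′) ∷ cs′) q
  ...   | pv , l , a , d = pv , l ,
            (λ where (here refl) → a (here refl)
                     (there m) → vm m) ,
            λ m → case ∈-pair (PP.∈-resp-↭ (perm-handle x y w p r g₁ g₂ fs) m) of λ where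
              (inj₁ refl) → subst (_∈ pv) (sym (proj₁ c)) (a (here refl))
              (inj₂ (inj₁ refl)) → oy
              (inj₂ (inj₂ m′)) → d m′
    where
    oy : o y ∈ pv
    oy = chain-start-∈ w (proj₂ c) (a (here refl)) (λ m → d (∈-++⁺ˡ (∈-++⁺ˡ (∈-++⁺ʳ r (∈-++⁺ʳ p m)))))
    vm : ∀ {z} → z ∈ v₁ ++ u ∷ v₂ → z ∈ pv
    vm m with ∈-++⁻ v₁ m
    ... | inj₁ m₁ = a (there (∈-++⁺ˡ m₁))
    ... | inj₂ (there m₂) = a (there (∈-++⁺ʳ v₁ m₂))
    ... | inj₂ (here refl) with chain-split p c′
    ...   | z , d₁ , (ez , d₂) = chain-start-∈ p d₁ (subst (_∈ pv) ez oy) (λ m′ → d (∈-++⁺ˡ (∈-++⁺ˡ (∈-++⁺ʳ r (∈-++⁺ˡ m′)))))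

-- An embedding of the map coded by t into (φ, β) whose boundary reads w and whose image is listed by U.
record Emb {H : Set} (φ β : H → H) (t : Tm) (w U : List H) : Set where
  constructor emb
  field
    p     : Half t → H
    wf    : WF t
    im    : map p (halves t) ≡ U
    bdy   : map p (bw t) ≡ w
    p-opp : ∀ h → β (p h) ≡ p (opp t h)
    inner : All (λ f → IsCyc φ (map p f)) (fcs t)

data Embs {H : Set} (φ β : H → H) : List Tm → List (List H) → List H → Set where
  []  : Embs φ β [] [] []
  _∷_ : ∀ {t w U ts ws Us} → Emb φ β t w U → Embs φ β ts ws Us → Embs φ β (t ∷ ts) (w ∷ ws) (U ++ Us)

map-∘₂ : {A B C : Set} {f : A → B} {g : B → C} {h : A → C} → (∀ x → g (f x) ≡ h x) → (xs : List A) → map g (map f xs) ≡ map h xs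
map-∘₂ e xs = trans (sym (map-∘ xs)) (map-cong e xs)

emb-loop : {H : Set} {φ β : H → H} → (∀ h → β (β h) ≡ h) → {x y : H} → β x ≡ y → {t u : Tm} {w₁ w₂ U₁ U₂ : List H} →
  Emb φ β t w₁ U₁ → Emb φ β u w₂ U₂ → Emb φ β (loop t u) (x ∷ w₁ ++ y ∷ w₂) (x ∷ y ∷ U₁ ++ U₂)
emb-loop {H} {φ} {β} ββ {x} {y} xy {t} {u} {w₁} {w₂} {U₁} {U₂} (emb p₁ wf₁ im₁ b₁ o₁ i₁) (emb p₂ wf₂ im₂ b₂ o₂ i₂) =
  emb p (wf₁ , wf₂)
    (cong (λ z → x ∷ y ∷ z) (trans (map-++ p (map (inj₂ ∘ inj₁) (halves t)) _)
      (cong₂ _++_ (trans (map-∘₂ (λ _ → refl) (halves t)) im₁) (trans (map-∘₂ (λ _ → refl) (halves u)) im₂))))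
    (cong (x ∷_) (trans (map-++ p (map (inj₂ ∘ inj₁) (bw t)) _)
      (cong₂ (λ a c → a ++ y ∷ c) (trans (map-∘₂ (λ _ → refl) (bw t)) b₁) (trans (map-∘₂ (λ _ → refl) (bw u)) b₂))))
    op
    (AllP.++⁺ (AllP.map⁺ (All.map (λ {f} → subst (IsCyc φ) (map-∘ f)) i₁)) (AllP.map⁺ (All.map (λ {f} → subst (IsCyc φ) (map-∘ f)) i₂)))
  where
  p : Half (loop t u) → H
  p (inj₁ true) = x
  p (inj₁ false) = y
  p (inj₂ (inj₁ h)) = p₁ h
  p (inj₂ (inj₂ h)) = p₂ h
  op : ∀ h → β (p h) ≡ p (opp (loop t u) h)
  op (inj₁ true) = xy
  op (inj₁ false) = trans (cong β (sym xy)) (ββ x)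
  op (inj₂ (inj₁ h)) = o₁ h
  op (inj₂ (inj₂ h)) = o₂ h

drop-length : {A : Set} (xs ys : List A) → drop (length xs) (xs ++ ys) ≡ ys
drop-length [] ys = refl
drop-length (x ∷ xs) ys = drop-length xs ys

take-length : {A : Set} (xs ys : List A) → take (length xs) (xs ++ ys) ≡ xs
take-length [] ys = refl
take-length (x ∷ xs) ys = cong (x ∷_) (take-length xs ys)

emb-split : {H : Set} {φ β : H → H} → (∀ h → β (β h) ≡ h) → {x y : H} → β x ≡ y → {t : Tm} (ys : List H) {w U : List H} →
  IsCyc φ (y ∷ ys) → Emb φ β t (ys ++ w) U → Emb φ β (split (length ys) t) (x ∷ w) (x ∷ y ∷ U)
emb-split {H} {φ} {β} ββ {x} {y} xy {t} ys {w} {U} cyc (emb p₁ wf₁ im₁ b₁ o₁ i₁) =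
  emb p (wf₁ , len)
    (cong (λ z → x ∷ y ∷ z) (trans (map-∘₂ (λ _ → refl) (halves t)) im₁))
    (cong (x ∷_) (trans (map-∘₂ (λ _ → refl) (drop (length ys) (bw t)))
      (trans (sym (LP.drop-map (length ys) (bw t))) (trans (cong (drop (length ys)) b₁) (drop-length ys w)))))
    op
    (subst (IsCyc φ) (cong (y ∷_) (sym (trans (map-∘₂ (λ _ → refl) (take (length ys) (bw t)))
      (trans (sym (LP.take-map (length ys) (bw t))) (trans (cong (take (length ys)) b₁) (take-length ys w)))))) cyc
     ∷ AllP.map⁺ (All.map (λ {f} → subst (IsCyc φ) (map-∘ f)) i₁))
  where
  p : Half (split (length ys) t) → H
  p (inj₁ true) = x
  p (inj₁ false) = y
  p (inj₂ h) = p₁ h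
  op : ∀ h → β (p h) ≡ p (opp (split (length ys) t) h)
  op (inj₁ true) = xy
  op (inj₁ false) = trans (cong β (sym xy)) (ββ x)
  op (inj₂ h) = o₁ h
  len : length ys ≤ bd t
  len = subst (length ys ≤_) (trans (sym (length-++ ys)) (trans (cong length (sym b₁)) (length-map p₁ (bw t)))) (m≤m+n (length ys) (length w))

-- A run without handles, read backwards, builds one term per boundary word: `pop` becomes `pt`,
-- `arc` becomes `loop` and `absorb` becomes `split`.
assemble : {H : Set} {φ β : H → H} → (∀ h → β (β h) ≡ h) → {ws fs : List (List H)} {P E : ℕ} →
  Explore β ws fs P 0 E → All (IsCyc φ) fs →
  Σ (List Tm) λ ts → Σ (List H) λ U → Embs φ β ts ws U × U ↭ LL ws fs × concatMap degs ts ↭ map length fs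
assemble ββ done [] = [] , [] , [] , ↭-refl , ↭-refl
assemble ββ (pop e) q with assemble ββ e q
... | ts , U , es , pu , pd = pt ∷ ts , U , emb (λ ()) tt refl refl (λ ()) [] ∷ es , pu , pd
assemble {H} ββ (arc {x} {y} {w₁} {w₂} {ws} {fs} xy e) q with assemble ββ e q
... | t₁ ∷ t₂ ∷ ts , _ , (_∷_ {U = U₁} e₁ (_∷_ {U = U₂} {Us = Us} e₂ es)) , pu , pd =
  loop t₁ t₂ ∷ ts , _ , emb-loop ββ xy e₁ e₂ ∷ es ,
  ↭-trans (prep x (prep y (↭-trans (↭-reflexive (++-assoc U₁ U₂ Us)) pu))) (↭-sym (perm-loop x y w₁ w₂ ws fs)) ,
  ↭-trans (↭-reflexive (++-assoc (degs t₁) (degs t₂) _)) pd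
assemble ββ (absorb {x} {y} {w} {p} {r} {ws} {f₁} {f₂} xy e) q with assemble ββ e (AllP.++⁺ (AllP.++⁻ˡ f₁ q) (All.tail (AllP.++⁻ʳ f₁ q)))
... | t ∷ ts , _ , (_∷_ {U = U} {Us = Us} e₁ es) , pu , pd =
  -- The absorbed face `p ++ y ∷ r`, read from `y` on, is `y ∷ r ++ p`; so `r ++ p` is the part of
  -- it that becomes the beginning of the boundary.
  split (length (r ++ p)) t ∷ ts , _ ,
  emb-split ββ xy (r ++ p) (isCyc-rot p r (All.head (AllP.++⁻ʳ f₁ q))) (subst (λ z → Emb _ _ t z U) (sym (++-assoc r p w)) e₁) ∷ es ,
  ↭-trans (prep x (prep y pu)) (↭-sym (perm-absorb x y w p r ws f₁ f₂)) ,
  ↭-trans (prep _ pd) (↭-trans (↭-reflexive (cong₂ _∷_ leq (map-++ length f₁ f₂)))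
    (↭-trans (↭-sym (PP.shift (length (p ++ y ∷ r)) (map length f₁) (map length f₂))) (↭-reflexive (sym (map-++ length f₁ _)))))
  where
  leq : suc (length (r ++ p)) ≡ length (p ++ y ∷ r)
  leq = trans (cong suc (trans (length-++ r) (trans (+-comm (length r) (length p)) (sym (length-++ p))))) (sym (length-mid p))

-- The vertices enter only through a labelling `o` compatible with `φ` and `β` and a duplicate-free
-- list `vs` of attained values. The field `conn` says that no nonempty union of inner faces is
-- closed under `β`, so that all of them are reached from the root face `w`.
record Planar {H : Set} (φ β : H → H) (w : List H) (fs : List (List H)) : Set₁ where
  field
    β-inv   : ∀ h → β (β h) ≡ h
    β-fpf   : ∀ h → β h ≢ h
    cyc     : All (IsCyc φ) fs
    cycʷ    : Σ H λ h → Seg φ h w h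
    uniq    : Unique (LL (w ∷ []) fs)
    full    : ∀ h → h ∈ LL (w ∷ []) fs
    conn    : ∀ gs → All (λ f → IsCyc φ f × f ∈ fs) gs → ClosedUnder β (concat gs) → gs ≡ []
    V       : Set
    o       : H → V
    o-eq    : ∀ h → o (φ h) ≡ o (β h)
    vs      : List V
    vs-uniq : Unique vs
    vs-hit  : ∀ {v} → v ∈ vs → Σ H λ h → o h ≡ v
    n       : ℕ
    n-eq    : length (LL (w ∷ []) fs) ≡ 2 * n
    χ       : length vs + suc (length fs) ≡ n + 2

-- Every vertex is exhausted during the exploration, so there are at most `P` of them; the relation
-- P + F + 2g = 1 + E of the run, set against Euler's formula, then forces g = 0, and the run
-- assembles to a term.
decode : {H : Set} {φ β : H → H} {w : List H} {fs : List (List H)} → Planar φ β w fs →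
  Σ Tm λ t → Σ (List H) λ U → Emb φ β t w U × U ↭ LL (w ∷ []) fs × degs t ↭ map length fs
decode {H} {φ} {β} {w} {fs} pl = result
  where
  open Planar pl
  ex = explore (λ f → IsCyc φ f × f ∈ fs) β-inv β-fpf conn _ (w ∷ []) fs ≤-refl uniq (λ {h} _ → full (β h))
         (All.tabulate (λ m → All.lookup cyc m , m))
  P = proj₁ ex
  g = proj₁ (proj₂ ex)
  E = proj₁ (proj₂ (proj₂ ex))
  e : Explore β (w ∷ []) fs P g E
  e = proj₂ (proj₂ (proj₂ ex))
  po = popped o β-inv e {vs = o (proj₁ cycʷ) ∷ []} (seg-chain o-eq w (proj₂ cycʷ) ∷ []) (All.map (λ {f} → λ where (h , s , _) → o h , seg-chain o-eq f s) cyc)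
  V≤P : length vs ≤ P
  V≤P = subst (length vs ≤_) (proj₁ (proj₂ po)) (unique-⊆-length vs-uniq
    (λ m → case vs-hit m of λ where (h , refl) → proj₂ (proj₂ (proj₂ po)) (full h)))
  E≡n : E ≡ n
  E≡n = ℕP.*-cancelˡ-≡ E n 2 (trans (sym (explore-length e)) n-eq)
  g≡0 : g ≡ 0
  g≡0 = lem g V≤P (trans (explore-count e) (cong suc E≡n)) χ
    where
    lem : ∀ g {v p f m} → v ≤ p → p + f + 2 * g ≡ suc m → v + suc f ≡ m + 2 → g ≡ 0
    lem zero _ _ _ = refl
    lem (suc g) {v} {p} {f} {m} le e₁ e₂ = ⊥-elim (ℕP.<-irrefl refl (begin-strict
      suc m <⟨ s≤s (subst (suc m ≤_) (+-comm 2 m) (n≤1+n (suc m))) ⟩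
      suc (m + 2) ≡⟨ cong suc (sym e₂) ⟩
      suc (v + suc f) ≡⟨ sym (eq v f) ⟩
      v + f + 2 ≤⟨ ℕP.+-monoˡ-≤ 2 (ℕP.+-monoˡ-≤ f le) ⟩
      p + f + 2 ≤⟨ ℕP.+-monoʳ-≤ (p + f) (ℕP.*-monoʳ-≤ 2 (s≤s (z≤n {g}))) ⟩
      p + f + 2 * suc g ≡⟨ e₁ ⟩
      suc m ∎))
      where
      open ℕP.≤-Reasoning
      eq : ∀ v f → v + f + 2 ≡ suc (v + suc f)
      eq = ℕR.solve-∀
  result : Σ Tm λ t → Σ (List H) λ U → Emb φ β t w U × U ↭ LL (w ∷ []) fs × degs t ↭ map length fs
  result with assemble β-inv (subst (λ z → Explore β (w ∷ []) fs P z E) g≡0 e) cyc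
  ... | t ∷ [] , _ , (_∷_ {U = U} em []) , pu , pd = t , U , em , subst (_↭ _) (++-identityʳ U) pu , subst (_↭ _) (++-identityʳ (degs t)) pd

-- Rigidity of rooted maps

map-unique⇒inj : {A B : Set} (p : A → B) {xs : List A} → Unique (map p xs) → ∀ {h h′} → h ∈ xs → h′ ∈ xs → p h ≡ p h′ → h ≡ h′
map-unique⇒inj p (n ∷ u) (here refl) (here refl) e = refl
map-unique⇒inj p (n ∷ u) (here refl) (there m) e = ⊥-elim (All.lookup n (∈-map⁺ p m) e)
map-unique⇒inj p (n ∷ u) (there m) (here refl) e = ⊥-elim (All.lookup n (∈-map⁺ p m) (sym e))
map-unique⇒inj p (n ∷ u) (there m) (there m′) e = map-unique⇒inj p u m m′ e

Inj : {A B : Set} → (A → B) → Set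
Inj {A} p = ∀ {h h′ : A} → p h ≡ p h′ → h ≡ h′

∉-map : {A B : Set} {p : A → B} → Inj p → {x : A} {xs : List A} → x ∉ xs → p x ∉ map p xs
∉-map {p = p} inj x∉ m with ∈-map⁻ p m
... | y , y∈ , e = x∉ (subst (_∈ _) (sym (inj e)) y∈)

split-unique : {A : Set} {y : A} (xs xs′ : List A) {ys ys′ : List A} → y ∉ xs → y ∉ xs′ → xs ++ y ∷ ys ≡ xs′ ++ y ∷ ys′ →
  xs ≡ xs′ × ys ≡ ys′
split-unique [] [] _ _ refl = refl , refl
split-unique [] (x ∷ xs′) _ n′ refl = ⊥-elim (n′ (here refl))
split-unique (x ∷ xs) [] n _ refl = ⊥-elim (n (here refl))
split-unique (x ∷ xs) (x′ ∷ xs′) n n′ e with ∷-injective e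
... | refl , e′ with split-unique xs xs′ (n ∘ there) (n′ ∘ there) e′
...   | refl , refl = refl , refl

seg-unique : {H : Set} {φ : H → H} {a y : H} (ys ys′ : List H) → Seg φ a ys y → Seg φ a ys′ y → y ∉ ys → y ∉ ys′ → ys ≡ ys′
seg-unique [] [] _ _ _ _ = refl
seg-unique [] (x ∷ ys′) refl (refl , _) _ n = ⊥-elim (n (here refl))
seg-unique (x ∷ ys) [] (refl , _) refl n _ = ⊥-elim (n (here refl))
seg-unique (x ∷ ys) (x′ ∷ ys′) (refl , s) (refl , s′) n n′ = cong (x ∷_) (seg-unique ys ys′ s s′ (n ∘ there) (n′ ∘ there))

true∉ : {A B : Set} {x : A} {xs : List B} → inj₁ x ∉ map inj₂ xs
true∉ m with ∈-map⁻ inj₂ m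
... | _ , _ , ()

true∉₂ : {A B C : Set} {f : C → B} {x : A} {xs : List C} → inj₁ x ∉ map (inj₂ ∘ f) xs
true∉₂ {f = f} m with ∈-map⁻ (inj₂ ∘ f) m
... | _ , _ , ()

-- The first boundary letter is the root side. Its opposite lies on the boundary exactly for `loop`,
-- where its position separates the two parts; for `split` the `φ`-segment that returns to it is the
-- word of the new face and gives `i`. So the boundary word determines the term and the embedding.
emb-unique : {H : Set} {φ β : H → H} (t t′ : Tm) → WF t → WF t′ → (p : Half t → H) (p′ : Half t′ → H) → Inj p → Inj p′ →
  (∀ h → β (p h) ≡ p (opp t h)) → (∀ h → β (p′ h) ≡ p′ (opp t′ h)) →
  All (λ f → IsCyc φ (map p f)) (fcs t) → All (λ f → IsCyc φ (map p′ f)) (fcs t′) → map p (bw t) ≡ map p′ (bw t′) →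
  Σ (t ≡ t′) λ e → ∀ h → p h ≡ p′ (subst Half e h)
emb-unique pt pt _ _ p p′ ip ip′ op op′ c c′ e = refl , λ ()
emb-unique pt (loop _ _) _ _ p p′ ip ip′ op op′ c c′ ()
emb-unique pt (split _ _) _ _ p p′ ip ip′ op op′ c c′ ()
emb-unique (loop _ _) pt _ _ p p′ ip ip′ op op′ c c′ ()
emb-unique (split _ _) pt _ _ p p′ ip ip′ op op′ c c′ ()
emb-unique {φ = φ} {β} (loop t u) (loop t′ u′) (wt , wu) (wt′ , wu′) p p′ ip ip′ op op′ c c′ e with ∷-injective e
... | ex , e₁ = result
  where
  p₁ = p ∘ inj₂ ∘ inj₁
  p₂ = p ∘ inj₂ ∘ inj₂
  p₁′ = p′ ∘ inj₂ ∘ inj₁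
  p₂′ = p′ ∘ inj₂ ∘ inj₂
  ey : p (inj₁ false) ≡ p′ (inj₁ false)
  ey = trans (sym (op (inj₁ true))) (trans (cong β ex) (op′ (inj₁ true)))
  e₂ : map p₁ (bw t) ++ p (inj₁ false) ∷ map p₂ (bw u) ≡ map p₁′ (bw t′) ++ p (inj₁ false) ∷ map p₂′ (bw u′)
  e₂ = trans (sym (trans (map-++ p (map (inj₂ ∘ inj₁) (bw t)) _) (cong₂ (λ a b → a ++ p (inj₁ false) ∷ b) (map-∘₂ (λ _ → refl) (bw t)) (map-∘₂ (λ _ → refl) (bw u)))))
    (trans e₁ (trans (map-++ p′ (map (inj₂ ∘ inj₁) (bw t′)) _) (trans (cong₂ (λ a b → a ++ p′ (inj₁ false) ∷ b) (map-∘₂ (λ _ → refl) (bw t′)) (map-∘₂ (λ _ → refl) (bw u′)))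
      (cong (λ z → map p₁′ (bw t′) ++ z ∷ map p₂′ (bw u′)) (sym ey)))))
  y∉ : p (inj₁ false) ∉ map p₁ (bw t)
  y∉ m = ∉-map ip true∉₂ (subst (p (inj₁ false) ∈_) (map-∘ (bw t)) m)
  y∉′ : p (inj₁ false) ∉ map p₁′ (bw t′)
  y∉′ m = ∉-map ip′ true∉₂ (subst₂ _∈_ ey (map-∘ (bw t′)) m)
  e₃ = split-unique (map p₁ (bw t)) (map p₁′ (bw t′)) y∉ y∉′ e₂
  un : ∀ {A B : Set} {f : A → B} {g : B → _} {fs} → All (λ f → IsCyc φ (map g f)) (map (map f) fs) → All (λ x → IsCyc φ (map (g ∘ f) x)) fs
  un {f = f} {g} a = All.map (λ {x} → subst (IsCyc φ) (sym (map-∘ x))) (AllP.map⁻ a)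
  r₁ = emb-unique {φ = φ} {β} t t′ wt wt′ p₁ p₁′ (inj₁-inj ∘ inj₂-inj ∘ ip) (inj₁-inj ∘ inj₂-inj ∘ ip′) (op ∘ inj₂ ∘ inj₁) (op′ ∘ inj₂ ∘ inj₁)
        (un (AllP.++⁻ˡ _ c)) (un (AllP.++⁻ˡ _ c′)) (proj₁ e₃)
  r₂ = emb-unique {φ = φ} {β} u u′ wu wu′ p₂ p₂′ (inj₂-inj ∘ inj₂-inj ∘ ip) (inj₂-inj ∘ inj₂-inj ∘ ip′) (op ∘ inj₂ ∘ inj₂) (op′ ∘ inj₂ ∘ inj₂)
        (un (AllP.++⁻ʳ (map (map (inj₂ ∘ inj₁)) (fcs t)) c)) (un (AllP.++⁻ʳ (map (map (inj₂ ∘ inj₁)) (fcs t′)) c′)) (proj₂ e₃)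
  result : Σ (loop t u ≡ loop t′ u′) λ e → ∀ h → p h ≡ p′ (subst Half e h)
  result with r₁ | r₂
  ... | refl , h₁ | refl , h₂ = refl , λ where
    (inj₁ true) → ex
    (inj₁ false) → ey
    (inj₂ (inj₁ h)) → h₁ h
    (inj₂ (inj₂ h)) → h₂ h
emb-unique {β = β} (loop t u) (split i t′) _ _ p p′ ip ip′ op op′ c c′ e with ∷-injective e
... | ex , e₁ = ⊥-elim (∉-map ip′ true∉ (subst₂ _∈_ (trans (sym (op (inj₁ true))) (trans (cong β ex) (op′ (inj₁ true)))) e₁ (∈-map⁺ p (∈-insert (map (inj₂ ∘ inj₁) (bw t))))))
emb-unique {β = β} (split i t) (loop t′ u′) _ _ p p′ ip ip′ op op′ c c′ e with ∷-injective e
... | ex , e₁ = ⊥-elim (∉-map ip true∉ (subst₂ _∈_ (trans (sym (op′ (inj₁ true))) (trans (cong β (sym ex)) (op (inj₁ true)))) (sym e₁) (∈-map⁺ p′ (∈-insert (map (inj₂ ∘ inj₁) (bw t′))))))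
emb-unique {H} {φ} {β} (split i t) (split i′ t′) (wt , li) (wt′ , li′) p p′ ip ip′ op op′ ((a , (ea , sa) , _) ∷ c) ((a′ , (ea′ , sa′) , _) ∷ c′) e with ∷-injective e
... | ex , e₁ = result
  where
  q = p ∘ inj₂
  q′ = p′ ∘ inj₂
  ey : p (inj₁ false) ≡ p′ (inj₁ false)
  ey = trans (sym (op (inj₁ true))) (trans (cong β ex) (op′ (inj₁ true)))
  s : Seg φ (φ (p (inj₁ false))) (map p (map inj₂ (take i (bw t)))) (p (inj₁ false))
  s = subst (λ z → Seg φ _ _ z) (sym ea) sa
  s′ : Seg φ (φ (p (inj₁ false))) (map p′ (map inj₂ (take i′ (bw t′)))) (p (inj₁ false))
  s′ = subst₂ (λ z z′ → Seg φ (φ z) _ z′) (sym ey) (sym (trans ey ea′)) sa′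
  et : map q (take i (bw t)) ≡ map q′ (take i′ (bw t′))
  et = trans (map-∘ (take i (bw t))) (trans (seg-unique _ _ s s′ (∉-map ip true∉) (λ m → ∉-map ip′ true∉ (subst (_∈ _) ey m))) (sym (map-∘ (take i′ (bw t′)))))
  ed : map q (drop i (bw t)) ≡ map q′ (drop i′ (bw t′))
  ed = trans (map-∘ (drop i (bw t))) (trans e₁ (sym (map-∘ (drop i′ (bw t′)))))
  join : ∀ {A : Set} (f : A → H) i xs → map f xs ≡ map f (take i xs) ++ map f (drop i xs)
  join f i xs = trans (cong (map f) (sym (take++drop≡id i xs))) (map-++ f (take i xs) _)
  lt : ∀ {A : Set} (f : A → H) i (xs : List A) → i ≤ length xs → length (map f (take i xs)) ≡ i
  lt f i xs le = trans (length-map f (take i xs)) (trans (length-take i xs) (ℕP.m≤n⇒m⊓n≡m le))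
  ei : i ≡ i′
  ei = trans (sym (lt q i (bw t) li)) (trans (cong length et) (lt q′ i′ (bw t′) li′))
  r = emb-unique {φ = φ} {β} t t′ wt wt′ q q′ (inj₂-inj ∘ ip) (inj₂-inj ∘ ip′) (op ∘ inj₂) (op′ ∘ inj₂)
       (All.map (λ {x} → subst (IsCyc φ) (sym (map-∘ x))) (AllP.map⁻ c)) (All.map (λ {x} → subst (IsCyc φ) (sym (map-∘ x))) (AllP.map⁻ c′))
       (trans (join q i (bw t)) (trans (cong₂ _++_ et ed) (sym (join q′ i′ (bw t′)))))
  result : Σ (split i t ≡ split i′ t′) λ e → ∀ h → p h ≡ p′ (subst Half e h)
  result with ei | r
  ... | refl | refl , h = refl , λ where
    (inj₁ true) → ex
    (inj₁ false) → ey
    (inj₂ x) → h x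

-- The face permutation of a term and the change of root

nextIn : {H : Set} → DecidableEquality H → H → List H → H → H
nextIn _≟_ f [] h = h
nextIn _≟_ f (x ∷ []) h = f
nextIn _≟_ f (x ∷ y ∷ r) h = if does (h ≟ x) then y else nextIn _≟_ f (y ∷ r) h

headOr : {H : Set} → H → List H → H
headOr d [] = d
headOr d (x ∷ _) = x

cycNext : {H : Set} → DecidableEquality H → List (List H) → H → H
cycNext _≟_ [] h = h
cycNext _≟_ (c ∷ cs) h with any? (h ≟_) c
... | yes _ = nextIn _≟_ (headOr h c) c h
... | no _ = cycNext _≟_ cs h

nextIn-seg : {H : Set} (_≟_ : DecidableEquality H) {φ : H → H} (f x : H) (r : List H) → Unique (x ∷ r) →
  (∀ {h} → h ∈ x ∷ r → φ h ≡ nextIn _≟_ f (x ∷ r) h) → Seg φ x (x ∷ r) f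
nextIn-seg _≟_ f x [] u e = refl , e (here refl)
nextIn-seg _≟_ {φ} f x (y ∷ r) (n ∷ u) e = refl , subst (λ z → Seg φ z (y ∷ r) f) (sym φx) (nextIn-seg _≟_ f y r u e′)
  where
  φx : φ x ≡ y
  φx with e (here refl)
  ... | e₀ with x ≟ x
  ...   | yes _ = e₀
  ...   | no x≢x = ⊥-elim (x≢x refl)
  e′ : ∀ {h} → h ∈ y ∷ r → φ h ≡ nextIn _≟_ f (y ∷ r) h
  e′ {h} m with e (there m)
  ... | e₀ with h ≟ x
  ...   | yes refl = ⊥-elim (All.lookup n m refl)
  ...   | no _ = e₀

unique-++ʳ : {A : Set} (xs : List A) {ys : List A} → Unique (xs ++ ys) → Unique ys
unique-++ʳ [] u = u
unique-++ʳ (x ∷ xs) (_ ∷ u) = unique-++ʳ xs u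

unique-++ˡ : {A : Set} (xs : List A) {ys : List A} → Unique (xs ++ ys) → Unique xs
unique-++ˡ [] u = []
unique-++ˡ (x ∷ xs) (n ∷ u) = AllP.++⁻ˡ xs n ∷ unique-++ˡ xs u

unique-disjoint : {A : Set} (xs : List A) {ys : List A} {h : A} → Unique (xs ++ ys) → h ∈ xs → h ∈ ys → ⊥
unique-disjoint (x ∷ xs) (n ∷ u) (here refl) m = All.lookup (AllP.++⁻ʳ xs n) m refl
unique-disjoint (x ∷ xs) (n ∷ u) (there m′) m = unique-disjoint xs u m′ m

cycNext-∈ : {H : Set} (_≟_ : DecidableEquality H) (cs : List (List H)) → Unique (concat cs) → ∀ {x r h} → (x ∷ r) ∈ cs → h ∈ x ∷ r →
  cycNext _≟_ cs h ≡ nextIn _≟_ x (x ∷ r) h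
cycNext-∈ _≟_ (c ∷ cs) u {x} {r} {h} c∈ h∈ with any? (h ≟_) c
cycNext-∈ _≟_ (c ∷ cs) u (here refl) h∈ | yes _ = refl
cycNext-∈ _≟_ (c ∷ cs) u (there m) h∈ | yes h∈c = ⊥-elim (unique-disjoint c u h∈c (∈-concat⁺′ h∈ m))
cycNext-∈ _≟_ (c ∷ cs) u (here refl) h∈ | no h∉c = ⊥-elim (h∉c h∈)
cycNext-∈ _≟_ (c ∷ cs) u (there m) h∈ | no _ = cycNext-∈ _≟_ cs (unique-++ʳ c u) m h∈

unique-concat : {H : Set} (cs : List (List H)) {c : List H} → Unique (concat cs) → c ∈ cs → Unique c
unique-concat (c ∷ cs) u (here refl) = unique-++ˡ c u
unique-concat (c ∷ cs) u (there m) = unique-concat cs (unique-++ʳ c u) m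

cycNext-isCyc : {H : Set} (_≟_ : DecidableEquality H) (cs : List (List H)) → Unique (concat cs) → ∀ {x r} → (x ∷ r) ∈ cs → IsCyc (cycNext _≟_ cs) (x ∷ r)
cycNext-isCyc _≟_ cs u {x} {r} c∈ = x , nextIn-seg _≟_ x x r (unique-concat cs u c∈) (λ h∈ → cycNext-∈ _≟_ cs u c∈ h∈) , here refl

letters-↭ : ∀ t → bw t ++ concat (fcs t) ↭ halves t
letters-↭ pt = ↭-refl
letters-↭ (loop t u) = prep _ (↭-trans
    (↭-reflexive (trans (++-assoc a (inj₁ false ∷ b) (concat (fcs (loop t u)))) (cong (λ z → a ++ inj₁ false ∷ b ++ z) ec)))
    (↭-trans (S.solve 5 (λ a y b c d → a S.⊕ (y S.⊕ (b S.⊕ (c S.⊕ d))) S.⊜ y S.⊕ ((a S.⊕ c) S.⊕ (b S.⊕ d))) ↭-refl a [ inj₁ false ] b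
                 (map (inj₂ ∘ inj₁) (concat (fcs t))) (map (inj₂ ∘ inj₂) (concat (fcs u))))
      (prep _ (PP.++⁺ (↭-trans (↭-reflexive (sym (map-++ (inj₂ ∘ inj₁) (bw t) _))) (PP.map⁺ (inj₂ ∘ inj₁) (letters-↭ t)))
                      (↭-trans (↭-reflexive (sym (map-++ (inj₂ ∘ inj₂) (bw u) _))) (PP.map⁺ (inj₂ ∘ inj₂) (letters-↭ u)))))))
  where
  module S = CMSolver (PP.++-commutativeMonoid {A = Half (loop t u)})
  a = map (inj₂ ∘ inj₁) (bw t)
  b = map (inj₂ ∘ inj₂) (bw u)
  ec : concat (fcs (loop t u)) ≡ map (inj₂ ∘ inj₁) (concat (fcs t)) ++ map (inj₂ ∘ inj₂) (concat (fcs u))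
  ec = trans (sym (LP.concat-++ (map (map (inj₂ ∘ inj₁)) (fcs t)) _)) (cong₂ _++_ (LP.concat-map (fcs t)) (LP.concat-map (fcs u)))
letters-↭ (split i t) = prep _ (↭-trans
    (S.solve 4 (λ d y k c → d S.⊕ ((y S.⊕ k) S.⊕ c) S.⊜ y S.⊕ ((k S.⊕ d) S.⊕ c)) ↭-refl (map inj₂ (drop i (bw t))) [ inj₁ false ] (map inj₂ (take i (bw t))) (concat (map (map inj₂) (fcs t))))
    (prep _ (↭-trans (↭-reflexive (trans (cong₂ _++_ (trans (sym (map-++ inj₂ (take i (bw t)) _)) (cong (map inj₂) (take++drop≡id i (bw t)))) (LP.concat-map (fcs t)))
        (sym (map-++ inj₂ (bw t) _)))) (PP.map⁺ inj₂ (letters-↭ t)))))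
  where
  module S = CMSolver (PP.++-commutativeMonoid {A = Half (split i t)})

-- The face permutation is read off the words themselves, which makes the boundary and every inner
-- face a cycle by construction.
nxt : (t : Tm) → Half t → Half t
nxt t = cycNext (Half-≟ t) (bw t ∷ fcs t)

letters-unique : ∀ t → Unique (concat (bw t ∷ fcs t))
letters-unique t = unique-↭ (↭-sym (letters-↭ t)) (halves-unique t)

∈-letters : ∀ t h → h ∈ concat (bw t ∷ fcs t)
∈-letters t h = PP.∈-resp-↭ (↭-sym (letters-↭ t)) (∈-halves t h)

fcs-nonempty : ∀ t {f} → f ∈ fcs t → Σ (Half t) λ x → Σ (List (Half t)) λ r → f ≡ x ∷ r
fcs-nonempty (loop t u) m with ∈-++⁻ (map (map (inj₂ ∘ inj₁)) (fcs t)) m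
... | inj₁ m₁ with ∈-map⁻ (map (inj₂ ∘ inj₁)) m₁
...   | f , f∈ , refl with fcs-nonempty t f∈
...     | x , r , refl = _ , _ , refl
fcs-nonempty (loop t u) m | inj₂ m₂ with ∈-map⁻ (map (inj₂ ∘ inj₂)) m₂
...   | f , f∈ , refl with fcs-nonempty u f∈
...     | x , r , refl = _ , _ , refl
fcs-nonempty (split i t) (here refl) = _ , _ , refl
fcs-nonempty (split i t) (there m) with ∈-map⁻ (map inj₂) m
... | f , f∈ , refl with fcs-nonempty t f∈
...   | x , r , refl = _ , _ , refl

nxt-fcs : ∀ t → All (IsCyc (nxt t)) (fcs t)
nxt-fcs t = All.tabulate λ {f} m → lem f m (fcs-nonempty t m)
  where
  lem : ∀ f → f ∈ fcs t → (Σ (Half t) λ x → Σ (List (Half t)) λ r → f ≡ x ∷ r) → IsCyc (nxt t) f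
  lem f m (x , r , refl) = cycNext-isCyc (Half-≟ t) (bw t ∷ fcs t) (letters-unique t) (there m)

nxt-bw : ∀ t {x r} → bw t ≡ x ∷ r → IsCyc (nxt t) (bw t)
nxt-bw t {x} {r} e = subst (IsCyc (nxt t)) (sym e) (cycNext-isCyc (Half-≟ t) (bw t ∷ fcs t) (letters-unique t) (here (sym e)))

bw-nonempty : ∀ t → Half t → Σ (Half t) λ x → Σ (List (Half t)) λ r → bw t ≡ x ∷ r
bw-nonempty (loop t u) _ = _ , _ , refl
bw-nonempty (split i t) _ = _ , _ , refl

cycle-of : ∀ t (h : Half t) → Σ (List (Half t)) λ f → IsCyc (nxt t) f × h ∈ f × f ∈ bw t ∷ fcs t
cycle-of t h with ∈-concat⁻′ (bw t ∷ fcs t) (∈-letters t h)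
... | f , h∈ , here refl = bw t , nxt-bw t (proj₂ (proj₂ (bw-nonempty t h))) , h∈ , here refl
... | f , h∈ , there m = f , All.lookup (nxt-fcs t) m , h∈ , there m

seg-all : {H : Set} {φ : H → H} {S : H → Set} → (∀ {h} → S h → S (φ h)) → {a b : H} (w : List H) → Seg φ a w b → S a → ∀ {x} → x ∈ w → S x
seg-all cl (x ∷ w) (refl , s) sa (here refl) = sa
seg-all cl (x ∷ w) (refl , s) sa (there m) = seg-all cl w s (cl sa) m

isCyc-all : {H : Set} {φ : H → H} {S : H → Set} → (∀ {h} → S h → S (φ h)) → {f : List H} → IsCyc φ f →
  ∀ {h x} → h ∈ f → S h → x ∈ f → S x
isCyc-all {φ = φ} {S} cl c h∈ sh x∈ with ∈-∃++ h∈
... | p , r , refl with isCyc-rot p r c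
...   | b , (refl , s) , _ with ∈-++⁻ p x∈
...     | inj₁ m = seg-all cl (r ++ p) s (cl sh) (∈-++⁺ʳ r m)
...     | inj₂ (here refl) = sh
...     | inj₂ (there m) = seg-all cl (r ++ p) s (cl sh) (∈-++⁺ˡ m)

seg-chain-step : {H V : Set} {φ β : H → H} {o : H → V} {a b : H} {v u : V} (w : List H) → Seg φ a w b → Chain o β v w u → o b ≡ u →
  ∀ {h} → h ∈ w → o (φ h) ≡ o (β h)
seg-chain-step (x ∷ []) (refl , refl) (_ , c) e (here refl) = trans e (sym c)
seg-chain-step (x ∷ y ∷ w) (refl , (e₁ , s)) (_ , (e₂ , c)) e (here refl) = trans (cong _ (sym e₁)) e₂
seg-chain-step (x ∷ y ∷ w) (refl , s) (_ , c) e (there m) = seg-chain-step (y ∷ w) s c e m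

cyc-chain-step : {H V : Set} {φ β : H → H} {o : H → V} {w : List H} → IsCyc φ w → Closed o β w → ∀ {h} → h ∈ w → o (φ h) ≡ o (β h)
cyc-chain-step {w = x ∷ w} (a , (refl , s) , _) (v , (e , c)) m = seg-chain-step (x ∷ w) (refl , s) (e , c) e m

org-nxt : ∀ t → WF t → ∀ h → org t (nxt t h) ≡ org t (opp t h)
org-nxt t wf h with cycle-of t h
... | _ , c , h∈ , here refl = cyc-chain-step c (root t , chain-bw t wf) h∈
... | _ , c , h∈ , there m = cyc-chain-step c (All.lookup (chain-fcs t wf) m) h∈

-- Connectedness by induction on the term: deleting the root edge brings to the boundary only sides
-- that share a face with its opposite side, or that were on the boundary before.
unreached : ∀ t {R : Half t → Set} → (∀ {h} → R h → R (opp t h)) → (∀ {f h h′} → f ∈ fcs t → h ∈ f → h′ ∈ f → R h → R h′) →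
  (∀ {h} → h ∈ bw t → ¬ R h) → ∀ h → ¬ R h
unreached (loop t u) ro rf rb (inj₁ true) r = rb (here refl) r
unreached (loop t u) ro rf rb (inj₁ false) r = rb (here refl) (ro r)
unreached (loop t u) {R} ro rf rb (inj₂ (inj₁ h)) = unreached t {R ∘ inj₂ ∘ inj₁} ro
  (λ f∈ h∈ h′∈ → rf (∈-++⁺ˡ (∈-map⁺ _ f∈)) (∈-map⁺ _ h∈) (∈-map⁺ _ h′∈)) (λ m → rb (there (∈-++⁺ˡ (∈-map⁺ _ m)))) h
unreached (loop t u) {R} ro rf rb (inj₂ (inj₂ h)) = unreached u {R ∘ inj₂ ∘ inj₂} ro
  (λ f∈ h∈ h′∈ → rf (∈-++⁺ʳ (map (map (inj₂ ∘ inj₁)) (fcs t)) (∈-map⁺ _ f∈)) (∈-map⁺ _ h∈) (∈-map⁺ _ h′∈))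
  (λ m → rb (there (∈-++⁺ʳ (map (inj₂ ∘ inj₁) (bw t)) (there (∈-map⁺ _ m))))) h
unreached (split i t) ro rf rb (inj₁ true) r = rb (here refl) r
unreached (split i t) ro rf rb (inj₁ false) r = rb (here refl) (ro r)
unreached (split i t) {R} ro rf rb (inj₂ h) = unreached t {R ∘ inj₂} ro
  (λ f∈ h∈ h′∈ → rf (there (∈-map⁺ _ f∈)) (∈-map⁺ _ h∈) (∈-map⁺ _ h′∈)) lem h
  where
  lem : ∀ {h} → h ∈ bw t → ¬ R (inj₂ h)
  lem {h} m r with ∈-++⁻ (take i (bw t)) (subst (h ∈_) (sym (take++drop≡id i (bw t))) m)
  ... | inj₁ m₁ = rb (here refl) (ro (rf (here refl) (there (∈-map⁺ _ m₁)) (here refl) r))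
  ... | inj₂ m₂ = rb (there (∈-map⁺ _ m₂)) r

vert-hit : ∀ t v → v ≡ root t ⊎ (Σ (Half t) λ h → org t h ≡ v)
vert-hit pt tt = inj₁ refl
vert-hit (loop t u) (inj₁ v) with vert-hit t v
... | inj₁ refl = inj₂ (inj₁ false , refl)
... | inj₂ (h , e) = inj₂ (inj₂ (inj₁ h) , cong inj₁ e)
vert-hit (loop t u) (inj₂ v) with vert-hit u v
... | inj₁ refl = inj₁ refl
... | inj₂ (h , e) = inj₂ (inj₂ (inj₂ h) , cong inj₂ e)
vert-hit (split i t) v with vert-hit t v
... | inj₁ refl = inj₁ refl
... | inj₂ (h , e) = inj₂ (inj₂ h , e)

org-onto : ∀ t → Half t → ∀ v → Σ (Half t) λ h → org t h ≡ v
org-onto (loop t u) _ v with vert-hit (loop t u) v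
... | inj₁ refl = inj₁ true , refl
... | inj₂ r = r
org-onto (split i t) _ v with vert-hit (split i t) v
... | inj₁ refl = inj₁ true , refl
... | inj₂ r = r

degs-length : ∀ t → WF t → map length (fcs t) ≡ degs t
degs-length pt _ = refl
degs-length (loop t u) (wt , wu) = trans (map-++ length (map (map (inj₂ ∘ inj₁)) (fcs t)) _)
  (cong₂ _++_ (trans (map-∘₂ (length-map (inj₂ ∘ inj₁)) (fcs t)) (degs-length t wt)) (trans (map-∘₂ (length-map (inj₂ ∘ inj₂)) (fcs u)) (degs-length u wu)))
degs-length (split i t) (wt , li) = cong₂ _∷_ (cong suc (trans (length-map inj₂ (take i (bw t))) (trans (length-take i (bw t)) (ℕP.m≤n⇒m⊓n≡m li))))
  (trans (map-∘₂ (length-map inj₂) (fcs t)) (degs-length t wt))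

-- The conditions of `Planar` see the boundary only as a cycle, so any rotation of its word
-- satisfies them and can be decoded anew.
planar-rotated : ∀ t → WF t → Half t → ∀ u v → bw t ≡ u ++ v → Planar (nxt t) (opp t) (v ++ u) (fcs t)
planar-rotated t wf h₀ u v e = record
  { β-inv = opp-opp t ; β-fpf = opp-≢ t ; cyc = nxt-fcs t ; cycʷ = cw ; uniq = unique-↭ (↭-sym pm) (halves-unique t)
  ; full = λ h → PP.∈-resp-↭ (↭-sym pm) (∈-halves t h) ; conn = cn ; V = Vert t ; o = org t ; o-eq = org-nxt t wf ; vs = verts t
  ; vs-uniq = verts-unique t ; vs-hit = λ {w} _ → org-onto t h₀ w ; n = edges t
  ; n-eq = trans (PP.↭-length pm) (halves-length t)
  ; χ = trans (+-suc (length (verts t)) _) (trans (cong suc (trans (cong (λ z → length (verts t) + z) (trans (sym (length-map length (fcs t))) (cong length (degs-length t wf)))) (euler t))) (+-comm 2 (edges t))) }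
  where
  pm : LL ((v ++ u) ∷ []) (fcs t) ↭ halves t
  pm = ↭-trans (PP.++⁺ʳ (concat (fcs t)) (↭-trans (↭-reflexive (++-identityʳ (v ++ u))) (↭-trans (PP.++-comm v u) (↭-reflexive (sym e))))) (letters-↭ t)
  cw : Σ (Half t) λ h → Seg (nxt t) h (v ++ u) h
  cw with nxt-bw t (proj₂ (proj₂ (bw-nonempty t h₀)))
  ... | h , s , _ with seg-split u (subst (λ z → Seg (nxt t) h z h) e s)
  ...   | b , s₁ , s₂ = b , seg-++ v s₂ s₁
  cn : ∀ gs → All (λ f → IsCyc (nxt t) f × f ∈ fcs t) gs → ClosedUnder (opp t) (concat gs) → gs ≡ []
  cn [] _ _ = refl
  cn gs@(_ ∷ _) a@(((h , _ , h∈) , _) ∷ _) c = ⊥-elim (unreached t {λ h → h ∈ concat gs} c fc bc h (∈-++⁺ˡ h∈))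
    where
    clo : ∀ {h} → h ∈ concat gs → nxt t h ∈ concat gs
    clo m with ∈-concat⁻′ gs m
    ... | f , m₁ , m₂ = ∈-concat⁺′ (isCyc-closed (proj₁ (All.lookup a m₂)) m₁) m₂
    fc : ∀ {f h h′} → f ∈ fcs t → h ∈ f → h′ ∈ f → h ∈ concat gs → h′ ∈ concat gs
    fc f∈ h∈ h′∈ r = isCyc-all {S = λ h → h ∈ concat gs} clo (All.lookup (nxt-fcs t) f∈) h∈ r h′∈
    bc : ∀ {h} → h ∈ bw t → ¬ (h ∈ concat gs)
    bc m m′ with ∈-concat⁻′ gs m′
    ... | f , m₁ , m₂ = unique-disjoint (bw t) (letters-unique t) m (∈-concat⁺′ m₁ (proj₂ (All.lookup a m₂)))

-- t′ is the map of t rooted so that its boundary reads v ++ u.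
record Rerooted (t t′ : Tm) (u v : List (Half t)) : Set where
  field
    wf   : WF t
    wf′  : WF t′
    q    : Half t′ → Half t
    q-inj : Inj q
    q-sur : ∀ h → Σ (Half t′) λ h′ → q h′ ≡ h
    q-opp : ∀ h → opp t (q h) ≡ q (opp t′ h)
    q-bw  : map q (bw t′) ≡ v ++ u
    q-fcs : All (λ f → IsCyc (nxt t) (map q f)) (fcs t′)
    q-nxt : ∀ h → nxt t (q h) ≡ q (nxt t′ h)
    degs-↭ : degs t′ ↭ degs t
    vm    : Vert t′ → Vert t
    vm-org : ∀ h → org t (q h) ≡ vm (org t′ h)
    vm-root : vm (root t′) ≡ crn t (length u)
    vn    : Vert t → Vert t′
    vn-vm : ∀ x → vn (vm x) ≡ x
    vm-vn : ∀ x → vm (vn x) ≡ x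

seg-comm : {H H′ : Set} {φ : H → H} {φ′ : H′ → H′} (q : H′ → H) {a b : H′} {c d : H} (w : List H′) →
  Seg φ′ a w b → Seg φ c (map q w) d → d ≡ q b → ∀ {h} → h ∈ w → φ (q h) ≡ q (φ′ h)
seg-comm q (x ∷ []) (refl , refl) (_ , s) e (here refl) = trans s e
seg-comm q (x ∷ y ∷ w) (refl , (e₁ , s₁)) (_ , (e₂ , s₂)) e (here refl) = trans (sym e₂) (cong q e₁)
seg-comm q (x ∷ y ∷ w) (refl , s₁) (_ , s₂) e (there m) = seg-comm q (y ∷ w) s₁ s₂ e m

cyc-comm : {H H′ : Set} {φ : H → H} {φ′ : H′ → H′} (q : H′ → H) {w : List H′} → IsCyc φ′ w → (Σ H λ c → Seg φ c (map q w) c) →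
  ∀ {h} → h ∈ w → φ (q h) ≡ q (φ′ h)
cyc-comm q {x ∷ w} (a , (refl , s) , _) (c , (refl , s′)) m = seg-comm q (x ∷ w) (refl , s) (refl , s′) refl m

nth-length : {A : Set} (d : A) (u v : List A) → nth d (u ++ v) (length u) ≡ nth d v 0
nth-length d [] v = refl
nth-length d (x ∷ u) v = nth-length d u v

reroot : ∀ t → WF t → Half t → ∀ u v → bw t ≡ u ++ v → Σ Tm λ t′ → Rerooted t t′ u v
reroot t wf h₀ u v e with planar-rotated t wf h₀ u v e
... | pl with decode pl
...   | t′ , U , emb p wf′ im bdy p-opp inner , pu , pd = t′ , record
  { wf = wf ; wf′ = wf′ ; q = p ; q-inj = inj ; q-sur = sur ; q-opp = p-opp ; q-bw = bdy ; q-fcs = inner ; q-nxt = com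
  ; degs-↭ = ↭-trans pd (↭-reflexive (degs-length t wf))
  ; vm = proj₁ fac ; vm-org = proj₂ (proj₂ fac) ; vm-root = proj₁ (proj₂ fac)
  ; vn = proj₁ fac′ ; vn-vm = nm ; vm-vn = mn }
  where
  pu′ : U ↭ halves t
  pu′ = ↭-trans pu (↭-trans (PP.++⁺ʳ (concat (fcs t)) (↭-trans (↭-reflexive (++-identityʳ (v ++ u))) (↭-trans (PP.++-comm v u) (↭-reflexive (sym e))))) (letters-↭ t))
  inj : Inj p
  inj {h} {h′} = map-unique⇒inj p (subst Unique (sym im) (unique-↭ (↭-sym pu′) (halves-unique t))) (∈-halves t′ h) (∈-halves t′ h′)
  sur : ∀ h → Σ (Half t′) λ h′ → p h′ ≡ h
  sur h with ∈-map⁻ p (subst (h ∈_) (sym im) (PP.∈-resp-↭ (↭-sym pu′) (∈-halves t h)))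
  ... | h′ , _ , eq = h′ , sym eq
  com : ∀ h → nxt t (p h) ≡ p (nxt t′ h)
  com h with cycle-of t′ h
  ... | _ , c , h∈ , here refl = cyc-comm p c (subst (λ z → Σ _ λ c → Seg (nxt t) c z c) (sym bdy) (Planar.cycʷ pl)) h∈
  ... | f , c , h∈ , there m with All.lookup inner m
  ...   | a , s , _ = cyc-comm p c (a , s) h∈
  ct = chain-take (bw t) (length u) (chain-bw t wf)
  cl : TChain t (crn t (length u)) (v ++ u) (crn t (length u))
  cl = chain-++ v (subst (λ z → TChain t (crn t (length u)) z (root t)) (trans (cong (drop (length u)) e) (drop-length u v)) (proj₂ ct))
         (subst (λ z → TChain t (root t) z (crn t (length u))) (trans (cong (take (length u)) e) (take-length u v)) (proj₁ ct))
  -- The origin in `t`, read through the embedding, labels the sides of `t′` consistently and so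
  -- factors through the vertices of `t′`; `fac′` is the same argument in the other direction and
  -- gives the inverse.
  fac = factor t′ wf′ (org t ∘ p) {crn t (length u)}
    (chain-unmap p p-opp (bw t′) (subst (λ z → TChain t (crn t (length u)) z (crn t (length u))) (sym bdy) cl))
    (All.map (λ {f} → λ where (h , s , _) → org t h , chain-unmap p p-opp f (seg-chain (org-nxt t wf) (map p f) s)) inner)
  p⁻ : Half t → Half t′
  p⁻ h = proj₁ (sur h)
  g′ : Half t → Vert t′
  g′ h = org t′ (p⁻ h)
  g′p : ∀ h → g′ (p h) ≡ org t′ h
  g′p h = cong (org t′) (inj (proj₂ (sur (p h))))
  g′-eq : ∀ h → g′ (nxt t h) ≡ g′ (opp t h)
  g′-eq h = trans (cong (λ z → g′ (nxt t z)) (sym eq)) (trans (cong g′ (com h′)) (trans (g′p (nxt t′ h′))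
      (trans (org-nxt t′ wf′ h′) (trans (sym (g′p (opp t′ h′))) (trans (cong g′ (sym (p-opp h′))) (cong (λ z → g′ (opp t z)) eq))))))
    where
    h′ = p⁻ h
    eq = proj₂ (sur h)
  bwc = nxt-bw t (proj₂ (proj₂ (bw-nonempty t h₀)))
  fac′ = factor t wf g′ {g′ (proj₁ bwc)} (seg-chain g′-eq (bw t) (proj₁ (proj₂ bwc)))
    (All.map (λ {f} → λ where (h , s , _) → g′ h , seg-chain g′-eq f s) (nxt-fcs t))
  nm : ∀ x → proj₁ fac′ (proj₁ fac x) ≡ x
  nm x with org-onto t′ (p⁻ h₀) x
  ... | h , refl = trans (cong (proj₁ fac′) (sym (proj₂ (proj₂ fac) h))) (trans (sym (proj₂ (proj₂ fac′) (p h))) (g′p h))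
  mn : ∀ x → proj₁ fac (proj₁ fac′ x) ≡ x
  mn x with org-onto t h₀ x
  ... | h , refl = trans (cong (proj₁ fac) (sym (proj₂ (proj₂ fac′) h))) (trans (sym (proj₂ (proj₂ fac) (p⁻ h))) (cong (org t) (proj₂ (sur h))))

-- After the two rotations the boundary word is that of `t` again, so rigidity identifies the two
-- terms. This makes `rot` and `unrot` inverse to each other, although both are obtained by
-- exploration.
reroot-back : ∀ {t t′ t″ u v u′ v′} → bw t ≡ u ++ v → bw t′ ≡ u′ ++ v′ → length u′ ≡ length v →
  Rerooted t t′ u v → Rerooted t′ t″ u′ v′ → t″ ≡ t
reroot-back {t} {t′} {t″} {u} {v} {u′} {v′} e e′ el r r′ =
  proj₁ (emb-unique {φ = nxt t} {opp t} t″ t R′.wf′ R.wf (R.q ∘ R′.q) id (R′.q-inj ∘ R.q-inj) (λ z → z)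
    (λ h → trans (R.q-opp (R′.q h)) (cong R.q (R′.q-opp h))) (λ _ → refl)
    (All.map (λ {f} c → push f c) R′.q-fcs)
    (All.map (λ {f} → subst (IsCyc (nxt t)) (sym (map-id f))) (nxt-fcs t))
    (trans (map-∘ (bw t″)) (trans (cong (map R.q) R′.q-bw) (trans (map-++ R.q v′ u′) (trans (cong₂ _++_ (proj₂ sp) (proj₁ sp)) (trans (sym e) (sym (map-id (bw t)))))))))
  where
  module R = Rerooted r
  module R′ = Rerooted r′
  cut : ∀ {A : Set} (as cs : List A) {bs ds} → length as ≡ length cs → as ++ bs ≡ cs ++ ds → as ≡ cs × bs ≡ ds
  cut [] [] _ e = refl , e
  cut (a ∷ as) (c ∷ cs) l e with ∷-injective e
  ... | refl , e₁ with cut as cs (suc-injective l) e₁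
  ...   | refl , e₂ = refl , e₂
  sp : map R.q u′ ≡ v × map R.q v′ ≡ u
  sp = cut (map R.q u′) v (trans (length-map R.q u′) el) (trans (sym (map-++ R.q u′ v′)) (trans (cong (map R.q) (sym e′)) R.q-bw))
  seg-push : ∀ {a b} f → Seg (nxt t′) a f b → Seg (nxt t) (R.q a) (map R.q f) (R.q b)
  seg-push [] refl = refl
  seg-push (x ∷ f) (refl , s) = refl , subst (λ z → Seg (nxt t) z (map R.q f) _) (sym (R.q-nxt x)) (seg-push f s)
  push : ∀ f → IsCyc (nxt t′) (map R′.q f) → IsCyc (nxt t) (map (R.q ∘ R′.q) f)
  push f (a , s , m) = R.q a , subst (λ z → Seg (nxt t) (R.q a) z (R.q a)) (sym (map-∘ f)) (seg-push (map R′.q f) s) ,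
    subst (R.q a ∈_) (sym (map-∘ f)) (∈-map⁺ R.q m)

-- Distances, trails and short cycles

Near : (t : Tm) → ℕ → Vert t → Vert t → Set
Near t n u v = Σ (List (Half t)) λ hs → length hs ≤ n × TChain t u hs v

near-mono : ∀ t {m n u v} → m ≤ n → Near t m u v → Near t n u v
near-mono t le (hs , l , c) = hs , ≤-trans l le , c

near-refl : ∀ t {u} → Near t 0 u u
near-refl t = [] , z≤n , refl

near-trans : ∀ t {m n u v w} → Near t m u v → Near t n v w → Near t (m + n) u w
near-trans t (hs , l , c) (hs′ , l′ , c′) = hs ++ hs′ , subst (_≤ _) (sym (length-++ hs)) (+-mono-≤ l l′) , chain-++ hs c c′

near-edge : ∀ t h → Near t 1 (org t h) (org t (opp t h))
near-edge t h = h ∷ [] , s≤s z≤n , refl , refl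

near-sym : ∀ t {n u v} → Near t n u v → Near t n v u
near-sym t ([] , l , refl) = [] , l , refl
near-sym t {suc n} {u} {v} (h ∷ hs , s≤s l , (e , c)) = subst (λ z → Near t z v u) (+-comm n 1)
  (near-trans t (near-sym t (hs , l , c))
    (opp t h ∷ [] , s≤s z≤n , refl , trans (cong (org t) (opp-opp t h)) e))

near? : ∀ t n u v → Dec (Near t n u v)
near? t zero u v = map′ (λ where refl → near-refl t) (λ where ([] , _ , refl) → refl) (Vert-≟ t u v)
near? t (suc n) u v with Vert-≟ t u v
... | yes refl = yes (near-mono t z≤n (near-refl t))
... | no ne = map′ to from (any? (λ h → Vert-≟ t (org t h) u ×-dec near? t n (org t (opp t h)) v) (halves t))
  where
  to : Any (λ h → org t h ≡ u × Near t n (org t (opp t h)) v) (halves t) → Near t (suc n) u v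
  to a with Any.satisfied a
  ... | h , refl , (hs , l , c) = h ∷ hs , s≤s l , refl , c
  from : Near t (suc n) u v → Any (λ h → org t h ≡ u × Near t n (org t (opp t h)) v) (halves t)
  from ([] , _ , e) = ⊥-elim (ne e)
  from (h ∷ hs , s≤s l , (e , c)) = Any.map (λ where refl → e , hs , l , c) (∈-halves t h)

WF? : ∀ t → Dec (WF t)
WF? pt = yes tt
WF? (loop t u) = WF? t ×-dec WF? u
WF? (split i t) = WF? t ×-dec (i ≤? bd t)

-- Good c t: no edge of t closes a cycle of length at most c + 1.
Good : ℕ → Tm → Set
Good c pt = ⊤
Good c (loop t u) = Good c t × Good c u
Good c (split i t) = Good c t × ¬ Near t c (root t) (crn t i)

Good? : ∀ c t → Dec (Good c t)
Good? c pt = yes tt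
Good? c (loop t u) = Good? c t ×-dec Good? c u
Good? c (split i t) = Good? c t ×-dec ¬? (near? t c (root t) (crn t i))

Apart : (t : Tm) → Half t → Half t → Set
Apart t h h′ = h ≢ h′ × opp t h ≢ h′

apart-sym : ∀ t {h h′} → Apart t h h′ → Apart t h′ h
apart-sym t {h} {h′} (a , b) = (λ e → a (sym e)) , (λ e → b (trans (cong (opp t) (sym e)) (opp-opp t h′)))

only-inj₂ : {A B : Set} (xs : List (A ⊎ B)) → (Σ (List B) λ ys → xs ≡ map inj₂ ys) ⊎
  (Σ (List (A ⊎ B)) λ p → Σ A λ a → Σ (List (A ⊎ B)) λ r → xs ≡ p ++ inj₁ a ∷ r)
only-inj₂ [] = inj₁ ([] , refl)
only-inj₂ (inj₁ a ∷ xs) = inj₂ ([] , a , xs , refl)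
only-inj₂ (inj₂ b ∷ xs) with only-inj₂ xs
... | inj₁ (ys , refl) = inj₁ (b ∷ ys , refl)
... | inj₂ (p , a , r , refl) = inj₂ (inj₂ b ∷ p , a , r , refl)

stay₁ : ∀ t u {v z} (l : List (Half t ⊎ Half u)) → TChain (loop t u) (inj₁ v) (map inj₂ l) z →
  Σ (List (Half t)) λ l′ → Σ (Vert t) λ z′ → l ≡ map inj₁ l′ × z ≡ inj₁ z′ × TChain t v l′ z′
stay₁ t u [] refl = [] , _ , refl , refl , refl
stay₁ t u (inj₁ h ∷ l) (e , c) with stay₁ t u l c
... | l′ , z′ , refl , refl , c′ = h ∷ l′ , z′ , refl , refl , inj₁-inj e , c′
stay₁ t u (inj₂ h ∷ l) (() , c)

stay₂ : ∀ t u {v z} (l : List (Half t ⊎ Half u)) → TChain (loop t u) (inj₂ v) (map inj₂ l) z →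
  Σ (List (Half u)) λ l′ → Σ (Vert u) λ z′ → l ≡ map inj₂ l′ × z ≡ inj₂ z′ × TChain u v l′ z′
stay₂ t u [] refl = [] , _ , refl , refl , refl
stay₂ t u (inj₂ h ∷ l) (e , c) with stay₂ t u l c
... | l′ , z′ , refl , refl , c′ = h ∷ l′ , z′ , refl , refl , inj₂-inj e , c′
stay₂ t u (inj₁ h ∷ l) (() , c)

no-inj₁ : {B : Set} (β : Bool ⊎ B → Bool ⊎ B) → (∀ x → β (inj₁ x) ≡ inj₁ (not x)) → ∀ x (l : List (Bool ⊎ B)) →
  All (λ h → inj₁ x ≢ h × β (inj₁ x) ≢ h) l → Σ (List B) λ ys → l ≡ map inj₂ ys
no-inj₁ β e x [] [] = [] , refl
no-inj₁ β e x (inj₂ b ∷ l) (_ ∷ a) with no-inj₁ β e x l a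
... | ys , refl = b ∷ ys , refl
no-inj₁ β e true (inj₁ true ∷ l) ((n , _) ∷ _) = ⊥-elim (n refl)
no-inj₁ β e false (inj₁ false ∷ l) ((n , _) ∷ _) = ⊥-elim (n refl)
no-inj₁ β e true (inj₁ false ∷ l) ((_ , n) ∷ _) = ⊥-elim (n (e true))
no-inj₁ β e false (inj₁ true ∷ l) ((_ , n) ∷ _) = ⊥-elim (n (e false))

allPairs-map⁻ : {A B : Set} {R : B → B → Set} {f : A → B} (xs : List A) → AllPairs R (map f xs) → AllPairs (λ x y → R (f x) (f y)) xs
allPairs-map⁻ [] [] = []
allPairs-map⁻ (x ∷ xs) (a ∷ p) = AllP.map⁻ a ∷ allPairs-map⁻ xs p

-- After crossing the bridge once, a walk that never uses it again stays on the other side and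
-- cannot close.
loop-bridge : ∀ t u x l {v} → TChain (loop t u) v (inj₁ x ∷ map inj₂ l) v → ⊥
loop-bridge t u true l (e , d) with stay₁ t u l d
... | _ , _ , _ , refl , _ = case e of λ ()
loop-bridge t u false l (e , d) with stay₂ t u l d
... | _ , _ , _ , refl , _ = case e of λ ()

split-detour : ∀ i t x l {v} → TChain (split i t) v (inj₁ x ∷ map inj₂ l) v → Near t (length l) (root t) (crn t i)
split-detour i t true l (refl , d) = near-sym t (l , ≤-refl , chain-unmap inj₂ (λ _ → refl) l d)
split-detour i t false l (refl , d) = l , ≤-refl , chain-unmap inj₂ (λ _ → refl) l d

-- A closed trail uses the root edge at most once. Rotated to start there, it would be a bridge
-- crossed once in a `loop`, or a detour of length at most `c` between the ends of the root edge in
-- a `split`; otherwise it lies in a subterm.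
no-short-trail : ∀ c t → Good c t → ∀ {v} h hs → length hs ≤ c → TChain t v (h ∷ hs) v → AllPairs (Apart t) (h ∷ hs) → ⊥
no-short-trail c (loop t u) (gt , gu) {v} h hs le ch ap with only-inj₂ (h ∷ hs)
... | inj₂ (p , x , r , eq) = bridge
  where
  ch′ : Closed (org (loop t u)) (opp (loop t u)) (inj₁ x ∷ r ++ p)
  ch′ = chain-rot p (subst (λ z → TChain (loop t u) v z v) eq ch)
  ap′ : AllPairs (Apart (loop t u)) (inj₁ x ∷ r ++ p)
  ap′ = allPairs-↭ (apart-sym (loop t u)) (PP.++-comm p (inj₁ x ∷ r)) (subst (AllPairs _) eq ap)
  bridge : ⊥
  bridge with no-inj₁ (opp (loop t u)) (λ _ → refl) x (r ++ p) (AllPairs.head ap′)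
  ... | l , el = loop-bridge t u x l (subst (λ z → TChain (loop t u) (proj₁ ch′) (inj₁ x ∷ z) (proj₁ ch′)) el (proj₂ ch′))
no-short-trail c (loop t u) (gt , gu) {inj₁ v} h hs le ch ap | inj₁ (h₀ ∷ l , refl) with stay₁ t u {v} {inj₁ v} (h₀ ∷ l) ch
... | h′ ∷ l′ , _ , refl , refl , d = no-short-trail c t gt h′ l′ (subst (_≤ c) (trans (length-map inj₂ (map inj₁ l′)) (length-map inj₁ l′)) le) d
         (AllPairs.map (λ where (a , b) → (λ e → a (cong (inj₂ ∘ inj₁) e)) , (λ e → b (cong (inj₂ ∘ inj₁) e))) (allPairs-map⁻ (h′ ∷ l′) (allPairs-map⁻ (map inj₁ (h′ ∷ l′)) ap)))
no-short-trail c (loop t u) (gt , gu) {inj₂ v} h hs le ch ap | inj₁ (h₀ ∷ l , refl) with stay₂ t u {v} {inj₂ v} (h₀ ∷ l) ch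
... | h′ ∷ l′ , _ , refl , refl , d = no-short-trail c u gu h′ l′ (subst (_≤ c) (trans (length-map inj₂ (map inj₂ l′)) (length-map inj₂ l′)) le) d
         (AllPairs.map (λ where (a , b) → (λ e → a (cong (inj₂ ∘ inj₂) e)) , (λ e → b (cong (inj₂ ∘ inj₂) e))) (allPairs-map⁻ (h′ ∷ l′) (allPairs-map⁻ (map inj₂ (h′ ∷ l′)) ap)))
no-short-trail c (loop t u) (gt , gu) h hs le ch ap | inj₁ ([] , ())
no-short-trail c (split i t) (gt , nn) {v} h hs le ch ap with only-inj₂ (h ∷ hs)
... | inj₁ (h′ ∷ l′ , refl) = no-short-trail c t gt h′ l′ (subst (_≤ c) (length-map inj₂ l′) le) (chain-unmap inj₂ (λ _ → refl) (h′ ∷ l′) ch)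
         (AllPairs.map (λ where (a , b) → (λ e → a (cong inj₂ e)) , (λ e → b (cong inj₂ e))) (allPairs-map⁻ (h′ ∷ l′) ap))
... | inj₁ ([] , ())
... | inj₂ (p , x , r , eq) = body
  where
  ch′ : Closed (org (split i t)) (opp (split i t)) (inj₁ x ∷ r ++ p)
  ch′ = chain-rot p (subst (λ z → TChain (split i t) v z v) eq ch)
  ap′ : AllPairs (Apart (split i t)) (inj₁ x ∷ r ++ p)
  ap′ = allPairs-↭ (apart-sym (split i t)) (PP.++-comm p (inj₁ x ∷ r)) (subst (AllPairs _) eq ap)
  len : length (r ++ p) ≤ c
  len = subst (_≤ c) (suc-injective (trans (cong length eq) (trans (PP.↭-length (PP.++-comm p (inj₁ x ∷ r))) refl))) le
  body : ⊥
  body with no-inj₁ (opp (split i t)) (λ _ → refl) x (r ++ p) (AllPairs.head ap′)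
  ... | l , el = nn (near-mono t (subst (_≤ c) (trans (cong length el) (length-map inj₂ l)) len)
    (split-detour i t x l (subst (λ z → TChain (split i t) (proj₁ ch′) (inj₁ x ∷ z) (proj₁ ch′)) el (proj₂ ch′))))

Simple : (t : Tm) → Vert t → List (Half t) → Vert t → Set
Simple t u hs v = TChain t u hs v × Unique (map (org t) hs) × v ∉ map (org t) hs

-- Loop erasure: if the start reappears later on the simplified walk, the part before its
-- reappearance is dropped.
simplify : ∀ t {u v} hs → TChain t u hs v → Σ (List (Half t)) λ hs′ → length hs′ ≤ length hs × Simple t u hs′ v
simplify t [] c = [] , z≤n , c , [] , λ ()
simplify t {u} {v} (h ∷ hs) (e , c) with simplify t hs c
... | hs′ , l , c′ , uq , v∉ with Vert-≟ t u v
...   | yes refl = [] , z≤n , refl , [] , λ ()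
...   | no u≢v with any? (Vert-≟ t u) (map (org t) hs′)
...     | no u∉ = h ∷ hs′ , s≤s l , (e , c′) , All.tabulate (λ {z} m eq → u∉ (subst (_∈ _) (trans (sym eq) e) m)) ∷ uq ,
                  λ where (here eq) → u≢v (trans (sym e) (sym eq)) ; (there m) → v∉ m
...     | yes u∈ with ∈-map⁻ (org t) u∈
...       | x , x∈ , refl with ∈-∃++ x∈
...         | p , r , refl with chain-split p c′
...           | z , c₁ , (refl , c₂) = x ∷ r ,
    ≤-trans (subst (suc (length r) ≤_) (sym (length-++ p)) (m≤n+m (suc (length r)) (length p))) (≤-trans l (n≤1+n _)) , (refl , c₂) ,
    unique-++ʳ (map (org t) p) (subst Unique (map-++ (org t) p (x ∷ r)) uq) ,
    λ m → v∉ (subst (v ∈_) (sym (map-++ (org t) p (x ∷ r))) (∈-++⁺ʳ (map (org t) p) m))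

-- An edge traversed backwards later would lead back to the origin of `h`, which a simple path never
-- meets again.
simple-apart : ∀ t {u v} hs → Simple t u hs v → AllPairs (Apart t) hs
simple-apart t [] _ = []
simple-apart t {u} {v} (h ∷ hs) ((e , c) , (n ∷ uq) , v∉) = All.tabulate ap ∷ simple-apart t hs (c , uq , v∉ ∘ there)
  where
  back : ∀ {w} (hs : List (Half t)) → TChain t w hs v → All (λ z → org t h ≢ z) (map (org t) hs) → org t h ≢ v → opp t h ∉ hs
  back (x ∷ []) (_ , c) _ nv (here refl) = nv (trans (sym (cong (org t) (opp-opp t h))) c)
  back (x ∷ y ∷ hs) (_ , (e , c)) (_ ∷ (n ∷ _)) nv (here refl) = n (trans (sym (cong (org t) (opp-opp t h))) (sym e))
  back (x ∷ hs) (_ , c) (_ ∷ ns) nv (there m) = back hs c ns nv m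
  ap : ∀ {x} → x ∈ hs → Apart t h x
  ap {x} m = (λ where refl → All.lookup n (∈-map⁺ (org t) m) refl) ,
    (λ eq → back hs c n (λ eq′ → v∉ (here (sym eq′))) (subst (_∈ hs) (sym eq) m))

GCycle : (t : Tm) → List (Half t) → Set
GCycle t hs = Closed (org t) (opp t) hs × Unique (map (org t) hs) × AllPairs (Apart t) hs

chain-inj₂ : ∀ i t {u v} hs → TChain t u hs v → TChain (split i t) u (map inj₂ hs) v
chain-inj₂ i t hs c = chain-map inj₂ id (λ _ → refl) (λ _ → refl) hs c

close-cycle : ∀ i t hs → Simple t (root t) hs (crn t i) → GCycle (split i t) (inj₁ false ∷ map inj₂ hs)
close-cycle i t hs s@(c , uq , v∉) = (_ , refl , chain-inj₂ i t hs c) ,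
  (All.tabulate (λ {z} m eq → v∉ (subst (crn t i ∈_) (map-∘₂ (λ _ → refl) hs) (subst (_∈ _) (sym eq) m))) ∷ subst Unique (sym (map-∘₂ (λ _ → refl) hs)) uq) ,
  (All.tabulate (λ m → (λ where refl → true∉ m) , (λ where refl → true∉ m)) ∷
   AllPairsP.map⁺ (AllPairs.map (λ where (a , b) → (λ e → a (inj₂-inj e)) , (λ e → b (inj₂-inj e))) (simple-apart t hs s)))

gcycle-map : ∀ {t t′} (p : Half t → Half t′) (f : Vert t → Vert t′) → Inj p → (∀ {x y} → f x ≡ f y → x ≡ y) →
  (∀ h → org t′ (p h) ≡ f (org t h)) → (∀ h → opp t′ (p h) ≡ p (opp t h)) → ∀ hs → GCycle t hs → GCycle t′ (map p hs)
gcycle-map {t} {t′} p f pi fi po pb hs ((v , c) , uq , ap) = (f v , chain-map p f po pb hs c) ,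
  subst Unique (sym (trans (sym (map-∘ hs)) (trans (map-cong po hs) (map-∘ hs)))) (UP.map⁺ fi uq) ,
  AllPairsP.map⁺ (AllPairs.map (λ where (a , b) → (λ e → a (pi e)) , (λ e → b (pi (trans (sym (pb _)) e)))) ap)

-- At the innermost place where `Good` fails, the root edge of a `split` closes a simple path of
-- length at most `c`.
short-cycle : ∀ c t → ¬ Good c t → Σ (Half t) λ h → Σ (List (Half t)) λ hs → length hs ≤ c × GCycle t (h ∷ hs)
short-cycle c pt ng = ⊥-elim (ng tt)
short-cycle c (loop t u) ng with Good? c t
... | no nt with short-cycle c t nt
...   | h , hs , l , cy = inj₂ (inj₁ h) , map (inj₂ ∘ inj₁) hs , subst (_≤ c) (sym (length-map _ hs)) l ,
        gcycle-map {t} {loop t u} (inj₂ ∘ inj₁) inj₁ (inj₁-inj ∘ inj₂-inj) inj₁-inj (λ _ → refl) (λ _ → refl) (h ∷ hs) cy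
short-cycle c (loop t u) ng | yes gt with Good? c u
... | yes gu = ⊥-elim (ng (gt , gu))
... | no nu with short-cycle c u nu
...   | h , hs , l , cy = inj₂ (inj₂ h) , map (inj₂ ∘ inj₂) hs , subst (_≤ c) (sym (length-map _ hs)) l ,
        gcycle-map {u} {loop t u} (inj₂ ∘ inj₂) inj₂ (inj₂-inj ∘ inj₂-inj) inj₂-inj (λ _ → refl) (λ _ → refl) (h ∷ hs) cy
short-cycle c (split i t) ng with Good? c t
... | no nt with short-cycle c t nt
...   | h , hs , l , cy = inj₂ h , map inj₂ hs , subst (_≤ c) (sym (length-map _ hs)) l ,
        gcycle-map {t} {split i t} inj₂ id inj₂-inj (λ e → e) (λ _ → refl) (λ _ → refl) (h ∷ hs) cy
short-cycle c (split i t) ng | yes gt with near? t c (root t) (crn t i)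
... | no nn = ⊥-elim (ng (gt , nn))
... | yes (hs , l , ch) with simplify t hs ch
...   | hs′ , l′ , s = inj₁ false , map inj₂ hs′ , subst (_≤ c) (sym (length-map _ hs′)) (≤-trans l′ l) , close-cycle i t hs′ s

-- `Good` is defined along one particular decomposition, but `short-cycle` and `no-short-trail` show
-- it equivalent to the absence of short cycles, which does not depend on the root.
good-reroot : ∀ c {t t′ u v} → Rerooted t t′ u v → Good c t → Good c t′
good-reroot c {t} {t′} r g with Good? c t′
... | yes g′ = g′
... | no ng with short-cycle c t′ ng
...   | h , hs , l , cy with gcycle-map {t′} {t} R.q R.vm R.q-inj (λ {x} {y} e → trans (sym (R.vn-vm x)) (trans (cong R.vn e) (R.vn-vm y))) R.vm-org R.q-opp (h ∷ hs) cy
  where module R = Rerooted r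
...     | (v , ch) , _ , ap = ⊥-elim (no-short-trail c t g _ _ (subst (_≤ c) (sym (length-map _ hs)) l) ch ap)

near-reroot⁺ : ∀ {t t′ u v n x y} (r : Rerooted t t′ u v) → Near t′ n x y → Near t n (Rerooted.vm r x) (Rerooted.vm r y)
near-reroot⁺ {n = n} r (hs , l , c) = map R.q hs , subst (_≤ n) (sym (length-map R.q hs)) l , chain-map R.q R.vm R.vm-org R.q-opp hs c
  where module R = Rerooted r

near-reroot⁻ : ∀ {t t′ u v n x y} (r : Rerooted t t′ u v) → Near t n x y → Near t′ n (Rerooted.vn r x) (Rerooted.vn r y)
near-reroot⁻ {t} {t′} {n = n} r (hs , l , c) = map q⁻ hs , subst (_≤ n) (sym (length-map q⁻ hs)) l , chain-map q⁻ R.vn qo qb hs c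
  where
  module R = Rerooted r
  q⁻ : Half t → Half t′
  q⁻ h = proj₁ (R.q-sur h)
  qq : ∀ h → R.q (q⁻ h) ≡ h
  qq h = proj₂ (R.q-sur h)
  qo : ∀ h → org t′ (q⁻ h) ≡ R.vn (org t h)
  qo h = trans (sym (R.vn-vm (org t′ (q⁻ h)))) (cong R.vn (trans (sym (R.vm-org (q⁻ h))) (cong (org t) (qq h))))
  qb : ∀ h → opp t′ (q⁻ h) ≡ q⁻ (opp t h)
  qb h = R.q-inj (trans (sym (R.q-opp (q⁻ h))) (trans (cong (opp t) (qq h)) (sym (qq (opp t h)))))

near-reroot : ∀ {t t′ u v n x y} (r : Rerooted t t′ u v) → Near t n (Rerooted.vm r x) (Rerooted.vm r y) → Near t′ n x y
near-reroot {t′ = t′} {n = n} {x} {y} r nr = subst₂ (Near t′ n) (Rerooted.vn-vm r x) (Rerooted.vn-vm r y) (near-reroot⁻ r nr)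

reroot-bd : ∀ {t t′ u v} → bw t ≡ u ++ v → Rerooted t t′ u v → bd t′ ≡ bd t
reroot-bd {t} {t′} {u} {v} e r = trans (sym (length-map R.q (bw t′))) (trans (cong length R.q-bw) (trans (PP.↭-length (PP.++-comm v u)) (cong length (sym e))))
  where module R = Rerooted r

reroot-edges : ∀ {t t′ u v} → Rerooted t t′ u v → edges t′ ≡ edges t
reroot-edges {t} {t′} r = ℕP.*-cancelˡ-≡ _ _ 2 (trans (sym (halves-length t′)) (trans (≤-antisym
    (subst (_≤ length (halves t)) (length-map R.q (halves t′)) (unique-⊆-length (UP.map⁺ R.q-inj (halves-unique t′)) (λ {x} _ → ∈-halves t x)))
    (subst (length (halves t) ≤_) (length-map R.q (halves t′)) (unique-⊆-length (halves-unique t) (λ {x} _ → case R.q-sur x of λ where (h , refl) → ∈-map⁺ R.q (∈-halves t′ h)))))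
  (halves-length t)))
  where module R = Rerooted r

-- Moving the root along the boundary

crn-0 : ∀ t → WF t → crn t 0 ≡ root t
crn-0 pt _ = refl
crn-0 (loop t u) _ = refl
crn-0 (split i t) _ = refl

crn-end : ∀ t {k} → bd t ≤ k → crn t k ≡ root t
crn-end t {k} le = nth-end (root t) (map (org t) (bw t)) k (subst (_≤ k) (sym (length-map (org t) (bw t))) le)

abstract
  -- On `pt` and on ill-formed terms the rotation is the identity, which makes `rot` total.
  rotAux : ∀ t w → bw t ≡ w → Dec (WF t) → Tm
  rotAux t [] _ _ = t
  rotAux t (x ∷ w) e (yes wf) = proj₁ (reroot t wf x (x ∷ []) w e)
  rotAux t (x ∷ w) e (no _) = t

  rot : Tm → Tm
  rot t = rotAux t (bw t) refl (WF? t)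

  rot-spec : ∀ t → WF t → ∀ {x w} → bw t ≡ x ∷ w → Rerooted t (rot t) (x ∷ []) w
  rot-spec t wf {x} {w} e′ = aux (bw t) refl (WF? t) e′
    where
    aux : ∀ w₀ (e : bw t ≡ w₀) d → w₀ ≡ x ∷ w → Rerooted t (rotAux t w₀ e d) (x ∷ []) w
    aux .(x ∷ w) e (yes wf′) refl = proj₂ (reroot t wf′ x (x ∷ []) w e)
    aux .(x ∷ w) e (no n) refl = ⊥-elim (n wf)

unsnoc : {A : Set} (x : A) (w : List A) → Σ (List A) λ u → Σ A λ z → x ∷ w ≡ u ++ z ∷ []
unsnoc x [] = [] , x , refl
unsnoc x (y ∷ w) with unsnoc y w
... | u , z , e = x ∷ u , z , cong (x ∷_) e

abstract
  unrotAux : ∀ t w → bw t ≡ w → Dec (WF t) → Tm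
  unrotAux t [] _ _ = t
  unrotAux t (x ∷ w) e (yes wf) = proj₁ (reroot t wf x (proj₁ (unsnoc x w)) (proj₁ (proj₂ (unsnoc x w)) ∷ []) (trans e (proj₂ (proj₂ (unsnoc x w)))))
  unrotAux t (x ∷ w) e (no _) = t

  unrot : Tm → Tm
  unrot t = unrotAux t (bw t) refl (WF? t)

  unrot-spec : ∀ t → WF t → 1 ≤ bd t → Σ (List (Half t)) λ u → Σ (Half t) λ z → bw t ≡ u ++ z ∷ [] × Rerooted t (unrot t) u (z ∷ [])
  unrot-spec t wf le = aux (bw t) refl (WF? t) le
    where
    aux : ∀ w₀ (e : bw t ≡ w₀) d → 1 ≤ length w₀ → Σ (List (Half t)) λ u → Σ (Half t) λ z → bw t ≡ u ++ z ∷ [] × Rerooted t (unrotAux t w₀ e d) u (z ∷ [])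
    aux (x ∷ w) e (yes wf′) _ = _ , _ , trans e (proj₂ (proj₂ (unsnoc x w))) , proj₂ (reroot t wf′ x (proj₁ (unsnoc x w)) (proj₁ (proj₂ (unsnoc x w)) ∷ []) (trans e (proj₂ (proj₂ (unsnoc x w)))))
    aux (x ∷ w) e (no n) _ = ⊥-elim (n wf)

uncons : {A : Set} (w : List A) → 1 ≤ length w → Σ A λ x → Σ (List A) λ w′ → w ≡ x ∷ w′
uncons (x ∷ w) _ = x , w , refl

record RotOf (t t′ : Tm) : Set where
  field
    x : Half t
    w : List (Half t)
    e : bw t ≡ x ∷ w
    r : Rerooted t t′ (x ∷ []) w
  open Rerooted r public
  bd-≡ : bd t′ ≡ bd t
  bd-≡ = reroot-bd e r
  bd-≥1 : 1 ≤ bd t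
  bd-≥1 = subst (λ z → 1 ≤ length z) (sym e) (s≤s z≤n)
  crn-vm : ∀ k → k < bd t → vm (crn t′ k) ≡ crn t (suc k)
  crn-vm k lt = trans (sym (nth-map vm (root t′) (map (org t′) (bw t′)) k))
    (trans (cong (λ l → nth (vm (root t′)) l k) (trans (trans (sym (map-∘ (bw t′))) (map-cong (λ h → sym (vm-org h)) (bw t′))) (trans (map-∘ (bw t′)) (cong (map (org t)) q-bw)))) main)
    where
    main : nth (vm (root t′)) (map (org t) (w ++ x ∷ [])) k ≡ crn t (suc k)
    main with k <? length w
    ... | yes k<w = trans (cong (λ l → nth (vm (root t′)) l k) (map-++ (org t) w (x ∷ [])))
          (trans (nth-++ˡ _ (map (org t) w) _ k (subst (k <_) (sym (length-map (org t) w)) k<w))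
          (trans (irr (map (org t) w) k (subst (k <_) (sym (length-map (org t) w)) k<w)) (cong (λ l → nth (root t) (map (org t) l) (suc k)) (sym e))))
      where
      irr : ∀ {A : Set} {d d′ : A} xs k → k < length xs → nth d xs k ≡ nth d′ xs k
      irr (x ∷ xs) zero lt = refl
      irr (x ∷ xs) (suc k) (s≤s lt) = irr xs k lt
    -- The last corner of `t′` is the old root, which has index `bd t` as well as 0 in `t`.
    ... | no k≮w with ≤-antisym (≤-pred (subst (suc k ≤_) (cong length e) lt)) (≮⇒≥ k≮w)
    ...   | refl = trans (cong (λ l → nth (vm (root t′)) l k) (map-++ (org t) w (x ∷ [])))
            (trans (cong (nth (vm (root t′)) (map (org t) w ++ org t x ∷ [])) (sym (length-map (org t) w)))
            (trans (nth-length _ (map (org t) w) _) (trans (trans (sym (cong (λ l → nth (root t) (map (org t) l) 0) e)) (crn-0 t wf)) (sym (crn-end t (≤-reflexive (cong length e)))))))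
  near⁺ : ∀ {n j k} → j < bd t → k < bd t → Near t′ n (crn t′ j) (crn t′ k) → Near t n (crn t (suc j)) (crn t (suc k))
  near⁺ {n} lj lk nr = subst₂ (Near t n) (crn-vm _ lj) (crn-vm _ lk) (near-reroot⁺ r nr)
  near⁻ : ∀ {n j k} → j < bd t → k < bd t → Near t n (crn t (suc j)) (crn t (suc k)) → Near t′ n (crn t′ j) (crn t′ k)
  near⁻ {n} lj lk nr = near-reroot r (subst₂ (Near t n) (sym (crn-vm _ lj)) (sym (crn-vm _ lk)) nr)

rot-of : ∀ t → WF t → 1 ≤ bd t → RotOf t (rot t)
rot-of t wf le with uncons (bw t) le
... | x , w , e = record { x = x ; w = w ; e = e ; r = rot-spec t wf e }

unrot-rot : ∀ t → WF t → 1 ≤ bd t → unrot (rot t) ≡ t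
unrot-rot t wf le with rot-of t wf le
... | R with unrot-spec (rot t) (RotOf.wf′ R) (subst (1 ≤_) (sym (RotOf.bd-≡ R)) le)
...   | u , z , e , r′ = reroot-back (RotOf.e R) e
        (suc-injective (trans (+-comm 1 (length u)) (trans (sym (length-++ u)) (trans (cong length (sym e)) (trans (RotOf.bd-≡ R) (cong length (RotOf.e R))))))) (RotOf.r R) r′

rot-unrot : ∀ t → WF t → 1 ≤ bd t → rot (unrot t) ≡ t
rot-unrot t wf le with unrot-spec t wf le
... | u , z , e , r with rot-of (unrot t) (Rerooted.wf′ r) (subst (1 ≤_) (sym (reroot-bd e r)) le)
...   | R′ = reroot-back e (RotOf.e R′) refl r (RotOf.r R′)

unrot-of : ∀ t → WF t → 1 ≤ bd t → RotOf (unrot t) t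
unrot-of t wf le with unrot-spec t wf le
... | u , z , e , r = subst (RotOf (unrot t)) (rot-unrot t wf le) (rot-of (unrot t) (Rerooted.wf′ r) (subst (1 ≤_) (sym (reroot-bd e r)) le))

good-unrot : ∀ c t → WF t → 1 ≤ bd t → Good c t → Good c (unrot t)
good-unrot c t wf le g with unrot-spec t wf le
... | u , z , e , r = good-reroot c r g

good-rotof : ∀ c {t t′} → RotOf t t′ → Good c t → Good c t′
good-rotof c R = good-reroot c (RotOf.r R)

crn-split : ∀ i t k → crn (split i t) (suc k) ≡ crn t (i + k)
crn-split i t k = trans (cong (λ l → nth (root t) l k) (trans (map-∘₂ (λ _ → refl) (drop i (bw t))) (sym (LP.drop-map i (bw t))))) (nth-drop (root t) i (map (org t) (bw t)) k)

map-org-loop : ∀ t u → map (org (loop t u)) (bw (loop t u)) ≡ inj₂ (root u) ∷ map inj₁ (map (org t) (bw t)) ++ inj₁ (root t) ∷ map inj₂ (map (org u) (bw u))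
map-org-loop t u = cong (inj₂ (root u) ∷_) (trans (map-++ (org (loop t u)) (map (inj₂ ∘ inj₁) (bw t)) _)
  (cong₂ (λ a b → a ++ inj₁ (root t) ∷ b) (trans (map-∘₂ (λ _ → refl) (bw t)) (map-∘ (bw t))) (trans (map-∘₂ (λ _ → refl) (bw u)) (map-∘ (bw u)))))

crn-loop₁ : ∀ t u k → k ≤ bd t → crn (loop t u) (suc k) ≡ inj₁ (crn t k)
crn-loop₁ t u k le = trans (cong (λ l → nth (inj₂ (root u)) l (suc k)) (map-org-loop t u)) (go (map (org t) (bw t)) k (subst (k ≤_) (sym (length-map (org t) (bw t))) le))
  where
  go : ∀ (xs : List (Vert t)) k → k ≤ length xs → nth (inj₂ (root u)) (map inj₁ xs ++ inj₁ (root t) ∷ map inj₂ (map (org u) (bw u))) k ≡ inj₁ (nth (root t) xs k)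
  go [] zero _ = refl
  go (x ∷ xs) zero _ = refl
  go (x ∷ xs) (suc k) (s≤s le) = go xs k le

crn-loop₂ : ∀ t u k → crn (loop t u) (2 + bd t + k) ≡ inj₂ (crn u k)
crn-loop₂ t u k = trans (cong (λ l → nth (inj₂ (root u)) l (2 + bd t + k)) (map-org-loop t u))
  (trans (cong (λ z → nth (inj₂ (root u)) (map inj₁ (map (org t) (bw t)) ++ inj₁ (root t) ∷ map inj₂ (map (org u) (bw u))) (suc (z + k))) (sym (length-map (org t) (bw t))))
   (trans (go (map (org t) (bw t))) (nth-map inj₂ (root u) (map (org u) (bw u)) k)))
  where
  go : ∀ (xs : List (Vert t)) → nth (inj₂ (root u)) (map inj₁ xs ++ inj₁ (root t) ∷ map inj₂ (map (org u) (bw u))) (suc (length xs + k)) ≡ nth (inj₂ (root u)) (map inj₂ (map (org u) (bw u))) k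
  go [] = refl
  go (x ∷ xs) = go xs

bd-split : ∀ i t → bd (split i t) ≡ suc (bd t ∸ i)
bd-split i t = cong suc (trans (length-map inj₂ (drop i (bw t))) (length-drop i (bw t)))

bd-loop : ∀ t u → bd (loop t u) ≡ 2 + bd t + bd u
bd-loop t u = cong suc (trans (length-++ (map (inj₂ ∘ inj₁) (bw t))) (trans (cong₂ (λ a b → a + suc b) (length-map (inj₂ ∘ inj₁) (bw t)) (length-map (inj₂ ∘ inj₂) (bw u))) (+-suc (bd t) (bd u))))

near-crn : ∀ t → WF t → ∀ j k → Near t k (crn t j) (crn t (j + k))
near-crn t wf j k = take k (drop j (bw t)) , subst (_≤ k) (sym (length-take k (drop j (bw t)))) (ℕP.m⊓n≤m k _) ,
  subst (λ z → TChain t (crn t j) (take k (drop j (bw t))) z) (trans (cong (λ l → nth (root t) l k) (sym (LP.drop-map j (bw t)))) (nth-drop (root t) j (map (org t) (bw t)) k))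
    (proj₁ (chain-take (drop j (bw t)) k (proj₂ (chain-take (bw t) j (chain-bw t wf)))))

Lip : (t t′ : Tm) → (Vert t → Vert t′) → Set
Lip t t′ f = ∀ h → Near t′ 1 (f (org t h)) (f (org t (opp t h)))

lip-near : ∀ {t t′ f} → Lip t t′ f → ∀ {n u v} → Near t n u v → Near t′ n (f u) (f v)
lip-near {t′ = t′} lp ([] , l , refl) = near-mono t′ z≤n (near-refl t′)
lip-near {t} {t′} {f} lp {suc n} (h ∷ hs , s≤s l , (refl , c)) = near-trans t′ (lp h) (lip-near lp (hs , l , c))

near-split : ∀ {i t n u v} → Near t n u v → Near (split i t) n u v
near-split {i} {t} = lip-near {t} {split i t} {id} (λ h → near-edge (split i t) (inj₂ h))

near-loop₂ : ∀ {t u n a b} → Near u n a b → Near (loop t u) n (inj₂ a) (inj₂ b)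
near-loop₂ {t} {u} = lip-near {u} {loop t u} {inj₂} (λ h → near-edge (loop t u) (inj₂ (inj₂ h)))

collapse : ∀ t u → Vert (loop t u) → Vert u
collapse t u (inj₁ _) = root u
collapse t u (inj₂ v) = v

-- Contracting the part beyond the bridge lengthens no walk, so that part offers no shortcut between
-- vertices of `u`.
near-collapse : ∀ {t u n a b} → Near (loop t u) n (inj₂ a) (inj₂ b) → Near u n a b
near-collapse {t} {u} = lip-near {loop t u} {u} {collapse t u} lp
  where
  lp : Lip (loop t u) u (collapse t u)
  lp (inj₁ true) = near-mono u z≤n (near-refl u)
  lp (inj₁ false) = near-mono u z≤n (near-refl u)
  lp (inj₂ (inj₁ h)) = near-mono u z≤n (near-refl u)
  lp (inj₂ (inj₂ h)) = near-edge u h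

-- Crossing the bridge costs one step, after which the walk continues from the root of `t`.
near-cross : ∀ {t u n a b} → Near (loop t u) n (inj₂ a) (inj₁ b) → Σ ℕ λ n′ → suc n′ ≤ n × Near (loop t u) n′ (inj₁ (root t)) (inj₁ b)
near-cross ([] , _ , ())
near-cross {n = suc n} (inj₁ true ∷ hs , s≤s l , (e , c)) = n , ≤-refl , hs , l , c
near-cross (inj₁ false ∷ hs , _ , (() , c))
near-cross (inj₂ (inj₁ h) ∷ hs , _ , (() , c))
near-cross {n = suc n} (inj₂ (inj₂ h) ∷ hs , s≤s l , (e , c)) with near-cross (hs , l , c)
... | n′ , le , nr = n′ , ≤-trans le (n≤1+n n) , nr

-- Cutting along the leftmost geodesic

-- Down t q: the first boundary edge leads closer to the boundary corner q.
Down : Tm → ℕ → Set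
Down t q = Σ ℕ λ n → Near t n (crn t 1) (crn t q) × ¬ Near t n (crn t 0) (crn t q)

Up : Tm → ℕ → Set
Up t q = ∀ n → Near t n (crn t 1) (crn t q) → Near t n (crn t 0) (crn t q)

-- Only radii below `q` have to be tested, since the boundary itself is a walk of length `q` from
-- corner 0 to the target.
down⊎up : ∀ t → WF t → ∀ q → Down t q ⊎ Up t q
down⊎up t wf q with aux q
  where
  aux : ∀ N → Down t q ⊎ (∀ n → n < N → Near t n (crn t 1) (crn t q) → Near t n (crn t 0) (crn t q))
  aux zero = inj₂ (λ _ ())
  aux (suc N) with aux N
  ... | inj₁ d = inj₁ d
  ... | inj₂ u with near? t N (crn t 1) (crn t q) | near? t N (crn t 0) (crn t q)
  ...   | yes a | no b = inj₁ (N , a , b)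
  ...   | _ | yes b = inj₂ (λ n lt a → case ℕP.m≤n⇒m<n∨m≡n (≤-pred lt) of λ where (inj₁ l) → u n l a ; (inj₂ refl) → b)
  ...   | no na | _ = inj₂ (λ n lt a → case ℕP.m≤n⇒m<n∨m≡n (≤-pred lt) of λ where (inj₁ l) → u n l a ; (inj₂ refl) → ⊥-elim (na a))
... | inj₁ d = inj₁ d
... | inj₂ u = inj₂ λ n a → case n <? q of λ where
  (yes lt) → u n lt a
  (no ge) → near-mono t (≮⇒≥ ge) (near-crn t wf 0 q)

-- A region between the boundary and a leftmost geodesic, coded by the operations that glue it onto
-- the far side: `frz` is a geodesic edge, `hang` a bridge with a map at its end, `face` an edge
-- with an inner face of degree 1 + i.
data Prog : Set where
  nil  : Prog
  frz  : Prog → Prog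
  hang : Tm → Prog → Prog
  face : ℕ → Prog → Prog

glue : Tm → Prog → Tm
glue K nil = K
glue K (frz π) = unrot (glue K π)
glue K (hang e π) = loop e (glue K π)
glue K (face i π) = split i (glue K π)

-- The exploration along the leftmost geodesic from corner 0 to corner q: a boundary edge leading closer to the
-- target is followed (frz), any other one is deleted; K′ is what remains on the far side of the geodesic.
data Run : Tm → ℕ → Tm → Prog → Set where
  stop  : ∀ {K} → Run K 0 K nil
  freeze : ∀ {K q K′ π} → Down K (suc q) → Run (rot K) q K′ π → Run K (suc q) K′ (frz π)
  rhang : ∀ {e K q q′ K′ π} → q′ ≡ 2 + bd e + q → Up (loop e K) q′ → Run K q K′ π → Run (loop e K) q′ K′ (hang e π)
  rface : ∀ {i K q K′ π} → Up (split i K) (suc q) → Run K (i + q) K′ π → Run (split i K) (suc q) K′ (face i π)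

down-up-⊥ : ∀ t q → Down t q → Up t q → ⊥
down-up-⊥ t q (n , a , b) u = b (u n a)

-- `Down` and `Up` exclude each other, and for a deletion the shape of the term leaves no choice
-- between bridge and face.
run-det : ∀ {K q K₁ π₁ K₂ π₂} → Run K q K₁ π₁ → Run K q K₂ π₂ → K₁ ≡ K₂ × π₁ ≡ π₂
run-det stop stop = refl , refl
run-det stop (rhang () _ _)
run-det (rhang () _ _) stop
run-det (freeze _ r) (freeze _ r′) with run-det r r′
... | refl , refl = refl , refl
run-det {K} {q} (freeze d _) (rhang _ u _) = ⊥-elim (down-up-⊥ K q d u)
run-det {K} {q} (freeze d _) (rface u _) = ⊥-elim (down-up-⊥ K q d u)
run-det {K} {q} (rhang _ u _) (freeze d _) = ⊥-elim (down-up-⊥ K q d u)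
run-det {K} {q} (rface u _) (freeze d _) = ⊥-elim (down-up-⊥ K q d u)
run-det (rhang {e} refl _ r) (rhang eq _ r′) with +-cancelˡ-≡ (2 + bd e) _ _ eq
... | refl with run-det r r′
...   | refl , refl = refl , refl
run-det (rface _ r) (rface _ r′) with run-det r r′
... | refl , refl = refl , refl

-- If the target lay beyond the bridge, every walk to it would cross the bridge and leave a strictly
-- shorter walk from the other end; `Up` carries this back to the root, and the descent never stops.
-- So a deleted bridge always leaves the target on the side that is kept.
up-loop : ∀ e K → WF e → ∀ q → 1 ≤ q → Up (loop e K) q → WF K → 2 + bd e ≤ q
up-loop e K we (suc q) _ up wk with 2 + bd e ≤? suc q
... | yes le = le
... | no nle = ⊥-elim (imp (suc q) (suc q) ≤-refl (near-crn (loop e K) (we , wk) 0 (suc q)))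
  where
  q≤ : q ≤ bd e
  q≤ = ≤-pred (≤-pred (≰⇒> nle))
  tgt : crn (loop e K) (suc q) ≡ inj₁ (crn e q)
  tgt = crn-loop₁ e K q q≤
  c1 : crn (loop e K) 1 ≡ inj₁ (root e)
  c1 = trans (crn-loop₁ e K 0 z≤n) (cong inj₁ (crn-0 e we))
  imp : ∀ N n → n ≤ N → Near (loop e K) n (crn (loop e K) 0) (crn (loop e K) (suc q)) → ⊥
  imp N n le nr with near-cross (subst (Near (loop e K) n (inj₂ (root K))) tgt nr)
  imp (suc N) n le nr | n′ , le′ , nr′ = imp N n′ (≤-pred (≤-trans le′ le)) (up n′ (subst₂ (Near (loop e K) n′) (sym c1) (sym tgt) nr′))
  imp zero n le nr | n′ , le′ , nr′ = case ≤-trans le′ le of λ ()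

-- The recursion is lexicographic: a frozen step keeps the number of edges and lowers `q`, a
-- deletion lowers the number of edges although it may raise the index of the target by `i`.
run-exists : ∀ E K → edges K ≤ E → WF K → ∀ q → q ≤ bd K → Σ Tm λ K′ → Σ Prog λ π → Run K q K′ π
run-exists E K le wf zero _ = K , nil , stop
run-exists E K le wf (suc q) lq with down⊎up K wf (suc q)
... | inj₁ d with rot-of K wf (≤-trans (s≤s z≤n) lq)
...   | R with run-exists E (rot K) (≤-trans (≤-reflexive (reroot-edges (RotOf.r R))) le) (RotOf.wf′ R) q (≤-trans (≤-trans (n≤1+n q) lq) (≤-reflexive (sym (RotOf.bd-≡ R))))
...     | K′ , π , r = K′ , frz π , freeze d r
run-exists (suc E) (loop e K) (s≤s le) (we , wk) (suc q) lq | inj₂ up with up-loop e K we (suc q) (s≤s z≤n) up wk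
... | lb with run-exists E K (≤-trans (m≤n+m _ (edges e)) le) wk (suc q ∸ (2 + bd e)) (≤-trans (ℕP.∸-monoˡ-≤ (2 + bd e) (≤-trans lq (≤-reflexive (bd-loop e K)))) (≤-reflexive (m+n∸m≡n (2 + bd e) (bd K))))
...   | K′ , π , r = K′ , hang e π , rhang (sym (m+[n∸m]≡n lb)) up r
run-exists (suc E) (split i K) (s≤s le) (wk , li) (suc q) lq | inj₂ up
  with run-exists E K le wk (i + q) (≤-trans (ℕP.+-monoʳ-≤ i (≤-pred (≤-trans lq (≤-reflexive (bd-split i K))))) (≤-reflexive (m+[n∸m]≡n li)))
... | K′ , π , r = K′ , face i π , rface up r

-- For the coded region, `qs` is the number of boundary sides on the near side, `ls` the length of
-- the geodesic and `ds` the list of inner face degrees.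
qs : Prog → ℕ
qs nil = 0
qs (frz π) = suc (qs π)
qs (hang e π) = 2 + bd e + qs π
qs (face i π) = suc (qs π ∸ i)

ls : Prog → ℕ
ls nil = 0
ls (frz π) = suc (ls π)
ls (hang e π) = ls π
ls (face i π) = ls π

ds : Prog → List ℕ
ds nil = []
ds (frz π) = ds π
ds (hang e π) = degs e ++ ds π
ds (face i π) = suc i ∷ ds π

Valid : Prog → Set
Valid nil = ⊤
Valid (frz π) = Valid π
Valid (hang e π) = WF e × Valid π
Valid (face i π) = Valid π × i ≤ qs π

-- Gluing undoes the run step by step, with `unrot` undoing a frozen step.
run-valid : ∀ {K q K′ π} → WF K → q ≤ bd K → Run K q K′ π → Valid π × qs π ≡ q × K ≡ glue K′ π × WF K′
run-valid wf lq stop = tt , refl , refl , wf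
run-valid {K} wf lq (freeze {q = q} d r) with rot-of K wf (≤-trans (s≤s z≤n) lq)
... | R with run-valid (RotOf.wf′ R) (≤-trans (≤-trans (n≤1+n q) lq) (≤-reflexive (sym (RotOf.bd-≡ R)))) r
...   | v , refl , eq , w = v , refl , trans (sym (unrot-rot K wf (RotOf.bd-≥1 R))) (cong unrot eq) , w
run-valid (we , wk) lq (rhang {e} {K} {q} refl up r) with run-valid wk (ℕP.+-cancelˡ-≤ (2 + bd e) q (bd K) (≤-trans lq (≤-reflexive (bd-loop e K)))) r
... | v , refl , refl , w = (we , v) , refl , refl , w
run-valid (wk , li) lq (rface {i} {K} {q} up r)
  with run-valid wk (≤-trans (ℕP.+-monoʳ-≤ i (≤-pred (≤-trans lq (≤-reflexive (bd-split i K))))) (≤-reflexive (m+[n∸m]≡n li))) r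
... | v , e , refl , w = (v , subst (i ≤_) (sym e) (m≤m+n i q)) , cong suc (trans (cong (λ z → z ∸ i) e) (m+n∸m≡n i q)) , refl , w

-- The corners s ≤ f steps before the end of the boundary are s steps farther from corner q than the root.
FrozenTo : Tm → ℕ → ℕ → Set
FrozenTo K q f = ∀ s → s ≤ f → ∀ n → Near K n (crn K (bd K ∸ s)) (crn K q) → s ≤ n × Near K (n ∸ s) (crn K 0) (crn K q)

Frozen : Tm → ℕ → Set
Frozen K L = ∀ s → s ≤ L → ∀ n → Near K n (crn K (bd K ∸ s)) (crn K 0) → s ≤ n

-- The root edge can be left out of walks to the target: after a forward crossing `Up` supplies a
-- walk from the root no longer than the rest, and after a backward crossing the rest itself starts
-- at the root. Either way the length drops, which is the induction.
up-avoid : ∀ i K q → Up (split i K) (suc q) → ∀ N n → n ≤ N → Near (split i K) n (root K) (crn K (i + q)) → Near K n (root K) (crn K (i + q))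
up-avoid i K q up N n le nr@(hs , l , c) with only-inj₂ hs
... | inj₁ (ys , refl) = ys , subst (_≤ n) (length-map inj₂ ys) l , chain-unmap inj₂ (λ _ → refl) ys c
... | inj₂ (p , x , r , refl) = go N n le l
  where
  lr : suc (length r) ≤ length (p ++ inj₁ x ∷ r)
  lr = subst (suc (length r) ≤_) (sym (length-++ p)) (m≤n+m (suc (length r)) (length p))
  tgt = crn-split i K q
  rest : ∀ b → Σ (Vert K) (λ z → TChain (split i K) z (inj₁ b ∷ r) (crn K (i + q))) → ∀ n → suc (length r) ≤ suc n → Near (split i K) n (root K) (crn K (i + q))
  rest true (z , (e , d)) n (s≤s l′) = subst (Near (split i K) n (root K)) tgt (up n (subst₂ (Near (split i K) n) (sym (trans (crn-split i K 0) (cong (crn K) (+-identityʳ i)))) (sym tgt) (r , l′ , d)))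
  rest false (z , (e , d)) n (s≤s l′) = r , l′ , d
  go : ∀ N n → n ≤ N → length (p ++ inj₁ x ∷ r) ≤ n → Near K n (root K) (crn K (i + q))
  go N zero _ l = case ≤-trans lr l of λ ()
  go (suc N) (suc n) (s≤s le) l with chain-split p c
  ... | z , _ , d = near-mono K (n≤1+n n) (up-avoid i K q up N n le (rest x (z , d) n (≤-trans lr l)))

-- Frozen edges pile up at the end of the boundary, because a frozen step moves the root past one
-- edge. The parameter `f` counts those already frozen and makes the induction work: a deletion
-- keeps them at their distances, a frozen step adds one. At the end they form a geodesic of length
-- `ls π`, which is the distance of the two corners.
run-end : ∀ {K q K′ π} → WF K → q ≤ bd K → Run K q K′ π → ∀ f → q + f ≤ bd K → FrozenTo K q f →
  bd K′ + q ≡ bd K + ls π × Frozen K′ (f + ls π) × (∀ n → Near K n (crn K 0) (crn K q) → ls π ≤ n) × Near K (ls π) (crn K 0) (crn K q)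
run-end {K} wf lq stop f lf fz = refl , (λ s le n nr → proj₁ (fz s (subst (s ≤_) (+-identityʳ f) le) n nr)) , (λ _ _ → z≤n) , near-refl K
run-end {K} wf lq (freeze {q = q} {K′} {π} (m , a , b) r) f lf fz with rot-of K wf (≤-trans (s≤s z≤n) lq)
... | R = concl (run-end (RotOf.wf′ R) lq′ r (suc f) lf′ fz′)
  where
  open RotOf R using (bd-≡; near⁺; near⁻; bd-≥1; wf′)
  lq′ : q ≤ bd (rot K)
  lq′ = ≤-trans (≤-trans (n≤1+n q) lq) (≤-reflexive (sym bd-≡))
  lf′ : q + suc f ≤ bd (rot K)
  lf′ = ≤-trans (≤-reflexive (+-suc q f)) (≤-trans lf (≤-reflexive (sym bd-≡)))
  far : ∀ {n} → Near K n (crn K 0) (crn K (suc q)) → m < n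
  far {n} nr with m <? n
  ... | yes lt = lt
  ... | no nlt = ⊥-elim (b (near-mono K (≮⇒≥ nlt) nr))
  fz′ : FrozenTo (rot K) q (suc f)
  fz′ zero _ n nr = z≤n , subst (λ z → Near (rot K) n z (crn (rot K) q)) (trans (crn-end (rot K) ≤-refl) (sym (crn-0 (rot K) wf′))) nr
  -- The corner with offset `suc s` in `rot K` has offset `s` in `K`. The missing unit comes from
  -- the step just frozen: corner 1 is within `m` of the target and corner 0 is not.
  fz′ (suc s) (s≤s le) n nr with fz s le n (subst (λ z → Near K n (crn K z) (crn K (suc q))) idx (near⁺ k<bd lq (subst (λ z → Near (rot K) n (crn (rot K) (z ∸ suc s)) (crn (rot K) q)) bd-≡ nr)))
    where
    s<bd : suc s ≤ bd K
    s<bd = ≤-trans (≤-trans (s≤s le) (s≤s (m≤n+m f q))) lf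
    k<bd : bd K ∸ suc s < bd K
    k<bd = ℕP.∸-monoʳ-< (s≤s z≤n) s<bd
    idx : suc (bd K ∸ suc s) ≡ bd K ∸ s
    idx = sym (ℕP.+-∸-assoc 1 s<bd)
  ... | ls′ , nr′ with n ∸ s in eq | far nr′
  ...   | suc k | s≤s m≤k = ≤-trans (s≤s (≤-reflexive refl)) sn , near⁻ bd-≥1 lq (near-mono K (≤-trans m≤k (≤-reflexive (sym k≡))) a)
    where
    n≡ : n ≡ s + suc k
    n≡ = trans (sym (m+[n∸m]≡n ls′)) (cong (λ z → s + z) eq)
    sn : suc s ≤ n
    sn = ≤-trans (≤-trans (≤-reflexive (+-comm 1 s)) (ℕP.+-monoʳ-≤ s (s≤s z≤n))) (≤-reflexive (sym n≡))
    k≡ : n ∸ suc s ≡ k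
    k≡ = trans (cong (λ z → z ∸ suc s) (trans n≡ (+-suc s k))) (m+n∸m≡n (suc s) k)
  concl : bd K′ + q ≡ bd (rot K) + ls π × Frozen K′ (suc f + ls π) × (∀ n → Near (rot K) n (crn (rot K) 0) (crn (rot K) q) → ls π ≤ n) × Near (rot K) (ls π) (crn (rot K) 0) (crn (rot K) q) → _
  concl (e , F , lo , hi) =
    trans (+-suc (bd K′) q) (trans (cong suc (trans e (cong (λ z → z + ls π) bd-≡))) (sym (+-suc (bd K) (ls π)))) ,
    subst (Frozen K′) (sym (+-suc f (ls π))) F ,
    (λ where
      zero nr → ⊥-elim (case far nr of λ ())
      (suc n) nr → s≤s (lo n (near⁻ bd-≥1 lq (near-mono K (≤-pred (far nr)) a)))) ,
    near-trans K (near-crn K wf 0 1) (near⁺ bd-≥1 lq hi)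
run-end {.(loop e K)} {q′} (we , wk) lq (rhang {e} {K} {q} {_} {K′} {π} refl up r) f lf fz = concl (run-end wk lq′ r f lf′ fz′)
  where
  L = loop e K
  lq′ : q ≤ bd K
  lq′ = ℕP.+-cancelˡ-≤ (2 + bd e) q (bd K) (≤-trans lq (≤-reflexive (bd-loop e K)))
  lf′ : q + f ≤ bd K
  lf′ = ℕP.+-cancelˡ-≤ (2 + bd e) (q + f) (bd K) (≤-trans (≤-reflexive (sym (+-assoc (2 + bd e) q f))) (≤-trans lf (≤-reflexive (bd-loop e K))))
  down₂ : ∀ {n a b x y} → a ≡ inj₂ x → b ≡ inj₂ y → Near L n a b → Near K n x y
  down₂ refl refl = near-collapse
  up₂ : ∀ {n a b x y} → a ≡ inj₂ x → b ≡ inj₂ y → Near K n x y → Near L n a b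
  up₂ refl refl = near-loop₂
  c0 : crn L 0 ≡ inj₂ (crn K 0)
  c0 = cong inj₂ (sym (crn-0 K wk))
  cq = crn-loop₂ e K q
  fz′ : FrozenTo K q f
  fz′ s le n nr with fz s le n (up₂ idx cq nr)
    where
    idx : crn L (bd L ∸ s) ≡ inj₂ (crn K (bd K ∸ s))
    idx = trans (cong (crn L) (trans (cong (λ z → z ∸ s) (bd-loop e K)) (ℕP.+-∸-assoc (2 + bd e) (≤-trans le (≤-trans (m≤n+m f q) lf′))))) (crn-loop₂ e K (bd K ∸ s))
  ... | l , nr′ = l , down₂ c0 cq nr′
  concl : bd K′ + q ≡ bd K + ls π × Frozen K′ (f + ls π) × (∀ n → Near K n (crn K 0) (crn K q) → ls π ≤ n) × Near K (ls π) (crn K 0) (crn K q) → _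
  concl (E , F , lo , hi) = trans (shuf (bd K′) (2 + bd e) q) (trans (cong (λ z → 2 + bd e + z) E) (trans (sym (+-assoc (2 + bd e) (bd K) (ls π))) (cong (λ z → z + ls π) (sym (bd-loop e K))))) , F ,
    (λ n nr → lo n (down₂ c0 cq nr)) , up₂ c0 cq hi
    where
    shuf : ∀ a b c → a + (b + c) ≡ b + (a + c)
    shuf = ℕR.solve-∀
run-end {.(split i K)} (wk , li) lq (rface {i} {K} {q} {K′} {π} up r) f lf fz = concl (run-end wk lq′ r f lf′ fz′)
  where
  L = split i K
  lq₁ : q ≤ bd K ∸ i
  lq₁ = ≤-pred (≤-trans lq (≤-reflexive (bd-split i K)))
  lq′ : i + q ≤ bd K
  lq′ = ≤-trans (ℕP.+-monoʳ-≤ i lq₁) (≤-reflexive (m+[n∸m]≡n li))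
  lf₁ : q + f ≤ bd K ∸ i
  lf₁ = ≤-pred (≤-trans lf (≤-reflexive (bd-split i K)))
  lf′ : i + q + f ≤ bd K
  lf′ = ≤-trans (≤-reflexive (+-assoc i q f)) (≤-trans (ℕP.+-monoʳ-≤ i lf₁) (≤-reflexive (m+[n∸m]≡n li)))
  c0 : crn K 0 ≡ root K
  c0 = crn-0 K wk
  cq = crn-split i K q
  av : ∀ {n} → Near L n (crn L 0) (crn L (suc q)) → Near K n (crn K 0) (crn K (i + q))
  av {n} nr = subst (λ z → Near K n z (crn K (i + q))) (sym c0) (up-avoid i K q up n n ≤-refl (subst (Near L n (root K)) cq nr))
  fz′ : FrozenTo K (i + q) f
  fz′ s le n nr with fz s le n (subst₂ (Near L n) (sym idx) (sym cq) (near-split {i} {K} nr))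
    where
    s≤ : s ≤ bd K ∸ i
    s≤ = ≤-trans le (≤-trans (m≤n+m f q) lf₁)
    idx : crn L (bd L ∸ s) ≡ crn K (bd K ∸ s)
    idx = trans (cong (crn L) (trans (cong (λ z → z ∸ s) (bd-split i K)) (ℕP.+-∸-assoc 1 s≤))) (trans (crn-split i K (bd K ∸ i ∸ s))
      (cong (crn K) (trans (sym (ℕP.+-∸-assoc i s≤)) (cong (λ z → z ∸ s) (m+[n∸m]≡n li)))))
  ... | l , nr′ = l , av nr′
  concl : bd K′ + (i + q) ≡ bd K + ls π × Frozen K′ (f + ls π) × (∀ n → Near K n (crn K 0) (crn K (i + q)) → ls π ≤ n) × Near K (ls π) (crn K 0) (crn K (i + q)) → _
  concl (E , F , lo , hi) = bdeq , F , (λ n nr → lo n (av nr)) , subst₂ (Near L (ls π)) c0 (sym cq) (near-split {i} {K} hi)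
    where
    shuf : ∀ a b c → a + (b + c) ≡ b + (a + c)
    shuf = ℕR.solve-∀
    bdeq : bd K′ + suc q ≡ bd (split i K) + ls π
    bdeq = trans (+-suc (bd K′) q) (trans (cong suc (+-cancelˡ-≡ i _ _ (trans (shuf i (bd K′) q) (trans E (trans (cong (λ z → z + ls π) (sym (m+[n∸m]≡n li))) (+-assoc i (bd K ∸ i) (ls π)))))))
      (cong (λ z → z + ls π) (sym (bd-split i K))))

glue-shape : ∀ {K} → WF K → ∀ π → Valid π → ls π ≤ bd K → WF (glue K π) × bd (glue K π) + ls π ≡ qs π + bd K
glue-shape {K} wf nil _ _ = wf , +-identityʳ (bd K)
glue-shape {K} wf (frz π) v le with glue-shape wf π v (≤-trans (n≤1+n _) le)
... | w , e = RotOf.wf R , trans (+-suc (bd (unrot G)) (ls π)) (cong suc (trans (cong (λ z → z + ls π) (sym (RotOf.bd-≡ R))) e))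
  where
  G = glue K π
  b1 : 1 ≤ bd G
  b1 = ℕP.+-cancelʳ-≤ (ls π) 1 (bd G) (≤-trans le (≤-trans (m≤n+m (bd K) (qs π)) (≤-reflexive (sym e))))
  R : RotOf (unrot G) G
  R = unrot-of G w b1
glue-shape {K} wf (hang a π) (wa , v) le with glue-shape wf π v le
... | w , e = (wa , w) , trans (cong (λ z → z + ls π) (bd-loop a (glue K π))) (trans (+-assoc (2 + bd a) (bd (glue K π)) (ls π)) (trans (cong (λ z → 2 + bd a + z) e) (sym (+-assoc (2 + bd a) (qs π) (bd K)))))
glue-shape {K} wf (face i π) (v , li) le with glue-shape wf π v le
... | w , e = (w , il) , trans (cong (λ z → z + ls π) (bd-split i (glue K π))) (cong suc (+-cancelˡ-≡ i _ _
    (trans (sym (+-assoc i _ (ls π))) (trans (cong (λ z → z + ls π) (m+[n∸m]≡n il)) (trans e (trans (cong (λ z → z + bd K) (sym (m+[n∸m]≡n li))) (+-assoc i _ (bd K))))))))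
  where
  il : i ≤ bd (glue K π)
  il = ≤-trans li (ℕP.+-cancelʳ-≤ (ls π) (qs π) (bd (glue K π)) (≤-trans (ℕP.+-monoʳ-≤ (qs π) le) (≤-reflexive (sym e))))

-- Comparing maps that share their near side

-- A comparison of two maps with the same near side: a 1-Lipschitz map of vertices that matches the
-- corners 0 to `q` and the last `f` corners before the end of the boundary.
record LipC (A B : Tm) (q f : ℕ) : Set where
  field
    F   : Vert A → Vert B
    lip : Lip A B F
    Fq  : ∀ j → j ≤ q → F (crn A j) ≡ crn B j
    Fs  : ∀ s → s ≤ f → F (crn A (bd A ∸ s)) ≡ crn B (bd B ∸ s)

suc-∸ : ∀ {m s} → suc s ≤ m → suc (m ∸ suc s) ≡ m ∸ s
suc-∸ le = sym (ℕP.+-∸-assoc 1 le)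

∸suc-< : ∀ {m s} → suc s ≤ m → m ∸ suc s < m
∸suc-< le = ℕP.∸-monoʳ-< (s≤s z≤n) le

-- Moving the root back by one corner turns a corner of the geodesic at the end of the boundary into
-- a corner of the near side.
lipc-rot : ∀ {A A₂ B B₂ q f} → RotOf A A₂ → RotOf B B₂ → q + suc f ≤ bd A₂ → q + suc f ≤ bd B₂ → LipC A₂ B₂ q (suc f) → LipC A B (suc q) f
lipc-rot {A} {A₂} {B} {B₂} {q} {f} RA RB ra rb l = record
  { F = F′ ; lip = λ h → near-reroot⁺ (RotOf.r RB) (lip-near {A₂} {B₂} {F} lip (near-reroot⁻ (RotOf.r RA) (near-edge A h)))
  ; Fq = fq ; Fs = fs }
  where
  open LipC l
  F′ : Vert A → Vert B
  F′ x = RotOf.vm RB (F (RotOf.vn RA x))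
  step : ∀ k k′ → k < bd A₂ → k′ < bd B₂ → F (crn A₂ k) ≡ crn B₂ k′ → F′ (crn A (suc k)) ≡ crn B (suc k′)
  step k k′ lk lk′ e = trans (cong (λ z → RotOf.vm RB (F z)) (trans (cong (RotOf.vn RA) (sym (RotOf.crn-vm RA k (subst (k <_) (RotOf.bd-≡ RA) lk)))) (RotOf.vn-vm RA (crn A₂ k))))
    (trans (cong (RotOf.vm RB) e) (RotOf.crn-vm RB k′ (subst (k′ <_) (RotOf.bd-≡ RB) lk′)))
  ix : ∀ {X Y s} → RotOf X Y → suc s ≤ bd Y → suc (bd Y ∸ suc s) ≡ bd X ∸ s
  ix {s = s} R l = trans (suc-∸ l) (cong (λ z → z ∸ s) (RotOf.bd-≡ R))
  zr : ∀ {X Y} → RotOf X Y → crn X (bd X ∸ 0) ≡ crn X 0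
  zr {X} R = trans (crn-end X ≤-refl) (sym (crn-0 X (RotOf.wf R)))
  fs : ∀ s → s ≤ f → F′ (crn A (bd A ∸ s)) ≡ crn B (bd B ∸ s)
  fs s ls′ = subst₂ (λ a b → F′ (crn A a) ≡ crn B b) (ix RA s≤A) (ix RB s≤B) (step _ _ (∸suc-< s≤A) (∸suc-< s≤B) (Fs (suc s) (s≤s ls′)))
    where
    s≤A : suc s ≤ bd A₂
    s≤A = ≤-trans (s≤s ls′) (≤-trans (m≤n+m _ q) ra)
    s≤B : suc s ≤ bd B₂
    s≤B = ≤-trans (s≤s ls′) (≤-trans (m≤n+m _ q) rb)
  fq : ∀ j → j ≤ suc q → F′ (crn A j) ≡ crn B j
  fq zero _ = subst₂ (λ a b → F′ a ≡ b) (zr RA) (zr RB) (fs 0 z≤n)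
  fq (suc j) (s≤s lj) = step j j (lt ra) (lt rb) (Fq j lj)
    where
    lt : ∀ {m} → q + suc f ≤ m → j < m
    lt r = ≤-trans (s≤s lj) (≤-trans (≤-trans (≤-reflexive (+-comm 1 q)) (ℕP.+-monoʳ-≤ q (s≤s z≤n))) r)

-- A comparison of two far sides along the geodesic extends over any region glued to both, since
-- each glued edge joins corners that already match. Every frozen step uses up one corner of the
-- geodesic.
lipc-glue : ∀ {A′ B′ L} → WF A′ → WF B′ → L ≤ bd A′ → L ≤ bd B′ → LipC A′ B′ 0 L → ∀ π → Valid π → ls π ≤ L →
  LipC (glue A′ π) (glue B′ π) (qs π) (L ∸ ls π)
lipc-glue wa wb la lb base nil _ _ = base
lipc-glue {A′} {B′} {L} wa wb la lb base (frz π) v le =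
  lipc-rot (unrot-of (glue A′ π) (proj₁ sa) (≤-trans (≤-trans (s≤s z≤n) (m≤n+m _ (qs π))) ra))
    (unrot-of (glue B′ π) (proj₁ sb) (≤-trans (≤-trans (s≤s z≤n) (m≤n+m _ (qs π))) rb)) ra rb
    (subst (LipC (glue A′ π) (glue B′ π) (qs π)) (sym (suc-∸ le)) (lipc-glue wa wb la lb base π v ls≤))
  where
  ls≤ : ls π ≤ L
  ls≤ = ≤-trans (n≤1+n _) le
  sa = glue-shape wa π v (≤-trans ls≤ la)
  sb = glue-shape wb π v (≤-trans ls≤ lb)
  room : ∀ {x q m} → x + ls π ≡ q + m → L ≤ m → q + suc (L ∸ suc (ls π)) ≤ x
  room {x} {q} {m} e lm = ℕP.+-cancelʳ-≤ (ls π) _ _ (≤-trans (≤-reflexive (trans (+-assoc q _ (ls π)) (cong (λ z → q + z) (trans (cong (λ z → z + ls π) (suc-∸ le)) (ℕP.m∸n+n≡m ls≤))))) (≤-trans (ℕP.+-monoʳ-≤ q lm) (≤-reflexive (sym e))))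
  ra : qs π + suc (L ∸ suc (ls π)) ≤ bd (glue A′ π)
  ra = room (proj₂ sa) la
  rb : qs π + suc (L ∸ suc (ls π)) ≤ bd (glue B′ π)
  rb = room (proj₂ sb) lb
lipc-glue {A′} {B′} {L} wa wb la lb base (hang e π) (we , v) le = record { F = F′ ; lip = lip′ ; Fq = fq ; Fs = fs }
  where
  A₂ = glue A′ π
  B₂ = glue B′ π
  sa = glue-shape wa π v (≤-trans le la)
  sb = glue-shape wb π v (≤-trans le lb)
  open LipC (lipc-glue wa wb la lb base π v le)
  rt : F (root A₂) ≡ root B₂
  rt = trans (cong F (sym (crn-0 A₂ (proj₁ sa)))) (trans (Fq 0 z≤n) (crn-0 B₂ (proj₁ sb)))
  F′ : Vert (loop e A₂) → Vert (loop e B₂)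
  F′ (inj₁ x) = inj₁ x
  F′ (inj₂ y) = inj₂ (F y)
  lip′ : Lip (loop e A₂) (loop e B₂) F′
  lip′ (inj₁ true) = subst (λ z → Near (loop e B₂) 1 (inj₂ z) (inj₁ (root e))) (sym rt) (near-edge (loop e B₂) (inj₁ true))
  lip′ (inj₁ false) = subst (λ z → Near (loop e B₂) 1 (inj₁ (root e)) (inj₂ z)) (sym rt) (near-edge (loop e B₂) (inj₁ false))
  lip′ (inj₂ (inj₁ h)) = near-edge (loop e B₂) (inj₂ (inj₁ h))
  lip′ (inj₂ (inj₂ h)) = near-loop₂ (lip h)
  at₂ : ∀ a b → F (crn A₂ a) ≡ crn B₂ b → F′ (crn (loop e A₂) (2 + bd e + a)) ≡ crn (loop e B₂) (2 + bd e + b)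
  at₂ a b eq = trans (cong F′ (crn-loop₂ e A₂ a)) (trans (cong inj₂ eq) (sym (crn-loop₂ e B₂ b)))
  fq : ∀ j → j ≤ 2 + bd e + qs π → F′ (crn (loop e A₂) j) ≡ crn (loop e B₂) j
  fq zero _ = cong inj₂ rt
  fq (suc j) lj with j ≤? bd e
  ... | yes le′ = trans (cong F′ (crn-loop₁ e A₂ j le′)) (sym (crn-loop₁ e B₂ j le′))
  ... | no gt = subst (λ z → F′ (crn (loop e A₂) z) ≡ crn (loop e B₂) z) ej (at₂ _ _ (Fq (suc j ∸ (2 + bd e)) (≤-trans (ℕP.∸-monoˡ-≤ (2 + bd e) lj) (≤-reflexive (m+n∸m≡n (2 + bd e) (qs π))))))
    where
    ej : 2 + bd e + (suc j ∸ (2 + bd e)) ≡ suc j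
    ej = m+[n∸m]≡n (s≤s (≰⇒> gt))
  fs : ∀ s → s ≤ L ∸ ls π → F′ (crn (loop e A₂) (bd (loop e A₂) ∸ s)) ≡ crn (loop e B₂) (bd (loop e B₂) ∸ s)
  fs s ls′ = subst₂ (λ a b → F′ (crn (loop e A₂) a) ≡ crn (loop e B₂) b) (ix A₂ (proj₂ sa) la) (ix B₂ (proj₂ sb) lb) (at₂ _ _ (Fs s ls′))
    where
    ix : ∀ X {m} → bd X + ls π ≡ qs π + m → L ≤ m → 2 + bd e + (bd X ∸ s) ≡ bd (loop e X) ∸ s
    ix X {m} eq lm = trans (sym (ℕP.+-∸-assoc (2 + bd e) s≤)) (cong (λ z → z ∸ s) (sym (bd-loop e X)))
      where
      s≤ : s ≤ bd X
      s≤ = ℕP.+-cancelʳ-≤ (ls π) s (bd X) (≤-trans (ℕP.+-monoˡ-≤ (ls π) ls′) (≤-trans (≤-reflexive (ℕP.m∸n+n≡m le)) (≤-trans lm (≤-trans (m≤n+m m (qs π)) (≤-reflexive (sym eq))))))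
lipc-glue {A′} {B′} {L} wa wb la lb base (face i π) (v , li) le = record { F = F ; lip = lip′ ; Fq = fq ; Fs = fs }
  where
  A₂ = glue A′ π
  B₂ = glue B′ π
  sa = glue-shape wa π v (≤-trans le la)
  sb = glue-shape wb π v (≤-trans le lb)
  open LipC (lipc-glue wa wb la lb base π v le)
  rt : F (root A₂) ≡ root B₂
  rt = trans (cong F (sym (crn-0 A₂ (proj₁ sa)))) (trans (Fq 0 z≤n) (crn-0 B₂ (proj₁ sb)))
  lip′ : Lip (split i A₂) (split i B₂) F
  lip′ (inj₁ true) = subst₂ (Near (split i B₂) 1) (sym rt) (sym (Fq i li)) (near-edge (split i B₂) (inj₁ true))
  lip′ (inj₁ false) = subst₂ (Near (split i B₂) 1) (sym (Fq i li)) (sym rt) (near-edge (split i B₂) (inj₁ false))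
  lip′ (inj₂ h) = near-split {i} {B₂} (lip h)
  fq : ∀ j → j ≤ suc (qs π ∸ i) → F (crn (split i A₂) j) ≡ crn (split i B₂) j
  fq zero _ = rt
  fq (suc j) (s≤s lj) = trans (cong F (crn-split i A₂ j)) (trans (Fq (i + j) (≤-trans (ℕP.+-monoʳ-≤ i lj) (≤-reflexive (m+[n∸m]≡n li)))) (sym (crn-split i B₂ j)))
  fs : ∀ s → s ≤ L ∸ ls π → F (crn (split i A₂) (bd (split i A₂) ∸ s)) ≡ crn (split i B₂) (bd (split i B₂) ∸ s)
  fs s ls′ = trans (cong F (ix A₂ (proj₂ sa) la)) (trans (Fs s ls′) (sym (ix B₂ (proj₂ sb) lb)))
    where
    ix : ∀ X {m} → bd X + ls π ≡ qs π + m → L ≤ m → crn (split i X) (bd (split i X) ∸ s) ≡ crn X (bd X ∸ s)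
    ix X {m} eq lm = trans (cong (crn (split i X)) (trans (cong (λ z → z ∸ s) (bd-split i X)) (ℕP.+-∸-assoc 1 s≤))) (trans (crn-split i X (bd X ∸ i ∸ s))
        (cong (crn X) (trans (sym (ℕP.+-∸-assoc i s≤)) (cong (λ z → z ∸ s) (m+[n∸m]≡n i≤)))))
      where
      i+s : i + s ≤ bd X
      i+s = ℕP.+-cancelʳ-≤ (ls π) (i + s) (bd X) (≤-trans (≤-reflexive (+-assoc i s (ls π))) (≤-trans (+-mono-≤ li (≤-trans (ℕP.+-monoˡ-≤ (ls π) ls′) (≤-trans (≤-reflexive (ℕP.m∸n+n≡m le)) lm))) (≤-reflexive (sym eq))))
      i≤ : i ≤ bd X
      i≤ = ≤-trans (m≤m+n i s) i+s
      s≤ : s ≤ bd X ∸ i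
      s≤ = ≤-trans (≤-reflexive (sym (m+n∸m≡n i s))) (ℕP.∸-monoˡ-≤ i i+s)

lipc-near : ∀ {A B q f} → LipC A B q f → ∀ {n} i j → i ≤ q → j ≤ q → Near A n (crn A i) (crn A j) → Near B n (crn B i) (crn B j)
lipc-near {A} {B} l {n} i j li lj nr = subst₂ (Near B n) (Fq i li) (Fq j lj) (lip-near {A} {B} {F} lip nr)
  where open LipC l

-- With comparisons in both directions, distances between matched corners agree, so each step of a
-- run meets the same decision in both maps.
down-lip : ∀ {A B q f} → LipC A B q f → LipC B A q f → 1 ≤ q → Down A q → Down B q
down-lip {q = q} to fro le (n , dn , nd) = n , lipc-near to 1 q le ≤-refl dn , λ nr → nd (lipc-near fro 0 q z≤n ≤-refl nr)

up-lip : ∀ {A B q f} → LipC A B q f → LipC B A q f → 1 ≤ q → Up A q → Up B q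
up-lip {q = q} to fro le up n nr = lipc-near to 0 q z≤n ≤-refl (up n (lipc-near fro 1 q le ≤-refl nr))

transfer-freeze : ∀ c {A₂ B₂ A′ B′ q f π} → WF A₂ → WF B₂ → 1 ≤ bd A₂ → 1 ≤ bd B₂ →
  LipC (unrot A₂) (unrot B₂) (suc q) f → LipC (unrot B₂) (unrot A₂) (suc q) f →
  (Run A₂ q A′ π → Good c A₂ → Run B₂ q B′ π × Good c B₂) →
  Run (unrot A₂) (suc q) A′ (frz π) → Good c (unrot A₂) → Run (unrot B₂) (suc q) B′ (frz π) × Good c (unrot B₂)
transfer-freeze c {A₂} {B₂} {A′} {B′} {q} {f} {π} wa wb pa pb to fro ih (freeze d r) g =
  freeze (down-lip to fro (s≤s z≤n) d) (subst (λ z → Run z q B′ π) (sym (rot-unrot B₂ wb pb)) (proj₁ res)) , good-unrot c B₂ wb pb (proj₂ res)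
  where
  res : Run B₂ q B′ π × Good c B₂
  res = ih (subst (λ z → Run z q A′ π) (rot-unrot A₂ wa pa) r) (good-rotof c (unrot-of A₂ wa pa) g)

-- Both the decisions of the run and the condition on each glued inner face are statements about
-- distances between near-side corners; hence the far side may be exchanged for another one with the
-- same geodesic.
transfer : ∀ {c A′ B′ L} → WF A′ → WF B′ → L ≤ bd A′ → L ≤ bd B′ → LipC A′ B′ 0 L → LipC B′ A′ 0 L → Good c B′ →
  ∀ π → Valid π → ls π ≤ L → ∀ {q} → q ≡ qs π → Run (glue A′ π) q A′ π → Good c (glue A′ π) →
  Run (glue B′ π) q B′ π × Good c (glue B′ π)
transfer wa wb la lb ab ba gb nil _ _ _ stop _ = stop , gb
transfer {c} {A′} {B′} {L} wa wb la lb ab ba gb (frz π) v le refl r g =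
  transfer-freeze c (proj₁ sa) (proj₁ sb) (pos (proj₂ sa) la) (pos (proj₂ sb) lb) (lipc-glue wa wb la lb ab (frz π) v le) (lipc-glue wb wa lb la ba (frz π) v le)
    (transfer wa wb la lb ab ba gb π v ls≤ refl) r g
  where
  ls≤ : ls π ≤ L
  ls≤ = ≤-trans (n≤1+n (ls π)) le
  sa : WF (glue A′ π) × bd (glue A′ π) + ls π ≡ qs π + bd A′
  sa = glue-shape wa π v (≤-trans ls≤ la)
  sb : WF (glue B′ π) × bd (glue B′ π) + ls π ≡ qs π + bd B′
  sb = glue-shape wb π v (≤-trans ls≤ lb)
  pos : ∀ {x m} → x + ls π ≡ qs π + m → L ≤ m → 1 ≤ x
  pos {x} {m} e lm = ℕP.+-cancelʳ-≤ (ls π) 1 x (≤-trans le (≤-trans lm (≤-trans (m≤n+m m (qs π)) (≤-reflexive (sym e)))))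
transfer {c} {A′} {B′} wa wb la lb ab ba gb (hang e π) (we , v) le refl (rhang {q = q₁} eq′ up r) (ge , g) =
  rhang eq′ (up-lip (lipc-glue wa wb la lb ab (hang e π) (we , v) le) (lipc-glue wb wa lb la ba (hang e π) (we , v) le) (s≤s z≤n) up) (proj₁ res) , (ge , proj₂ res)
  where
  res : Run (glue B′ π) q₁ B′ π × Good c (glue B′ π)
  res = transfer wa wb la lb ab ba gb π v le (sym (+-cancelˡ-≡ (2 + bd e) _ _ eq′)) r g
transfer {c} {A′} {B′} wa wb la lb ab ba gb (face i π) (v , li) le refl (rface {q = q} up r) (g , nn) =
  rface (up-lip (lipc-glue wa wb la lb ab (face i π) (v , li) le) (lipc-glue wb wa lb la ba (face i π) (v , li) le) (s≤s z≤n) up) (proj₁ res) ,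
    (proj₂ res , λ nr → nn (subst (λ z → Near (glue A′ π) c z (crn (glue A′ π) i)) (crn-0 (glue A′ π) (proj₁ (glue-shape wa π v (≤-trans le la))))
      (lipc-near (lipc-glue wb wa lb la ba π v le) 0 i z≤n li (subst (λ z → Near (glue B′ π) c z (crn (glue B′ π) i)) (sym (crn-0 (glue B′ π) (proj₁ (glue-shape wb π v (≤-trans le lb))))) nr))))
  where
  res : Run (glue B′ π) (i + (qs π ∸ i)) B′ π × Good c (glue B′ π)
  res = transfer wa wb la lb ab ba gb π v le (m+[n∸m]≡n li) r g

-- The bare path, used as the smallest possible far side: its boundary goes out to the end and back,
-- and the last `L` sides lead to the root.
pth : ℕ → Tm
pth zero = pt
pth (suc L) = loop (pth L) pt

pth-wf : ∀ L → WF (pth L)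
pth-wf zero = tt
pth-wf (suc L) = pth-wf L , tt

pth-bd : ∀ L → bd (pth L) ≡ L + L
pth-bd zero = refl
pth-bd (suc L) = trans (bd-loop (pth L) pt) (trans (+-identityʳ _) (trans (cong (λ z → 2 + z) (pth-bd L)) (cong suc (sym (+-suc L L)))))

pth-good : ∀ c L → Good c (pth L)
pth-good c zero = tt
pth-good c (suc L) = pth-good c L , tt

pth-degs : ∀ L → degs (pth L) ≡ []
pth-degs zero = refl
pth-degs (suc L) = trans (++-identityʳ (degs (pth L))) (pth-degs L)

depth : ∀ L → Vert (pth L) → ℕ
depth zero _ = 0
depth (suc L) (inj₁ v) = suc (depth L v)
depth (suc L) (inj₂ _) = 0

pvert : ∀ L → ℕ → Vert (pth L)
pvert zero _ = tt
pvert (suc L) zero = inj₂ tt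
pvert (suc L) (suc s) = inj₁ (pvert L s)

depth-root : ∀ L → depth L (root (pth L)) ≡ 0
depth-root zero = refl
depth-root (suc L) = refl

pvert-0 : ∀ L → pvert L 0 ≡ root (pth L)
pvert-0 zero = refl
pvert-0 (suc L) = refl

depth-pvert : ∀ L s → s ≤ L → depth L (pvert L s) ≡ s
depth-pvert zero zero _ = refl
depth-pvert (suc L) zero _ = refl
depth-pvert (suc L) (suc s) (s≤s le) = cong suc (depth-pvert L s le)

depth-≤ : ∀ L v → depth L v ≤ L
depth-≤ zero _ = z≤n
depth-≤ (suc L) (inj₁ v) = s≤s (depth-≤ L v)
depth-≤ (suc L) (inj₂ _) = z≤n

crn-pth : ∀ L s → s ≤ L → crn (pth L) (bd (pth L) ∸ s) ≡ pvert L s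
crn-pth L zero _ = trans (crn-end (pth L) ≤-refl) (sym (pvert-0 L))
crn-pth (suc L) (suc s) (s≤s le) = trans (cong (λ z → crn (pth (suc L)) (z ∸ suc s)) (trans (bd-loop (pth L) pt) (+-identityʳ _)))
  (trans (cong (crn (pth (suc L))) (ℕP.+-∸-assoc 1 s≤))
    (trans (crn-loop₁ (pth L) pt (bd (pth L) ∸ s) (m∸n≤m (bd (pth L)) s)) (cong inj₁ (crn-pth L s le))))
  where
  s≤ : s ≤ bd (pth L)
  s≤ = ≤-trans le (≤-trans (m≤m+n L L) (≤-reflexive (sym (pth-bd L))))

depth-edge : ∀ L h → depth L (org (pth L) h) ≡ suc (depth L (org (pth L) (opp (pth L) h))) ⊎ depth L (org (pth L) (opp (pth L) h)) ≡ suc (depth L (org (pth L) h))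
depth-edge (suc L) (inj₁ true) = inj₂ (cong suc (depth-root L))
depth-edge (suc L) (inj₁ false) = inj₁ (cong suc (depth-root L))
depth-edge (suc L) (inj₂ (inj₁ h)) with depth-edge L h
... | inj₁ e = inj₁ (cong suc e)
... | inj₂ e = inj₂ (cong suc e)

near-pvert-suc : ∀ L s → s < L → Near (pth L) 1 (pvert L s) (pvert L (suc s))
near-pvert-suc (suc L) zero _ = subst (λ z → Near (pth (suc L)) 1 (inj₂ tt) (inj₁ z)) (sym (pvert-0 L)) (near-edge (pth (suc L)) (inj₁ true))
near-pvert-suc (suc L) (suc s) (s≤s lt) = lip-near {pth L} {pth (suc L)} {inj₁} (λ h → near-edge (pth (suc L)) (inj₂ (inj₁ h))) (near-pvert-suc L s lt)

near-pvert : ∀ L s s′ → s ≤ L → s′ ≤ L → s ≤ suc s′ → s′ ≤ suc s → Near (pth L) 1 (pvert L s) (pvert L s′)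
near-pvert L s s′ ls ls′ a b with ℕP.<-cmp s s′
... | tri≈ _ refl _ = near-mono (pth L) z≤n (near-refl (pth L))
... | tri< lt _ _ with ≤-antisym b lt
...   | refl = near-pvert-suc L s ls′
near-pvert L s s′ ls ls′ a b | tri> _ _ gt with ≤-antisym a gt
...   | refl = near-sym (pth L) (near-pvert-suc L s′ ls)

-- The vertex at depth `s` goes to the corner `s` steps before the end of the boundary; neighbouring
-- depths go to neighbouring corners.
to-pth : ∀ {K L} → WF K → L ≤ bd K → LipC (pth L) K 0 L
to-pth {K} {L} wf le = record { F = F ; lip = lip ; Fq = fq ; Fs = λ s ls → trans (cong F (crn-pth L s ls)) (cong (λ z → crn K (bd K ∸ z)) (depth-pvert L s ls)) }
  where
  F : Vert (pth L) → Vert K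
  F v = crn K (bd K ∸ depth L v)
  near1 : ∀ s → suc s ≤ L → Near K 1 (crn K (bd K ∸ suc s)) (crn K (bd K ∸ s))
  near1 s l = subst (λ z → Near K 1 (crn K (bd K ∸ suc s)) (crn K z)) (trans (+-comm _ 1) (suc-∸ (≤-trans l le))) (near-crn K wf (bd K ∸ suc s) 1)
  lip : Lip (pth L) K F
  lip h with depth-edge L h | depth-≤ L (org (pth L) h) | depth-≤ L (org (pth L) (opp (pth L) h))
  ... | inj₁ e | l | _ rewrite e = near1 _ l
  ... | inj₂ e | _ | l rewrite e = near-sym K (near1 _ l)
  fq : ∀ j → j ≤ 0 → F (crn (pth L) j) ≡ crn K j
  fq .0 z≤n = trans (cong (λ z → crn K (bd K ∸ z)) (trans (cong (depth L) (crn-0 (pth L) (pth-wf L))) (depth-root L))) (trans (crn-end K ≤-refl) (sym (crn-0 K wf)))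

-- The distance to the root capped at `L`; the cap gives a place on the path to vertices far from
-- the root.
height : (K : Tm) → ℕ → Vert K → ℕ
height K zero v = 0
height K (suc L) v with near? K (height K L v) v (root K)
... | yes _ = height K L v
... | no _ = suc L

height-≤ : ∀ K L v → height K L v ≤ L
height-≤ K zero v = z≤n
height-≤ K (suc L) v with near? K (height K L v) v (root K)
... | yes _ = ≤-trans (height-≤ K L v) (n≤1+n L)
... | no _ = ≤-refl

height-near : ∀ K L v n → n < L → Near K n v (root K) → height K L v ≤ n × Near K (height K L v) v (root K)
height-near K (suc L) v n (s≤s lt) nr with near? K (height K L v) v (root K)
... | yes y = least , y
  where
  least : height K L v ≤ n
  least with ℕP.m≤n⇒m<n∨m≡n lt
  ... | inj₁ lt′ = proj₁ (height-near K L v n lt′ nr)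
  ... | inj₂ refl = height-≤ K L v
... | no ny with ℕP.m≤n⇒m<n∨m≡n lt
...   | inj₁ lt′ = ⊥-elim (ny (proj₂ (height-near K L v n lt′ nr)))
...   | inj₂ refl = bad
  where
  fill : ∀ m → ¬ Near K (height K m v) v (root K) → height K m v ≡ m
  fill zero _ = refl
  fill (suc m) nn with near? K (height K m v) v (root K)
  ... | yes y = ⊥-elim (nn y)
  ... | no _ = refl
  bad : suc n ≤ n × Near K (suc n) v (root K)
  bad = ⊥-elim (ny (subst (λ z → Near K z v (root K)) (sym (fill n ny)) nr))

height-lip : ∀ K L v v′ → Near K 1 v′ v → height K L v′ ≤ suc (height K L v)
height-lip K L v v′ e with suc (height K L v) <? L
... | no ge = ≤-trans (height-≤ K L v′) (≮⇒≥ ge)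
... | yes lt = proj₁ (height-near K L v′ (suc (height K L v)) lt (near-trans K e (att L v (≤-trans (n≤1+n _) lt))))
  where
  att : ∀ L v → height K L v < L → Near K (height K L v) v (root K)
  att (suc L) v l with near? K (height K L v) v (root K)
  ... | yes y = y
  ... | no _ = ⊥-elim (ℕP.<-irrefl refl l)

-- Capped distance to the root is 1-Lipschitz, and on a geodesic it recovers the position along it;
-- so the far side retracts onto the path.
from-pth : ∀ {K L} → WF K → L ≤ bd K → Frozen K L → LipC K (pth L) 0 L
from-pth {K} {L} wf le fz = record { F = F ; lip = lip ; Fq = fq ; Fs = fs }
  where
  F : Vert K → Vert (pth L)
  F v = pvert L (height K L v)
  lip : Lip K (pth L) F
  lip h = near-pvert L _ _ (height-≤ K L _) (height-≤ K L _) (height-lip K L _ _ (near-edge K h)) (height-lip K L _ _ (near-sym K (near-edge K h)))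
  hgt : ∀ s → s ≤ L → height K L (crn K (bd K ∸ s)) ≡ s
  hgt s ls = ≤-antisym up low
    where
    nr : Near K s (crn K (bd K ∸ s)) (root K)
    nr = subst (Near K s (crn K (bd K ∸ s))) (crn-end K (≤-reflexive (sym (ℕP.m∸n+n≡m (≤-trans ls le))))) (near-crn K wf (bd K ∸ s) s)
    up : height K L (crn K (bd K ∸ s)) ≤ s
    up with ℕP.m≤n⇒m<n∨m≡n ls
    ... | inj₁ lt = proj₁ (height-near K L _ s lt nr)
    ... | inj₂ refl = height-≤ K L _
    low : s ≤ height K L (crn K (bd K ∸ s))
    low with ℕP.m≤n⇒m<n∨m≡n ls
    ... | inj₁ lt = fz s ls _ (subst (Near K _ (crn K (bd K ∸ s))) (sym (crn-0 K wf)) (proj₂ (height-near K L _ s lt nr)))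
    ... | inj₂ refl with height K L (crn K (bd K ∸ s)) <? s
    ...   | no ge = ≮⇒≥ ge
    ...   | yes lt = fz s ls _ (subst (Near K _ (crn K (bd K ∸ s))) (sym (crn-0 K wf)) (att L (crn K (bd K ∸ s)) lt))
      where
      att : ∀ L v → height K L v < L → Near K (height K L v) v (root K)
      att (suc L) v l with near? K (height K L v) v (root K)
      ... | yes y = y
      ... | no _ = ⊥-elim (ℕP.<-irrefl refl l)
  fs : ∀ s → s ≤ L → F (crn K (bd K ∸ s)) ≡ crn (pth L) (bd (pth L) ∸ s)
  fs s ls = trans (cong (pvert L) (hgt s ls)) (sym (crn-pth L s ls))
  fq : ∀ j → j ≤ 0 → F (crn K j) ≡ crn (pth L) j
  fq .0 z≤n = trans (cong F (trans (crn-0 K wf) (sym (crn-end K ≤-refl)))) (trans (fs 0 z≤n) (trans (crn-end (pth L) ≤-refl) (sym (crn-0 (pth L) (pth-wf L)))))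

glue-degs : ∀ {K} → WF K → ∀ π → Valid π → ls π ≤ bd K → degs (glue K π) ↭ degs K ++ ds π
glue-degs {K} wf nil _ _ = ↭-reflexive (sym (++-identityʳ (degs K)))
glue-degs {K} wf (frz π) v le with glue-shape wf π v (≤-trans (n≤1+n _) le)
... | w , e with unrot-spec (glue K π) w (ℕP.+-cancelʳ-≤ (ls π) 1 (bd (glue K π)) (≤-trans le (≤-trans (m≤n+m (bd K) (qs π)) (≤-reflexive (sym e)))))
...   | u , z , _ , r = ↭-trans (Rerooted.degs-↭ r) (glue-degs wf π v (≤-trans (n≤1+n _) le))
glue-degs {K} wf (hang a π) (_ , v) le = ↭-trans (PP.++⁺ˡ (degs a) (glue-degs wf π v le)) (PP.shifts (degs a) (degs K))
glue-degs {K} wf (face i π) (v , _) le = ↭-trans (prep (suc i) (glue-degs wf π v le)) (↭-sym (PP.shift (suc i) (degs K) (ds π)))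

run-good : ∀ c {K q K′ π} → WF K → q ≤ bd K → Run K q K′ π → Good c K → Good c K′
run-good c wf lq stop g = g
run-good c {K} wf lq (freeze {q = q} _ r) g with rot-of K wf (≤-trans (s≤s z≤n) lq)
... | R = run-good c (RotOf.wf′ R) (≤-trans (≤-trans (n≤1+n q) lq) (≤-reflexive (sym (RotOf.bd-≡ R)))) r (good-rotof c R g)
run-good c (we , wk) lq (rhang {e} {K} {q} refl up r) (_ , g) = run-good c wk (ℕP.+-cancelˡ-≤ (2 + bd e) q (bd K) (≤-trans lq (≤-reflexive (bd-loop e K)))) r g
run-good c (wk , li) lq (rface {i} {K} {q} up r) (g , _) =
  run-good c wk (≤-trans (ℕP.+-monoʳ-≤ i (≤-pred (≤-trans lq (≤-reflexive (bd-split i K))))) (≤-reflexive (m+[n∸m]≡n li))) r g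

-- The bijection with pairs of a far side and a region

Ok : ℕ → Tm → Set
Ok c t = WF t × Good c t

Ok? : ∀ c t → Dec (Ok c t)
Ok? c t = WF? t ×-dec Good? c t

Dist≥ : (t : Tm) → Vert t → Vert t → ℕ → Set
Dist≥ t u v l = ∀ n → Near t n u v → l ≤ n

dist≥? : ∀ t u v l → Dec (Dist≥ t u v l)
dist≥? t u v zero = yes (λ _ _ → z≤n)
dist≥? t u v (suc l) with near? t l u v
... | yes nr = no (λ d → 1+n≰n (d l nr))
... | no nn = yes (λ n nr → ≰⇒> (λ le → nn (near-mono t le nr)))

-- The lower bound is enough to make the last `l` sides a geodesic, since they are themselves a walk
-- of length `l`.
InB : ℕ → ℕ → ℕ → Tm → Set
InB c p l K = Ok c K × bd K ≡ p + l × Dist≥ K (crn K (bd K ∸ l)) (crn K 0) l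

-- A region is represented by a map, namely the one whose far side is the bare path of length `l`.
InY : ℕ → ℕ → ℕ → Tm → Set
InY c l q M = Ok c M × bd M ≡ q + l × (Σ Prog λ π → Run M q (pth l) π)

InK : ℕ → ℕ → ℕ → ℕ → Tm → Set
InK c p q l K = Ok c K × bd K ≡ q + p × Dist≥ K (crn K 0) (crn K q) l × Near K l (crn K 0) (crn K q)

-- Parts of a geodesic are geodesics: a shortcut near the end would shorten the whole.
frozen : ∀ {K L} → WF K → L ≤ bd K → Dist≥ K (crn K (bd K ∸ L)) (crn K 0) L → Frozen K L
frozen {K} {L} wf le d s ls n nr = ℕP.+-cancelˡ-≤ (L ∸ s) s n (≤-trans (≤-reflexive (ℕP.m∸n+n≡m ls)) (d _ (near-trans K seg nr)))
  where
  idx : bd K ∸ L + (L ∸ s) ≡ bd K ∸ s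
  idx = trans (sym (ℕP.+-∸-assoc (bd K ∸ L) ls)) (cong (λ z → z ∸ s) (ℕP.m∸n+n≡m le))
  seg : Near K (L ∸ s) (crn K (bd K ∸ L)) (crn K (bd K ∸ s))
  seg = subst (λ z → Near K (L ∸ s) (crn K (bd K ∸ L)) (crn K z)) idx (near-crn K wf (bd K ∸ L) (L ∸ s))

frozen-start : ∀ {K q} → WF K → FrozenTo K q 0
frozen-start {K} {q} wf .0 z≤n n nr = z≤n , subst (λ z → Near K n z (crn K q)) (trans (crn-end K ≤-refl) (sym (crn-0 K wf))) nr

run-facts : ∀ {K q K′ π p} → WF K → bd K ≡ q + p → Run K q K′ π →
  bd K′ ≡ p + ls π × Frozen K′ (ls π) × Dist≥ K (crn K 0) (crn K q) (ls π) × Near K (ls π) (crn K 0) (crn K q)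
run-facts {K} {q} {K′} {π} {p} wf e r with run-end wf lq r 0 (subst (_≤ bd K) (sym (+-identityʳ q)) lq) (frozen-start {K} {q} wf)
  where
  lq : q ≤ bd K
  lq = subst (q ≤_) (sym e) (m≤m+n q p)
... | a , b , c , d = +-cancelʳ-≡ q _ _ (trans a (trans (cong (λ z → z + ls π) e) (shuf q p (ls π)))) , b , c , d
  where
  shuf : ∀ q p l → q + p + l ≡ p + l + q
  shuf = ℕR.solve-∀

-- The run of `K` leaves the far side and a program. By `transfer` with the path in place of the far
-- side, the same program is the run of a region, and `run-facts` identifies its geodesic length
-- with `l`.
decompose : ∀ {c p q l} K → InK c p q l K → Σ Tm λ K′ → Σ Prog λ π → InB c p l K′ × InY c l q (glue (pth l) π) ×
  Run K q K′ π × Run (glue (pth l) π) q (pth l) π × K ≡ glue K′ π × degs K ↭ degs K′ ++ degs (glue (pth l) π)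
decompose {c} {p} {q} {l} K ((wf , g) , e , d≥ , nr) with run-exists (edges K) K ≤-refl wf q (subst (q ≤_) (sym e) (m≤m+n q p))
... | K′ , π , r with run-valid wf (subst (q ≤_) (sym e) (m≤m+n q p)) r | run-facts {p = p} wf e r
...   | v , refl , refl , wf′ | bd′ , fz , dl , nl with ≤-antisym (d≥ _ nl) (dl _ nr)
...     | refl = K′ , π ,
  ((wf′ , g′) , bd′ , fz (ls π) ≤-refl) ,
  ((proj₁ shp , proj₂ tr) , +-cancelʳ-≡ (ls π) _ _ (trans (proj₂ shp) (trans (cong (λ z → qs π + z) (pth-bd (ls π))) (sym (+-assoc (qs π) (ls π) (ls π))))) , π , proj₁ tr) ,
  r , proj₁ tr , refl ,
  ↭-trans (glue-degs wf′ π v l≤) (PP.++⁺ˡ (degs K′) (↭-sym (subst (λ z → degs (glue (pth (ls π)) π) ↭ z ++ ds π) (pth-degs (ls π)) (glue-degs (pth-wf (ls π)) π v lp))))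
  where
  l≤ : ls π ≤ bd K′
  l≤ = subst (ls π ≤_) (sym bd′) (m≤n+m (ls π) p)
  lp : ls π ≤ bd (pth (ls π))
  lp = subst (ls π ≤_) (sym (pth-bd (ls π))) (m≤m+n (ls π) (ls π))
  g′ : Good c K′
  g′ = run-good c wf (subst (qs π ≤_) (sym e) (m≤m+n (qs π) p)) r g
  tr = transfer {c} wf′ (pth-wf (ls π)) l≤ lp (from-pth wf′ l≤ fz) (to-pth wf′ l≤) (pth-good c (ls π)) π v ≤-refl refl r g
  shp = glue-shape (pth-wf (ls π)) π v lp

-- The converse exchange: the path of the region is replaced by an arbitrary far side with a
-- geodesic of the same length.
recompose : ∀ {c p q l} K′ M → InB c p l K′ → InY c l q M → Σ Prog λ π → InK c p q l (glue K′ π) × Run (glue K′ π) q K′ π × Run M q (pth l) π ×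
  M ≡ glue (pth l) π × degs (glue K′ π) ↭ degs K′ ++ degs M
recompose {c} {p} {q} {l} K′ M ((wf′ , g′) , bd′ , d≥) ((wm , gm) , bdm , π , r) with run-valid wm (subst (q ≤_) (sym bdm) (m≤m+n q l)) r | run-facts {p = l} wm bdm r
... | v , refl , refl , _ | bd″ , _ , _ , _ with +-cancelˡ-≡ l _ _ (trans (sym (pth-bd l)) bd″)
...   | refl = π ,
  ((proj₁ shp , proj₂ tr) , bdK , proj₁ (proj₂ (proj₂ rf)) , proj₂ (proj₂ (proj₂ rf))) , proj₁ tr , r , refl ,
  ↭-trans (glue-degs wf′ π v l≤) (PP.++⁺ˡ (degs K′) (↭-sym (subst (λ z → degs (glue (pth (ls π)) π) ↭ z ++ ds π) (pth-degs (ls π)) (glue-degs (pth-wf (ls π)) π v lp))))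
  where
  l≤ : ls π ≤ bd K′
  l≤ = subst (ls π ≤_) (sym bd′) (m≤n+m (ls π) p)
  lp : ls π ≤ bd (pth (ls π))
  lp = subst (ls π ≤_) (sym (pth-bd (ls π))) (m≤m+n (ls π) (ls π))
  fz = frozen wf′ l≤ d≥
  tr = transfer {c} (pth-wf (ls π)) wf′ lp l≤ (to-pth wf′ l≤) (from-pth wf′ l≤ fz) g′ π v ≤-refl refl r gm
  shp = glue-shape wf′ π v l≤
  bdK : bd (glue K′ π) ≡ qs π + p
  bdK = +-cancelʳ-≡ (ls π) _ _ (trans (proj₂ shp) (trans (cong (λ z → qs π + z) bd′) (sym (+-assoc (qs π) p (ls π)))))
  rf = run-facts {p = p} (proj₁ shp) bdK (proj₁ tr)

InY? : ∀ c l q M → Dec (InY c l q M)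
InY? c l q M with Ok? c M | ℕP._≟_ (bd M) (q + l)
... | no n | _ = no (n ∘ proj₁)
... | yes _ | no n = no (n ∘ proj₁ ∘ proj₂)
... | yes ok | yes e with run-exists (edges M) M ≤-refl (proj₁ ok) q (subst (q ≤_) (sym e) (m≤m+n q l))
...   | K′ , π , r with Tm-≟ K′ (pth l)
...     | yes refl = yes (ok , e , π , r)
...     | no n = no (λ where (_ , _ , π′ , r′) → n (proj₁ (run-det r r′)))

InB? : ∀ c p l K → Dec (InB c p l K)
InB? c p l K = Ok? c K ×-dec (ℕP._≟_ (bd K) (p + l) ×-dec dist≥? K (crn K (bd K ∸ l)) (crn K 0) l)


-- Boundary arcs that are geodesics themselves

frzs : ℕ → Prog
frzs zero = nil
frzs (suc q) = frz (frzs q)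

frzs-valid : ∀ q → Valid (frzs q)
frzs-valid zero = tt
frzs-valid (suc q) = frzs-valid q

frzs-ls : ∀ q → ls (frzs q) ≡ q
frzs-ls zero = refl
frzs-ls (suc q) = cong suc (frzs-ls q)

frzs-qs : ∀ q → qs (frzs q) ≡ q
frzs-qs zero = refl
frzs-qs (suc q) = cong suc (frzs-qs q)

frzs-ds : ∀ q → ds (frzs q) ≡ []
frzs-ds zero = refl
frzs-ds (suc q) = frzs-ds q

up-short : ∀ K → WF K → ∀ q → Up K (suc q) → Near K q (crn K 0) (crn K (suc q))
up-short K wf q up = up q (near-crn K wf 1 q)

-- A deletion step means `Up`, and then corner 0 would be as near to the target as corner 1, hence
-- nearer than the length of the run allows.
run-straight : ∀ {K q K′ π p} → WF K → bd K ≡ q + p → Run K q K′ π → ls π ≡ q → π ≡ frzs q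
run-straight wf e stop _ = refl
run-straight {K} {p = p} wf e (freeze {q = q} _ r) el with rot-of K wf (subst (1 ≤_) (sym e) (s≤s z≤n))
... | R = cong frz (run-straight {p = suc p} (RotOf.wf′ R) (trans (RotOf.bd-≡ R) (trans e (sym (+-suc q p)))) r (suc-injective el))
run-straight {K} {suc q} wf e R@(rhang _ up r) el = ⊥-elim (1+n≰n (subst (_≤ q) el (proj₁ (proj₂ (proj₂ (run-facts wf e R))) q (up-short K wf q up))))
run-straight {K} {suc q} wf e R@(rface up r) el = ⊥-elim (1+n≰n (subst (_≤ q) el (proj₁ (proj₂ (proj₂ (run-facts wf e R))) q (up-short K wf q up))))

-- Frozen steps only move the root, so the corners of `G` are those of `K` shifted cyclically by
-- `q`; corner 0 of `G` is the corner `q` steps before the end in `K`.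
record Unrolled (G K : Tm) (q : ℕ) : Set where
  field
    h    : Vert G → Vert K
    near : ∀ {n u v} → Near G n u v → Near K n (h u) (h v)
    hq   : ∀ i → i ≤ q → h (crn G i) ≡ crn K (bd K ∸ (q ∸ i))
    hs   : ∀ s → q + s ≤ bd K → h (crn G (bd G ∸ s)) ≡ crn K (bd K ∸ (q + s))

unroll : ∀ {K} → WF K → ∀ q → q ≤ bd K → Unrolled (glue K (frzs q)) K q
unroll {K} wf zero _ = record { h = id ; near = id ; hq = hq₀ ; hs = λ _ _ → refl }
  where
  hq₀ : ∀ i → i ≤ 0 → crn K i ≡ crn K (bd K ∸ (0 ∸ i))
  hq₀ .0 z≤n = trans (crn-0 K wf) (sym (crn-end K ≤-refl))
unroll {K} wf (suc q) lq = record { h = λ x → h (RotOf.vn R x) ; near = λ nr → near (near-reroot⁻ (RotOf.r R) nr) ; hq = hq′ ; hs = hs′ }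
  where
  G = glue K (frzs q)
  sh : WF G × bd G + ls (frzs q) ≡ qs (frzs q) + bd K
  sh = glue-shape wf (frzs q) (frzs-valid q) (subst (_≤ bd K) (sym (frzs-ls q)) (≤-trans (n≤1+n q) lq))
  bdG : bd G ≡ bd K
  bdG = +-cancelʳ-≡ q _ _ (trans (cong (λ z → bd G + z) (sym (frzs-ls q))) (trans (proj₂ sh) (trans (cong (λ z → z + bd K) (frzs-qs q)) (+-comm q (bd K)))))
  R : RotOf (unrot G) G
  R = unrot-of G (proj₁ sh) (subst (1 ≤_) (sym bdG) (≤-trans (s≤s z≤n) lq))
  open Unrolled (unroll wf q (≤-trans (n≤1+n q) lq))
  bdU : bd (unrot G) ≡ bd K
  bdU = trans (sym (RotOf.bd-≡ R)) bdG
  vc : ∀ k → k < bd K → h (RotOf.vn R (crn (unrot G) (suc k))) ≡ h (crn G k)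
  vc k lk = cong h (trans (cong (RotOf.vn R) (sym (RotOf.crn-vm R k (subst (k <_) (sym bdU) lk)))) (RotOf.vn-vm R (crn G k)))
  hs′ : ∀ s → suc q + s ≤ bd K → h (RotOf.vn R (crn (unrot G) (bd (unrot G) ∸ s))) ≡ crn K (bd K ∸ (suc q + s))
  hs′ s ls = trans (cong (λ z → h (RotOf.vn R (crn (unrot G) z))) (trans (cong (λ z → z ∸ s) bdU) (sym (suc-∸ s<)))) (trans (vc (bd K ∸ suc s) (∸suc-< s<))
      (trans (cong (λ z → h (crn G (z ∸ suc s))) (sym bdG)) (trans (hs (suc s) (subst (_≤ bd K) (sym (+-suc q s)) ls)) (cong (λ z → crn K (bd K ∸ z)) (+-suc q s)))))
    where
    s< : suc s ≤ bd K
    s< = ≤-trans (s≤s (m≤n+m s q)) ls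
  hq′ : ∀ i → i ≤ suc q → h (RotOf.vn R (crn (unrot G) i)) ≡ crn K (bd K ∸ (suc q ∸ i))
  hq′ zero _ = trans (cong (h ∘ RotOf.vn R) (trans (crn-0 (unrot G) (RotOf.wf R)) (sym (crn-end (unrot G) ≤-refl)))) (trans (hs′ 0 (subst (_≤ bd K) (sym (+-identityʳ (suc q))) lq)) (cong (λ z → crn K (bd K ∸ z)) (+-identityʳ (suc q))))
  hq′ (suc i) (s≤s li) = trans (vc i (≤-trans (s≤s li) lq)) (hq i li)

-- At the largest possible distance `q` nothing is deleted and the region degenerates to the
-- geodesic. This is the diagonal entry 1 of the unitriangular system.
straighten : ∀ {c p q} K → InK c p q q K → Σ Tm λ K′ → InB c p q K′ × K ≡ glue K′ (frzs q) × degs K ↭ degs K′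
straighten {c} {p} {q} K inK@((wf , g) , e , d≥ , nr) with run-exists (edges K) K ≤-refl wf q (subst (q ≤_) (sym e) (m≤m+n q p))
... | K′ , π , r with run-valid wf (subst (q ≤_) (sym e) (m≤m+n q p)) r | run-facts {p = p} wf e r
...   | v , _ , refl , wf′ | bd′ , fz , dl , nl with ≤-antisym (d≥ _ nl) (dl _ nr)
...     | eq with run-straight {p = p} wf e r (sym eq)
...       | refl = K′ , ((wf′ , run-good c wf (subst (q ≤_) (sym e) (m≤m+n q p)) r g) , trans bd′ (cong (λ z → p + z) (frzs-ls q)) , subst (λ z → Dist≥ K′ (crn K′ (bd K′ ∸ z)) (crn K′ 0) z) (frzs-ls q) (fz _ ≤-refl)) , refl ,
  ↭-trans (glue-degs wf′ (frzs q) v (subst (ls (frzs q) ≤_) (sym bd′) (m≤n+m _ p))) (↭-reflexive (trans (cong (degs K′ ++_) (frzs-ds q)) (++-identityʳ (degs K′))))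

bend : ∀ {c p q} K′ → InB c p q K′ → InK c p q q (glue K′ (frzs q)) × degs (glue K′ (frzs q)) ↭ degs K′
bend {c} {p} {q} K′ ((wf , g) , e , d≥) = ((proj₁ sh , gg q q≤) , trans bdG (trans e (+-comm p q)) , far , near-crn G (proj₁ sh) 0 q) ,
  ↭-trans (glue-degs wf (frzs q) (frzs-valid q) l≤) (↭-reflexive (trans (cong (degs K′ ++_) (frzs-ds q)) (++-identityʳ (degs K′))))
  where
  G = glue K′ (frzs q)
  q≤ : q ≤ bd K′
  q≤ = subst (q ≤_) (sym e) (m≤n+m q p)
  l≤ : ls (frzs q) ≤ bd K′
  l≤ = subst (_≤ bd K′) (sym (frzs-ls q)) q≤
  sh = glue-shape wf (frzs q) (frzs-valid q) l≤
  bdG : bd G ≡ bd K′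
  bdG = +-cancelʳ-≡ q _ _ (trans (cong (λ z → bd G + z) (sym (frzs-ls q))) (trans (proj₂ sh) (trans (cong (λ z → z + bd K′) (frzs-qs q)) (+-comm q (bd K′)))))
  gg : ∀ q → q ≤ bd K′ → Good c (glue K′ (frzs q))
  gg zero _ = g
  gg (suc q) lq = good-unrot c (glue K′ (frzs q)) (proj₁ sh′) (ℕP.+-cancelʳ-≤ (ls (frzs q)) 1 _ (≤-trans (s≤s (≤-reflexive (frzs-ls q))) (≤-trans lq (≤-trans (m≤n+m (bd K′) (qs (frzs q))) (≤-reflexive (sym (proj₂ sh′))))))) (gg q (≤-trans (n≤1+n q) lq))
    where sh′ = glue-shape wf (frzs q) (frzs-valid q) (subst (_≤ bd K′) (sym (frzs-ls q)) (≤-trans (n≤1+n q) lq))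
  open Unrolled (unroll wf q q≤)
  far : Dist≥ G (crn G 0) (crn G q) q
  far n nr = d≥ n (subst₂ (Near K′ n) (hq 0 z≤n) (trans (hq q ≤-refl) (trans (cong (λ z → crn K′ (bd K′ ∸ z)) (ℕP.n∸n≡0 q)) (trans (crn-end K′ ≤-refl) (sym (crn-0 K′ wf))))) (near nr))

-- Finiteness of the classes of terms

handshake : ∀ t → WF t → bd t + sum (degs t) ≡ 2 * edges t
handshake t wf = trans (trans (cong (λ z → bd t + z) (trans (cong sum (sym (degs-length t wf))) (sym (lc (fcs t))))) (trans (sym (length-++ (bw t))) (PP.↭-length (letters-↭ t)))) (halves-length t)
  where
  lc : ∀ {A : Set} (xss : List (List A)) → length (concat xss) ≡ sum (map length xss)
  lc [] = refl
  lc (xs ∷ xss) = trans (length-++ xs) (cong (λ z → length xs + z) (lc xss))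

-- A finite superset is all that is wanted, so `E` bounds the depth of a term instead of its number
-- of edges.
Bounded : ℕ → ℕ → Tm → Set
Bounded E N pt = ⊤
Bounded zero N (loop t u) = ⊥
Bounded (suc E) N (loop t u) = Bounded E N t × Bounded E N u
Bounded zero N (split i t) = ⊥
Bounded (suc E) N (split i t) = i < N × Bounded E N t

bounded-card : ∀ E N → ∃ λ n → HasCard (Bounded E N) n
bounded-card zero N = 1 , card-1 pt tt only
  where
  only : ∀ {t} → Bounded 0 N t → t ≡ pt
  only {pt} _ = refl
bounded-card (suc E) N with bounded-card E N
... | n , h = _ , card-cong to from
  (card-⊎ {P = λ t → t ≡ pt} (card-1 pt refl id)
    (card-⊎ {P = λ t → Σ Tm λ a → Σ Tm λ b → t ≡ loop a b × Bounded E N a × Bounded E N b}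
            {Q = λ t → Σ ℕ λ i → Σ Tm λ a → t ≡ split i a × i < N × Bounded E N a}
      (card-image (card-× h h) (λ ab _ → loop (proj₁ ab) (proj₂ ab)) (λ where (a , b) (p , q) → a , b , refl , p , q)
        (λ where (a , b) _ (.a , .b) _ refl → refl) (λ where _ (a , b , refl , p , q) → (a , b) , (p , q) , λ _ → refl))
      (card-image (card-× {P = _< N} (upTo N , UP.upTo⁺ N , ∈-upTo⁻ , ∈-upTo⁺ , refl) h) (λ ia _ → split (proj₁ ia) (proj₂ ia)) (λ where (i , a) (p , q) → i , a , refl , p , q)
        (λ where (i , a) _ (.i , .a) _ refl → refl) (λ where _ (i , a , refl , p , q) → (i , a) , (p , q) , λ _ → refl))
      (λ where (_ , _ , refl , _) (_ , _ , () , _)))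
    (λ where refl (inj₁ (_ , _ , () , _)) ; refl (inj₂ (_ , _ , () , _))))
  where
  to : ∀ {t} → t ≡ pt ⊎ ((Σ Tm λ a → Σ Tm λ b → t ≡ loop a b × Bounded E N a × Bounded E N b) ⊎ (Σ ℕ λ i → Σ Tm λ a → t ≡ split i a × i < N × Bounded E N a)) → Bounded (suc E) N t
  to (inj₁ refl) = tt
  to (inj₂ (inj₁ (a , b , refl , p , q))) = p , q
  to (inj₂ (inj₂ (i , a , refl , p , q))) = p , q
  from : ∀ {t} → Bounded (suc E) N t → t ≡ pt ⊎ ((Σ Tm λ a → Σ Tm λ b → t ≡ loop a b × Bounded E N a × Bounded E N b) ⊎ (Σ ℕ λ i → Σ Tm λ a → t ≡ split i a × i < N × Bounded E N a))
  from {pt} _ = inj₁ refl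
  from {loop a b} (p , q) = inj₂ (inj₁ (a , b , refl , p , q))
  from {split i a} (p , q) = inj₂ (inj₂ (i , a , refl , p , q))

bounded : ∀ E N t → edges t ≤ E → sum (degs t) ≤ N → Bounded E N t
bounded E N pt _ _ = tt
bounded (suc E) N (loop t u) (s≤s le) ls = bounded E N t (≤-trans (m≤m+n _ _) le) (≤-trans (m≤m+n _ _) ls′) , bounded E N u (≤-trans (m≤n+m _ _) le) (≤-trans (m≤n+m _ _) ls′)
  where
  sum-++ : ∀ xs ys → sum (xs ++ ys) ≡ sum xs + sum ys
  sum-++ [] ys = refl
  sum-++ (x ∷ xs) ys = trans (cong (λ z → x + z) (sum-++ xs ys)) (sym (+-assoc x (sum xs) (sum ys)))
  ls′ : sum (degs t) + sum (degs u) ≤ N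
  ls′ = ≤-trans (≤-reflexive (sym (sum-++ (degs t) (degs u)))) ls
bounded (suc E) N (split i t) (s≤s le) ls = ≤-trans (m≤m+n (suc i) _) ls , bounded E N t le (≤-trans (m≤n+m _ (suc i)) ls)

-- Weights and generating functions of classes

_⊞_ : {k : ℕ} → Vec ℕ k → Vec ℕ k → Vec ℕ k
m ⊞ m′ = Vec.zipWith _+_ m m′

lookup-ext : {A : Set} {k : ℕ} {m m′ : Vec A k} → (∀ r → lookup m r ≡ lookup m′ r) → m ≡ m′
lookup-ext {m = []} {[]} e = refl
lookup-ext {m = x ∷ m} {y ∷ m′} e = cong₂ _∷_ (e zero) (lookup-ext (λ r → e (suc r)))

⊞-lookup : {k : ℕ} (m m′ : Vec ℕ k) (r : Fin k) → lookup (m ⊞ m′) r ≡ lookup m r + lookup m′ r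
⊞-lookup m m′ r = VecP.lookup-zipWith _+_ r m m′

count-++ : {A : Set} (p : A → Bool) (xs : List A) {ys : List A} → count p (xs ++ ys) ≡ count p xs + count p ys
count-++ p [] = refl
count-++ p (x ∷ xs) with p x
... | true = cong suc (count-++ p xs)
... | false = count-++ p xs

count-↭ : {A : Set} (p : A → Bool) {xs ys : List A} → xs ↭ ys → count p xs ≡ count p ys
count-↭ p _↭_.refl = refl
count-↭ p (prep x e) with p x
... | true = cong suc (count-↭ p e)
... | false = count-↭ p e
count-↭ p (swap x y e) with p x | p y
... | true | true = cong (λ z → suc (suc z)) (count-↭ p e)
... | true | false = cong suc (count-↭ p e)
... | false | true = cong suc (count-↭ p e)
... | false | false = count-↭ p e
count-↭ p (_↭_.trans e e′) = trans (count-↭ p e) (count-↭ p e′)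

dg : ℕ → ℕ → ℕ
dg b r = 2 * (b + r)

dg-inj : ∀ b {k} {r s : Fin k} → dg b (toℕ r) ≡ dg b (toℕ s) → r ≡ s
dg-inj b {r = r} {s} e = FinP.toℕ-injective (+-cancelˡ-≡ b _ _ (ℕP.*-cancelˡ-≡ _ _ 2 e))

isDg : {k : ℕ} → ℕ → Fin k → ℕ → Bool
isDg b r d = d ≡ᵇ dg b (toℕ r)

-- Wt b m ds: the list ds consists of m_r copies of 2(b + r), for r < k.
record Wt {k : ℕ} (b : ℕ) (m : Vec ℕ k) (ds : List ℕ) : Set where
  constructor mkWt
  field
    allowed : All (λ d → Σ (Fin k) λ r → d ≡ dg b (toℕ r)) ds
    counts  : ∀ r → lookup m r ≡ count (isDg b r) ds

wtOf : (k : ℕ) → ℕ → List ℕ → Vec ℕ k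
wtOf k b ds = Vec.tabulate (λ r → count (isDg b r) ds)

wt-unique : ∀ {k b} {m m′ : Vec ℕ k} {ds} → Wt b m ds → Wt b m′ ds → m ≡ m′
wt-unique (mkWt _ e) (mkWt _ e′) = lookup-ext (λ r → trans (e r) (sym (e′ r)))

wt-↭ : ∀ {k b} {m : Vec ℕ k} {ds ds′} → ds ↭ ds′ → Wt b m ds → Wt b m ds′
wt-↭ {b = b} p (mkWt a e) = mkWt (PP.All-resp-↭ p a) λ r → trans (e r) (count-↭ (isDg b r) p)

wt-++ : ∀ {k b} {m m′ : Vec ℕ k} {ds ds′} → Wt b m ds → Wt b m′ ds′ → Wt b (m ⊞ m′) (ds ++ ds′)
wt-++ {b = b} {m} {m′} {ds} (mkWt a e) (mkWt a′ e′) = mkWt (AllP.++⁺ a a′) λ r → trans (⊞-lookup m m′ r) (trans (cong₂ _+_ (e r) (e′ r)) (sym (count-++ (isDg b r) ds)))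

wt-self : ∀ {k b} {m : Vec ℕ k} ds {ds′} → Wt b m (ds ++ ds′) → Wt b (wtOf k b ds) ds
wt-self {k} {b} ds (mkWt a _) = mkWt (AllP.++⁻ˡ ds a) λ r → VecP.lookup∘tabulate (λ r → count (isDg b r) ds) r

wt-++⁻ : ∀ {k b} {m : Vec ℕ k} ds {ds′} → Wt b m (ds ++ ds′) → Σ (Vec ℕ k) λ e → Σ (Vec ℕ k) λ e′ → Wt b e ds × Wt b e′ ds′ × e ⊞ e′ ≡ m
wt-++⁻ {k} {b} {m} ds {ds′} w@(mkWt a e) = wtOf k b ds , wtOf k b ds′ , w₁ , w₂ , wt-unique (wt-++ w₁ w₂) w
  where
  w₁ = wt-self ds w
  w₂ : Wt b (wtOf k b ds′) ds′
  w₂ = mkWt (AllP.++⁻ʳ ds a) λ r → VecP.lookup∘tabulate (λ r → count (isDg b r) ds′) r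

wt? : ∀ {k} b (m : Vec ℕ k) ds → Dec (Wt b m ds)
wt? b m ds = map′ (λ where (a , e) → mkWt a e) (λ where (mkWt a e) → a , e) (All.all? (λ d → FinP.any? (λ r → ℕP._≟_ d (dg b (toℕ r)))) ds ×-dec FinP.all? (λ r → ℕP._≟_ (lookup m r) (count (isDg b r) ds)))

≡ᵇ-true : ∀ {m n} → m ≡ n → (m ≡ᵇ n) ≡ true
≡ᵇ-true {zero} refl = refl
≡ᵇ-true {suc m} refl = ≡ᵇ-true {m} refl

≡ᵇ-sound : ∀ {m n} → (m ≡ᵇ n) ≡ true → m ≡ n
≡ᵇ-sound {zero} {zero} _ = refl
≡ᵇ-sound {suc m} {suc n} e = cong suc (≡ᵇ-sound {m} {n} e)

bool-ext : {x y : Bool} → (x ≡ true → y ≡ true) → (y ≡ true → x ≡ true) → x ≡ y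
bool-ext {true} {true} f g = refl
bool-ext {true} {false} f g = sym (f refl)
bool-ext {false} {true} f g = g refl
bool-ext {false} {false} f g = refl

unit : {k : ℕ} → Fin k → Vec ℕ k
unit r = Vec.tabulate (λ s → if r == s then 1 else 0)

wt-unit : ∀ {k} b (r : Fin k) → Wt b (unit r) (dg b (toℕ r) ∷ [])
wt-unit b r = mkWt ((r , refl) ∷ []) λ s → trans (VecP.lookup∘tabulate (λ s → if r == s then 1 else 0) s) (cong (λ z → if z then 1 else 0)
  (bool-ext (λ e → ≡ᵇ-true (cong (dg b) (≡ᵇ-sound e))) (λ e → ≡ᵇ-true (cong toℕ (dg-inj b {r = r} {s} (≡ᵇ-sound e))))))

wt-[]⁻ : ∀ {k b} {m : Vec ℕ k} → Wt b m [] → m ≡ Vec.replicate k 0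
wt-[]⁻ {k} (mkWt _ e) = lookup-ext (λ r → trans (e r) (sym (VecP.lookup-replicate r 0)))

wt-[] : ∀ {k b} → Wt b (Vec.replicate k 0) []
wt-[] = mkWt [] λ r → VecP.lookup-replicate r 0

sumFin : (k : ℕ) → (Fin k → ℕ) → ℕ
sumFin k f = foldr _+_ 0 (map f (allFin k))

foldr-add : {A : Set} (f g : A → ℕ) (xs : List A) → foldr _+_ 0 (map (λ r → f r + g r) xs) ≡ foldr _+_ 0 (map f xs) + foldr _+_ 0 (map g xs)
foldr-add f g [] = refl
foldr-add f g (x ∷ xs) = trans (cong (λ z → f x + g x + z) (foldr-add f g xs)) (+-interchange (f x) (g x) _ _)

foldr-delta : {A : Set} (h : A → ℕ) (x : A) (xs : List A) → Unique xs → x ∈ xs → (∀ y → y ≢ x → h y ≡ 0) → foldr _+_ 0 (map h xs) ≡ h x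
foldr-delta h x (y ∷ xs) (n ∷ u) (here refl) z = trans (cong (λ w → h y + w) (zeros xs n)) (+-identityʳ (h y))
  where
  zeros : ∀ xs → All (y ≢_) xs → foldr _+_ 0 (map h xs) ≡ 0
  zeros [] [] = refl
  zeros (w ∷ xs) (ne ∷ a) = cong₂ _+_ (z w (λ e → ne (sym e))) (zeros xs a)
foldr-delta h x (y ∷ xs) (n ∷ u) (there m) z = cong₂ _+_ (z y (λ e → All.lookup n m e)) (foldr-delta h x xs u m z)

wt-sum : ∀ {k b} (m : Vec ℕ k) ds → Wt b m ds → sum ds ≡ 2 * sumFin k (λ r → (b + toℕ r) * lookup m r)
wt-sum {k} {b} m ds (mkWt a e) = trans (go ds a) (cong (λ z → 2 * z) (cong (foldr _+_ 0) (map-cong (λ r → cong (λ z → (b + toℕ r) * z) (sym (e r))) (allFin k))))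
  where
  go : ∀ ds → All (λ d → Σ (Fin k) λ r → d ≡ dg b (toℕ r)) ds → sum ds ≡ 2 * sumFin k (λ r → (b + toℕ r) * count (isDg b r) ds)
  go [] [] = sym (trans (cong (λ z → 2 * z) (zs (allFin k))) refl)
    where
    zs : ∀ xs → foldr _+_ 0 (map (λ r → (b + toℕ r) * 0) xs) ≡ 0
    zs [] = refl
    zs (x ∷ xs) = cong₂ _+_ (ℕP.*-zeroʳ (b + toℕ x)) (zs xs)
  go (d ∷ ds) ((r , refl) ∷ a) = trans (cong₂ _+_ (sym (cong (λ z → 2 * z) del)) (go ds a))
    (trans (sym (ℕP.*-distribˡ-+ 2 (sumFin k h) _)) (cong (λ z → 2 * z) (trans (sym (foldr-add h _ (allFin k))) (cong (foldr _+_ 0) (map-cong step (allFin k))))))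
    where
    h : Fin k → ℕ
    h s = (b + toℕ s) * (if isDg b s d then 1 else 0)
    del : sumFin k h ≡ b + toℕ r
    del = trans (foldr-delta h r (allFin k) (UP.allFin⁺ k) (∈-allFin r) zero′) (trans (cong (λ z → (b + toℕ r) * (if z then 1 else 0)) (≡ᵇ-true {d} refl)) (ℕP.*-identityʳ (b + toℕ r)))
      where
      zero′ : ∀ s → s ≢ r → h s ≡ 0
      zero′ s ne with isDg b s d in eq
      ... | true = ⊥-elim (ne (sym (dg-inj b {r = r} {s} (≡ᵇ-sound eq))))
      ... | false = ℕP.*-zeroʳ (b + toℕ s)
    step : ∀ s → h s + (b + toℕ s) * count (isDg b s) ds ≡ (b + toℕ s) * count (isDg b s) (d ∷ ds)
    step s with isDg b s d
    ... | true = sym (ℕP.*-distribˡ-+ (b + toℕ s) 1 _)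
    ... | false = cong (λ z → z + (b + toℕ s) * count (isDg b s) ds) (ℕP.*-zeroʳ (b + toℕ s))

unique-concatMap : {A B : Set} (f : A → List B) (xs : List A) → Unique xs → (∀ x → Unique (f x)) → (∀ {x y z} → z ∈ f x → z ∈ f y → x ≡ y) → Unique (concatMap f xs)
unique-concatMap f [] u uf d = []
unique-concatMap f (x ∷ xs) (n ∷ u) uf d = UP.++⁺ (uf x) (unique-concatMap f xs u uf d) λ where
  (m , m′) → case ∈-concat⁻′ (map f xs) m′ of λ where
    (_ , m₁ , m₂) → case ∈-map⁻ f m₂ of λ where (y , y∈ , refl) → All.lookup n y∈ (d m m₁)

∈-concatMap : {A B : Set} (f : A → List B) {xs : List A} {x : A} {z : B} → x ∈ xs → z ∈ f x → z ∈ concatMap f xs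
∈-concatMap f x∈ z∈ = ∈-concat⁺′ z∈ (∈-map⁺ f x∈)

∈-concatMap⁻ : {A B : Set} (f : A → List B) (xs : List A) {z : B} → z ∈ concatMap f xs → Σ A λ x → x ∈ xs × z ∈ f x
∈-concatMap⁻ f xs m with ∈-concat⁻′ (map f xs) m
... | _ , m₁ , m₂ with ∈-map⁻ f m₂
...   | x , x∈ , refl = x , x∈ , m₁

below-unique : {k : ℕ} (m : Vec ℕ k) → Unique (below m)
below-unique [] = [] ∷ []
below-unique (x ∷ m) = unique-concatMap _ (upTo (suc x)) (UP.upTo⁺ (suc x)) (λ a → UP.map⁺ (λ where refl → refl) (below-unique m))
  (λ p q → case ∈-map⁻ _ p , ∈-map⁻ _ q of λ where ((_ , _ , refl) , (_ , _ , refl)) → refl)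

below-∸ : {k : ℕ} (m : Vec ℕ k) {e : Vec ℕ k} → e ∈ below m → e ⊞ Vec.zipWith _∸_ m e ≡ m
below-∸ [] {[]} _ = refl
below-∸ (x ∷ m) {e} e∈ with ∈-concatMap⁻ (λ a → map (a ∷_) (below m)) (upTo (suc x)) e∈
... | a , a∈ , m₁ with ∈-map⁻ (a ∷_) m₁
...   | e′ , e′∈ , refl = cong₂ _∷_ (m+[n∸m]≡n (≤-pred (∈-upTo⁻ a∈))) (below-∸ m e′∈)

∈-below : {k : ℕ} (e e′ : Vec ℕ k) → e ∈ below (e ⊞ e′)
∈-below [] [] = here refl
∈-below (a ∷ e) (a′ ∷ e′) = ∈-concatMap (λ z → map (z ∷_) (below (e ⊞ e′))) {upTo (suc (a + a′))} (∈-upTo⁺ (s≤s (m≤m+n a a′))) (∈-map⁺ (a ∷_) (∈-below e e′))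

⊞-∸ : {k : ℕ} (e e′ : Vec ℕ k) → Vec.zipWith _∸_ (e ⊞ e′) e ≡ e′
⊞-∸ [] [] = refl
⊞-∸ (a ∷ e) (a′ ∷ e′) = cong₂ _∷_ (m+n∸m≡n a a′) (⊞-∸ e e′)

-- `P m` is the class of objects of weight `m`, and `S` is its generating function.
SerOf : {k : ℕ} {X : Set} → (Vec ℕ k → X → Set) → Ser k → Set
SerOf P S = ∀ m → Σ ℕ λ c → HasCard (P m) c × S m ≡ + c

serof-≡ : {k : ℕ} {X Y : Set} {P : Vec ℕ k → X → Set} {Q : Vec ℕ k → Y → Set} {A B : Ser k} → SerOf P A → SerOf Q B →
  (f : ∀ {m} x → P m x → Y) → (∀ {m} x (p : P m x) → Q m (f x p)) → (∀ {m} x (p : P m x) x′ (p′ : P m x′) → f x p ≡ f x′ p′ → x ≡ x′) →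
  (g : ∀ {m} y → Q m y → X) → (∀ {m} y (q : Q m y) → P m (g y q)) → (∀ {m} y (q : Q m y) y′ (q′ : Q m y′) → g y q ≡ g y′ q′ → y ≡ y′) →
  ∀ m → A m ≡ B m
serof-≡ a b f fq fi g gp gi m with a m | b m
... | c , h , e | c′ , h′ , e′ = trans e (trans (cong +_ (card-≡ h h′ f fq fi g gp gi)) (sym e′))

Conv : {k : ℕ} {X Y : Set} → (Vec ℕ k → X → Set) → (Vec ℕ k → Y → Set) → Vec ℕ k → X × Y → Set
Conv {k} P Q m (x , y) = Σ (Vec ℕ k) λ e → Σ (Vec ℕ k) λ e′ → P e x × Q e′ y × e ⊞ e′ ≡ m

sum-sumℤ : {A : Set} (c : A → ℕ) (F : A → ℤ) (xs : List A) → (∀ x → F x ≡ + c x) → sumℤ (map F xs) ≡ + sum (map c xs)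
sum-sumℤ c F [] e = refl
sum-sumℤ c F (x ∷ xs) e = cong₂ _+ℤ_ (e x) (sum-sumℤ c F xs e)

-- By `uq` an object determines its weight; hence the sum over splittings of the monomial counts
-- each pair once.
serof-⊛ : {k : ℕ} {X Y : Set} {P : Vec ℕ k → X → Set} {Q : Vec ℕ k → Y → Set} {A B : Ser k} → (∀ {m m′ x} → P m x → P m′ x → m ≡ m′) →
  SerOf P A → SerOf Q B → SerOf (Conv P Q) (A ⊛ B)
serof-⊛ {k} {X} {Y} {P} {Q} {A} {B} uq a b m = sum (map cnt (below m)) ,
  card-image (card-Σ {P = λ e xy → P e (proj₁ xy) × Q (Vec.zipWith _∸_ m e) (proj₂ xy)} (below m) (below-unique m) (λ e → card-× (proj₁ (proj₂ (a e))) (proj₁ (proj₂ (b (Vec.zipWith _∸_ m e))))))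
    (λ exy _ → proj₂ exy) (λ where (e , x , y) (e∈ , p , q) → e , Vec.zipWith _∸_ m e , p , q , below-∸ m e∈)
    (λ where (e , x , y) (_ , p , _) (e′ , .x , .y) (_ , p′ , _) refl → cong (_, x , y) (uq p p′))
    (λ where (x , y) (e , e′ , p , q , refl) → (e , x , y) , (∈-below e e′ , p , subst (λ z → Q z y) (sym (⊞-∸ e e′)) q) , λ _ → refl) ,
  sum-sumℤ cnt (λ e → A e *ℤ B (Vec.zipWith _∸_ m e)) (below m) (λ e → trans (cong₂ _*ℤ_ (proj₂ (proj₂ (a e))) (proj₂ (proj₂ (b (Vec.zipWith _∸_ m e))))) (sym (ℤP.pos-* (proj₁ (a e)) _)))
  where
  cnt : Vec ℕ k → ℕ
  cnt e = proj₁ (a e) * proj₁ (b (Vec.zipWith _∸_ m e))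

Either : {k : ℕ} {X Y : Set} → (Vec ℕ k → X → Set) → (Vec ℕ k → Y → Set) → Vec ℕ k → X ⊎ Y → Set
Either P Q m (inj₁ x) = P m x
Either P Q m (inj₂ y) = Q m y

serof-⊕ : {k : ℕ} {X Y : Set} {P : Vec ℕ k → X → Set} {Q : Vec ℕ k → Y → Set} {A B : Ser k} → SerOf P A → SerOf Q B → SerOf (Either P Q) (A ⊕ B)
serof-⊕ {P = P} {Q} a b m with a m | b m
... | c , h , e | c′ , h′ , e′ = c + c′ ,
  card-cong (λ {x} → to {x}) (λ {x} → from {x}) (card-⊎ {P = λ z → Σ _ λ x → z ≡ inj₁ x × P m x} {Q = λ z → Σ _ λ y → z ≡ inj₂ y × Q m y}
    (card-image h (λ x _ → inj₁ x) (λ x p → x , refl , p) (λ where _ _ _ _ refl → refl) (λ where _ (x , refl , p) → x , p , λ _ → refl))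
    (card-image h′ (λ x _ → inj₂ x) (λ x p → x , refl , p) (λ where _ _ _ _ refl → refl) (λ where _ (x , refl , p) → x , p , λ _ → refl))
    (λ where (_ , refl , _) (_ , () , _))) ,
  cong₂ _+ℤ_ e e′
  where
  to : ∀ {z} → (Σ _ λ x → z ≡ inj₁ x × P m x) ⊎ (Σ _ λ y → z ≡ inj₂ y × Q m y) → Either P Q m z
  to (inj₁ (_ , refl , p)) = p
  to (inj₂ (_ , refl , p)) = p
  from : ∀ {z} → Either P Q m z → (Σ _ λ x → z ≡ inj₁ x × P m x) ⊎ (Σ _ λ y → z ≡ inj₂ y × Q m y)
  from {inj₁ x} p = inj₁ (x , refl , p)
  from {inj₂ y} p = inj₂ (y , refl , p)

ΣS-at : {k : ℕ} {I : Set} (S : I → Ser k) (is : List I) (m : Vec ℕ k) → ΣS (map S is) m ≡ sumℤ (map (λ i → S i m) is)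
ΣS-at S [] m = refl
ΣS-at S (i ∷ is) m = cong (λ z → S i m +ℤ z) (ΣS-at S is m)

serof-Σ : {k : ℕ} {I X : Set} {P : I → Vec ℕ k → X → Set} {S : I → Ser k} (is : List I) → Unique is → (∀ i → SerOf (P i) (S i)) →
  SerOf (λ m ix → proj₁ ix ∈ is × P (proj₁ ix) m (proj₂ ix)) (ΣS (map S is))
serof-Σ {P = P} {S} is u h m = _ , card-Σ {P = λ i → P i m} {c = λ i → proj₁ (h i m)} is u (λ i → proj₁ (proj₂ (h i m))) ,
  trans (ΣS-at S is m) (sum-sumℤ (λ i → proj₁ (h i m)) (λ i → S i m) is (λ i → proj₂ (proj₂ (h i m))))

sameMono-≡ : {k : ℕ} (m m′ : Vec ℕ k) → sameMono m m′ ≡ true → m ≡ m′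
sameMono-≡ [] [] _ = refl
sameMono-≡ (x ∷ m) (y ∷ m′) e with x ≡ᵇ y in eq
... | true = cong₂ _∷_ (≡ᵇ-sound eq) (sameMono-≡ m m′ e)

sameMono-refl : {k : ℕ} (m : Vec ℕ k) → sameMono m m ≡ true
sameMono-refl [] = refl
sameMono-refl (x ∷ m) rewrite ≡ᵇ-true {x} refl = sameMono-refl m

serof-var : {k : ℕ} (r : Fin k) → SerOf {X = ⊤} (λ m _ → m ≡ unit r) (varS r)
serof-var r m with sameMono m (unit r) in eq
... | true = 1 , card-1 tt (sameMono-≡ m (unit r) eq) (λ _ → refl) , refl
... | false = 0 , card-⊥ (λ where refl → case trans (sym eq) (sameMono-refl (unit r)) of λ ()) , refl

-- Boundary length and weight fix the number of sides by `handshake`, which bounds both edges and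
-- indices.
finite-class : ∀ {k} b n (m : Vec ℕ k) → ∃ λ c → HasCard (λ t → WF t × bd t ≡ n × Wt b m (degs t)) c
finite-class {k} b n m with bounded-card (n + S) S
  where
  S = 2 * sumFin k (λ r → (b + toℕ r) * lookup m r)
... | _ , h with card-filter h (λ t → WF? t ×-dec (ℕP._≟_ (bd t) n ×-dec wt? b m (degs t)))
...   | c , h′ = c , card-cong proj₂ (λ {t} → λ where p@(wf , e , w) → bounded _ _ t (le t wf e w) (≤-reflexive (wt-sum m (degs t) w)) , p) h′
  where
  le : ∀ t → WF t → bd t ≡ n → Wt b m (degs t) → edges t ≤ n + 2 * sumFin k (λ r → (b + toℕ r) * lookup m r)
  le t wf e w = ≤-trans (m≤m+n (edges t) (edges t + 0)) (≤-reflexive (trans (sym (handshake t wf)) (cong₂ _+_ e (wt-sum m (degs t) w))))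

InClass : {k : ℕ} → ℕ → (Tm → Set) → Vec ℕ k → Tm → Set
InClass b P m t = P t × Wt b m (degs t)

class-uniq : ∀ {k b P} {m m′ : Vec ℕ k} {t} → InClass b P m t → InClass b P m′ t → m ≡ m′
class-uniq (_ , w) (_ , w′) = wt-unique w w′

classSer : ∀ {k} b n (P : Tm → Set) → (∀ t → Dec (P t)) → Ser k
classSer b n P P? m = + proj₁ (card-filter (proj₂ (finite-class b n m)) P?)

serof-class : ∀ {k} b n (P : Tm → Set) (P? : ∀ t → Dec (P t)) → (∀ {t} → P t → WF t × bd t ≡ n) → SerOf {k} (InClass b P) (classSer b n P P?)
serof-class b n P P? h m = _ , card-cong (λ where ((_ , _ , w) , p) → p , w) (λ where (p , w) → (proj₁ (h p) , proj₂ (h p) , w) , p) (proj₂ (card-filter (proj₂ (finite-class b n m)) P?)) , refl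

-- A bijection presented as a relation that is total and injective from both sides; the two
-- directions need not be shown inverse to each other.
serof-rel : {k : ℕ} {X Y : Set} {P : Vec ℕ k → X → Set} {Q : Vec ℕ k → Y → Set} {A B : Ser k} → SerOf P A → SerOf Q B → (R : X → Y → Set) →
  (∀ {m} x → P m x → Σ Y λ y → Q m y × R x y) → (∀ {m} y → Q m y → Σ X λ x → P m x × R x y) →
  (∀ {x x′ y} → R x y → R x′ y → x ≡ x′) → (∀ {x y y′} → R x y → R x y′ → y ≡ y′) → ∀ m → A m ≡ B m
serof-rel {P = P} {Q} a b R f g l r = serof-≡ {P = P} {Q} a b
  (λ x p → proj₁ (f x p)) (λ x p → proj₁ (proj₂ (f x p))) (λ x p x′ p′ e → l (proj₂ (proj₂ (f x p))) (subst (R x′) (sym e) (proj₂ (proj₂ (f x′ p′)))))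
  (λ y q → proj₁ (g y q)) (λ y q → proj₁ (proj₂ (g y q))) (λ y q y′ q′ e → r (proj₂ (proj₂ (g y q))) (subst (λ z → R z y′) (sym e) (proj₂ (proj₂ (g y′ q′)))))

-- Geodesic decomposition and root-edge recursion for the series

PA : ℕ → ℕ → Tm → Set
PA c n t = Ok c t × bd t ≡ n

PD : ℕ → ℕ → ℕ → ℕ → Tm → Set
PD c p q L t = Ok c t × bd t ≡ q + p × Dist≥ t (crn t 0) (crn t q) L

data IsSplit : Tm → Set where
  isSplit : ∀ {i t} → IsSplit (split i t)

PS : ℕ → ℕ → Tm → Set
PS c n t = Ok c t × bd t ≡ n × IsSplit t

IsSplit? : ∀ t → Dec (IsSplit t)
IsSplit? pt = no λ ()
IsSplit? (loop _ _) = no λ ()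
IsSplit? (split _ _) = yes isSplit

-- Generating functions: A of maps with boundary n; B of maps whose last l boundary edges form a geodesic; Y of the
-- regions between q boundary edges and a leftmost geodesic of length l; D of maps with dist(corner 0, corner q) ≥ L.
opaque
  serA : ∀ {k} → ℕ → ℕ → ℕ → Ser k
  serA b c n = classSer b n (PA c n) (λ t → Ok? c t ×-dec ℕP._≟_ (bd t) n)

  serB : ∀ {k} → ℕ → ℕ → ℕ → ℕ → Ser k
  serB b c p l = classSer b (p + l) (InB c p l) (InB? c p l)

  serY : ∀ {k} → ℕ → ℕ → ℕ → ℕ → Ser k
  serY b c l q = classSer b (q + l) (InY c l q) (InY? c l q)

  serD : ∀ {k} → ℕ → ℕ → ℕ → ℕ → ℕ → Ser k
  serD b c p q L = classSer b (q + p) (PD c p q L) (λ t → Ok? c t ×-dec (ℕP._≟_ (bd t) (q + p) ×-dec dist≥? t (crn t 0) (crn t q) L))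

  serE : ∀ {k} → ℕ → ℕ → ℕ → Ser k
  serE b c n = classSer b n (PS c n) (λ t → Ok? c t ×-dec (ℕP._≟_ (bd t) n ×-dec IsSplit? t))

  isA : ∀ {k} b c n → SerOf {k} (InClass b (PA c n)) (serA b c n)
  isA b c n = serof-class b n (PA c n) _ (λ where ((w , _) , e) → w , e)

  isB : ∀ {k} b c p l → SerOf {k} (InClass b (InB c p l)) (serB b c p l)
  isB b c p l = serof-class b (p + l) (InB c p l) _ (λ where ((w , _) , e , _) → w , e)

  isY : ∀ {k} b c l q → SerOf {k} (InClass b (InY c l q)) (serY b c l q)
  isY b c l q = serof-class b (q + l) (InY c l q) _ (λ where ((w , _) , e , _) → w , e)

  isD : ∀ {k} b c p q L → SerOf {k} (InClass b (PD c p q L)) (serD b c p q L)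
  isD b c p q L = serof-class b (q + p) (PD c p q L) _ (λ where ((w , _) , e , _) → w , e)

  isE : ∀ {k} b c n → SerOf {k} (InClass b (PS c n)) (serE b c n)
  isE b c n = serof-class b n (PS c n) _ (λ where ((w , _) , e , _) → w , e)

dist-case : ∀ t u v L → Dist≥ t u v L ⊎ (Σ ℕ λ l → l < L × Dist≥ t u v l × Near t l u v)
dist-case t u v zero = inj₁ (λ _ _ → z≤n)
dist-case t u v (suc L) with dist-case t u v L
... | inj₂ (l , lt , r) = inj₂ (l , ≤-trans lt (n≤1+n L) , r)
... | inj₁ d with near? t L u v
...   | yes nr = inj₂ (L , ≤-refl , d , nr)
...   | no nn = inj₁ (λ n nr → ≰⇒> (λ le → nn (near-mono t le nr)))

-- Maps with the two corners at distance `l` below `L` are cut along the geodesic, and the others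
-- are counted by `serD`. Taking `L` equal to `q` gives the unitriangular system, taking `L = suc c`
-- the rule for removing an inner face.
geodesic-split : ∀ {k} b c p q L (m : Vec ℕ k) → serA b c (q + p) m ≡ (ΣS (map (λ l → serB b c p l ⊛ serY b c l q) (upTo L)) ⊕ serD b c p q L) m
geodesic-split {k} b c p q L = serof-rel {P = InClass b (PA c (q + p))} (isA b c (q + p))
  (serof-⊕ (serof-Σ {P = λ l → Conv (InClass b (InB c p l)) (InClass b (InY c l q))} (upTo L) (UP.upTo⁺ L) (λ l → serof-⊛ (class-uniq {P = InB c p l}) (isB b c p l) (isY b c l q))) (isD b c p q L))
  R f g left right
  where
  R : Tm → (ℕ × (Tm × Tm)) ⊎ Tm → Set
  R t (inj₁ (l , K′ , M)) = l < L × Dist≥ t (crn t 0) (crn t q) l × Near t l (crn t 0) (crn t q) × (Σ Prog λ π → Run t q K′ π × Run M q (pth l) π × t ≡ glue K′ π × M ≡ glue (pth l) π)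
  R t (inj₂ t′) = t ≡ t′ × Dist≥ t (crn t 0) (crn t q) L
  f : ∀ {m} t → InClass b (PA c (q + p)) m t → Σ _ λ y → Either _ _ m y × R t y
  f t ((ok , e) , w) with dist-case t (crn t 0) (crn t q) L
  ... | inj₁ d = inj₂ t , ((ok , e , d) , w) , refl , d
  ... | inj₂ (l , lt , d , nr) with decompose {c} {p} {q} {l} t (ok , e , d , nr)
  ...   | K′ , π , inB , inY , r , r′ , eq , pm with wt-++⁻ (degs K′) (wt-↭ pm w)
  ...     | e₁ , e₂ , w₁ , w₂ , es = inj₁ (l , K′ , glue (pth l) π) , (∈-upTo⁺ lt , e₁ , e₂ , (inB , w₁) , (inY , w₂) , es) , lt , d , nr , π , r , r′ , eq , refl
  g : ∀ {m} y → Either _ _ m y → Σ Tm λ t → InClass b (PA c (q + p)) m t × R t y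
  g (inj₁ (l , K′ , M)) (l∈ , e₁ , e₂ , (inB , w₁) , (inY , w₂) , refl) with recompose {c} {p} {q} {l} K′ M inB inY
  ... | π , (ok , e , d , nr) , r , r′ , eq , pm = glue K′ π , ((ok , e) , wt-↭ (↭-sym pm) (wt-++ w₁ w₂)) , ∈-upTo⁻ l∈ , d , nr , π , r , r′ , refl , eq
  g (inj₂ t) ((ok , e , d) , w) = t , ((ok , e) , w) , refl , d
  left : ∀ {t t′ y} → R t y → R t′ y → t ≡ t′
  left {y = inj₁ (l , K′ , M)} (_ , _ , _ , π , _ , r , e , _) (_ , _ , _ , π′ , _ , r′ , e′ , _) with run-det r r′
  ... | _ , refl = trans e (sym e′)
  left {y = inj₂ _} (refl , _) (refl , _) = refl
  right : ∀ {t y y′} → R t y → R t y′ → y ≡ y′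
  right {y = inj₁ (l , K′ , M)} {inj₁ (l′ , K″ , M′)} (_ , d , nr , π , r , _ , _ , e) (_ , d′ , nr′ , π′ , r′ , _ , _ , e′) with ≤-antisym (d _ nr′) (d′ _ nr) | run-det r r′
  ... | refl | refl , refl = cong (λ z → inj₁ (l , K′ , z)) (trans e (sym e′))
  right {y = inj₁ _} {inj₂ _} (lt , _ , nr , _) (_ , d) = ⊥-elim (1+n≰n (≤-trans lt (d _ nr)))
  right {y = inj₂ _} {inj₁ _} (_ , d) (lt , _ , nr , _) = ⊥-elim (1+n≰n (≤-trans lt (d _ nr)))
  right {y = inj₂ _} {inj₂ _} (refl , _) (refl , _) = refl

glue-frzs-inj : ∀ q {K K′} → WF K → WF K′ → q ≤ bd K → q ≤ bd K′ → glue K (frzs q) ≡ glue K′ (frzs q) → K ≡ K′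
glue-frzs-inj zero _ _ _ _ e = e
glue-frzs-inj (suc q) {K} {K′} w w′ l l′ e = glue-frzs-inj q w w′ (≤-trans (n≤1+n q) l) (≤-trans (n≤1+n q) l′)
  (trans (sym (rt w l)) (trans (cong rot e) (rt w′ l′)))
  where
  rt : ∀ {K} → WF K → suc q ≤ bd K → rot (unrot (glue K (frzs q))) ≡ glue K (frzs q)
  rt {K} w l = rot-unrot (glue K (frzs q)) (proj₁ sh) (ℕP.+-cancelʳ-≤ (ls (frzs q)) 1 _ (≤-trans (s≤s (≤-reflexive (frzs-ls q))) (≤-trans l (≤-trans (m≤n+m (bd K) (qs (frzs q))) (≤-reflexive (sym (proj₂ sh)))))))
    where sh = glue-shape w (frzs q) (frzs-valid q) (subst (_≤ bd K) (sym (frzs-ls q)) (≤-trans (n≤1+n q) l))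

-- The boundary bounds the distance by `q`, so distance at least `q` means that the arc is a
-- geodesic; moving the root past it gives the class of `serB`.
geodesic-end : ∀ {k} b c p q (m : Vec ℕ k) → serD b c p q q m ≡ serB b c p q m
geodesic-end b c p q = serof-rel {P = InClass b (PD c p q q)} {InClass b (InB c p q)} (isD b c p q q) (isB b c p q) R f g left right
  where
  R : Tm → Tm → Set
  R t K′ = t ≡ glue K′ (frzs q) × WF K′ × q ≤ bd K′
  f : ∀ {m} t → InClass b (PD c p q q) m t → Σ Tm λ K′ → InClass b (InB c p q) m K′ × R t K′
  f t ((ok , e , d) , w) with straighten {c} {p} {q} t (ok , e , d , near-crn t (proj₁ ok) 0 q)
  ... | K′ , inB@((wf , _) , e′ , _) , eq , pm = K′ , (inB , wt-↭ pm w) , eq , wf , subst (q ≤_) (sym e′) (m≤n+m q p)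
  g : ∀ {m} K′ → InClass b (InB c p q) m K′ → Σ Tm λ t → InClass b (PD c p q q) m t × R t K′
  g K′ (inB@((wf , _) , e′ , _) , w) with bend {c} {p} {q} K′ inB
  ... | (ok , e , d , _) , pm = glue K′ (frzs q) , ((ok , e , d) , wt-↭ (↭-sym pm) w) , refl , wf , subst (q ≤_) (sym e′) (m≤n+m q p)
  left : ∀ {t t′ y} → R t y → R t′ y → t ≡ t′
  left (refl , _) (refl , _) = refl
  right : ∀ {t y y′} → R t y → R t y′ → y ≡ y′
  right (e , w , l) (e′ , w′ , l′) = glue-frzs-inj q w w′ l l′ (trans (sym e) e′)

-- The bridge contributes two boundary sides, so parts of boundary `i` and `n - 1 - i` give `n + 1`.
tutte-loop : ∀ {k} b c n (m : Vec ℕ k) → serA b c (suc n) m ≡ (ΣS (map (λ i → serA b c i ⊛ serA b c (n ∸ suc i)) (upTo n)) ⊕ serE b c (suc n)) m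
tutte-loop {k} b c n = serof-rel {P = InClass b (PA c (suc n))} (isA b c (suc n))
  (serof-⊕ (serof-Σ {P = λ i → Conv (InClass b (PA c i)) (InClass b (PA c (n ∸ suc i)))} (upTo n) (UP.upTo⁺ n) (λ i → serof-⊛ (class-uniq {P = PA c i}) (isA b c i) (isA b c (n ∸ suc i)))) (isE b c (suc n)))
  R f g left right
  where
  R : Tm → (ℕ × (Tm × Tm)) ⊎ Tm → Set
  R t (inj₁ (i , a , u)) = t ≡ loop a u × i ≡ bd a
  R t (inj₂ t′) = t ≡ t′ × IsSplit t
  f : ∀ {m} t → InClass b (PA c (suc n)) m t → Σ _ λ y → Either _ _ m y × R t y
  f pt ((_ , ()) , _)
  f (split i t) ((ok , e) , w) = inj₂ (split i t) , ((ok , e , isSplit) , w) , refl , isSplit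
  f (loop a u) ((((wa , wu) , (ga , gu)) , e) , w) with wt-++⁻ (degs a) w
  ... | e₁ , e₂ , w₁ , w₂ , es = inj₁ (bd a , a , u) , (∈-upTo⁺ lt , e₁ , e₂ , (((wa , ga) , refl) , w₁) , (((wu , gu) , bu) , w₂) , es) , refl , refl
    where
    eq : n ≡ suc (bd a) + bd u
    eq = suc-injective (trans (sym e) (bd-loop a u))
    lt : bd a < n
    lt = subst (bd a <_) (sym eq) (s≤s (m≤m+n (bd a) (bd u)))
    bu : bd u ≡ n ∸ suc (bd a)
    bu = sym (trans (cong (λ z → z ∸ suc (bd a)) eq) (m+n∸m≡n (suc (bd a)) (bd u)))
  g : ∀ {m} y → Either _ _ m y → Σ Tm λ t → InClass b (PA c (suc n)) m t × R t y
  g (inj₁ (i , a , u)) (i∈ , e₁ , e₂ , (((wa , ga) , refl) , w₁) , (((wu , gu) , bu) , w₂) , refl) = loop a u , ((((wa , wu) , (ga , gu)) , eq) , wt-++ w₁ w₂) , refl , refl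
    where
    eq : bd (loop a u) ≡ suc n
    eq = trans (bd-loop a u) (cong suc (trans (cong (λ z → suc (bd a) + z) bu) (m+[n∸m]≡n (∈-upTo⁻ i∈))))
  g (inj₂ t) ((ok , e , sp) , w) = t , ((ok , e) , w) , refl , sp
  left : ∀ {t t′ y} → R t y → R t′ y → t ≡ t′
  left {y = inj₁ _} (refl , _) (refl , _) = refl
  left {y = inj₂ _} (refl , _) (refl , _) = refl
  right : ∀ {t y y′} → R t y → R t y′ → y ≡ y′
  right {y = inj₁ _} {inj₁ _} (refl , refl) (refl , refl) = refl
  right {y = inj₁ _} {inj₂ _} (refl , _) (_ , ())
  right {y = inj₂ _} {inj₁ _} (_ , ()) (refl , _)
  right {y = inj₂ _} {inj₂ _} (refl , _) (refl , _) = refl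

-- The root edge closes no cycle of length at most c + 1 exactly when its ends are at distance at
-- least c + 1 after its removal.
tutte-split : ∀ {k} b → 1 ≤ b → ∀ c n (m : Vec ℕ k) → serE b c (suc n) m ≡ ΣS (map (λ r → varS r ⊛ serD b c n (dg b (toℕ r) ∸ 1) (suc c)) (allFin k)) m
tutte-split {k} b 1≤b c n = serof-rel {P = InClass b (PS c (suc n))} (isE b c (suc n))
  (serof-Σ {P = λ r → Conv {X = ⊤} (λ m _ → m ≡ unit r) (InClass b (PD c n (dg b (toℕ r) ∸ 1) (suc c)))} (allFin k) (UP.allFin⁺ k) (λ r → serof-⊛ {P = λ m _ → m ≡ unit r} (λ where refl refl → refl) (serof-var r) (isD b c n (dg b (toℕ r) ∸ 1) (suc c))))
  R f g left right
  where
  R : Tm → Fin k × (⊤ × Tm) → Set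
  R t (r , _ , a) = t ≡ split (dg b (toℕ r) ∸ 1) a
  pos : ∀ (r : Fin k) → suc (dg b (toℕ r) ∸ 1) ≡ dg b (toℕ r)
  pos r = m+[n∸m]≡n (≤-trans 1≤b (≤-trans (m≤m+n b (toℕ r)) (m≤m+n (b + toℕ r) _)))
  f : ∀ {m} t → InClass b (PS c (suc n)) m t → Σ _ λ y → _ × R t y
  f (split i a) ((((wa , li) , (ga , nn)) , e , _) , w) with wt-++⁻ (suc i ∷ []) w
  ... | e₁ , e₂ , w₁@(mkWt ((r , er) ∷ []) _) , w₂ , es with trans (cong (λ z → z ∸ 1) er) refl
  ...   | refl = (r , tt , a) , (∈-allFin r , e₁ , e₂ , wt-unique w₁ (subst (λ z → Wt b (unit r) (z ∷ [])) (sym (pos r)) (wt-unit b r)) , (((wa , ga) , bda , far) , w₂) , es) , refl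
    where
    bda : bd a ≡ i + n
    bda = trans (sym (m+[n∸m]≡n li)) (cong (λ z → i + z) (suc-injective (trans (sym (bd-split i a)) e)))
    far : Dist≥ a (crn a 0) (crn a i) (suc c)
    far n nr = ≰⇒> (λ le → nn (near-mono a le (subst (λ z → Near a n z (crn a i)) (crn-0 a wa) nr)))
  g : ∀ {m} y → _ → Σ Tm λ t → InClass b (PS c (suc n)) m t × R t y
  g (r , _ , a) (_ , e₁ , e₂ , refl , (((wa , ga) , bda , far) , w₂) , refl) = split i a ,
    ((((wa , subst (i ≤_) (sym bda) (m≤m+n i n)) , (ga , λ nr → 1+n≰n (far c (subst (λ z → Near a c z (crn a i)) (sym (crn-0 a wa)) nr)))) ,
      trans (bd-split i a) (cong suc (trans (cong (λ z → z ∸ i) bda) (m+n∸m≡n i n))) , isSplit) ,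
     subst (λ z → Wt b (unit r ⊞ e₂) (z ∷ degs a)) (sym (pos r)) (wt-++ (wt-unit b r) w₂)) , refl
    where i = dg b (toℕ r) ∸ 1
  left : ∀ {t t′ y} → R t y → R t′ y → t ≡ t′
  left refl refl = refl
  right : ∀ {t y y′} → R t y → R t y′ → y ≡ y′
  right {y = r , tt , a} {r′ , tt , a′} e e′ with trans (sym e) e′
  ... | e″ with split-inj e″
    where
    split-inj : ∀ {i j a a′} → split i a ≡ split j a′ → i ≡ j × a ≡ a′
    split-inj refl = refl , refl
  ...   | ei , refl with dg-inj b {r = r} {r′} (trans (sym (pos r)) (trans (cong suc ei) (pos r′)))
  ...     | refl = refl

-- The other boundary arc, of length `p`, already joins the two corners too closely.
serD-zero : ∀ {k} b c p q → p ≤ c → ∀ (m : Vec ℕ k) → serD b c p q (suc c) m ≡ + 0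
serD-zero b c p q le m with isD b c p q (suc c) m
... | n , h , e = trans e (cong +_ (card-unique h (card-⊥ (λ {t} → none {t}))))
  where
  none : ∀ {t} → InClass b (PD c p q (suc c)) m t → ⊥
  none {t} ((ok , eb , d) , _) = 1+n≰n (≤-trans (d p (subst (λ z → Near t p z (crn t q)) (trans (crn-end t (≤-reflexive eb)) (sym (crn-0 t (proj₁ ok)))) (near-sym t (near-crn t (proj₁ ok) q p)))) le)

isZeroMono-sound : {k : ℕ} (m : Vec ℕ k) → isZeroMono m ≡ true → m ≡ Vec.replicate k 0
isZeroMono-sound [] _ = refl
isZeroMono-sound (zero ∷ m) e = cong (0 ∷_) (isZeroMono-sound m e)

isZeroMono-rep : (k : ℕ) → isZeroMono (Vec.replicate k 0) ≡ true
isZeroMono-rep zero = refl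
isZeroMono-rep (suc k) = isZeroMono-rep k

serA-0 : ∀ {k} b c (m : Vec ℕ k) → serA b c 0 m ≡ oneS m
serA-0 {k} b c m with isA b c 0 m
... | n , h , e with isZeroMono m in eq
...   | true = trans e (cong +_ (card-unique h (card-1 pt (((tt , tt) , refl) , subst (λ z → Wt b z []) (sym (isZeroMono-sound m eq)) wt-[]) only)))
  where
  only : ∀ {t} → InClass b (PA c 0) m t → t ≡ pt
  only {pt} _ = refl
  only {loop _ _} ((_ , ()) , _)
  only {split _ _} ((_ , ()) , _)
...   | false = trans e (cong +_ (card-unique h (card-⊥ none)))
  where
  none : ∀ {t} → InClass b (PA c 0) m t → ⊥
  none {pt} (_ , w) with trans (sym eq) (trans (cong isZeroMono (wt-[]⁻ w)) (isZeroMono-rep k))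
  ... | ()
  none {loop _ _} ((_ , ()) , _)
  none {split _ _} ((_ , ()) , _)

-- All inner degrees are even and the total number of sides is even.
serA-odd : ∀ {k} b c n (m : Vec ℕ k) → serA b c (suc (2 * n)) m ≡ + 0
serA-odd {k} b c n m with isA b c (suc (2 * n)) m
... | x , h , e = trans e (cong +_ (card-unique h (card-⊥ (λ {t} → none {t}))))
  where
  S = sumFin k (λ r → (b + toℕ r) * lookup m r)
  odd-even : ∀ a c → suc (2 * a) ≡ 2 * c → ⊥
  odd-even zero (suc c) e = case suc-injective (trans e (cong suc (+-suc c (c + 0)))) of λ ()
  odd-even (suc a) (suc c) e = odd-even a c (suc-injective (suc-injective (trans (cong suc (sym (trans (ℕP.*-suc 2 a) refl))) (trans e (ℕP.*-suc 2 c)))))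
  none : ∀ {t} → InClass b (PA c (suc (2 * n))) m t → ⊥
  none {t} (((wf , _) , eb) , w) = odd-even (n + S) (edges t) (trans (cong suc (ℕP.*-distribˡ-+ 2 n S)) (trans (cong₂ _+_ (sym eb) (sym (wt-sum m (degs t) w))) (handshake t wf)))

-- The ring of formal power series

unique-same-↭ : {X : Set} {xs ys : List X} → Unique xs → Unique ys → (∀ {x} → x ∈ xs → x ∈ ys) → (∀ {x} → x ∈ ys → x ∈ xs) → xs ↭ ys
unique-same-↭ {xs = []} {[]} _ _ _ _ = ↭-refl
unique-same-↭ {xs = []} {y ∷ ys} _ _ _ g = case g (here refl) of λ ()
unique-same-↭ {xs = x ∷ xs} {ys} (n ∷ u) u′ f g with ∈-∃++ (f (here refl))
... | as , bs , refl = ↭-trans (prep x (unique-same-↭ u uab f′ g′)) (↭-sym (PP.shift x as bs))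
  where
  ush : Unique (x ∷ as ++ bs)
  ush = unique-↭ (PP.shift x as bs) u′
  uab : Unique (as ++ bs)
  uab = AllPairs.tail ush
  f′ : ∀ {z} → z ∈ xs → z ∈ as ++ bs
  f′ z∈ with PP.∈-resp-↭ (PP.shift x as bs) (f (there z∈))
  ... | here refl = ⊥-elim (All.lookup n z∈ refl)
  ... | there m = m
  g′ : ∀ {z} → z ∈ as ++ bs → z ∈ xs
  g′ z∈ with g (PP.∈-resp-↭ (↭-sym (PP.shift x as bs)) (there z∈))
  ... | here refl = ⊥-elim (All.lookup (AllPairs.head ush) z∈ refl)
  ... | there m = m

sumℤ-↭ : {xs ys : List ℤ} → xs ↭ ys → sumℤ xs ≡ sumℤ ys
sumℤ-↭ _↭_.refl = refl
sumℤ-↭ (prep x e) = cong (λ z → x +ℤ z) (sumℤ-↭ e)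
sumℤ-↭ (swap x y e) = trans (cong (λ z → x +ℤ (y +ℤ z)) (sumℤ-↭ e)) (trans (sym (ℤP.+-assoc x y _)) (trans (cong (λ z → z +ℤ _) (ℤP.+-comm x y)) (ℤP.+-assoc y x _)))
sumℤ-↭ (_↭_.trans e e′) = trans (sumℤ-↭ e) (sumℤ-↭ e′)

sumℤ-cong : {X : Set} {F G : X → ℤ} (xs : List X) → (∀ {x} → x ∈ xs → F x ≡ G x) → sumℤ (map F xs) ≡ sumℤ (map G xs)
sumℤ-cong [] e = refl
sumℤ-cong (x ∷ xs) e = cong₂ _+ℤ_ (e (here refl)) (sumℤ-cong xs (e ∘ there))

sumℤ-reindex : {X Y : Set} {F : X → ℤ} {G : Y → ℤ} {xs : List X} {ys : List Y} (f : X → Y) (g : Y → X) → Unique xs → Unique ys →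
  (∀ {x} → x ∈ xs → f x ∈ ys × g (f x) ≡ x × F x ≡ G (f x)) → (∀ {y} → y ∈ ys → g y ∈ xs × f (g y) ≡ y) →
  sumℤ (map F xs) ≡ sumℤ (map G ys)
sumℤ-reindex {F = F} {G} {xs} {ys} f g u u′ h h′ = trans (sumℤ-cong xs (λ m → proj₂ (proj₂ (h m))))
  (trans (cong sumℤ (map-∘ xs)) (sumℤ-↭ (PP.map⁺ G (unique-same-↭ (uniq xs u (λ m → proj₁ (proj₂ (h m)))) u′
    (λ m → case ∈-map⁻ f m of λ where (x , x∈ , refl) → proj₁ (h x∈))
    (λ {y} m → subst (_∈ map f xs) (proj₂ (h′ m)) (∈-map⁺ f (proj₁ (h′ m))))))))
  where
  uniq : ∀ xs → Unique xs → (∀ {x} → x ∈ xs → g (f x) ≡ x) → Unique (map f xs)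
  uniq [] [] _ = []
  uniq (x ∷ xs) (n ∷ u) e = All.tabulate (λ m eq → case ∈-map⁻ f m of λ where
      (x′ , x′∈ , refl) → All.lookup n x′∈ (trans (sym (e (here refl))) (trans (cong g eq) (e (there x′∈)))))
    ∷ uniq xs u (e ∘ there)

sumℤ-*ˡ : {X : Set} (a : ℤ) {F : X → ℤ} (xs : List X) → a *ℤ sumℤ (map F xs) ≡ sumℤ (map (λ x → a *ℤ F x) xs)
sumℤ-*ˡ a [] = ℤP.*-zeroʳ a
sumℤ-*ˡ a {F} (x ∷ xs) = trans (ℤP.*-distribˡ-+ a (F x) _) (cong (λ z → a *ℤ F x +ℤ z) (sumℤ-*ˡ a xs))

sumℤ-*ʳ : {X : Set} (a : ℤ) {F : X → ℤ} (xs : List X) → sumℤ (map F xs) *ℤ a ≡ sumℤ (map (λ x → F x *ℤ a) xs)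
sumℤ-*ʳ a {F} xs = trans (ℤP.*-comm _ a) (trans (sumℤ-*ˡ a xs) (sumℤ-cong xs (λ {x} _ → ℤP.*-comm a (F x))))

sumℤ-+ : {X : Set} {F G : X → ℤ} (xs : List X) → sumℤ (map (λ x → F x +ℤ G x) xs) ≡ sumℤ (map F xs) +ℤ sumℤ (map G xs)
sumℤ-+ [] = refl
sumℤ-+ {F = F} {G} (x ∷ xs) = trans (cong (λ z → F x +ℤ G x +ℤ z) (sumℤ-+ xs)) (lem (F x) (G x) _ _)
  where
  lem : ∀ a b c d → (a +ℤ b) +ℤ (c +ℤ d) ≡ (a +ℤ c) +ℤ (b +ℤ d)
  lem = ℤR.solve-∀

sumℤ-zero : {X : Set} {F : X → ℤ} (xs : List X) → (∀ {x} → x ∈ xs → F x ≡ + 0) → sumℤ (map F xs) ≡ + 0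
sumℤ-zero [] e = refl
sumℤ-zero (x ∷ xs) e = cong₂ _+ℤ_ (e (here refl)) (sumℤ-zero xs (e ∘ there))

sumℤ-++ : (xs ys : List ℤ) → sumℤ (xs ++ ys) ≡ sumℤ xs +ℤ sumℤ ys
sumℤ-++ [] ys = sym (ℤP.+-identityˡ _)
sumℤ-++ (x ∷ xs) ys = trans (cong (λ z → x +ℤ z) (sumℤ-++ xs ys)) (sym (ℤP.+-assoc x _ _))

sumℤ-nested : {X Y : Set} (f : X → List Y) (F : X → Y → ℤ) (xs : List X) →
  sumℤ (map (λ x → sumℤ (map (F x) (f x))) xs) ≡ sumℤ (map (λ xy → F (proj₁ xy) (proj₂ xy)) (concatMap (λ x → map (x ,_) (f x)) xs))
sumℤ-nested f F [] = refl
sumℤ-nested f F (x ∷ xs) = trans (cong₂ _+ℤ_ (cong sumℤ (map-∘ (f x))) (sumℤ-nested f F xs))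
  (trans (sym (sumℤ-++ (map _ (map (x ,_) (f x))) _)) (cong sumℤ (sym (map-++ _ (map (x ,_) (f x)) _))))

infixl 7 _⊟_
_⊟_ : {k : ℕ} → Vec ℕ k → Vec ℕ k → Vec ℕ k
m ⊟ e = Vec.zipWith _∸_ m e

⊞-comm : {k : ℕ} (e e′ : Vec ℕ k) → e ⊞ e′ ≡ e′ ⊞ e
⊞-comm e e′ = VecP.zipWith-comm +-comm e e′

⊞-assoc : {k : ℕ} (a b c : Vec ℕ k) → (a ⊞ b) ⊞ c ≡ a ⊞ (b ⊞ c)
⊞-assoc a b c = VecP.zipWith-assoc +-assoc a b c

∈-below′ : {k : ℕ} {m : Vec ℕ k} (e e′ : Vec ℕ k) → e ⊞ e′ ≡ m → e ∈ below m
∈-below′ e e′ refl = ∈-below e e′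

⊟-flip : {k : ℕ} (m e : Vec ℕ k) → e ∈ below m → (m ⊟ e) ∈ below m × m ⊟ (m ⊟ e) ≡ e
⊟-flip m e e∈ = ∈-below′ (m ⊟ e) e eq , trans (cong (λ z → z ⊟ (m ⊟ e)) (sym eq)) (⊞-∸ (m ⊟ e) e)
  where
  eq : (m ⊟ e) ⊞ e ≡ m
  eq = trans (⊞-comm (m ⊟ e) e) (below-∸ m e∈)

_≈S_ : {k : ℕ} → Ser k → Ser k → Set
A ≈S B = ∀ m → A m ≡ B m

⊛-comm : {k : ℕ} (A B : Ser k) → (A ⊛ B) ≈S (B ⊛ A)
⊛-comm A B m = sumℤ-reindex (m ⊟_) (m ⊟_) (below-unique m) (below-unique m)
  (λ {e} e∈ → proj₁ (⊟-flip m e e∈) , proj₂ (⊟-flip m e e∈) , trans (ℤP.*-comm (A e) _) (cong (λ z → B (m ⊟ e) *ℤ A z) (sym (proj₂ (⊟-flip m e e∈)))))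
  (λ {e} e∈ → ⊟-flip m e e∈)

⊛-cong : {k : ℕ} {A A′ B B′ : Ser k} → A ≈S A′ → B ≈S B′ → (A ⊛ B) ≈S (A′ ⊛ B′)
⊛-cong a b m = sumℤ-cong (below m) (λ {e} _ → cong₂ _*ℤ_ (a e) (b (m ⊟ e)))

⊛-distribˡ : {k : ℕ} (A B C : Ser k) → (A ⊛ (B ⊕ C)) ≈S ((A ⊛ B) ⊕ (A ⊛ C))
⊛-distribˡ A B C m = trans (sumℤ-cong (below m) (λ {e} _ → ℤP.*-distribˡ-+ (A e) (B (m ⊟ e)) (C (m ⊟ e)))) (sumℤ-+ (below m))

zeroV : (k : ℕ) → Vec ℕ k
zeroV k = Vec.replicate k 0

⊞-zero : {k : ℕ} (m : Vec ℕ k) → zeroV k ⊞ m ≡ m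
⊞-zero m = VecP.zipWith-identityˡ (λ _ → refl) m

sumℤ-delta : {X : Set} (h : X → ℤ) (x : X) (xs : List X) → Unique xs → x ∈ xs → (∀ y → y ≢ x → h y ≡ + 0) → sumℤ (map h xs) ≡ h x
sumℤ-delta h x (y ∷ xs) (n ∷ u) (here refl) z = trans (cong (λ w → h y +ℤ w) (sumℤ-zero xs (λ {w} m → z w (λ e → All.lookup n m (sym e))))) (ℤP.+-identityʳ (h y))
sumℤ-delta h x (y ∷ xs) (n ∷ u) (there m) z = trans (cong₂ _+ℤ_ (z y (λ e → All.lookup n m e)) (sumℤ-delta h x xs u m z)) (ℤP.+-identityˡ _)

const-⊛ : {k : ℕ} (c : ℤ) (A : Ser k) (m : Vec ℕ k) → (constS c ⊛ A) m ≡ c *ℤ A m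
const-⊛ {k} c A m = trans (sumℤ-delta (λ e → constS c e *ℤ A (m ⊟ e)) (zeroV k) (below m) (below-unique m) (∈-below′ (zeroV k) m (⊞-zero m)) off)
  (cong₂ _*ℤ_ (cong (λ z → if z then c else + 0) (isZeroMono-rep k)) (cong A (trans (cong (λ z → z ⊟ zeroV k) (sym (⊞-zero m))) (⊞-∸ (zeroV k) m))))
  where
  off : ∀ e → e ≢ zeroV k → constS c e *ℤ A (m ⊟ e) ≡ + 0
  off e ne with isZeroMono e in eq
  ... | true = ⊥-elim (ne (isZeroMono-sound e eq))
  ... | false = refl

⊛-identityˡ : {k : ℕ} (A : Ser k) → (oneS ⊛ A) ≈S A
⊛-identityˡ A m = trans (const-⊛ (+ 1) A m) (ℤP.*-identityˡ (A m))

-- Both sides sum over the ways to write `m` as p + s + w; the reindexing passes from the pair (p +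
-- s, p) to the pair (p, s).
⊛-assoc : {k : ℕ} (A B C : Ser k) → ((A ⊛ B) ⊛ C) ≈S (A ⊛ (B ⊛ C))
⊛-assoc {k} A B C m = trans lhs (trans (sumℤ-reindex f g ul ur fw bk) (sym rhs))
  where
  L = concatMap (λ e → map (e ,_) (below e)) (below m)
  R = concatMap (λ e → map (e ,_) (below (m ⊟ e))) (below m)
  lhs : ((A ⊛ B) ⊛ C) m ≡ sumℤ (map (λ ef → A (proj₂ ef) *ℤ B (proj₁ ef ⊟ proj₂ ef) *ℤ C (m ⊟ proj₁ ef)) L)
  lhs = trans (sumℤ-cong (below m) (λ {e} _ → sumℤ-*ʳ (C (m ⊟ e)) (below e))) (sumℤ-nested below (λ e f → A f *ℤ B (e ⊟ f) *ℤ C (m ⊟ e)) (below m))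
  rhs : (A ⊛ (B ⊛ C)) m ≡ sumℤ (map (λ ef → A (proj₁ ef) *ℤ (B (proj₂ ef) *ℤ C (m ⊟ proj₁ ef ⊟ proj₂ ef))) R)
  rhs = trans (sumℤ-cong (below m) (λ {e} _ → sumℤ-*ˡ (A e) (below (m ⊟ e)))) (sumℤ-nested (λ e → below (m ⊟ e)) (λ e f → A e *ℤ (B f *ℤ C (m ⊟ e ⊟ f))) (below m))
  ul : Unique L
  ul = unique-concatMap _ (below m) (below-unique m) (λ e → UP.map⁺ (λ where refl → refl) (below-unique e))
    (λ p q → case ∈-map⁻ _ p , ∈-map⁻ _ q of λ where ((_ , _ , refl) , (_ , _ , refl)) → refl)
  ur : Unique R
  ur = unique-concatMap _ (below m) (below-unique m) (λ e → UP.map⁺ (λ where refl → refl) (below-unique (m ⊟ e)))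
    (λ p q → case ∈-map⁻ _ p , ∈-map⁻ _ q of λ where ((_ , _ , refl) , (_ , _ , refl)) → refl)
  f : Vec ℕ k × Vec ℕ k → Vec ℕ k × Vec ℕ k
  f (e , p) = p , e ⊟ p
  g : Vec ℕ k × Vec ℕ k → Vec ℕ k × Vec ℕ k
  g (p , s) = p ⊞ s , p
  ∸∸ : ∀ (p s w : Vec ℕ k) → (p ⊞ (s ⊞ w)) ⊟ p ⊟ s ≡ w
  ∸∸ p s w = trans (cong (λ z → z ⊟ s) (⊞-∸ p (s ⊞ w))) (⊞-∸ s w)
  fw : ∀ {x} → x ∈ L → f x ∈ R × g (f x) ≡ x × A (proj₂ x) *ℤ B (proj₁ x ⊟ proj₂ x) *ℤ C (m ⊟ proj₁ x) ≡ A (proj₁ (f x)) *ℤ (B (proj₂ (f x)) *ℤ C (m ⊟ proj₁ (f x) ⊟ proj₂ (f x)))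
  fw x∈ with ∈-concatMap⁻ (λ e → map (e ,_) (below e)) (below m) x∈
  ... | e , e∈ , m₁ with ∈-map⁻ (e ,_) m₁
  ...   | p , p∈ , refl = ∈-concatMap (λ e → map (e ,_) (below (m ⊟ e))) {below m} (∈-below′ p (s ⊞ w) tot) (∈-map⁺ (p ,_) (∈-below′ s w (sym (trans (cong (λ z → z ⊟ p) (sym tot)) (⊞-∸ p (s ⊞ w)))))) ,
      cong (_, p) (below-∸ e p∈) , trans (ℤP.*-assoc (A p) (B s) (C w)) (cong (λ z → A p *ℤ (B s *ℤ C z)) (sym (trans (cong (λ z → z ⊟ p ⊟ s) (sym tot)) (∸∸ p s w))))
    where
    s = e ⊟ p
    w = m ⊟ e
    tot : p ⊞ (s ⊞ w) ≡ m
    tot = trans (sym (⊞-assoc p s w)) (trans (cong (λ z → z ⊞ w) (below-∸ e p∈)) (below-∸ m e∈))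
  bk : ∀ {y} → y ∈ R → g y ∈ L × f (g y) ≡ y
  bk y∈ with ∈-concatMap⁻ (λ e → map (e ,_) (below (m ⊟ e))) (below m) y∈
  ... | p , p∈ , m₁ with ∈-map⁻ (p ,_) m₁
  ...   | s , s∈ , refl = ∈-concatMap (λ e → map (e ,_) (below e)) {below m} (∈-below′ (p ⊞ s) (m ⊟ p ⊟ s) (trans (⊞-assoc p s _) (trans (cong (p ⊞_) (below-∸ (m ⊟ p) s∈)) (below-∸ m p∈)))) (∈-map⁺ (_ ,_) (∈-below p s)) ,
      cong (p ,_) (⊞-∸ p s)

negS : {k : ℕ} → Ser k → Ser k
negS A m = -ℤ A m

serRing : ℕ → CommutativeRing _ _
serRing k = record
  { Carrier = Ser k ; _≈_ = _≈S_ ; _+_ = _⊕_ ; _*_ = _⊛_ ; -_ = negS ; 0# = zeroS ; 1# = oneS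
  ; isCommutativeRing = record
    { isRing = record
      { +-isAbelianGroup = record
        { isGroup = record
          { isMonoid = record
            { isSemigroup = record
              { isMagma = record { isEquivalence = record { refl = λ _ → refl ; sym = λ e m → sym (e m) ; trans = λ e f m → trans (e m) (f m) } ; ∙-cong = λ e f m → cong₂ _+ℤ_ (e m) (f m) }
              ; assoc = λ A B C m → ℤP.+-assoc (A m) (B m) (C m) }
            ; identity = (λ A m → ℤP.+-identityˡ (A m)) , (λ A m → ℤP.+-identityʳ (A m)) }
          ; inverse = (λ A m → ℤP.+-inverseˡ (A m)) , (λ A m → ℤP.+-inverseʳ (A m)) ; ⁻¹-cong = λ e m → cong -ℤ_ (e m) }
        ; comm = λ A B m → ℤP.+-comm (A m) (B m) }
      ; *-cong = ⊛-cong
      ; *-assoc = ⊛-assoc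
      ; *-identity = ⊛-identityˡ , (λ A m → trans (⊛-comm A oneS m) (⊛-identityˡ A m))
      ; distrib = ⊛-distribˡ , (λ A B C m → trans (⊛-comm (B ⊕ C) A m) (trans (⊛-distribˡ A B C m) (cong₂ _+ℤ_ (⊛-comm A B m) (⊛-comm A C m)))) }
    ; *-comm = ⊛-comm } }

-- Expansions under the substitution z = u + R / u

odd : ℕ → ℕ
odd zero = 1
odd (suc l) = suc (suc (odd l))

even : ℕ → ℕ
even zero = 0
even (suc l) = suc (suc (even l))

odd-even : ∀ l → odd l ≡ suc (even l)
odd-even zero = refl
odd-even (suc l) = cong (λ z → suc (suc z)) (odd-even l)

module RingNotation (𝓡 : CommutativeRing 0ℓ 0ℓ) where
  open CommutativeRing 𝓡 public using (_≈_; commutativeSemiring; ring; setoid) renaming (Carrier to E; _+_ to _⊹_; _*_ to _·_; -_ to ⊝_; 0# to 𝟘; 1# to 𝟙; -‿inverseˡ to ⊝-invˡ; -‿inverseʳ to ⊝-invʳ; refl to ≈-refl; sym to ≈-sym; trans to ≈-trans; +-cong to ⊹-cong; +-comm to ⊹-comm; *-cong to ·-cong; -‿cong to ⊝-cong; +-identityˡ to ⊹-idˡ; +-identityʳ to ⊹-idʳ; *-identityˡ to ·-idˡ; *-identityʳ to ·-idʳ; zeroˡ to ·-zeroˡ; zeroʳ to ·-zeroʳ; distribˡ to ·-distribˡ; reflexive to ≈-reflexive)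
  open SetoidR setoid public
  open NatSolver commutativeSemiring public using (solve; con; _:+_; _:*_; _:=_)

module PathAlgebra (𝓡 : CommutativeRing 0ℓ 0ℓ) where
  open RingNotation 𝓡

  neg-mul : ∀ x → ⊝ x ≈ ⊝ 𝟙 · x
  neg-mul x = ≈-sym (RingP.-1*x≈-x ring x)

  infixr 8 _^ᵣ_
  _^ᵣ_ : E → ℕ → E
  x ^ᵣ zero = 𝟙
  x ^ᵣ suc n = x · x ^ᵣ n

  sm : ℕ → (ℕ → E) → E
  sm zero f = 𝟘
  sm (suc n) f = f 0 ⊹ sm n (f ∘ suc)

  sm-cong : ∀ n {f g : ℕ → E} → (∀ i → i < n → f i ≈ g i) → sm n f ≈ sm n g
  sm-cong zero e = ≈-refl
  sm-cong (suc n) e = ⊹-cong (e 0 (s≤s z≤n)) (sm-cong n (λ i lt → e (suc i) (s≤s lt)))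

  sm-zero : ∀ n {f : ℕ → E} → (∀ i → i < n → f i ≈ 𝟘) → sm n f ≈ 𝟘
  sm-zero zero e = ≈-refl
  sm-zero (suc n) e = ≈-trans (⊹-cong (e 0 (s≤s z≤n)) (sm-zero n (λ i lt → e (suc i) (s≤s lt)))) (⊹-idˡ 𝟘)

  sm-last : ∀ n (f : ℕ → E) → sm (suc n) f ≈ sm n f ⊹ f n
  sm-last zero f = ≈-trans (⊹-idʳ (f 0)) (≈-sym (⊹-idˡ (f 0)))
  sm-last (suc n) f = ≈-trans (⊹-cong ≈-refl (sm-last n (f ∘ suc))) (assoc (f 0) (sm n (f ∘ suc)) (f (suc n)))
    where
    assoc = solve 3 (λ a b c → a :+ (b :+ c) := a :+ b :+ c) ≈-refl

  sm-+ : ∀ n (f g : ℕ → E) → sm n (λ i → f i ⊹ g i) ≈ sm n f ⊹ sm n g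
  sm-+ zero f g = ≈-sym (⊹-idˡ 𝟘)
  sm-+ (suc n) f g = ≈-trans (⊹-cong ≈-refl (sm-+ n (f ∘ suc) (g ∘ suc))) (inter (f 0) (g 0) _ _)
    where
    inter = solve 4 (λ a b c d → (a :+ b) :+ (c :+ d) := (a :+ c) :+ (b :+ d)) ≈-refl

  sm-*ˡ : ∀ n a (f : ℕ → E) → a · sm n f ≈ sm n (λ i → a · f i)
  sm-*ˡ zero a f = ·-zeroʳ a
  sm-*ˡ (suc n) a f = ≈-trans (·-distribˡ a (f 0) _) (⊹-cong ≈-refl (sm-*ˡ n a (f ∘ suc)))

  sm-swap : ∀ n m (f : ℕ → ℕ → E) → sm n (λ i → sm m (f i)) ≈ sm m (λ j → sm n (λ i → f i j))
  sm-swap zero m f = ≈-sym (sm-zero m (λ _ _ → ≈-refl))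
  sm-swap (suc n) m f = ≈-trans (⊹-cong ≈-refl (sm-swap n m (f ∘ suc))) (≈-sym (sm-+ m (f 0) (λ j → sm n (λ i → f (suc i) j))))

  sm-extend : ∀ n d {f : ℕ → E} → (∀ i → n ≤ i → f i ≈ 𝟘) → sm (n + d) f ≈ sm n f
  sm-extend zero d z = sm-zero d (λ i _ → z i z≤n)
  sm-extend (suc n) d z = ⊹-cong ≈-refl (sm-extend n d (λ i le → z (suc i) (s≤s le)))

  cv : (ℕ → E) → (ℕ → E) → ℕ → E
  cv F G zero = F 0 · G 0
  cv F G (suc N) = F 0 · G (suc N) ⊹ cv (F ∘ suc) G N

  cv-cong : ∀ {F F′ G G′ : ℕ → E} N → (∀ i → i ≤ N → F i ≈ F′ i) → (∀ i → i ≤ N → G i ≈ G′ i) → cv F G N ≈ cv F′ G′ N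
  cv-cong zero e e′ = ·-cong (e 0 z≤n) (e′ 0 z≤n)
  cv-cong (suc N) e e′ = ⊹-cong (·-cong (e 0 z≤n) (e′ (suc N) ≤-refl)) (cv-cong N (λ i le → e (suc i) (s≤s le)) (λ i le → e′ i (≤-trans le (n≤1+n N))))

  cv-last : ∀ (F G : ℕ → E) N → cv F G (suc N) ≈ cv F (G ∘ suc) N ⊹ F (suc N) · G 0
  cv-last F G zero = ≈-refl
  cv-last F G (suc N) = ≈-trans (⊹-cong ≈-refl (cv-last (F ∘ suc) G N)) (assoc _ _ _)
    where
    assoc = solve 3 (λ a b c → a :+ (b :+ c) := a :+ b :+ c) ≈-refl

  cv-+ˡ : ∀ (F F′ G : ℕ → E) N → cv (λ i → F i ⊹ F′ i) G N ≈ cv F G N ⊹ cv F′ G N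
  cv-+ˡ F F′ G zero = lem _ _ _
    where
    lem = solve 3 (λ a b c → (a :+ b) :* c := a :* c :+ b :* c) ≈-refl
  cv-+ˡ F F′ G (suc N) = ≈-trans (⊹-cong ≈-refl (cv-+ˡ (F ∘ suc) (F′ ∘ suc) G N)) (lem _ _ _ _ _)
    where
    lem = solve 5 (λ a b c d e → (a :+ b) :* c :+ (d :+ e) := (a :* c :+ d) :+ (b :* c :+ e)) ≈-refl

  cv-*ˡ : ∀ x (F G : ℕ → E) N → cv (λ i → x · F i) G N ≈ x · cv F G N
  cv-*ˡ x F G zero = lem _ _ _
    where
    lem = solve 3 (λ a b c → (a :* b) :* c := a :* (b :* c)) ≈-refl
  cv-*ˡ x F G (suc N) = ≈-trans (⊹-cong ≈-refl (cv-*ˡ x (F ∘ suc) G N)) (lem _ _ _ _)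
    where
    lem = solve 4 (λ a b c d → (a :* b) :* c :+ a :* d := a :* (b :* c :+ d)) ≈-refl

  cv-comm : ∀ (F G : ℕ → E) N → cv F G N ≈ cv G F N
  cv-comm F G zero = lem _ _
    where
    lem = solve 2 (λ a b → a :* b := b :* a) ≈-refl
  cv-comm F G (suc N) = ≈-trans (⊹-cong ≈-refl (cv-comm (F ∘ suc) G N)) (≈-trans (lem _ _ _) (≈-sym (cv-last G F N)))
    where
    lem = solve 3 (λ a b c → a :* b :+ c := c :+ b :* a) ≈-refl

  cv-smˡ : ∀ J (F : ℕ → ℕ → E) G N → cv (λ i → sm J (λ l → F l i)) G N ≈ sm J (λ l → cv (F l) G N)
  cv-smˡ zero F G N = zer N
    where
    zer : ∀ N → cv (λ _ → 𝟘) G N ≈ 𝟘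
    zer zero = ·-zeroˡ _
    zer (suc N) = ≈-trans (⊹-cong (·-zeroˡ _) (zer N)) (⊹-idˡ 𝟘)
  cv-smˡ (suc J) F G N = ≈-trans (cv-+ˡ (F 0) (λ i → sm J (λ l → F (suc l) i)) G N) (⊹-cong ≈-refl (cv-smˡ J (F ∘ suc) G N))

  -- Both sides are the sum of w l · v l′ · κ (l + l′) over l + l′ < M.
  cv-triangle : ∀ M (w v κ : ℕ → E) → (∀ s → M ≤ s → κ s ≈ 𝟘) → ∀ M′ → M ≤ M′ →
    sm M (λ s → κ s · cv w v s) ≈ sm M (λ l → w l · sm M′ (λ l′ → v l′ · κ (l + l′)))
  cv-triangle zero w v κ z M′ le = ≈-refl
  cv-triangle (suc M) w v κ z M′ le = begin
    κ 0 · (w 0 · v 0) ⊹ sm M (λ s → κ (suc s) · (w 0 · v (suc s) ⊹ cv (w ∘ suc) v s))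
      ≈⟨ ⊹-cong ≈-refl (≈-trans (sm-cong M (λ s _ → dist (κ (suc s)) (w 0) (v (suc s)) _)) (sm-+ M _ _)) ⟩
    κ 0 · (w 0 · v 0) ⊹ (sm M (λ s → w 0 · (v (suc s) · κ (suc s))) ⊹ sm M (λ s → κ (suc s) · cv (w ∘ suc) v s))
      ≈⟨ ⊹-cong ≈-refl (⊹-cong (≈-sym (sm-*ˡ M (w 0) _)) (cv-triangle M (w ∘ suc) v (κ ∘ suc) (λ s l → z (suc s) (s≤s l)) M′ (≤-trans (n≤1+n M) le))) ⟩
    κ 0 · (w 0 · v 0) ⊹ (w 0 · sm M (λ s → v (suc s) · κ (suc s)) ⊹ sm M (λ l → w (suc l) · sm M′ (λ l′ → v l′ · κ (suc (l + l′)))))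
      ≈⟨ comb (κ 0) (w 0) (v 0) _ _ ⟩
    w 0 · sm (suc M) (λ s → v s · κ s) ⊹ sm M (λ l → w (suc l) · sm M′ (λ l′ → v l′ · κ (suc (l + l′))))
      ≈⟨ ⊹-cong (·-cong ≈-refl ext) ≈-refl ⟩
    w 0 · sm M′ (λ s → v s · κ s) ⊹ sm M (λ l → w (suc l) · sm M′ (λ l′ → v l′ · κ (suc (l + l′)))) ∎
    where
    dist = solve 4 (λ a b c d → a :* (b :* c :+ d) := b :* (c :* a) :+ a :* d) ≈-refl
    comb = solve 5 (λ k w v s t → k :* (w :* v) :+ (w :* s :+ t) := w :* (v :* k :+ s) :+ t) ≈-refl
    ext : sm (suc M) (λ s → v s · κ s) ≈ sm M′ (λ s → v s · κ s)
    ext = ≈-trans (≈-sym (sm-extend (suc M) (M′ ∸ suc M) {λ s → v s · κ s} (λ i l → ≈-trans (·-cong (≈-refl {v i}) (z i l)) (·-zeroʳ (v i))))) (≈-reflexive (cong (λ n → sm n (λ s → v s · κ s)) (m+[n∸m]≡n le)))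

  -- The diagonal has a hypothesis of its own, since 2 need not be cancellable in the ring.
  sm-antisym : ∀ N (c : ℕ → ℕ → E) → (∀ i j → c i j ⊹ c j i ≈ 𝟘) → (∀ i → c i i ≈ 𝟘) → sm N (λ i → sm N (c i)) ≈ 𝟘
  sm-antisym zero c a d = ≈-refl
  sm-antisym (suc N) c a d = begin
    (c 0 0 ⊹ sm N (λ j → c 0 (suc j))) ⊹ sm N (λ i → c (suc i) 0 ⊹ sm N (λ j → c (suc i) (suc j)))
      ≈⟨ ⊹-cong (⊹-cong (d 0) ≈-refl) (sm-+ N _ _) ⟩
    (𝟘 ⊹ sm N (λ j → c 0 (suc j))) ⊹ (sm N (λ i → c (suc i) 0) ⊹ sm N (λ i → sm N (λ j → c (suc i) (suc j))))
      ≈⟨ lem _ _ _ ⟩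
    (sm N (λ j → c 0 (suc j)) ⊹ sm N (λ i → c (suc i) 0)) ⊹ sm N (λ i → sm N (λ j → c (suc i) (suc j)))
      ≈⟨ ⊹-cong (≈-trans (≈-sym (sm-+ N _ _)) (sm-zero N (λ i _ → a 0 (suc i)))) (sm-antisym N (λ i j → c (suc i) (suc j)) (λ i j → a (suc i) (suc j)) (λ i → d (suc i))) ⟩
    𝟘 ⊹ 𝟘 ≈⟨ ⊹-idˡ 𝟘 ⟩
    𝟘 ∎
    where
    lem = solve 3 (λ a b c → (con 0 :+ a) :+ (b :+ c) := (a :+ b) :+ c) ≈-refl

  nat : ℕ → E
  nat zero = 𝟘
  nat (suc n) = 𝟙 ⊹ nat n

  nat-+ : ∀ a b → nat (a + b) ≈ nat a ⊹ nat b
  nat-+ zero b = ≈-sym (⊹-idˡ _)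
  nat-+ (suc a) b = ≈-trans (⊹-cong ≈-refl (nat-+ a b)) (asc 𝟙 (nat a) (nat b))
    where
    asc = solve 3 (λ a b c → a :+ (b :+ c) := a :+ b :+ c) ≈-refl

  module Paths (R : E) where

    -- K n m is the coefficient of z⁻ⁿ in u⁻ᵐ, where z = u + R / u.
    K : ℕ → ℕ → E
    K zero zero = 𝟙
    K zero (suc m) = 𝟘
    K (suc n) zero = 𝟘
    K (suc n) (suc m) = K n m ⊹ R · K n (suc (suc m))

    K-above : ∀ n m → n < m → K n m ≈ 𝟘
    K-above zero (suc m) _ = ≈-refl
    K-above (suc n) (suc m) (s≤s lt) = ≈-trans (⊹-cong (K-above n m lt) (·-cong ≈-refl (K-above n (suc (suc m)) (≤-trans lt (≤-trans (n≤1+n m) (n≤1+n (suc m))))))) (≈-trans (⊹-idˡ _) (·-zeroʳ R))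

    K-diag : ∀ n → K n n ≈ 𝟙
    K-diag zero = ≈-refl
    K-diag (suc n) = ≈-trans (⊹-cong (K-diag n) (≈-trans (·-cong ≈-refl (K-above n (suc (suc n)) (n≤1+n (suc n)))) (·-zeroʳ R))) (⊹-idʳ 𝟙)

    -- Expansion in powers of 1/z is multiplicative: this is u^(-i) times u^(-j).
    K-product : ∀ N i j → cv (λ a → K a i) (λ a → K a j) N ≈ K N (i + j)
    K-product zero zero j = ·-idˡ _
    K-product zero (suc i) j = ·-zeroˡ _
    K-product (suc N) zero j = ≈-trans (⊹-cong (·-idˡ _) (zer N)) (⊹-idʳ _)
      where
      zer : ∀ N → cv (λ _ → 𝟘) (λ a → K a j) N ≈ 𝟘
      zer zero = ·-zeroˡ _
      zer (suc N) = ≈-trans (⊹-cong (·-zeroˡ _) (zer N)) (⊹-idˡ 𝟘)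
    K-product (suc N) (suc i) j = ≈-trans (⊹-cong (·-zeroˡ _) (≈-trans (cv-+ˡ (λ a → K a i) (λ a → R · K a (suc (suc i))) (λ a → K a j) N)
      (⊹-cong (K-product N i j) (≈-trans (cv-*ˡ R (λ a → K a (suc (suc i))) (λ a → K a j) N) (·-cong ≈-refl (K-product N (suc (suc i)) j)))))) (⊹-idˡ _)

    -- kk n a b is the coefficient of z⁻ⁿ⁻¹ in u^(b - a).
    kk : ℕ → ℕ → ℕ → E
    kk n a zero = K (suc n) a
    kk n zero (suc b) = ⊝ (R ^ᵣ suc b · K (suc n) (suc b))
    kk n (suc a) (suc b) = kk n a b

    -- Multiplication by z = u + R/u shifts the power of z by one.
    kk-step : ∀ n a b → kk (suc n) a b ≈ kk n a (suc b) ⊹ R · kk n (suc a) b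
    kk-step n zero zero = lem R (K (suc n) 1)
      where
      one = solve 2 (λ r k → (r :* con 1) :* k := r :* k) ≈-refl
      lem : ∀ r k → 𝟘 ≈ ⊝ ((r · 𝟙) · k) ⊹ r · k
      lem r k = ≈-sym (≈-trans (⊹-cong (⊝-cong (one r k)) ≈-refl) (⊝-invˡ (r · k)))
    kk-step n (suc a) zero = ≈-refl
    kk-step n zero (suc zero) = lem R (K (suc n) 2)
      where
      one = solve 2 (λ r k → (r :* con 1) :* (con 0 :+ r :* k) := (r :* (r :* con 1)) :* k) ≈-refl
      lem : ∀ r k → ⊝ ((r · 𝟙) · (𝟘 ⊹ r · k)) ≈ ⊝ ((r · (r · 𝟙)) · k) ⊹ r · 𝟘
      lem r k = ≈-trans (⊝-cong (one r k)) (≈-sym (≈-trans (⊹-cong ≈-refl (·-zeroʳ r)) (⊹-idʳ _)))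
    kk-step n zero (suc (suc b)) = lem R (R ^ᵣ b) (K (suc n) (suc b)) (K (suc n) (suc (suc (suc b))))
      where
      one = solve 5 (λ n r p k k′ → n :* ((r :* (r :* p)) :* (k :+ r :* k′)) := n :* ((r :* (r :* (r :* p))) :* k′) :+ r :* (n :* ((r :* p) :* k))) ≈-refl
      lem : ∀ r p k k′ → ⊝ ((r · (r · p)) · (k ⊹ r · k′)) ≈ ⊝ ((r · (r · (r · p))) · k′) ⊹ r · ⊝ ((r · p) · k)
      lem r p k k′ = ≈-trans (neg-mul _) (≈-trans (one (⊝ 𝟙) r p k k′) (≈-sym (⊹-cong (neg-mul _) (·-cong ≈-refl (neg-mul _)))))
    kk-step n (suc a) (suc b) = kk-step n a b

    -- R^a u^(b-a) + R^b u^(a-b) is symmetric under exchange of u and R/u, hence a polynomial in z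
    -- without negative powers. The same fact is behind the sign in the second clause of `kk`.
    kk-antisym : ∀ n a b → R ^ᵣ a · kk n a b ⊹ R ^ᵣ b · kk n b a ≈ 𝟘
    kk-antisym n zero zero = lem
      where
      lem : 𝟙 · 𝟘 ⊹ 𝟙 · 𝟘 ≈ 𝟘
      lem = ≈-trans (⊹-cong (·-zeroʳ 𝟙) (·-zeroʳ 𝟙)) (⊹-idˡ 𝟘)
    kk-antisym n zero (suc b) = lem (R ^ᵣ suc b) _
      where
      lem : ∀ p k → 𝟙 · ⊝ (p · k) ⊹ p · k ≈ 𝟘
      lem p k = ≈-trans (⊹-cong (·-idˡ _) ≈-refl) (⊝-invˡ (p · k))
    kk-antisym n (suc a) zero = lem (R ^ᵣ suc a) _
      where
      lem : ∀ p k → p · k ⊹ 𝟙 · ⊝ (p · k) ≈ 𝟘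
      lem p k = ≈-trans (⊹-cong ≈-refl (·-idˡ _)) (⊝-invʳ (p · k))
    kk-antisym n (suc a) (suc b) = ≈-trans (lem R (R ^ᵣ a) (R ^ᵣ b) _ _) (≈-trans (·-cong ≈-refl (kk-antisym n a b)) (·-zeroʳ R))
      where
      lem = solve 5 (λ r p q x y → (r :* p) :* x :+ (r :* q) :* y := r :* (p :* x :+ q :* y)) ≈-refl

    kk-diag : ∀ n a → kk n a a ≈ 𝟘
    kk-diag n zero = ≈-refl
    kk-diag n (suc a) = kk-diag n a

    kk-step² : ∀ n a b → kk (suc (suc n)) a b ≈ kk n a (suc (suc b)) ⊹ (R ⊹ R) · kk n a b ⊹ (R · R) · kk n (suc (suc a)) b
    kk-step² n a b = ≈-trans (kk-step (suc n) a b) (≈-trans (⊹-cong (kk-step n a (suc b)) (·-cong ≈-refl (kk-step n (suc a) b))) (lem R _ _ _))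
      where
      lem = solve 4 (λ r x y z → (x :+ r :* y) :+ r :* (y :+ r :* z) := x :+ (r :+ r) :* y :+ (r :* r) :* z) ≈-refl

    -- The coefficient of z⁻ⁿ⁻¹ in (u^(2l+1) + (R/u)^(2l+1)) u^(b - a).
    Tk : ℕ → ℕ → ℕ → ℕ → E
    Tk n l a b = kk n a (odd l + b) ⊹ R ^ᵣ odd l · kk n (odd l + a) b

    Tk-0 : ∀ n a b → kk (suc n) a b ≈ Tk n 0 a b
    Tk-0 n a b = ≈-trans (kk-step n a b) (⊹-cong ≈-refl (lem R _))
      where
      lem = solve 2 (λ r x → r :* x := (r :* con 1) :* x) ≈-refl

    -- Multiplication by z² on S_l = u^(2l+1) + (R/u)^(2l+1): it gives S_{l+1} + 2R S_l + R²
    -- S_{l-1}. At l = 0 the last term folds back, because R times S with index -1 is S_0, and the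
    -- coefficient becomes 3R.
    TU : ℕ → (ℕ → E) → E
    TU zero T = T 1 ⊹ (R ⊹ R ⊹ R) · T 0
    TU (suc l) T = T (suc (suc l)) ⊹ (R ⊹ R) · T (suc l) ⊹ (R · R) · T l

    Tk-step² : ∀ n l a b → Tk (suc (suc n)) l a b ≈ TU l (λ l′ → Tk n l′ a b)
    Tk-step² n zero a b = ≈-trans (⊹-cong (kk-step² n a (suc b)) (·-cong ≈-refl (kk-step² n (suc a) b))) (lem R _ _ _ _)
      where
      lem = solve 5 (λ r x y z w → (x :+ (r :+ r) :* y :+ (r :* r) :* z) :+ (r :* con 1) :* (y :+ (r :+ r) :* z :+ (r :* r) :* w) := (x :+ (r :* (r :* (r :* con 1))) :* w) :+ (r :+ r :+ r) :* (y :+ (r :* con 1) :* z)) ≈-refl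
    Tk-step² n (suc l) a b = ≈-trans (⊹-cong (kk-step² n a (suc (suc (odd l + b)))) (·-cong ≈-refl (kk-step² n (suc (suc (odd l + a))) b))) (lem R (R ^ᵣ odd l) _ _ _ _ _ _)
      where
      lem : ∀ r p x y z x′ y′ z′ → (x ⊹ (r ⊹ r) · y ⊹ (r · r) · z) ⊹ (r · (r · p)) · (x′ ⊹ (r ⊹ r) · y′ ⊹ (r · r) · z′)
        ≈ (x ⊹ (r · (r · (r · (r · p)))) · z′) ⊹ (r ⊹ r) · (y ⊹ (r · (r · p)) · y′) ⊹ (r · r) · (z ⊹ p · x′)
      lem = solve 8 (λ r p x y z x′ y′ z′ → (x :+ (r :+ r) :* y :+ (r :* r) :* z) :+ (r :* (r :* p)) :* (x′ :+ (r :+ r) :* y′ :+ (r :* r) :* z′) := (x :+ (r :* (r :* (r :* (r :* p)))) :* z′) :+ (r :+ r) :* (y :+ (r :* (r :* p)) :* y′) :+ (r :* r) :* (z :+ p :* x′)) ≈-refl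

    -- The coefficient of S_l in z^(2i+1); each step multiplies by z² and so is the transpose of
    -- `TU`.
    tcR : ℕ → ℕ → E
    tcR zero zero = 𝟙
    tcR zero (suc l) = 𝟘
    tcR (suc i) zero = (R ⊹ R ⊹ R) · tcR i 0 ⊹ (R · R) · tcR i 1
    tcR (suc i) (suc l) = tcR i l ⊹ (R ⊹ R) · tcR i (suc l) ⊹ (R · R) · tcR i (suc (suc l))

    tcR-above : ∀ i l → i < l → tcR i l ≈ 𝟘
    tcR-above zero (suc l) _ = ≈-refl
    tcR-above (suc i) (suc l) (s≤s lt) = ≈-trans (⊹-cong (⊹-cong (tcR-above i l lt) (·-cong ≈-refl (tcR-above i (suc l) (≤-trans lt (n≤1+n l))))) (·-cong ≈-refl (tcR-above i (suc (suc l)) (≤-trans lt (≤-trans (n≤1+n l) (n≤1+n (suc l))))))) (lem (R ⊹ R) (R · R))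
      where
      lem = solve 2 (λ a b → con 0 :+ a :* con 0 :+ b :* con 0 := con 0) ≈-refl

    -- Summation by parts between `tcR` and `TU`; truncation at `N` leaves one boundary term on
    -- either side.
    tcR-shift : ∀ i N (T : ℕ → E) → sm (suc N) (λ l → tcR (suc i) l · T l) ⊹ tcR i N · T (suc N) ≈ sm (suc N) (λ l → tcR i l · TU l T) ⊹ (R · R) · (tcR i (suc N) · T N)
    tcR-shift i zero T = lem R (tcR i 0) (tcR i 1) (T 0) (T 1)
      where
      lem = solve 5 (λ r x y a b → ((r :+ r :+ r) :* x :+ (r :* r) :* y) :* a :+ con 0 :+ x :* b := (x :* (b :+ (r :+ r :+ r) :* a) :+ con 0) :+ (r :* r) :* (y :* a)) ≈-refl
    tcR-shift i (suc N) T = begin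
      sm (suc (suc N)) (λ l → tcR (suc i) l · T l) ⊹ tcR i (suc N) · T (suc (suc N)) ≈⟨ ⊹-cong (sm-last (suc N) (λ l → tcR (suc i) l · T l)) ≈-refl ⟩
      (s₁ ⊹ tcR (suc i) (suc N) · T (suc N)) ⊹ tcR i (suc N) · T (suc (suc N)) ≈⟨ lem₁ R s₁ (tcR i N) (tcR i (suc N)) (tcR i (suc (suc N))) (T (suc N)) (T (suc (suc N))) ⟩
      (s₁ ⊹ tcR i N · T (suc N)) ⊹ (((R ⊹ R) · tcR i (suc N) ⊹ (R · R) · tcR i (suc (suc N))) · T (suc N) ⊹ tcR i (suc N) · T (suc (suc N))) ≈⟨ ⊹-cong (tcR-shift i N T) ≈-refl ⟩
      (s₂ ⊹ (R · R) · (tcR i (suc N) · T N)) ⊹ (((R ⊹ R) · tcR i (suc N) ⊹ (R · R) · tcR i (suc (suc N))) · T (suc N) ⊹ tcR i (suc N) · T (suc (suc N))) ≈⟨ lem₂ R s₂ (tcR i (suc N)) (tcR i (suc (suc N))) (T N) (T (suc N)) (T (suc (suc N))) ⟩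
      (s₂ ⊹ tcR i (suc N) · TU (suc N) T) ⊹ (R · R) · (tcR i (suc (suc N)) · T (suc N)) ≈⟨ ⊹-cong (≈-sym (sm-last (suc N) (λ l → tcR i l · TU l T))) ≈-refl ⟩
      sm (suc (suc N)) (λ l → tcR i l · TU l T) ⊹ (R · R) · (tcR i (suc (suc N)) · T (suc N)) ∎
      where
      s₁ = sm (suc N) (λ l → tcR (suc i) l · T l)
      s₂ = sm (suc N) (λ l → tcR i l · TU l T)
      lem₁ = solve 7 (λ r s x y z a b → (s :+ (x :+ (r :+ r) :* y :+ (r :* r) :* z) :* a) :+ y :* b := (s :+ x :* a) :+ (((r :+ r) :* y :+ (r :* r) :* z) :* a :+ y :* b)) ≈-refl
      lem₂ = solve 7 (λ r s y z c a b → (s :+ (r :* r) :* (y :* c)) :+ (((r :+ r) :* y :+ (r :* r) :* z) :* a :+ y :* b) := (s :+ y :* (b :+ (r :+ r) :* a :+ (r :* r) :* c)) :+ (r :* r) :* (z :* a)) ≈-refl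

    -- Lowering the power of 1/z by 2i + 1 multiplies by z^(2i+1), which is expanded in the S_l.
    kk-expand : ∀ i N → i < N → ∀ n a b → kk (odd i + n) a b ≈ sm N (λ l → tcR i l · Tk n l a b)
    kk-expand zero (suc N) _ n a b = ≈-trans (Tk-0 n a b) (≈-trans (≈-sym (·-idˡ _)) (≈-trans (≈-sym (⊹-idʳ _)) (⊹-cong ≈-refl (≈-sym (sm-zero N (λ l _ → ·-zeroˡ _))))))
    kk-expand (suc i) (suc N) (s≤s lt) n a b = begin
      kk (suc (suc (odd i + n))) a b ≈⟨ ≈-reflexive (cong (λ z → kk z a b) (sym (trans (+-suc (odd i) (suc n)) (cong suc (+-suc (odd i) n))))) ⟩
      kk (odd i + suc (suc n)) a b ≈⟨ kk-expand i (suc N) (≤-trans lt (n≤1+n N)) (suc (suc n)) a b ⟩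
      sm (suc N) (λ l → tcR i l · Tk (suc (suc n)) l a b) ≈⟨ sm-cong (suc N) (λ l _ → ·-cong (≈-refl {tcR i l}) (Tk-step² n l a b)) ⟩
      sm (suc N) (λ l → tcR i l · TU l T) ≈⟨ pad _ (≈-trans (·-cong ≈-refl (≈-trans (·-cong (tcR-above i (suc N) (≤-trans lt (n≤1+n N))) ≈-refl) (·-zeroˡ _))) (·-zeroʳ _)) ⟩
      sm (suc N) (λ l → tcR i l · TU l T) ⊹ (R · R) · (tcR i (suc N) · T N) ≈⟨ ≈-sym (tcR-shift i N T) ⟩
      sm (suc N) (λ l → tcR (suc i) l · T l) ⊹ tcR i N · T (suc N) ≈⟨ ≈-sym (pad _ (≈-trans (·-cong (tcR-above i N lt) ≈-refl) (·-zeroˡ _))) ⟩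
      sm (suc N) (λ l → tcR (suc i) l · T l) ∎
      where
      T = λ l → Tk n l a b
      pad : ∀ x {y} → y ≈ 𝟘 → x ≈ x ⊹ y
      pad x e = ≈-trans (≈-sym (⊹-idʳ x)) (⊹-cong ≈-refl (≈-sym e))

-- The coefficient of u^(2l+1) + (R/u)^(2l+1) in (u + R/u)^(2i+1), without its power of R.
tc : ℕ → ℕ → ℕ
tc zero zero = 1
tc zero (suc l) = 0
tc (suc i) zero = (tc i 0 + tc i 0 + tc i 0) + tc i 1
tc (suc i) (suc l) = tc i l + (tc i (suc l) + tc i (suc l)) + tc i (suc (suc l))

odd+odd : ∀ l l′ → odd l + odd l′ ≡ even (suc (l + l′))
odd+odd zero l′ = cong suc (odd-even l′)
odd+odd (suc l) l′ = cong (λ z → suc (suc z)) (odd+odd l l′)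

even-mono : ∀ {a b} → a < b → even a < even b
even-mono {zero} {suc b} _ = s≤s z≤n
even-mono {suc a} {suc b} (s≤s lt) = s≤s (s≤s (even-mono lt))

odd-pos : ∀ l → 1 ≤ odd l
odd-pos zero = s≤s z≤n
odd-pos (suc l) = s≤s z≤n

-- The explicit solution of Tutte's equation

module TutteSolution (𝓡 : CommutativeRing 0ℓ 0ℓ) (R : CommutativeRing.Carrier 𝓡) (J₀ : ℕ) (g : ℕ → CommutativeRing.Carrier 𝓡) where
  open RingNotation 𝓡
  open PathAlgebra 𝓡
  open Paths R

  J : ℕ
  J = suc J₀

  -- With S_l = u^(2l+1) + (R/u)^(2l+1): Σ g_i z^(2i+1) = Σ q_l S_l, and z minus this sum is Σ y_l
  -- S_l. Then `w l` is the coefficient of u^(-2l-1) in F = Σ y_l (R/u)^(2l+1), and `f n` that of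
  -- z^(-n-1).
  q : ℕ → E
  q l = sm J (λ i → g i · tcR i l)

  y : ℕ → E
  y zero = 𝟙 ⊹ ⊝ q 0
  y (suc l) = ⊝ q (suc l)

  w : ℕ → E
  w l = R ^ᵣ odd l · y l

  f : ℕ → E
  f n = sm J (λ l → w l · K (suc n) (odd l))

  y+q : ∀ {T : ℕ → E} → sm J (λ l → y l · T l) ⊹ sm J (λ l → q l · T l) ≈ T 0
  y+q {T} = begin
    (y 0 · T 0 ⊹ sm J₀ (λ l → y (suc l) · T (suc l))) ⊹ (q 0 · T 0 ⊹ sm J₀ (λ l → q (suc l) · T (suc l)))
      ≈⟨ lem (y 0 · T 0) (sm J₀ (λ l → y (suc l) · T (suc l))) (q 0 · T 0) (sm J₀ (λ l → q (suc l) · T (suc l))) ⟩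
    (y 0 · T 0 ⊹ q 0 · T 0) ⊹ (sm J₀ (λ l → y (suc l) · T (suc l)) ⊹ sm J₀ (λ l → q (suc l) · T (suc l)))
      ≈⟨ ⊹-cong zer (≈-trans (≈-sym (sm-+ J₀ (λ l → y (suc l) · T (suc l)) (λ l → q (suc l) · T (suc l)))) (sm-zero J₀ (λ l _ → can (q (suc l)) (T (suc l))))) ⟩
    T 0 ⊹ 𝟘 ≈⟨ ⊹-idʳ _ ⟩
    T 0 ∎
    where
    lem = solve 4 (λ a b c d → (a :+ b) :+ (c :+ d) := (a :+ c) :+ (b :+ d)) ≈-refl
    fac = solve 3 (λ n x t → n :* x :* t :+ x :* t := (n :+ con 1) :* (x :* t)) ≈-refl
    can : ∀ x t → ⊝ x · t ⊹ x · t ≈ 𝟘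
    can x t = ≈-trans (⊹-cong (·-cong (neg-mul x) ≈-refl) ≈-refl) (≈-trans (fac (⊝ 𝟙) x t) (≈-trans (·-cong (⊝-invˡ 𝟙) ≈-refl) (·-zeroˡ _)))
    spl = solve 3 (λ a n t → (con 1 :+ n) :* t :+ a :* t := t :+ (n :* t :+ a :* t)) ≈-refl
    zer : y 0 · T 0 ⊹ q 0 · T 0 ≈ T 0
    zer = ≈-trans (spl (q 0) (⊝ q 0) (T 0)) (≈-trans (⊹-cong ≈-refl (can (q 0) (T 0))) (⊹-idʳ _))

  gf : ∀ n → sm J (λ i → g i · f (odd i + n)) ≈ sm J (λ l′ → w l′ · sm J (λ l → q l · Tk n l (odd l′) 0))
  gf n = begin
    sm J (λ i → g i · f (odd i + n))
      ≈⟨ sm-cong J (λ i lt → ≈-trans (·-cong (≈-refl {g i}) (sm-cong J (λ l′ _ → ·-cong (≈-refl {w l′}) (kk-expand i J lt n (odd l′) 0)))) (sm-*ˡ J (g i) (λ l′ → w l′ · sm J (λ l → tcR i l · Tk n l (odd l′) 0)))) ⟩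
    sm J (λ i → sm J (λ l′ → g i · (w l′ · sm J (λ l → tcR i l · Tk n l (odd l′) 0))))
      ≈⟨ sm-swap J J (λ i l′ → g i · (w l′ · sm J (λ l → tcR i l · Tk n l (odd l′) 0))) ⟩
    sm J (λ l′ → sm J (λ i → g i · (w l′ · sm J (λ l → tcR i l · Tk n l (odd l′) 0))))
      ≈⟨ sm-cong J (λ l′ _ → inner l′) ⟩
    sm J (λ l′ → w l′ · sm J (λ l → q l · Tk n l (odd l′) 0)) ∎
    where
    asc = solve 3 (λ a b c → a :* (b :* c) := b :* (a :* c)) ≈-refl
    asc₂ = solve 3 (λ a b c → a :* (b :* c) := c :* (a :* b)) ≈-refl
    com = solve 2 (λ a b → a :* b := b :* a) ≈-refl
    inner : ∀ l′ → sm J (λ i → g i · (w l′ · sm J (λ l → tcR i l · Tk n l (odd l′) 0))) ≈ w l′ · sm J (λ l → q l · Tk n l (odd l′) 0)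
    inner l′ = begin
      sm J (λ i → g i · (w l′ · sm J (λ l → tcR i l · T l))) ≈⟨ sm-cong J (λ i _ → asc (g i) (w l′) (sm J (λ l → tcR i l · T l))) ⟩
      sm J (λ i → w l′ · (g i · sm J (λ l → tcR i l · T l))) ≈⟨ ≈-sym (sm-*ˡ J (w l′) (λ i → g i · sm J (λ l → tcR i l · T l))) ⟩
      w l′ · sm J (λ i → g i · sm J (λ l → tcR i l · T l)) ≈⟨ ·-cong ≈-refl (sm-cong J (λ i _ → ≈-trans (sm-*ˡ J (g i) (λ l → tcR i l · T l)) (sm-cong J (λ l _ → asc₂ (g i) (tcR i l) (T l))))) ⟩
      w l′ · sm J (λ i → sm J (λ l → T l · (g i · tcR i l))) ≈⟨ ·-cong ≈-refl (sm-swap J J (λ i l → T l · (g i · tcR i l))) ⟩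
      w l′ · sm J (λ l → sm J (λ i → T l · (g i · tcR i l))) ≈⟨ ·-cong ≈-refl (sm-cong J (λ l _ → ≈-trans (≈-sym (sm-*ˡ J (T l) (λ i → g i · tcR i l))) (com (T l) (q l)))) ⟩
      w l′ · sm J (λ l → q l · T l) ∎
      where
      T = λ l → Tk n l (odd l′) 0

  -- The coefficient of z^(-n) in F².
  square : ℕ → E
  square n = sm J (λ l′ → w l′ · sm J (λ l → w l · K n (odd l + odd l′)))

  -- Put P = z - Σ g_i z^(2i+1) = F + F′, where F′ is F with u and R/u exchanged. Then PF - F² = F
  -- F′ is symmetric, hence a polynomial in z, and the coefficients of z^(-n-1) in PF and F² agree.
  f-step : ∀ n → f (suc n) ≈ square (suc n) ⊹ sm J (λ i → g i · f (odd i + n))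
  f-step n = begin
    f (suc n) ≈⟨ sm-cong J (λ l′ _ → ·-cong (≈-refl {w l′}) (≈-trans (Tk-0 n (odd l′) 0) (≈-sym (y+q {λ l → Tk n l (odd l′) 0})))) ⟩
    sm J (λ l′ → w l′ · (sm J (λ l → y l · Tk n l (odd l′) 0) ⊹ sm J (λ l → q l · Tk n l (odd l′) 0)))
      ≈⟨ ≈-trans (sm-cong J (λ l′ _ → ·-distribˡ (w l′) (sm J (λ l → y l · Tk n l (odd l′) 0)) (sm J (λ l → q l · Tk n l (odd l′) 0)))) (sm-+ J (λ l′ → w l′ · sm J (λ l → y l · Tk n l (odd l′) 0)) (λ l′ → w l′ · sm J (λ l → q l · Tk n l (odd l′) 0))) ⟩
    sm J (λ l′ → w l′ · sm J (λ l → y l · Tk n l (odd l′) 0)) ⊹ sm J (λ l′ → w l′ · sm J (λ l → q l · Tk n l (odd l′) 0))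
      ≈⟨ ⊹-cong main (≈-sym (gf n)) ⟩
    square (suc n) ⊹ sm J (λ i → g i · f (odd i + n)) ∎
    where
    -- The terms of F F′; `kk-antisym` cancels them in pairs.
    c : ℕ → ℕ → E
    c l′ l = w l′ · (y l · kk n (odd l′) (odd l + 0))
    dist = solve 5 (λ a b x p k → a :* (b :* (x :+ p :* k)) := a :* (b :* x) :+ a :* ((p :* b) :* k)) ≈-refl
    anti : ∀ l′ l → c l′ l ⊹ c l l′ ≈ 𝟘
    anti l′ l = ≈-trans (⊹-cong (≈-reflexive (cong (λ z → w l′ · (y l · kk n (odd l′) z)) (+-identityʳ (odd l)))) (≈-reflexive (cong (λ z → w l · (y l′ · kk n (odd l) z)) (+-identityʳ (odd l′)))))
      (≈-trans (lem (R ^ᵣ odd l′) (y l′) (y l) _ (R ^ᵣ odd l) _) (≈-trans (·-cong ≈-refl (kk-antisym n (odd l′) (odd l))) (·-zeroʳ _)))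
      where
      lem = solve 6 (λ p a b k p′ k′ → (p :* a) :* (b :* k) :+ (p′ :* b) :* (a :* k′) := (a :* b) :* (p :* k :+ p′ :* k′)) ≈-refl
    diag : ∀ l → c l l ≈ 𝟘
    diag l = ≈-trans (·-cong ≈-refl (≈-trans (·-cong ≈-refl (≈-trans (≈-reflexive (cong (kk n (odd l)) (+-identityʳ (odd l)))) (kk-diag n (odd l)))) (·-zeroʳ _))) (·-zeroʳ _)
    row : ∀ l′ → w l′ · sm J (λ l → y l · Tk n l (odd l′) 0) ≈ sm J (c l′) ⊹ w l′ · sm J (λ l → w l · K (suc n) (odd l + odd l′))
    row l′ = ≈-trans (sm-*ˡ J (w l′) (λ l → y l · Tk n l (odd l′) 0)) (≈-trans (sm-cong J (λ l _ → dist (w l′) (y l) (kk n (odd l′) (odd l + 0)) (R ^ᵣ odd l) (K (suc n) (odd l + odd l′))))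
      (≈-trans (sm-+ J (c l′) (λ l → w l′ · (w l · K (suc n) (odd l + odd l′)))) (⊹-cong ≈-refl (≈-sym (sm-*ˡ J (w l′) (λ l → w l · K (suc n) (odd l + odd l′)))))))
    main : sm J (λ l′ → w l′ · sm J (λ l → y l · Tk n l (odd l′) 0)) ≈ square (suc n)
    main = ≈-trans (sm-cong J (λ l′ _ → row l′)) (≈-trans (sm-+ J (λ l′ → sm J (c l′)) (λ l′ → w l′ · sm J (λ l → w l · K (suc n) (odd l + odd l′)))) (≈-trans (⊹-cong (sm-antisym J c anti diag) ≈-refl) (⊹-idˡ _)))

  K-product-odd : ∀ N l l′ → cv (λ a → K (suc a) (odd l)) (λ a → K (suc a) (odd l′)) N ≈ K (suc (suc N)) (odd l + odd l′)
  K-product-odd N l l′ = begin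
    cv (λ a → K (suc a) (odd l)) (λ a → K (suc a) (odd l′)) N
      ≈⟨ ≈-sym (≈-trans (⊹-cong ≈-refl (≈-trans (·-cong (≈-refl {K (suc (suc N)) (odd l)}) (K-above 0 (odd l′) (odd-pos l′))) (·-zeroʳ _))) (⊹-idʳ _)) ⟩
    cv (λ a → K (suc a) (odd l)) (λ a → K (suc a) (odd l′)) N ⊹ K (suc (suc N)) (odd l) · K 0 (odd l′)
      ≈⟨ ≈-sym (cv-last (λ a → K (suc a) (odd l)) (λ a → K a (odd l′)) N) ⟩
    cv (λ a → K (suc a) (odd l)) (λ a → K a (odd l′)) (suc N)
      ≈⟨ ≈-sym (≈-trans (⊹-cong (≈-trans (·-cong (K-above 0 (odd l) (odd-pos l)) (≈-refl {K (suc (suc N)) (odd l′)})) (·-zeroˡ _)) ≈-refl) (⊹-idˡ _)) ⟩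
    cv (λ a → K a (odd l)) (λ a → K a (odd l′)) (suc (suc N)) ≈⟨ K-product (suc (suc N)) (odd l) (odd l′) ⟩
    K (suc (suc N)) (odd l + odd l′) ∎

  square-cv : ∀ N → square (suc (suc N)) ≈ cv f f N
  square-cv N = ≈-sym (begin
    cv f f N ≈⟨ cv-smˡ J (λ l′ a → w l′ · K (suc a) (odd l′)) f N ⟩
    sm J (λ l′ → cv (λ a → w l′ · K (suc a) (odd l′)) f N) ≈⟨ sm-cong J (λ l′ _ → ≈-trans (cv-*ˡ (w l′) (λ a → K (suc a) (odd l′)) f N) (·-cong (≈-refl {w l′}) (row l′))) ⟩
    sm J (λ l′ → w l′ · sm J (λ l → w l · K (suc (suc N)) (odd l + odd l′))) ∎)
    where
    row : ∀ l′ → cv (λ a → K (suc a) (odd l′)) f N ≈ sm J (λ l → w l · K (suc (suc N)) (odd l + odd l′))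
    row l′ = ≈-trans (cv-comm (λ a → K (suc a) (odd l′)) f N) (≈-trans (cv-smˡ J (λ l a → w l · K (suc a) (odd l)) (λ a → K (suc a) (odd l′)) N)
      (sm-cong J (λ l _ → ≈-trans (cv-*ˡ (w l) (λ a → K (suc a) (odd l)) (λ a → K (suc a) (odd l′)) N) (·-cong (≈-refl {w l}) (K-product-odd N l l′)))))

  square-1 : square 1 ≈ 𝟘
  square-1 = sm-zero J (λ l′ _ → ≈-trans (·-cong (≈-refl {w l′}) (sm-zero J (λ l _ → ≈-trans (·-cong (≈-refl {w l}) (K-above 1 (odd l + odd l′) (+-mono-≤ (odd-pos l) (odd-pos l′)))) (·-zeroʳ _)))) (·-zeroʳ _))

  q-above : ∀ l → J ≤ l → q l ≈ 𝟘
  q-above l le = sm-zero J (λ i lt → ≈-trans (·-cong (≈-refl {g i}) (tcR-above i l (≤-trans lt le))) (·-zeroʳ _))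

  w-above : ∀ l → J ≤ l → w l ≈ 𝟘
  w-above (suc l) le = ≈-trans (·-cong (≈-refl {R ^ᵣ odd (suc l)}) (≈-trans (⊝-cong (q-above (suc l) le)) (RingP.-0#≈0# ring))) (·-zeroʳ _)

  pow-+ : ∀ a b → R ^ᵣ (a + b) ≈ R ^ᵣ a · R ^ᵣ b
  pow-+ zero b = ≈-sym (·-idˡ _)
  pow-+ (suc a) b = ≈-trans (·-cong ≈-refl (pow-+ a b)) (asc R _ _)
    where
    asc = solve 3 (λ a b c → a :* (b :* c) := a :* b :* c) ≈-refl

  -- By homogeneity `tcR i l` is `tc i l` times R^(i-l); multiplying by R^l avoids negative
  -- exponents.
  tcR-tc : ∀ i l → R ^ᵣ l · tcR i l ≈ nat (tc i l) · R ^ᵣ i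
  tcR-tc zero zero = ·-cong (≈-sym (⊹-idʳ 𝟙)) ≈-refl
  tcR-tc zero (suc l) = ≈-trans (·-zeroʳ _) (≈-sym (·-zeroˡ _))
  tcR-tc (suc i) zero = begin
    𝟙 · ((R ⊹ R ⊹ R) · tcR i 0 ⊹ (R · R) · tcR i 1) ≈⟨ lem R (tcR i 0) (tcR i 1) ⟩
    R · ((𝟙 · tcR i 0 ⊹ 𝟙 · tcR i 0 ⊹ 𝟙 · tcR i 0) ⊹ (R · 𝟙) · tcR i 1) ≈⟨ ·-cong ≈-refl (⊹-cong (⊹-cong (⊹-cong (tcR-tc i 0) (tcR-tc i 0)) (tcR-tc i 0)) (tcR-tc i 1)) ⟩
    R · ((nat (tc i 0) · p ⊹ nat (tc i 0) · p ⊹ nat (tc i 0) · p) ⊹ nat (tc i 1) · p) ≈⟨ lem₂ R p (nat (tc i 0)) (nat (tc i 1)) ⟩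
    ((nat (tc i 0) ⊹ nat (tc i 0) ⊹ nat (tc i 0)) ⊹ nat (tc i 1)) · (R · p) ≈⟨ ·-cong (≈-sym (≈-trans (nat-+ (tc i 0 + tc i 0 + tc i 0) (tc i 1)) (⊹-cong (≈-trans (nat-+ (tc i 0 + tc i 0) (tc i 0)) (⊹-cong (nat-+ (tc i 0) (tc i 0)) ≈-refl)) ≈-refl))) ≈-refl ⟩
    nat (tc (suc i) 0) · (R · p) ∎
    where
    p = R ^ᵣ i
    lem = solve 3 (λ r a b → con 1 :* ((r :+ r :+ r) :* a :+ (r :* r) :* b) := r :* ((con 1 :* a :+ con 1 :* a :+ con 1 :* a) :+ (r :* con 1) :* b)) ≈-refl
    lem₂ = solve 4 (λ r p a b → r :* ((a :* p :+ a :* p :+ a :* p) :+ b :* p) := ((a :+ a :+ a) :+ b) :* (r :* p)) ≈-refl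
  tcR-tc (suc i) (suc l) = begin
    (R · s) · (tcR i l ⊹ (R ⊹ R) · tcR i (suc l) ⊹ (R · R) · tcR i (suc (suc l))) ≈⟨ lem R s (tcR i l) (tcR i (suc l)) (tcR i (suc (suc l))) ⟩
    R · (s · tcR i l ⊹ ((R · s) · tcR i (suc l) ⊹ (R · s) · tcR i (suc l)) ⊹ (R · (R · s)) · tcR i (suc (suc l))) ≈⟨ ·-cong ≈-refl (⊹-cong (⊹-cong (tcR-tc i l) (⊹-cong (tcR-tc i (suc l)) (tcR-tc i (suc l)))) (tcR-tc i (suc (suc l)))) ⟩
    R · (nat (tc i l) · p ⊹ (nat (tc i (suc l)) · p ⊹ nat (tc i (suc l)) · p) ⊹ nat (tc i (suc (suc l))) · p) ≈⟨ lem₂ R p (nat (tc i l)) (nat (tc i (suc l))) (nat (tc i (suc (suc l)))) ⟩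
    (nat (tc i l) ⊹ (nat (tc i (suc l)) ⊹ nat (tc i (suc l))) ⊹ nat (tc i (suc (suc l)))) · (R · p) ≈⟨ ·-cong (≈-sym (≈-trans (nat-+ (tc i l + (tc i (suc l) + tc i (suc l))) (tc i (suc (suc l)))) (⊹-cong (≈-trans (nat-+ (tc i l) (tc i (suc l) + tc i (suc l))) (⊹-cong ≈-refl (nat-+ (tc i (suc l)) (tc i (suc l))))) ≈-refl))) ≈-refl ⟩
    nat (tc (suc i) (suc l)) · (R · p) ∎
    where
    p = R ^ᵣ i
    s = R ^ᵣ l
    lem = solve 5 (λ r s a b c → (r :* s) :* (a :+ (r :+ r) :* b :+ (r :* r) :* c) := r :* (s :* a :+ ((r :* s) :* b :+ (r :* s) :* b) :+ (r :* (r :* s)) :* c)) ≈-refl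
    lem₂ = solve 5 (λ r p a b c → r :* (a :* p :+ (b :* p :+ b :* p) :+ c :* p) := (a :+ (b :+ b) :+ c) :* (r :* p)) ≈-refl

  odd-split : ∀ l → odd l ≡ l + suc l
  odd-split zero = refl
  odd-split (suc l) = cong suc (trans (cong suc (odd-split l)) (sym (+-suc l (suc l))))

  -- The sum in the second equation of the theorem, with i + 1 in the role of the summation index
  -- there, l = j, R = 1 + V_0, and weights for all even degrees up to a bound.
  V : ℕ → E
  V l = sm J (λ i → g i · (nat (tc i l) · R ^ᵣ suc (i + l)))

  qV : ∀ l → R ^ᵣ odd l · q l ≈ V l
  qV l = ≈-trans (sm-*ˡ J (R ^ᵣ odd l) (λ i → g i · tcR i l)) (sm-cong J (λ i _ → begin
    R ^ᵣ odd l · (g i · tcR i l) ≈⟨ ·-cong (≈-trans (≈-reflexive (cong (R ^ᵣ_) (odd-split l))) (pow-+ l (suc l))) ≈-refl ⟩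
    (R ^ᵣ l · R ^ᵣ suc l) · (g i · tcR i l) ≈⟨ lem (R ^ᵣ l) (R ^ᵣ suc l) (g i) (tcR i l) ⟩
    g i · ((R ^ᵣ l · tcR i l) · R ^ᵣ suc l) ≈⟨ ·-cong ≈-refl (·-cong (tcR-tc i l) ≈-refl) ⟩
    g i · ((nat (tc i l) · R ^ᵣ i) · R ^ᵣ suc l) ≈⟨ ·-cong ≈-refl (≈-trans (asc _ _ _) (·-cong ≈-refl (≈-trans (≈-sym (pow-+ i (suc l))) (≈-reflexive (cong (R ^ᵣ_) (+-suc i l)))))) ⟩
    g i · (nat (tc i l) · R ^ᵣ suc (i + l)) ∎))
    where
    lem = solve 4 (λ a b c d → (a :* b) :* (c :* d) := c :* ((a :* d) :* b)) ≈-refl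
    asc = solve 3 (λ a b c → (a :* b) :* c := a :* (b :* c)) ≈-refl

  module Unit (Ry : R · y 0 ≈ 𝟙) where

    w-0 : w 0 ≈ 𝟙
    w-0 = ≈-trans (lem R (y 0)) Ry
      where
      lem = solve 2 (λ r x → (r :* con 1) :* x := r :* x) ≈-refl

    -- Only u^(-1) contributes to z^(-1), with coefficient w_0 = R y_0; the condition R y_0 = 1 is
    -- this normalization.
    f-0 : f 0 ≈ 𝟙
    f-0 = ≈-trans (⊹-cong (≈-trans (·-cong w-0 (K-diag 1)) (·-idˡ 𝟙)) (sm-zero J₀ (λ l _ → ≈-trans (·-cong (≈-refl {w (suc l)}) (K-above 1 (odd (suc l)) (s≤s (s≤s z≤n)))) (·-zeroʳ _)))) (⊹-idʳ 𝟙)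

    zl : ∀ {a} b → a ≈ 𝟘 → a · b ≈ 𝟘
    zl b e = ≈-trans (·-cong e ≈-refl) (·-zeroˡ b)

    -- The coefficient of u^(-2s-2) in F² - zF.
    Q : ℕ → E
    Q s = cv w w s ⊹ ⊝ (w (suc s) ⊹ R · w s)

    -- The coefficient of z^(-2T-2) in F² - zF, computed from the expansions in 1/z and in 1/u; `e`
    -- is the amount by which the recursion for `f` exceeds the convolution.
    Q-sum : ∀ T {e} → f (even (suc T)) ≈ cv f f (even T) ⊹ e → sm (suc (J + T)) (λ s → K (even (suc T)) (even (suc s)) · Q s) ⊹ e ≈ 𝟘
    Q-sum T {e} he = begin
      sm M (λ s → κ s · Q s) ⊹ e ≈⟨ ⊹-cong (≈-trans (sm-cong M (λ s _ → ·-distribˡ (κ s) (cv w w s) (⊝ (w (suc s) ⊹ R · w s)))) (sm-+ M (λ s → κ s · cv w w s) (λ s → κ s · ⊝ (w (suc s) ⊹ R · w s)))) ≈-refl ⟩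
      (sm M (λ s → κ s · cv w w s) ⊹ sm M (λ s → κ s · ⊝ (w (suc s) ⊹ R · w s))) ⊹ e ≈⟨ ⊹-cong (⊹-cong sq (≈-trans (sm-cong M (λ s _ → mv (κ s) (w (suc s) ⊹ R · w s))) (≈-trans (≈-sym (sm-*ˡ M (⊝ 𝟙) (λ s → κ s · (w (suc s) ⊹ R · w s)))) (·-cong ≈-refl fe)))) ≈-refl ⟩
      (cv f f (even T) ⊹ ⊝ 𝟙 · f (even (suc T))) ⊹ e ≈⟨ ⊹-cong (⊹-cong ≈-refl (·-cong ≈-refl he)) ≈-refl ⟩
      (cv f f (even T) ⊹ ⊝ 𝟙 · (cv f f (even T) ⊹ e)) ⊹ e ≈⟨ fin (⊝ 𝟙) _ e ⟩
      (𝟙 ⊹ ⊝ 𝟙) · (cv f f (even T) ⊹ e) ≈⟨ ≈-trans (·-cong (⊝-invʳ 𝟙) ≈-refl) (·-zeroˡ _) ⟩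
      𝟘 ∎
      where
      M = suc (J + T)
      n = even (suc T)
      κ = λ s → K n (even (suc s))
      fin = solve 3 (λ m c e → (c :+ m :* (c :+ e)) :+ e := (con 1 :+ m) :* (c :+ e)) ≈-refl
      swp = solve 3 (λ m k x → k :* (m :* x) := m :* (k :* x)) ≈-refl
      mv : ∀ k x → k · ⊝ x ≈ ⊝ 𝟙 · (k · x)
      mv k x = ≈-trans (·-cong ≈-refl (neg-mul x)) (swp (⊝ 𝟙) k x)
      κ-above : ∀ s → M ≤ s → κ s ≈ 𝟘
      κ-above s le = K-above n (even (suc s)) (even-mono (s≤s (≤-trans (s≤s (m≤n+m T J)) le)))
      J≤M : M ≡ J + suc T
      J≤M = sym (+-suc J T)
      ext : ∀ {F : ℕ → E} → (∀ l → J ≤ l → F l ≈ 𝟘) → sm J F ≈ sm M F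
      ext {F} z = ≈-trans (≈-sym (sm-extend J (suc T) z)) (≈-reflexive (cong (λ k → sm k F) (sym J≤M)))
      sq : sm M (λ s → κ s · cv w w s) ≈ cv f f (even T)
      sq = begin
        sm M (λ s → κ s · cv w w s) ≈⟨ cv-triangle M w w κ κ-above M ≤-refl ⟩
        sm M (λ l → w l · sm M (λ l′ → w l′ · κ (l + l′))) ≈⟨ ≈-sym (ext {λ l → w l · sm M (λ l′ → w l′ · κ (l + l′))} (λ l le → zl (sm M (λ l′ → w l′ · κ (l + l′))) (w-above l le))) ⟩
        sm J (λ l → w l · sm M (λ l′ → w l′ · κ (l + l′))) ≈⟨ sm-cong J (λ l _ → ·-cong (≈-refl {w l}) (≈-trans (≈-sym (ext {λ l′ → w l′ · κ (l + l′)} (λ l′ le → zl (κ (l + l′)) (w-above l′ le))))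
            (sm-cong J (λ l′ _ → ·-cong (≈-refl {w l′}) (≈-reflexive (cong (K n) (trans (cong (λ z → even (suc z)) (+-comm l l′)) (sym (odd+odd l′ l))))))))) ⟩
        square (suc (suc (even T))) ≈⟨ square-cv (even T) ⟩
        cv f f (even T) ∎
      fe : sm M (λ s → κ s · (w (suc s) ⊹ R · w s)) ≈ f n
      fe = begin
        sm M (λ s → κ s · (w (suc s) ⊹ R · w s)) ≈⟨ ≈-trans (sm-cong M (λ s _ → spl (κ s) (w (suc s)) R (w s))) (sm-+ M (λ s → w (suc s) · κ s) (λ s → w s · (R · κ s))) ⟩
        sm M (λ s → w (suc s) · κ s) ⊹ sm M (λ s → w s · (R · κ s)) ≈⟨ ⊹-cong (≈-sym (≈-trans (⊹-cong (·-zeroʳ (w 0)) ≈-refl) (⊹-idˡ _))) ≈-refl ⟩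
        sm (suc M) (λ l → w l · K n (even l)) ⊹ sm M (λ s → w s · (R · κ s)) ≈⟨ ⊹-cong (≈-trans (sm-last M (λ l → w l · K n (even l))) (≈-trans (⊹-cong ≈-refl (zl (K n (even M)) (w-above M (≤-trans (m≤m+n J (suc T)) (≤-reflexive (sym J≤M)))))) (⊹-idʳ _))) ≈-refl ⟩
        sm M (λ l → w l · K n (even l)) ⊹ sm M (λ s → w s · (R · κ s)) ≈⟨ ≈-sym (sm-+ M (λ l → w l · K n (even l)) (λ s → w s · (R · κ s))) ⟩
        sm M (λ l → w l · K n (even l) ⊹ w l · (R · κ l)) ≈⟨ sm-cong M (λ l _ → ≈-trans (≈-sym (·-distribˡ (w l) (K n (even l)) (R · κ l))) (·-cong (≈-refl {w l}) (≈-reflexive (cong (K (suc n)) (sym (odd-even l)))))) ⟩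
        sm M (λ l → w l · K (suc n) (odd l)) ≈⟨ ≈-sym (ext {λ l → w l · K (suc n) (odd l)} (λ l le → zl (K (suc n) (odd l)) (w-above l le))) ⟩
        f n ∎
        where
        spl = solve 4 (λ k a r b → k :* (a :+ r :* b) := a :* k :+ b :* (r :* k)) ≈-refl

    -- `K` is unitriangular, so once the earlier Q_s vanish the sum reduces to Q_T.
    Q-value : ∀ T {e} → f (even (suc T)) ≈ cv f f (even T) ⊹ e → (∀ s → s < T → Q s ≈ 𝟘) → Q T ⊹ e ≈ 𝟘
    Q-value T {e} he z = ≈-trans (⊹-cong (≈-sym tri) ≈-refl) (Q-sum T he)
      where
      κ = λ s → K (even (suc T)) (even (suc s))
      tri : sm (suc (J + T)) (λ s → κ s · Q s) ≈ Q T
      tri = begin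
        sm (suc (J + T)) (λ s → κ s · Q s) ≈⟨ ≈-reflexive (cong (λ k → sm k (λ s → κ s · Q s)) (cong suc (+-comm J T))) ⟩
        sm (suc T + J) (λ s → κ s · Q s) ≈⟨ sm-extend (suc T) J {λ s → κ s · Q s} (λ s le → zl (Q s) (K-above (even (suc T)) (even (suc s)) (even-mono (s≤s le)))) ⟩
        sm (suc T) (λ s → κ s · Q s) ≈⟨ sm-last T (λ s → κ s · Q s) ⟩
        sm T (λ s → κ s · Q s) ⊹ κ T · Q T ≈⟨ ⊹-cong (sm-zero T (λ s lt → ≈-trans (·-cong (≈-refl {κ s}) (z s lt)) (·-zeroʳ _))) (≈-trans (·-cong (K-diag (even (suc T))) ≈-refl) (·-idˡ _)) ⟩
        𝟘 ⊹ Q T ≈⟨ ⊹-idˡ _ ⟩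
        Q T ∎

    U : ℕ → E
    U zero = R ⊹ ⊝ 𝟙
    U (suc l) = ⊝ w (suc l)

    Z : ℕ → E
    Z zero = 𝟘
    Z (suc T) = cv U (U ∘ suc) T

    -- With w_0 = 1 and R = 1 + U_0, the two terms of the square containing w_0 combine with the
    -- terms of zF. Thus Q_T = 0 reads V_T = V_{T+1} + Σ V_j V_{T-j} over 0 ≤ j < T.
    Q-U : ∀ T → Q T ≈ (U (suc T) ⊹ ⊝ U T) ⊹ Z T
    Q-U zero = begin
      w 0 · w 0 ⊹ ⊝ (w 1 ⊹ R · w 0) ≈⟨ ⊹-cong (≈-trans (·-cong w-0 w-0) (·-idˡ 𝟙)) (⊝-cong (⊹-cong ≈-refl (≈-trans (·-cong ≈-refl w-0) (idr R)))) ⟩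
      𝟙 ⊹ ⊝ (w 1 ⊹ R) ≈⟨ ⊹-cong ≈-refl (≈-trans (neg-mul _) (lem (⊝ 𝟙) (w 1) R)) ⟩
      𝟙 ⊹ (⊝ 𝟙 · w 1 ⊹ ⊝ 𝟙 · R) ≈⟨ ⊹-cong (≈-sym sq) ≈-refl ⟩
      ⊝ 𝟙 · ⊝ 𝟙 ⊹ (⊝ 𝟙 · w 1 ⊹ ⊝ 𝟙 · R) ≈⟨ fin (⊝ 𝟙) (w 1) R ⟩
      (⊝ 𝟙 · w 1 ⊹ ⊝ 𝟙 · (R ⊹ ⊝ 𝟙)) ⊹ 𝟘 ≈⟨ ⊹-cong (⊹-cong (≈-sym (neg-mul _)) (≈-sym (neg-mul _))) ≈-refl ⟩
      (⊝ w 1 ⊹ ⊝ (R ⊹ ⊝ 𝟙)) ⊹ 𝟘 ∎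
      where
      idr = solve 1 (λ r → r :* con 1 := r) ≈-refl
      lem = solve 3 (λ m a r → m :* (a :+ r) := m :* a :+ m :* r) ≈-refl
      fin = solve 3 (λ m a r → m :* m :+ (m :* a :+ m :* r) := (m :* a :+ m :* (r :+ m)) :+ con 0) ≈-refl
      sq : ⊝ 𝟙 · ⊝ 𝟙 ≈ 𝟙
      sq = ≈-trans (≈-sym (neg-mul (⊝ 𝟙))) (RingP.-‿involutive ring 𝟙)
    Q-U (suc T) = begin
      cv w w (suc T) ⊹ ⊝ (w (suc (suc T)) ⊹ R · w (suc T)) ≈⟨ ⊹-cong (cvw T) ≈-refl ⟩
      (w (suc T) ⊹ w (suc T) ⊹ Y T) ⊹ ⊝ (w (suc (suc T)) ⊹ R · w (suc T)) ≈⟨ ⊹-cong (⊹-cong (⊹-cong (≈-sym (nn _)) (≈-sym (nn _))) ≈-refl) (neg-mul _) ⟩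
      (⊝ 𝟙 · U (suc T) ⊹ ⊝ 𝟙 · U (suc T) ⊹ Y T) ⊹ ⊝ 𝟙 · (w (suc (suc T)) ⊹ R · w (suc T)) ≈⟨ ⊹-cong ≈-refl (≈-trans (·-cong ≈-refl (⊹-cong (≈-sym (nn _)) (·-cong ≈-refl (≈-sym (nn _))))) (dd (⊝ 𝟙) _ R _)) ⟩
      (⊝ 𝟙 · U (suc T) ⊹ ⊝ 𝟙 · U (suc T) ⊹ Y T) ⊹ ((⊝ 𝟙 · ⊝ 𝟙) · U (suc (suc T)) ⊹ (⊝ 𝟙 · ⊝ 𝟙) · (R · U (suc T))) ≈⟨ ⊹-cong ≈-refl (⊹-cong (≈-trans (·-cong sq ≈-refl) (·-idˡ _)) (≈-trans (·-cong sq ≈-refl) (·-idˡ _))) ⟩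
      (⊝ 𝟙 · U (suc T) ⊹ ⊝ 𝟙 · U (suc T) ⊹ Y T) ⊹ (U (suc (suc T)) ⊹ R · U (suc T)) ≈⟨ fin (⊝ 𝟙) (U (suc T)) (Y T) (U (suc (suc T))) R ⟩
      (U (suc (suc T)) ⊹ ⊝ 𝟙 · U (suc T)) ⊹ ((R ⊹ ⊝ 𝟙) · U (suc T) ⊹ Y T) ≈⟨ ⊹-cong (⊹-cong ≈-refl (≈-sym (neg-mul _))) (≈-sym (zu T)) ⟩
      (U (suc (suc T)) ⊹ ⊝ U (suc T)) ⊹ cv U (U ∘ suc) T ∎
      where
      sq : ⊝ 𝟙 · ⊝ 𝟙 ≈ 𝟙
      sq = ≈-trans (≈-sym (neg-mul (⊝ 𝟙))) (RingP.-‿involutive ring 𝟙)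
      nn : ∀ x → ⊝ 𝟙 · ⊝ x ≈ x
      nn x = ≈-trans (≈-sym (neg-mul (⊝ x))) (RingP.-‿involutive ring x)
      dd = solve 4 (λ m a r b → m :* (m :* a :+ r :* (m :* b)) := (m :* m) :* a :+ (m :* m) :* (r :* b)) ≈-refl
      fin = solve 5 (λ m u y v r → (m :* u :+ m :* u :+ y) :+ (v :+ r :* u) := (v :+ m :* u) :+ ((r :+ m) :* u :+ y)) ≈-refl
      Y : ℕ → E
      Y zero = 𝟘
      Y (suc T) = cv (U ∘ suc) (U ∘ suc) T
      one : ∀ {a b} → a ≈ 𝟙 → a · b ≈ b
      one e = ≈-trans (·-cong e ≈-refl) (·-idˡ _)
      com = solve 2 (λ a b → a :* b := b :* a) ≈-refl
      sgn : ∀ T → cv (w ∘ suc) (w ∘ suc) T ≈ cv (U ∘ suc) (U ∘ suc) T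
      sgn T = ≈-trans (cv-cong T (λ i _ → ≈-sym (nn (w (suc i)))) (λ _ _ → ≈-refl)) (≈-trans (cv-*ˡ (⊝ 𝟙) (U ∘ suc) (w ∘ suc) T) (≈-trans (·-cong ≈-refl (≈-trans (cv-comm (U ∘ suc) (w ∘ suc) T)
        (≈-trans (cv-cong T (λ i _ → ≈-sym (nn (w (suc i)))) (λ _ _ → ≈-refl)) (cv-*ˡ (⊝ 𝟙) (U ∘ suc) (U ∘ suc) T))))
        (≈-trans (ass (⊝ 𝟙) _) (one sq))))
        where
        ass = solve 2 (λ m x → m :* (m :* x) := (m :* m) :* x) ≈-refl
      rest : ∀ T → cv (w ∘ suc) w T ≈ w (suc T) ⊹ Y T
      rest zero = ≈-trans (com _ _) (≈-trans (one w-0) (≈-sym (⊹-idʳ _)))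
      rest (suc T) = ≈-trans (cv-last (w ∘ suc) w T) (≈-trans (⊹-cong (sgn T) (≈-trans (com _ _) (one w-0))) (sw _ _))
        where
        sw = solve 2 (λ a b → a :+ b := b :+ a) ≈-refl
      cvw : ∀ T → cv w w (suc T) ≈ w (suc T) ⊹ w (suc T) ⊹ Y T
      cvw T = ≈-trans (⊹-cong (one w-0) (rest T)) (asc _ _ _)
        where
        asc = solve 3 (λ a b c → a :+ (b :+ c) := a :+ b :+ c) ≈-refl
      zu : ∀ T → cv U (U ∘ suc) T ≈ (R ⊹ ⊝ 𝟙) · U (suc T) ⊹ Y T
      zu zero = ≈-sym (⊹-idʳ _)
      zu (suc T) = ≈-refl

    -- For l ≥ 1 the signs in `U` and `y` cancel; for l = 0 the normalization gives R - 1 = R - R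
    -- y_0 = R q_0.
    U-V : ∀ l → U l ≈ V l
    U-V (suc l) = begin
      ⊝ (R ^ᵣ odd (suc l) · ⊝ q (suc l)) ≈⟨ ≈-trans (neg-mul _) (≈-trans (·-cong ≈-refl (≈-trans (·-cong ≈-refl (neg-mul _)) (lem (⊝ 𝟙) _ _))) (≈-trans (≈-sym (neg-mul _)) (≈-trans (⊝-cong (≈-sym (neg-mul _))) (RingP.-‿involutive ring _)))) ⟩
      R ^ᵣ odd (suc l) · q (suc l) ≈⟨ qV (suc l) ⟩
      V (suc l) ∎
      where
      lem = solve 3 (λ m a b → a :* (m :* b) := m :* (a :* b)) ≈-refl
    U-V zero = ≈-trans (≈-trans (⊹-cong ≈-refl (⊝-cong (≈-sym Ry))) fin) (≈-trans (·-cong (rr R) ≈-refl) (qV 0))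
      where
      rr = solve 1 (λ r → r := r :* con 1) ≈-refl
      lem = solve 3 (λ m r x → r :+ m :* (r :* (con 1 :+ m :* x)) := (con 1 :+ m) :* r :+ (m :* m) :* (r :* x)) ≈-refl
      sq : ⊝ 𝟙 · ⊝ 𝟙 ≈ 𝟙
      sq = ≈-trans (≈-sym (neg-mul (⊝ 𝟙))) (RingP.-‿involutive ring 𝟙)
      fin : R ⊹ ⊝ (R · (𝟙 ⊹ ⊝ q 0)) ≈ R · q 0
      fin = ≈-trans (⊹-cong ≈-refl (≈-trans (neg-mul _) (·-cong ≈-refl (·-cong ≈-refl (⊹-cong ≈-refl (neg-mul _)))))) (≈-trans (lem (⊝ 𝟙) R (q 0))
        (≈-trans (⊹-cong (≈-trans (·-cong (⊝-invʳ 𝟙) ≈-refl) (·-zeroˡ _)) (≈-trans (·-cong sq ≈-refl) (·-idˡ _))) (⊹-idˡ _)))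

-- Elimination of the geodesic series

module Eliminate (𝓡 : CommutativeRing 0ℓ 0ℓ) where
  open RingNotation 𝓡
  open PathAlgebra 𝓡

  sm-split : ∀ a c (F : ℕ → E) → sm (a + c) F ≈ sm a F ⊹ sm c (λ i → F (a + i))
  sm-split zero c F = ≈-sym (⊹-idˡ _)
  sm-split (suc a) c F = ≈-trans (⊹-cong ≈-refl (sm-split a c (F ∘ suc))) (asc _ _ _)
    where
    asc = solve 3 (λ a b c → a :+ (b :+ c) := a :+ b :+ c) ≈-refl

  sm-odd : ∀ b (F : ℕ → E) → (∀ i → F (even i) ≈ 𝟘) → sm (suc (even b)) F ≈ sm b (F ∘ odd)
  sm-odd zero F z = ≈-trans (⊹-idʳ _) (z 0)
  sm-odd (suc b) F z = ≈-trans (⊹-cong (z 0) (⊹-cong ≈-refl (sm-odd b (λ i → F (suc (suc i))) (λ i → z (suc i))))) (⊹-idˡ _)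

  cv-sm : ∀ N (F G : ℕ → E) → cv F G N ≈ sm (suc N) (λ i → F i · G (N ∸ i))
  cv-sm zero F G = ≈-sym (⊹-idʳ _)
  cv-sm (suc N) F G = ⊹-cong ≈-refl (cv-sm N (F ∘ suc) G)

  cvt : (ℕ → E) → ℕ → E
  cvt h zero = 𝟘
  cvt h (suc N) = cv h h N

  -- The matrix Y is unitriangular, hence the B p l can be eliminated in favour of the A (j + p).
  eliminate : (A : ℕ → E) (B Y : ℕ → ℕ → E) → (∀ p q → A (q + p) ≈ sm q (λ l → B p l · Y l q) ⊹ B p q) →
    ∀ L (y : ℕ → E) → Σ (ℕ → E) λ x → ∀ p → sm L (λ l → B p l · y l) ≈ sm L (λ j → x j · A (j + p))
  eliminate A B Y h zero y = (λ _ → 𝟘) , λ _ → ≈-refl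
  eliminate A B Y h (suc L) y = x , prf
    where
    -- Solving the relation at `q = L` for `B p L` changes the lower coefficients by `Y l L` times
    -- `y L`. The coefficients stay independent of `p`, so that they can become face weights.
    y′ : ℕ → E
    y′ l = y l ⊹ ⊝ (Y l L · y L)
    rec = eliminate A B Y h L y′
    x : ℕ → E
    x j = if j ≡ᵇ L then y L else proj₁ rec j
    x-L : x L ≈ y L
    x-L = ≈-reflexive (cong (λ z → if z then y L else proj₁ rec L) (≡ᵇ-true {L} refl))
    x-< : ∀ j → j < L → x j ≈ proj₁ rec j
    x-< j lt with j ≡ᵇ L in eq
    ... | true = ⊥-elim (<-irrefl (≡ᵇ-sound eq) lt)
    ... | false = ≈-refl
    fac = solve 5 (λ m b a t s → b :* (a :+ m :* (t :* s)) :+ (b :* t) :* s := b :* a :+ (con 1 :+ m) :* (b :* (t :* s))) ≈-refl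
    term : ∀ p l → B p l · y′ l ⊹ (B p l · Y l L) · y L ≈ B p l · y l
    term p l = ≈-trans (⊹-cong (·-cong ≈-refl (⊹-cong ≈-refl (neg-mul _))) ≈-refl) (≈-trans (fac (⊝ 𝟙) (B p l) (y l) (Y l L) (y L)) (≈-trans (⊹-cong ≈-refl (≈-trans (·-cong (⊝-invʳ 𝟙) ≈-refl) (·-zeroˡ _))) (⊹-idʳ _)))
    com = solve 2 (λ a b → a :* b := b :* a) ≈-refl
    dis = solve 3 (λ a b c → a :* (b :+ c) := b :* a :+ c :* a) ≈-refl
    asc = solve 3 (λ a b c → a :+ (b :+ c) := a :+ b :+ c) ≈-refl
    smr : ∀ n (F : ℕ → E) s → sm n F · s ≈ sm n (λ l → F l · s)
    smr n F s = ≈-trans (com _ _) (≈-trans (sm-*ˡ n s F) (sm-cong n (λ l _ → com s (F l))))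
    prf : ∀ p → sm (suc L) (λ l → B p l · y l) ≈ sm (suc L) (λ j → x j · A (j + p))
    prf p = begin
      sm (suc L) (λ l → B p l · y l) ≈⟨ sm-last L (λ l → B p l · y l) ⟩
      sm L (λ l → B p l · y l) ⊹ B p L · y L ≈⟨ ⊹-cong (≈-trans (sm-cong L (λ l _ → ≈-sym (term p l))) (sm-+ L (λ l → B p l · y′ l) (λ l → (B p l · Y l L) · y L))) ≈-refl ⟩
      sm L (λ l → B p l · y′ l) ⊹ sm L (λ l → (B p l · Y l L) · y L) ⊹ B p L · y L ≈⟨ ≈-trans (≈-sym (asc _ _ _)) (⊹-cong ≈-refl (⊹-cong (≈-sym (smr L (λ l → B p l · Y l L) (y L))) ≈-refl)) ⟩
      sm L (λ l → B p l · y′ l) ⊹ (sm L (λ l → B p l · Y l L) · y L ⊹ B p L · y L) ≈⟨ ⊹-cong (proj₂ rec p) (≈-trans (≈-sym (dis (y L) _ _)) (·-cong ≈-refl (≈-sym (h p L)))) ⟩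
      sm L (λ j → proj₁ rec j · A (j + p)) ⊹ y L · A (L + p) ≈⟨ ⊹-cong (sm-cong L (λ j lt → ·-cong (≈-sym (x-< j lt)) ≈-refl)) (·-cong (≈-sym x-L) ≈-refl) ⟩
      sm L (λ j → x j · A (j + p)) ⊹ x L · A (L + p) ≈⟨ ≈-sym (sm-last L (λ j → x j · A (j + p))) ⟩
      sm (suc L) (λ j → x j · A (j + p)) ∎

-- Agreement up to a degree: fixed points and uniqueness for Tutte's equation

deg : {k : ℕ} → Vec ℕ k → ℕ
deg [] = 0
deg (x ∷ m) = x + deg m

deg-⊞ : {k : ℕ} (e e′ : Vec ℕ k) → deg (e ⊞ e′) ≡ deg e + deg e′
deg-⊞ [] [] = refl
deg-⊞ (x ∷ e) (x′ ∷ e′) = trans (cong (λ z → x + x′ + z) (deg-⊞ e e′)) (+-interchange x x′ (deg e) (deg e′))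

deg-0 : {k : ℕ} (m : Vec ℕ k) → deg m ≡ 0 → m ≡ zeroV k
deg-0 [] _ = refl
deg-0 (zero ∷ m) e = cong (0 ∷_) (deg-0 m e)

Agree : {k : ℕ} → ℕ → Ser k → Ser k → Set
Agree d A B = ∀ m → deg m < d → A m ≡ B m

≈⇒agree : {k : ℕ} {A B : Ser k} → A ≈S B → ∀ d → Agree d A B
≈⇒agree e d m _ = e m

agree⇒≈ : {k : ℕ} {A B : Ser k} → (∀ d → Agree d A B) → A ≈S B
agree⇒≈ h m = h (suc (deg m)) m ≤-refl

agree-⊕ : {k d : ℕ} {A A′ B B′ : Ser k} → Agree d A A′ → Agree d B B′ → Agree d (A ⊕ B) (A′ ⊕ B′)
agree-⊕ a b m lt = cong₂ _+ℤ_ (a m lt) (b m lt)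

agree-⊛ : {k d : ℕ} {A A′ B B′ : Ser k} → Agree d A A′ → Agree d B B′ → Agree d (A ⊛ B) (A′ ⊛ B′)
agree-⊛ a b m lt = sumℤ-cong (below m) (λ {e} e∈ → cong₂ _*ℤ_ (a e (≤-<-trans (ll e e∈) lt)) (b (m ⊟ e) (≤-<-trans (lr e e∈) lt)))
  where
  ll : ∀ e → e ∈ below m → deg e ≤ deg m
  ll e e∈ = subst (λ z → deg e ≤ deg z) (below-∸ m e∈) (subst (deg e ≤_) (sym (deg-⊞ e (m ⊟ e))) (m≤m+n _ _))
  lr : ∀ e → e ∈ below m → deg (m ⊟ e) ≤ deg m
  lr e e∈ = subst (λ z → deg (m ⊟ e) ≤ deg z) (below-∸ m e∈) (subst (deg (m ⊟ e) ≤_) (sym (deg-⊞ e (m ⊟ e))) (m≤n+m _ _))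

ZeroConst : {k : ℕ} → Ser k → Set
ZeroConst {k} G = G (zeroV k) ≡ + 0

-- A factor without constant term gains one degree: its lowest contribution already uses a variable.
agree-⊛₀ : {k d : ℕ} {G G′ A A′ : Ser k} → ZeroConst G → ZeroConst G′ → Agree (suc d) G G′ → Agree d A A′ → Agree (suc d) (G ⊛ A) (G′ ⊛ A′)
agree-⊛₀ {k} {d} {G} {G′} {A} {A′} z z′ a b m (s≤s lt) = sumℤ-cong (below m) term
  where
  term : ∀ {e} → e ∈ below m → G e *ℤ A (m ⊟ e) ≡ G′ e *ℤ A′ (m ⊟ e)
  term {e} e∈ with deg e in eq
  ... | zero with deg-0 e eq
  ...   | refl = trans (cong (λ c → c *ℤ A (m ⊟ zeroV k)) z) (sym (cong (λ c → c *ℤ A′ (m ⊟ zeroV k)) z′))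
  term {e} e∈ | suc n = cong₂ _*ℤ_ (a e (s≤s (≤-trans le lt))) (b (m ⊟ e) (≤-trans small lt))
    where
    tot : deg m ≡ suc n + deg (m ⊟ e)
    tot = trans (cong deg (sym (below-∸ m e∈))) (trans (deg-⊞ e (m ⊟ e)) (cong (λ z → z + deg (m ⊟ e)) eq))
    le : deg e ≤ deg m
    le = subst₂ _≤_ (sym eq) (sym tot) (m≤m+n (suc n) _)
    small : suc (deg (m ⊟ e)) ≤ deg m
    small = subst (suc (deg (m ⊟ e)) ≤_) (sym tot) (s≤s (m≤n+m _ n))

agree-mono : {k d d′ : ℕ} {A B : Ser k} → d′ ≤ d → Agree d A B → Agree d′ A B
agree-mono le a m lt = a m (≤-trans lt le)

agree-trans : {k d : ℕ} {A B C : Ser k} → Agree d A B → Agree d B C → Agree d A C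
agree-trans a b m lt = trans (a m lt) (b m lt)

agree-sym : {k d : ℕ} {A B : Ser k} → Agree d A B → Agree d B A
agree-sym a m lt = sym (a m lt)

agree-refl : {k d : ℕ} {A : Ser k} → Agree d A A
agree-refl m _ = refl

-- `Φ` contracts for the degree filtration, so the coefficient of `m` is stable after deg m + 1
-- iterations.
fixpoint : {k : ℕ} (Φ : Ser k → Ser k) → (∀ d {A B} → Agree d A B → Agree (suc d) (Φ A) (Φ B)) → Σ (Ser k) λ ρ → ρ ≈S Φ ρ
fixpoint {k} Φ con = ρ , prf
  where
  it : ℕ → Ser k
  it zero = zeroS
  it (suc n) = Φ (it n)
  step : ∀ n → Agree n (it n) (it (suc n))
  step zero _ ()
  step (suc n) = con n (step n)
  steps : ∀ n d → Agree n (it n) (it (d + n))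
  steps n zero = agree-refl
  steps n (suc d) = agree-trans (steps n d) (agree-mono (m≤n+m n d) (step (d + n)))
  ρ : Ser k
  ρ m = it (suc (deg m)) m
  ρ-it : ∀ d → Agree d ρ (it d)
  ρ-it d m lt = trans (steps (suc (deg m)) (d ∸ suc (deg m)) m ≤-refl) (cong (λ z → it z m) (ℕP.m∸n+n≡m lt))
  prf : ρ ≈S Φ ρ
  prf m = sym (con (deg m) (ρ-it (deg m)) m ≤-refl)

module _ (k : ℕ) where
  open PathAlgebra (serRing k) using (sm; cv; _^ᵣ_)

  agree-sm : ∀ {d} n {F G : ℕ → Ser k} → (∀ i → i < n → Agree d (F i) (G i)) → Agree d (sm n F) (sm n G)
  agree-sm zero h = agree-refl
  agree-sm (suc n) h = agree-⊕ (h 0 (s≤s z≤n)) (agree-sm n (λ i lt → h (suc i) (s≤s lt)))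

  agree-cv : ∀ {d} N {F F′ G G′ : ℕ → Ser k} → (∀ i → i ≤ N → Agree d (F i) (F′ i)) → (∀ i → i ≤ N → Agree d (G i) (G′ i)) → Agree d (cv F G N) (cv F′ G′ N)
  agree-cv zero a b = agree-⊛ (a 0 z≤n) (b 0 z≤n)
  agree-cv (suc N) a b = agree-⊕ (agree-⊛ (a 0 z≤n) (b (suc N) ≤-refl)) (agree-cv N (λ i le → a (suc i) (s≤s le)) (λ i le → b i (≤-trans le (n≤1+n N))))

  agree-pow : ∀ {d} n {A B : Ser k} → Agree d A B → Agree d (A ^ᵣ n) (B ^ᵣ n)
  agree-pow zero h = agree-refl
  agree-pow (suc n) h = agree-⊛ h (agree-pow n h)

  open Eliminate (serRing k) using (cvt)

  TutteEq : ℕ → (ℕ → Ser k) → (ℕ → Ser k) → Set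
  TutteEq J g h = h 0 ≈S oneS × (∀ n → h (suc n) ≈S (cvt h n ⊕ sm J (λ i → g i ⊛ h (odd i + n))))

  -- Induction on the degree and, within it, on `n`: the quadratic term only has smaller indices,
  -- and the linear term has larger ones but carries a weight without constant term.
  tutte-unique : ∀ J g → (∀ i → ZeroConst (g i)) → ∀ h h′ → TutteEq J g h → TutteEq J g h′ → ∀ n → h n ≈S h′ n
  tutte-unique J g z h h′ (h0 , hs) (h0′ , hs′) n = agree⇒≈ (λ d → agrees d n)
    where
    agrees : ∀ d n → Agree d (h n) (h′ n)
    upto : ∀ d n N → n ≤ N → Agree (suc d) (h n) (h′ n)
    agrees zero n _ ()
    agrees (suc d) n = upto d n n ≤-refl
    upto d zero N le = agree-trans (≈⇒agree h0 (suc d)) (agree-sym (≈⇒agree h0′ (suc d)))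
    upto d (suc n) (suc N) (s≤s le) = agree-trans (≈⇒agree (hs n) (suc d)) (agree-trans
      (agree-⊕ (cvs n le) (agree-sm J (λ i _ → agree-⊛₀ {G = g i} {G′ = g i} (z i) (z i) agree-refl (agrees d (odd i + n))))) (agree-sym (≈⇒agree (hs′ n) (suc d))))
      where
      cvs : ∀ n → n ≤ N → Agree (suc d) (cvt h n) (cvt h′ n)
      cvs zero _ = agree-refl
      cvs (suc n) ln = agree-cv n (λ i li → upto d i N (≤-trans li (≤-trans (n≤1+n n) ln))) (λ i li → upto d i N (≤-trans li (≤-trans (n≤1+n n) ln)))

-- The system for the V_j: quadratic form and uniqueness

append-unique : {A : Set} (f : List A → List A) {ys : List A} → f [] ≡ ys → (∀ x xs → f (x ∷ xs) ≡ x ∷ f xs) → ∀ xs → f xs ≡ xs ++ ys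
append-unique f e s [] = e
append-unique f e s (x ∷ xs) = trans (s x xs) (cong (x ∷_) (append-unique f e s xs))

-- The body of comps-append is found by unification: it is the append function local to the definition of compositions.
mutual
  comps-append : ℕ → List (List ℕ) → List (List ℕ)
  comps-append n xs = _

  comps-unfold : ∀ n xs → xs ≡ map (List._∷_ 1) (compositions n) → compositions (suc n) ≡ comps-append n xs
  comps-unfold n xs e with map (List._∷_ 1) (compositions n) | e
  ... | .xs | refl = refl

incHead : List ℕ → List (List ℕ)
incHead [] = []
incHead (x ∷ xs) = (suc x ∷ xs) ∷ []

compositions-suc : ∀ n → compositions (suc n) ≡ map (1 ∷_) (compositions n) ++ concatMap incHead (compositions n)
compositions-suc n = trans (comps-unfold n _ refl) (append-unique (comps-append n) (cong concat (map-cong (λ where [] → refl ; (x ∷ xs) → refl) (compositions n))) (λ _ _ → refl) (map (1 ∷_) (compositions n)))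

compositions-nonempty : ∀ n {c} → c ∈ compositions (suc n) → Σ ℕ λ x → Σ (List ℕ) λ r → c ≡ x ∷ r
compositions-nonempty n {c} c∈ with ∈-++⁻ (map (1 ∷_) (compositions n)) (subst (c ∈_) (compositions-suc n) c∈)
... | inj₁ m with ∈-map⁻ (1 ∷_) m
...   | r , _ , refl = 1 , r , refl
compositions-nonempty n {c} c∈ | inj₂ m with ∈-concatMap⁻ incHead (compositions n) m
... | x ∷ r , _ , here refl = suc x , r , refl

module _ {k : ℕ} where
  open PathAlgebra (serRing k) using (sm; cv; sm-cong; sm-*ˡ; cv-cong; cv-last; cv-comm)
  open CommutativeRing (serRing k) using () renaming (refl to ≈-refl; sym to ≈-sym; trans to ≈-trans; +-cong to ⊕-cong; +-identityˡ to ⊕-idˡ; +-identityʳ to ⊕-idʳ; +-assoc to ⊕-assoc; zeroʳ to ⊛-zeroʳ; distribˡ to ⊛-distrib)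

  ΣS-++ : (xs ys : List (Ser k)) → ΣS (xs ++ ys) ≈S (ΣS xs ⊕ ΣS ys)
  ΣS-++ [] ys = ≈-sym (⊕-idˡ (ΣS ys))
  ΣS-++ (x ∷ xs) ys = ≈-trans (⊕-cong (≈-refl {x}) (ΣS-++ xs ys)) (≈-sym (⊕-assoc x (ΣS xs) (ΣS ys)))

  ΣS-cong : {I : Set} {F G : I → Ser k} (is : List I) → (∀ {i} → i ∈ is → F i ≈S G i) → ΣS (map F is) ≈S ΣS (map G is)
  ΣS-cong [] e = ≈-refl
  ΣS-cong (i ∷ is) e = ⊕-cong (e (here refl)) (ΣS-cong is (e ∘ there))

  ΣS-*ˡ : {I : Set} (A : Ser k) {F : I → Ser k} (is : List I) → ΣS (map (λ i → A ⊛ F i) is) ≈S (A ⊛ ΣS (map F is))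
  ΣS-*ˡ A [] = ≈-sym (⊛-zeroʳ A)
  ΣS-*ˡ A {F} (i ∷ is) = ≈-trans (⊕-cong (≈-refl {A ⊛ F i}) (ΣS-*ˡ A {F} is)) (≈-sym (⊛-distrib A (F i) (ΣS (map F is))))

  ΣS-upTo : ∀ n (F : ℕ → Ser k) → ΣS (map F (upTo n)) ≈S sm n F
  ΣS-upTo n F = go n id
    where
    go : ∀ n (h : ℕ → ℕ) → ΣS (map F (applyUpTo h n)) ≈S sm n (F ∘ h)
    go zero h = ≈-refl
    go (suc n) h = ⊕-cong (≈-refl {F (h 0)}) (go n (h ∘ suc))

  ΣS-allFin : ∀ n (F : Fin n → Ser k) (G : ℕ → Ser k) → (∀ r → F r ≈S G (toℕ r)) → ΣS (map F (allFin n)) ≈S sm n G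
  ΣS-allFin n F G e = go n id F G e
    where
    go : ∀ n {m} (h : Fin n → Fin m) (F : Fin m → Ser k) (G : ℕ → Ser k) → (∀ r → F (h r) ≈S G (toℕ r)) → ΣS (map F (tabulate h)) ≈S sm n G
    go zero h F G e = ≈-refl
    go (suc n) h F G e = ⊕-cong (e zero) (go n (h ∘ suc) F (G ∘ suc) (λ r → e (suc r)))

  headWith : (ℕ → Ser k) → (ℕ → Ser k) → List ℕ → Ser k
  headWith v w [] = zeroS
  headWith v w (x ∷ c) = v x ⊛ ΠS (map w c)

  -- The first part has a weight function `v` of its own: a composition either starts with 1 or
  -- arises by increasing the first part of a smaller one, which shifts `v`.
  head-sum : ∀ n (v w : ℕ → Ser k) → ΣS (map (headWith v w) (compositions (suc n))) ≈S sm (suc n) (λ i → v (suc i) ⊛ hS (n ∸ i) w)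
  head-sum n v w = ≈-trans (≈-trans (λ m → cong (λ z → ΣS (map (headWith v w) z) m) (compositions-suc n))
      (≈-trans (λ m → cong (λ z → ΣS z m) (map-++ (headWith v w) (map (1 ∷_) (compositions n)) _)) (ΣS-++ (map (headWith v w) (map (1 ∷_) (compositions n))) _)))
    (⊕-cong (≈-trans (λ m → cong (λ z → ΣS z m) (sym (map-∘ (compositions n)))) (ΣS-*ˡ (v 1) {λ c → ΠS (map w c)} (compositions n)))
      (≈-trans (λ m → cong (λ z → ΣS z m) (inc (compositions n))) (rest n)))
    where
    inc : ∀ cs → map (headWith v w) (concatMap incHead cs) ≡ concatMap (λ c → map (headWith v w) (incHead c)) cs
    inc [] = refl
    inc ([] ∷ cs) = inc cs
    inc ((x ∷ c) ∷ cs) = cong (v (suc x) ⊛ ΠS (map w c) ∷_) (inc cs)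
    drop-inc : ∀ cs → (∀ {c} → c ∈ cs → Σ ℕ λ x → Σ (List ℕ) λ r → c ≡ x ∷ r) → concatMap (λ c → map (headWith v w) (incHead c)) cs ≡ map (headWith (v ∘ suc) w) cs
    drop-inc [] ne = refl
    drop-inc ([] ∷ cs) ne = case ne (here refl) of λ ()
    drop-inc ((x ∷ c) ∷ cs) ne = cong (v (suc x) ⊛ ΠS (map w c) ∷_) (drop-inc cs (ne ∘ there))
    rest : ∀ n → ΣS (concatMap (λ c → map (headWith v w) (incHead c)) (compositions n)) ≈S sm n (λ i → v (suc (suc i)) ⊛ hS (n ∸ suc i) w)
    rest zero = ≈-refl
    rest (suc n) = ≈-trans (λ m → cong (λ z → ΣS z m) (drop-inc (compositions (suc n)) (compositions-nonempty n))) (head-sum n (v ∘ suc) w)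

  hS-rec : ∀ n (w : ℕ → Ser k) → hS (suc n) w ≈S sm (suc n) (λ i → w (suc i) ⊛ hS (n ∸ i) w)
  hS-rec n w = ≈-trans (ΣS-cong (compositions (suc n)) (λ {c} c∈ → same c (compositions-nonempty n c∈))) (head-sum n w w)
    where
    same : ∀ c → (Σ ℕ λ x → Σ (List ℕ) λ r → c ≡ x ∷ r) → ΠS (map w c) ≈S headWith w w c
    same _ (x , r , refl) = ≈-refl

  hArgs-in : ∀ b (V : ℕ → Ser k) i → suc i < b → hArgs b V (suc i) ≡ V (suc (suc i))
  hArgs-in b V i lt = cong (λ z → if z then V (suc (suc i)) else zeroS) (<ᵇ-true lt)
    where
    <ᵇ-true : ∀ {m n} → m < n → (m <ᵇ n) ≡ true
    <ᵇ-true {zero} (s≤s _) = refl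
    <ᵇ-true {suc m} (s≤s lt) = <ᵇ-true lt

  quad : (ℕ → Ser k) → ℕ → Ser k
  quad V T = cv (λ i → V (suc (suc i))) V T

  -- Splitting off the first part expresses h_{T+1} by lower h's, which are V's themselves. In the
  -- theorem's indices the equations become V_T = Σ V_{i+1} V_{T-1-i} over 0 ≤ i ≤ T.
  hS-quad : ∀ b (V : ℕ → Ser k) T → suc T < b → (∀ t → t ≤ T → V t ≈S hS t (hArgs b V)) → hS (suc T) (hArgs b V) ≈S quad V T
  hS-quad b V T lt e = ≈-trans (hS-rec T (hArgs b V)) (≈-trans (sm-cong (suc T) (λ i li → ⊛-cong (λ m → cong (λ z → z m) (hArgs-in b V i (≤-trans (s≤s li) lt))) (≈-sym (e (T ∸ i) (m∸n≤m T i)))))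
    (≈-sym (Eliminate.cv-sm (serRing k) T (λ i → V (suc (suc i))) V)))

  hS-0 : ∀ (w : ℕ → Ser k) → hS 0 w ≈S oneS
  hS-0 w = ⊕-idʳ oneS

  quad⇒hS : ∀ b (V : ℕ → Ser k) → V 0 ≈S oneS → (∀ T → suc T < b → V (suc T) ≈S quad V T) → ∀ N t → t ≤ N → t < b → V t ≈S hS t (hArgs b V)
  quad⇒hS b V v0 vq N zero _ _ = ≈-trans v0 (≈-sym (hS-0 (hArgs b V)))
  quad⇒hS b V v0 vq (suc N) (suc T) (s≤s le) lt = ≈-trans (vq T lt) (≈-sym (hS-quad b V T lt (λ t lt′ → quad⇒hS b V v0 vq N t (≤-trans lt′ le) (≤-trans (s≤s lt′) (≤-trans (n≤1+n (suc T)) lt)))))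

  hS⇒quad : ∀ b (V : ℕ → Ser k) → (∀ t → t < b → V t ≈S hS t (hArgs b V)) → ∀ T → suc T < b → V (suc T) ≈S quad V T
  hS⇒quad b V h T lt = ≈-trans (h (suc T) lt) (hS-quad b V T lt (λ t le → h t (≤-trans (s≤s le) (≤-trans (n≤1+n (suc T)) lt))))

  -- In a nonzero term both exponents have positive degree, so each is strictly below the total.
  agree-⊛₀₀ : ∀ {d} {G G′ A A′ : Ser k} → ZeroConst G → ZeroConst G′ → ZeroConst A → ZeroConst A′ → Agree d G G′ → Agree d A A′ → Agree (suc d) (G ⊛ A) (G′ ⊛ A′)
  agree-⊛₀₀ {d} {G} {G′} {A} {A′} z z′ y y′ a b m (s≤s lt) = sumℤ-cong (below m) term
    where
    term : ∀ {e} → e ∈ below m → G e *ℤ A (m ⊟ e) ≡ G′ e *ℤ A′ (m ⊟ e)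
    term {e} e∈ with deg e in eq | deg (m ⊟ e) in eq′
    ... | zero | _ with deg-0 e eq
    ...   | refl = trans (cong (λ c → c *ℤ A (m ⊟ zeroV k)) z) (sym (cong (λ c → c *ℤ A′ (m ⊟ zeroV k)) z′))
    term {e} e∈ | suc n | zero = trans (cong (λ c → G e *ℤ c) (trans (cong A (deg-0 _ eq′)) y)) (trans (ℤP.*-zeroʳ (G e)) (sym (trans (cong (λ c → G′ e *ℤ c) (trans (cong A′ (deg-0 _ eq′)) y′)) (ℤP.*-zeroʳ (G′ e)))))
    term {e} e∈ | suc n | suc n′ = cong₂ _*ℤ_ (a e (≤-trans (≤-reflexive (cong suc eq)) (≤-trans se lt))) (b (m ⊟ e) (≤-trans (≤-reflexive (cong suc eq′)) (≤-trans sm′ lt)))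
      where
      tot : deg m ≡ suc n + suc n′
      tot = trans (cong deg (sym (below-∸ m e∈))) (trans (deg-⊞ e (m ⊟ e)) (cong₂ _+_ eq eq′))
      se : suc (suc n) ≤ deg m
      se = subst (suc (suc n) ≤_) (sym tot) (≤-trans (≤-reflexive (+-comm 1 (suc n))) (ℕP.+-monoʳ-≤ (suc n) (s≤s z≤n)))
      sm′ : suc (suc n′) ≤ deg m
      sm′ = subst (suc (suc n′) ≤_) (sym tot) (s≤s (m≤n+m (suc n′) n))

  agree-ΣS : ∀ {d} {I : Set} {F G : I → Ser k} (is : List I) → (∀ i → Agree d (F i) (G i)) → Agree d (ΣS (map F is)) (ΣS (map G is))
  agree-ΣS [] h = agree-refl
  agree-ΣS (i ∷ is) h = agree-⊕ (h i) (agree-ΣS is h)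

  agree-powS : ∀ {d} n {A B : Ser k} → Agree d A B → Agree d (powS A n) (powS B n)
  agree-powS zero h = agree-refl
  agree-powS (suc n) h = agree-⊛ h (agree-powS n h)

  varS-zero : ∀ (r : Fin k) → ZeroConst (varS r)
  varS-zero r with sameMono (zeroV k) (unit r) in eq
  ... | false = refl
  ... | true = ⊥-elim (one≢ (trans (sym (trans (VecP.lookup∘tabulate (λ s → if r == s then 1 else 0) r) (cong (λ z → if z then 1 else 0) (≡ᵇ-true {toℕ r} refl)))) (trans (cong (λ z → lookup z r) (sym (sameMono-≡ (zeroV k) (unit r) eq))) (VecP.lookup-replicate r 0))))
    where
    one≢ : 1 ≡ 0 → ⊥
    one≢ ()

  zeroV-tab : Vec.tabulate {n = k} (λ _ → 0) ≡ zeroV k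
  zeroV-tab = lookup-ext (λ r → trans (VecP.lookup∘tabulate (λ _ → 0) r) (sym (VecP.lookup-replicate r 0)))

  -- Induction on the degree. The two high series depend on V_0 in lower degree only, as every
  -- summand carries a variable; the remaining ones follow by descending index from the quadratic
  -- form.
  solution-unique : ∀ b (V W : ℕ → Ser k) → IsSolution b V → IsSolution b W → ∀ t → t ≤ suc b → V t ≈S W t
  solution-unique b V W (vh , vb , vb′ , vz) (wh , wb , wb′ , wz) t le = agree⇒≈ (λ d → agrees d t le)
    where
    zc : (X : ℕ → Ser k) → (∀ t → 1 ≤ t → t ≤ suc b → X t (Vec.tabulate (λ _ → 0)) ≡ + 0) → ∀ t → 1 ≤ t → t ≤ suc b → ZeroConst (X t)
    zc X h t l u = trans (cong (X t) (sym zeroV-tab)) (h t l u)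
    agrees : ∀ d t → t ≤ suc b → Agree d (V t) (W t)
    agrees zero t _ _ ()
    agrees (suc d) t le = body t le
      where
      high : ∀ s → Agree (suc d) (rhsHigh b V s) (rhsHigh b W s)
      high s = agree-ΣS (allFin k) (λ r → agree-⊛₀ {G = varS r} {varS r} {coef r ⊛ powS (oneS ⊕ V 1) (expo r)} {coef r ⊛ powS (oneS ⊕ W 1) (expo r)} (varS-zero r) (varS-zero r) agree-refl
          (agree-⊛ {A = coef r} {coef r} {powS (oneS ⊕ V 1) (expo r)} {powS (oneS ⊕ W 1) (expo r)} agree-refl (agree-powS (expo r) {oneS ⊕ V 1} {oneS ⊕ W 1} (agree-⊕ {A = oneS} {oneS} {V 1} {W 1} agree-refl (agrees d 1 (s≤s z≤n))))))
        where
        coef : Fin k → Ser k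
        coef r = constS (binomℤ (2 * (b + toℕ r) ∸ 1) ((+ (b + toℕ r)) -ℤ (+ s)))
        expo : Fin k → ℕ
        expo r = b + toℕ r + s ∸ 1
      at-b : Agree (suc d) (V b) (W b)
      at-b = agree-trans (≈⇒agree vb (suc d)) (agree-trans (high b) (agree-sym (≈⇒agree wb (suc d))))
      at-b′ : Agree (suc d) (V (suc b)) (W (suc b))
      at-b′ = agree-trans (≈⇒agree vb′ (suc d)) (agree-trans (high (suc b)) (agree-sym (≈⇒agree wb′ (suc d))))
      V0W0 : 0 < b → Agree (suc d) (V 0) (W 0)
      V0W0 lt = agree-trans (≈⇒agree (≈-trans (vh 0 lt) (hS-0 (hArgs b V))) (suc d)) (agree-sym (≈⇒agree (≈-trans (wh 0 lt) (hS-0 (hArgs b W))) (suc d)))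
      -- The last summand, with the factor `V 0` equal to 1, is the only linear one and is supplied
      -- by `a`; the others multiply two series without constant term and gain a degree.
      terms : ∀ T j → suc j + T < b → Agree (suc d) (V (suc (suc (j + T)))) (W (suc (suc (j + T)))) →
        Agree (suc d) (cv (λ i → V (suc (suc (j + i)))) V T) (cv (λ i → W (suc (suc (j + i)))) W T)
      terms zero j lt a = agree-⊛ a (V0W0 (≤-trans (s≤s z≤n) lt))
      terms (suc T) j lt a = agree-⊕
        (agree-⊛₀₀ {d} {V (suc (suc (j + 0)))} {W (suc (suc (j + 0)))} {V (suc T)} {W (suc T)} (zc V vz _ (s≤s z≤n) j2) (zc W wz _ (s≤s z≤n) j2) (zc V vz _ (s≤s z≤n) T1) (zc W wz _ (s≤s z≤n) T1) (agrees d _ j2) (agrees d _ T1))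
        (agree-trans (≈⇒agree (cv-cong T (λ i _ m → cong (λ z → V (suc (suc z)) m) (+-suc j i)) (λ _ _ _ → refl)) (suc d))
            (agree-trans (terms T (suc j) (≤-trans (≤-reflexive (cong (λ z → suc (suc z)) (sym (+-suc j T)))) lt) (subst (λ z → Agree (suc d) (V (suc (suc z))) (W (suc (suc z)))) (+-suc j T) a))
              (≈⇒agree (cv-cong T (λ i _ m → cong (λ z → W (suc (suc z)) m) (sym (+-suc j i))) (λ _ _ _ → refl)) (suc d))))
        where
        j2 : suc (suc (j + 0)) ≤ suc b
        j2 = ≤-trans (s≤s (s≤s (ℕP.+-monoʳ-≤ j z≤n))) (≤-trans lt (n≤1+n b))
        T1 : suc T ≤ suc b
        T1 = ≤-trans (m≤n+m (suc T) (suc j)) (≤-trans (≤-trans (n≤1+n _) lt) (n≤1+n b))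
      -- Descends from `t = b`, since the equation for `V t` contains `V (suc t)` linearly.
      mid : ∀ n t → t + n ≡ b → 1 ≤ t → Agree (suc d) (V t) (W t)
      mid zero t e _ = subst (λ z → Agree (suc d) (V z) (W z)) (sym (trans (sym (+-identityʳ t)) e)) at-b
      mid (suc n) (suc T) e _ = agree-trans (≈⇒agree (hS⇒quad b V vh T lt) (suc d)) (agree-trans (terms T 0 lt (mid n (suc (suc T)) (trans (cong suc (sym (+-suc T n))) e) (s≤s z≤n))) (agree-sym (≈⇒agree (hS⇒quad b W wh T lt) (suc d))))
        where
        lt : suc T < b
        lt = subst (suc (suc T) ≤_) e (≤-trans (≤-reflexive (+-comm 1 (suc T))) (ℕP.+-monoʳ-≤ (suc T) (s≤s z≤n)))
      zero-case : ∀ x → x ≡ b → Agree (suc d) (V 0) (W 0)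
      zero-case zero refl = at-b
      zero-case (suc _) refl = V0W0 (s≤s z≤n)
      body : ∀ t → t ≤ suc b → Agree (suc d) (V t) (W t)
      body zero _ = zero-case b refl
      body (suc t) le with ℕP.m≤n⇒m<n∨m≡n le
      ... | inj₂ refl = at-b′
      ... | inj₁ (s≤s l) = mid (b ∸ suc t) (suc t) (m+[n∸m]≡n l) (s≤s z≤n)

-- Binomial coefficients

-- The binomial coefficient of `n` over x - y, zero when y exceeds x.
bc : ℕ → ℕ → ℕ → ℕ
bc n x zero = n choose x
bc n zero (suc y) = 0
bc n (suc x) (suc y) = bc n x y

nC0≡1 : ∀ n → n choose 0 ≡ 1
nC0≡1 n = trans (nCk≡nC[n∸k] {n = n} z≤n) (nCn≡1 n)

bc-pascal : ∀ n x y → bc (suc n) x y ≡ bc n x y + bc n x (suc y)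
bc-pascal n zero zero = trans (nC0≡1 (suc n)) (sym (trans (+-identityʳ _) (nC0≡1 n)))
bc-pascal n (suc x) zero = trans (sym (nCk+nC[k+1]≡[n+1]C[k+1] n x)) (+-comm (n choose x) (n choose suc x))
bc-pascal n zero (suc y) = refl
bc-pascal n (suc x) (suc y) = bc-pascal n x y

-- Two Pascal steps give the recursion of `tc`; at l = 0 the coefficient 3 comes from the equality
-- of the two middle binomial coefficients of 2i + 1.
tc-bc : ∀ i l → tc i l ≡ bc (suc (2 * i)) i l
tc-bc zero zero = refl
tc-bc zero (suc l) = refl
tc-bc (suc i) l = trans (step l) (cong (λ z → bc (suc z) (suc i) l) (sym (ℕP.*-suc 2 i)))
  where
  n = suc (2 * i)
  two : ∀ x y → bc (suc (suc n)) x y ≡ bc n x y + (bc n x (suc y) + bc n x (suc y)) + bc n x (suc (suc y))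
  two x y = trans (bc-pascal (suc n) x y) (trans (cong₂ _+_ (bc-pascal n x y) (bc-pascal n x (suc y))) (lem (bc n x y) (bc n x (suc y)) (bc n x (suc (suc y)))))
    where
    lem : ∀ a b c → (a + b) + (b + c) ≡ a + (b + b) + c
    lem = ℕR.solve-∀
  mid : n choose suc i ≡ n choose i
  mid = trans (nCk≡nC[n∸k] (s≤s (m≤m+n i (i + 0)))) (cong (n choose_) (trans (cong (λ z → z ∸ i) (cong (λ z → i + z) (+-identityʳ i))) (m+n∸m≡n i i)))
  step : ∀ l → tc (suc i) l ≡ bc (suc (suc n)) (suc i) l
  step zero = trans (cong₂ _+_ (trans (cong (λ z → z + z + z) (tc-bc i 0)) (lem (bc n i 0))) (tc-bc i 1)) (trans (cong (λ z → z + (bc n i 0 + bc n i 0) + bc n i 1) (sym mid)) (sym (two (suc i) 0)))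
    where
    lem : ∀ a → a + a + a ≡ a + (a + a)
    lem = ℕR.solve-∀
  step (suc l) = trans (cong₂ _+_ (cong₂ _+_ (tc-bc i l) (cong₂ _+_ (tc-bc i (suc l)) (tc-bc i (suc l)))) (tc-bc i (suc (suc l)))) (sym (two i l))

binomℤ-bc : ∀ n x y → binomℤ n ((+ x) -ℤ (+ y)) ≡ + bc n x y
binomℤ-bc n x y = trans (cong (binomℤ n) (ℤP.m-n≡m⊖n x y)) (go x y)
  where
  go : ∀ x y → binomℤ n (x ⊖ℤ y) ≡ + bc n x y
  go zero zero = refl
  go (suc x) zero = refl
  go zero (suc y) = refl
  go (suc x) (suc y) = trans (cong (binomℤ n) (ℤP.[1+m]⊖[1+n]≡m⊖n x y)) (go x y)

even-2* : ∀ n → even n ≡ 2 * n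
even-2* zero = refl
even-2* (suc n) = trans (cong (λ z → suc (suc z)) (even-2* n)) (sym (ℕP.*-suc 2 n))

parity : ∀ n → (Σ ℕ λ p → n ≡ even p) ⊎ (Σ ℕ λ p → n ≡ odd p)
parity zero = inj₁ (0 , refl)
parity (suc zero) = inj₂ (0 , refl)
parity (suc (suc n)) with parity n
... | inj₁ (p , refl) = inj₁ (suc p , refl)
... | inj₂ (p , refl) = inj₂ (suc p , refl)

even+odd : ∀ i p → even i + odd p ≡ odd (i + p)
even+odd zero p = refl
even+odd (suc i) p = cong (λ z → suc (suc z)) (even+odd i p)

odd+even : ∀ i p → odd i + even p ≡ odd (i + p)
odd+even i p = trans (+-comm (odd i) (even p)) (trans (even+odd p i) (cong odd (+-comm p i)))

even-cancel : ∀ {a b} → a < b → suc (even a) ≤ even b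
even-cancel {zero} {suc b} _ = s≤s z≤n
even-cancel {suc a} {suc b} (s≤s lt) = s≤s (s≤s (even-cancel lt))

<ᵇ-yes : ∀ {m n} → m < n → (m <ᵇ n) ≡ true
<ᵇ-yes {zero} (s≤s _) = refl
<ᵇ-yes {suc m} (s≤s lt) = <ᵇ-yes lt

<ᵇ-+ : ∀ m r → (m + r <ᵇ m) ≡ false
<ᵇ-+ zero r = refl
<ᵇ-+ (suc m) r = <ᵇ-+ m r

even+even≢odd : ∀ a a′ p → even a + even a′ ≡ odd p → ⊥
even+even≢odd zero zero zero ()
even+even≢odd zero zero (suc p) ()
even+even≢odd zero (suc a′) zero ()
even+even≢odd zero (suc a′) (suc p) e = even+even≢odd zero a′ p (suc-injective (suc-injective e))
even+even≢odd (suc a) a′ zero ()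
even+even≢odd (suc a) a′ (suc p) e = even+even≢odd a a′ p (suc-injective (suc-injective e))

tc-above : ∀ i l → i < l → tc i l ≡ 0
tc-above i l lt = trans (tc-bc i l) (bc-above (suc (2 * i)) i l lt)
  where
  bc-above : ∀ n x y → x < y → bc n x y ≡ 0
  bc-above n zero (suc y) _ = refl
  bc-above n (suc x) (suc y) (s≤s lt) = bc-above n x y lt

-- From the geodesic relations to Tutte's equation and the values of V

module Kernel (𝓡 : CommutativeRing 0ℓ 0ℓ) (b′ k : ℕ) where
  open RingNotation 𝓡
  open PathAlgebra 𝓡
  open Eliminate 𝓡

  private
    c : ℕ
    c = even b′
    J₀ : ℕ
    J₀ = b′ + k

  vanish : ∀ {x z} → z ≈ 𝟘 → x · z ≈ 𝟘
  vanish {x} e = ≈-trans (·-cong ≈-refl e) (·-zeroʳ x)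

  module Reduction (A : ℕ → E) (B Y D : ℕ → ℕ → E) (W x : ℕ → E) (x-k : x k ≈ 𝟘) (A-odd : ∀ n → A (odd n) ≈ 𝟘)
    (A-B : ∀ p q → A (q + p) ≈ sm q (λ l → B p l · Y l q) ⊹ B p q)
    (A-D : ∀ n r → A (odd (b′ + r) + n) ≈ sm (suc c) (λ l → B n l · Y l (odd (b′ + r))) ⊹ D n r)
    (A-step : ∀ n → A (suc n) ≈ cvt A n ⊹ W (suc n)) (W-sum : ∀ n → W (suc n) ≈ sm k (λ r → x r · D n r)) where

    el : ∀ r → Σ (ℕ → E) λ z → ∀ p → sm (suc c) (λ l → B p l · Y l (odd (b′ + r))) ≈ sm (suc c) (λ j → z j · A (j + p))
    el r = eliminate A B Y A-B (suc c) (λ l → Y l (odd (b′ + r)))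

    X : ℕ → E
    X j = sm k (λ r → x r · ⊝ proj₁ (el r) j)

    -- The weight of faces of degree 2i + 2: produced by the elimination when i < b - 1, the given
    -- variable from there on.
    g : ℕ → E
    g i = if i <ᵇ b′ then X (odd i) else x (i ∸ b′)

    g-low : ∀ i → i < b′ → g i ≡ X (odd i)
    g-low i lt = cong (λ z → if z then X (odd i) else x (i ∸ b′)) (<ᵇ-yes lt)

    g-high : ∀ r → g (b′ + r) ≡ x r
    g-high r = trans (cong (λ z → if z then X (odd (b′ + r)) else x (b′ + r ∸ b′)) (<ᵇ-+ b′ r)) (cong x (m+n∸m≡n b′ r))

    D-A : ∀ n r → D n r ≈ A (odd (b′ + r) + n) ⊹ ⊝ 𝟙 · sm (suc c) (λ j → proj₁ (el r) j · A (j + n))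
    D-A n r = ≈-sym (≈-trans (⊹-cong (≈-trans (A-D n r) (⊹-cong (proj₂ (el r) n) ≈-refl)) ≈-refl) (≈-trans (lem (⊝ 𝟙) S₀ (D n r)) (≈-trans (⊹-cong (≈-trans (·-cong (⊝-invʳ 𝟙) ≈-refl) (·-zeroˡ S₀)) ≈-refl) (⊹-idˡ _))))
      where
      S₀ = sm (suc c) (λ j → proj₁ (el r) j · A (j + n))
      lem = solve 3 (λ m s d → (s :+ d) :+ m :* s := (con 1 :+ m) :* s :+ d) ≈-refl

    W-A : ∀ n → W (suc n) ≈ sm (suc c) (λ j → X j · A (j + n)) ⊹ sm k (λ r → x r · A (odd (b′ + r) + n))
    W-A n = begin
      W (suc n) ≈⟨ W-sum n ⟩
      sm k (λ r → x r · D n r) ≈⟨ sm-cong k (λ r _ → ≈-trans (·-cong ≈-refl (D-A n r)) (≈-trans (·-distribˡ (x r) _ _) (⊹-comm _ _))) ⟩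
      sm k (λ r → x r · (⊝ 𝟙 · sm (suc c) (λ j → z r j · A (j + n))) ⊹ x r · A (odd (b′ + r) + n)) ≈⟨ sm-+ k (λ r → x r · (⊝ 𝟙 · sm (suc c) (λ j → z r j · A (j + n)))) (λ r → x r · A (odd (b′ + r) + n)) ⟩
      sm k (λ r → x r · (⊝ 𝟙 · sm (suc c) (λ j → z r j · A (j + n)))) ⊹ sm k (λ r → x r · A (odd (b′ + r) + n)) ≈⟨ ⊹-cong low ≈-refl ⟩
      sm (suc c) (λ j → X j · A (j + n)) ⊹ sm k (λ r → x r · A (odd (b′ + r) + n)) ∎
      where
      z : ℕ → ℕ → E
      z r = proj₁ (el r)
      asc = solve 4 (λ a m b d → a :* (m :* (b :* d)) := d :* (a :* (m :* b))) ≈-refl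
      com = solve 2 (λ a b → a :* b := b :* a) ≈-refl
      low : sm k (λ r → x r · (⊝ 𝟙 · sm (suc c) (λ j → z r j · A (j + n)))) ≈ sm (suc c) (λ j → X j · A (j + n))
      low = begin
        sm k (λ r → x r · (⊝ 𝟙 · sm (suc c) (λ j → z r j · A (j + n)))) ≈⟨ sm-cong k (λ r _ → ≈-trans (·-cong ≈-refl (sm-*ˡ (suc c) (⊝ 𝟙) (λ j → z r j · A (j + n)))) (sm-*ˡ (suc c) (x r) (λ j → ⊝ 𝟙 · (z r j · A (j + n))))) ⟩
        sm k (λ r → sm (suc c) (λ j → x r · (⊝ 𝟙 · (z r j · A (j + n))))) ≈⟨ sm-swap k (suc c) (λ r j → x r · (⊝ 𝟙 · (z r j · A (j + n)))) ⟩
        sm (suc c) (λ j → sm k (λ r → x r · (⊝ 𝟙 · (z r j · A (j + n))))) ≈⟨ sm-cong (suc c) (λ j _ → ≈-trans (sm-cong k (λ r _ → ≈-trans (asc (x r) (⊝ 𝟙) (z r j) (A (j + n))) (·-cong ≈-refl (·-cong ≈-refl (≈-sym (neg-mul (z r j))))))) (≈-trans (≈-sym (sm-*ˡ k (A (j + n)) (λ r → x r · ⊝ z r j))) (com (A (j + n)) (X j)))) ⟩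
        sm (suc c) (λ j → X j · A (j + n)) ∎

    -- The additional summand r = k has weight `x k`, which is zero; it makes the number of weights
    -- positive, as `TutteSolution` requires.
    g-sum : ∀ n → sm (suc J₀) (λ i → g i · A (odd i + n)) ≈ sm b′ (λ i → X (odd i) · A (odd i + n)) ⊹ sm k (λ r → x r · A (odd (b′ + r) + n))
    g-sum n = begin
      sm (suc (b′ + k)) F ≈⟨ ≈-reflexive (cong (λ z → sm z F) (sym (+-suc b′ k))) ⟩
      sm (b′ + suc k) F ≈⟨ sm-split b′ (suc k) F ⟩
      sm b′ F ⊹ sm (suc k) (λ r → F (b′ + r)) ≈⟨ ⊹-cong (sm-cong b′ (λ i lt → ·-cong (≈-reflexive (g-low i lt)) ≈-refl)) (≈-trans (sm-cong (suc k) (λ r _ → ·-cong (≈-reflexive (g-high r)) (≈-refl {A (odd (b′ + r) + n)}))) (sm-last k (λ r → x r · A (odd (b′ + r) + n)))) ⟩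
      sm b′ (λ i → X (odd i) · A (odd i + n)) ⊹ (sm k (λ r → x r · A (odd (b′ + r) + n)) ⊹ x k · A (odd (b′ + k) + n)) ≈⟨ ⊹-cong ≈-refl (≈-trans (⊹-cong ≈-refl (≈-trans (·-cong x-k ≈-refl) (·-zeroˡ _))) (⊹-idʳ _)) ⟩
      sm b′ (λ i → X (odd i) · A (odd i + n)) ⊹ sm k (λ r → x r · A (odd (b′ + r) + n)) ∎
      where
      F : ℕ → E
      F i = g i · A (odd i + n)

    tutte : ∀ n → A (suc n) ≈ cvt A n ⊹ sm (suc J₀) (λ i → g i · A (odd i + n))
    tutte n with parity n
    -- For odd `n`, the terms with even `j` contain an `A` of odd index and vanish; what remains has
    -- the odd shifts of Tutte's equation. For even `n` both sides are zero.
    ... | inj₂ (p , refl) = ≈-trans (A-step (odd p)) (⊹-cong ≈-refl (≈-trans (W-A (odd p)) (≈-trans (⊹-cong (sm-odd b′ (λ j → X j · A (j + odd p))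
            (λ i → vanish (≈-trans (≈-reflexive (cong A (even+odd i p))) (A-odd (i + p))))) ≈-refl) (≈-sym (g-sum (odd p))))))
    ... | inj₁ (p , refl) = ≈-trans (≈-trans (≈-reflexive (cong A (sym (odd-even p)))) (A-odd p)) (≈-sym (≈-trans (⊹-cong (cvz p)
            (sm-zero (suc J₀) {λ i → g i · A (odd i + even p)} (λ i _ → vanish (≈-trans (≈-reflexive (cong A (odd+even i p))) (A-odd (i + p)))))) (⊹-idˡ 𝟘)))
      where
      oddpart : ∀ i j p → i + j ≡ odd p → A i · A j ≈ 𝟘
      oddpart i j p e with parity i | parity j
      ... | inj₂ (a , refl) | _ = ≈-trans (·-cong (A-odd a) ≈-refl) (·-zeroˡ (A j))
      ... | inj₁ _ | inj₂ (a , refl) = vanish (A-odd a)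
      ... | inj₁ (a , refl) | inj₁ (a′ , refl) = ⊥-elim (even+even≢odd a a′ p e)
      cvz : ∀ p → cvt A (even p) ≈ 𝟘
      cvz zero = ≈-refl
      cvz (suc p) = ≈-trans (cv-sm (suc (even p)) A A) (sm-zero (suc (suc (even p))) (λ i lt → oddpart i (suc (even p) ∸ i) p (trans (m+[n∸m]≡n (≤-pred lt)) (sym (odd-even p)))))

  module Solved (R : E) (g : ℕ → E) (R-eq : R ≈ 𝟙 ⊹ TutteSolution.V 𝓡 R J₀ g 0) where
    module T = TutteSolution 𝓡 R J₀ g

    Ry : R · T.y 0 ≈ 𝟙
    Ry = begin
      R · (𝟙 ⊹ ⊝ T.q 0) ≈⟨ ·-cong ≈-refl (⊹-cong ≈-refl (neg-mul (T.q 0))) ⟩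
      R · (𝟙 ⊹ ⊝ 𝟙 · T.q 0) ≈⟨ lem R (⊝ 𝟙) (T.q 0) ⟩
      R ⊹ ⊝ 𝟙 · ((R · 𝟙) · T.q 0) ≈⟨ ⊹-cong R-eq (·-cong ≈-refl (T.qV 0)) ⟩
      (𝟙 ⊹ T.V 0) ⊹ ⊝ 𝟙 · T.V 0 ≈⟨ lem₂ (⊝ 𝟙) (T.V 0) ⟩
      𝟙 ⊹ (𝟙 ⊹ ⊝ 𝟙) · T.V 0 ≈⟨ ≈-trans (⊹-cong ≈-refl (≈-trans (·-cong (⊝-invʳ 𝟙) ≈-refl) (·-zeroˡ _))) (⊹-idʳ 𝟙) ⟩
      𝟙 ∎
      where
      lem = solve 3 (λ r m q → r :* (con 1 :+ m :* q) := r :+ m :* ((r :* con 1) :* q)) ≈-refl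
      lem₂ = solve 2 (λ m v → (con 1 :+ v) :+ m :* v := con 1 :+ (con 1 :+ m) :* v) ≈-refl

    open T.Unit Ry public

    f-tutte : ∀ n → T.f (suc n) ≈ cvt T.f n ⊹ sm (suc J₀) (λ i → g i · T.f (odd i + n))
    f-tutte n = ≈-trans (T.f-step n) (⊹-cong (sq n) ≈-refl)
      where
      sq : ∀ n → T.square (suc n) ≈ cvt T.f n
      sq zero = T.square-1
      sq (suc n) = T.square-cv n

    -- Shifted like the system: `v t` is V_{t-1}, starting with 1.
    v : ℕ → E
    v zero = 𝟙
    v (suc l) = U l

    one+v₁ : 𝟙 ⊹ v 1 ≈ R
    one+v₁ = ≈-trans (lem R (⊝ 𝟙)) (≈-trans (⊹-cong (⊝-invʳ 𝟙) ≈-refl) (⊹-idˡ R))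
      where
      lem = solve 2 (λ r m → con 1 :+ (r :+ m) := (con 1 :+ m) :+ r) ≈-refl

    v-quad : ∀ t → cv (λ i → v (suc (suc i))) v t ≈ U (suc t) ⊹ Z t
    v-quad zero = ≈-trans (·-idʳ (U 1)) (≈-sym (⊹-idʳ (U 1)))
    v-quad (suc t) = ≈-trans (cv-last (U ∘ suc) v t) (≈-trans (⊹-cong (cv-comm (U ∘ suc) U t) (·-idʳ (U (suc (suc t))))) (⊹-comm _ _))

    term : ℕ → ℕ → E
    term l r = g (b′ + r) · (nat (tc (b′ + r) l) · R ^ᵣ suc (b′ + r + l))

    -- The coefficient `tc i l` vanishes for i < l. So from l = b - 1 on, the weights produced by
    -- the elimination drop out and only the given variables remain.
    v-high : g (b′ + k) ≈ 𝟘 → ∀ l → b′ ≤ l → v (suc l) ≈ sm k (term l)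
    v-high gk l le = begin
      U l ≈⟨ U-V l ⟩
      sm (suc (b′ + k)) F ≈⟨ ≈-reflexive (cong (λ z → sm z F) (sym (+-suc b′ k))) ⟩
      sm (b′ + suc k) F ≈⟨ sm-split b′ (suc k) F ⟩
      sm b′ F ⊹ sm (suc k) (term l) ≈⟨ ⊹-cong (sm-zero b′ {F} (λ i lt → vanish (≈-trans (·-cong (≈-reflexive (cong nat (tc-above i l (≤-trans lt le)))) ≈-refl) (·-zeroˡ _)))) (sm-last k (term l)) ⟩
      𝟘 ⊹ (sm k (term l) ⊹ term l k) ≈⟨ ≈-trans (⊹-idˡ _) (≈-trans (⊹-cong ≈-refl (≈-trans (·-cong gk ≈-refl) (·-zeroˡ _))) (⊹-idʳ _)) ⟩
      sm k (term l) ∎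
      where
      F : ℕ → E
      F i = g i · (nat (tc i l) · R ^ᵣ suc (i + l))

    module Values (A W : ℕ → E) (A≈f : ∀ n → A n ≈ T.f n) (A-step : ∀ n → A (suc n) ≈ cvt A n ⊹ W (suc n)) (W-zero : ∀ t → t < b′ → W (even (suc t)) ≈ 𝟘) where

      f-even : ∀ t → T.f (even (suc t)) ≈ cv T.f T.f (even t) ⊹ W (even (suc t))
      f-even t = ≈-trans (≈-sym (A≈f (even (suc t)))) (≈-trans (A-step (suc (even t))) (⊹-cong (cv-cong (even t) (λ i _ → A≈f i) (λ i _ → A≈f i)) ≈-refl))

      -- A boundary shorter than 2b bounds trees only, so the recursion for `f` has no defect there,
      -- and triangularity gives the Q_t one after the other.
      Q-zero : ∀ N t → t ≤ N → t < b′ → Q t ≈ 𝟘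
      Q-zero N t le lt = ≈-trans (≈-sym (≈-trans (⊹-cong ≈-refl (W-zero t lt)) (⊹-idʳ (Q t)))) (Q-value t (f-even t) (below-t N le))
        where
        below-t : ∀ N → t ≤ N → ∀ s → s < t → Q s ≈ 𝟘
        below-t zero z≤n s ()
        below-t (suc N) le s st = Q-zero N s (≤-pred (≤-trans st le)) (≤-trans st (≤-trans (n≤1+n _) lt))

      U-W : ∀ t {e} → Q t ⊹ e ≈ 𝟘 → U t ≈ (U (suc t) ⊹ Z t) ⊹ e
      U-W t {e} h = begin
        U t ≈⟨ ≈-sym (⊹-idʳ (U t)) ⟩
        U t ⊹ 𝟘 ≈⟨ ⊹-cong ≈-refl (≈-trans (≈-sym h) (⊹-cong (Q-U t) ≈-refl)) ⟩
        U t ⊹ (((U (suc t) ⊹ ⊝ U t) ⊹ Z t) ⊹ e) ≈⟨ lem (U t) (U (suc t)) (⊝ U t) (Z t) e ⟩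
        (U t ⊹ ⊝ U t) ⊹ ((U (suc t) ⊹ Z t) ⊹ e) ≈⟨ ≈-trans (⊹-cong (⊝-invʳ (U t)) ≈-refl) (⊹-idˡ _) ⟩
        (U (suc t) ⊹ Z t) ⊹ e ∎
        where
        lem = solve 5 (λ u v m z e → u :+ (((v :+ m) :+ z) :+ e) := (u :+ m) :+ ((v :+ z) :+ e)) ≈-refl

      v-low : ∀ t → t < b′ → v (suc t) ≈ cv (λ i → v (suc (suc i))) v t
      v-low t lt = ≈-trans (U-W t (≈-trans (⊹-idʳ (Q t)) (Q-zero t t ≤-refl lt))) (≈-trans (⊹-idʳ _) (≈-sym (v-quad t)))

      -- The first defect occurs at boundary length 2b: Q_{b-1} is minus the series of maps whose
      -- root edge is not a bridge, and rewriting Q in the V_j gives the formula for E_b.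
      v-W : v (suc b′) ≈ sm (suc b′) (λ t → v t · v (suc (suc b′) ∸ t)) ⊹ W (even (suc b′))
      v-W = ≈-trans (U-W b′ (Q-value b′ (f-even b′) (λ s lt → Q-zero s s ≤-refl lt))) (⊹-cong (⊹-cong (≈-sym (·-idˡ _)) (≈-sym (Z-sum b′))) ≈-refl)
        where
        Z-sum : ∀ n → sm n (λ t → v (suc t) · v (suc n ∸ t)) ≈ Z n
        Z-sum zero = ≈-refl
        Z-sum (suc n) = ≈-sym (≈-trans (cv-sm n U (U ∘ suc)) (sm-cong (suc n) (λ t lt → ·-cong (≈-refl {U t}) (≈-reflexive (cong v (sym (ℕP.+-∸-assoc 2 (≤-pred lt))))))))

-- The solution for the series of maps

module Algebra (b′ k : ℕ) where
  open PathAlgebra (serRing k) using (sm; nat; _^ᵣ_)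
  open CommutativeRing (serRing k) using () renaming (refl to ≈-refl; *-cong to ·-cong; zeroˡ to ⊛-zeroˡ)
  open Eliminate (serRing k) using (cv-sm; cvt)
  open Kernel (serRing k) b′ k

  b : ℕ
  b = suc b′

  -- With c = 2b - 2, `Good c` forbids the cycles of length at most 2b - 1.
  c : ℕ
  c = even b′

  A W : ℕ → Ser k
  A = serA b c
  W = serE b c

  x : ℕ → Ser k
  x r with r <? k
  ... | yes lt = varS (fromℕ< lt)
  ... | no _ = zeroS

  x-fin : ∀ (r : Fin k) → x (toℕ r) ≡ varS r
  x-fin r with toℕ r <? k
  ... | yes lt = cong varS (FinP.fromℕ<-toℕ r lt)
  ... | no nlt = ⊥-elim (nlt (FinP.toℕ<n r))

  x-k : x k ≈S zeroS
  x-k m with k <? k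
  ... | yes lt = ⊥-elim (<-irrefl refl lt)
  ... | no _ = refl

  x-zero : ∀ r → ZeroConst (x r)
  x-zero r with r <? k
  ... | yes lt = varS-zero (fromℕ< lt)
  ... | no _ = refl

  D : ℕ → ℕ → Ser k
  D n r = serD b c n (odd (b′ + r)) (suc c)

  dg-odd : ∀ r → dg b r ∸ 1 ≡ odd (b′ + r)
  dg-odd r = trans (cong (λ z → z ∸ 1) (ℕP.*-suc 2 (b′ + r))) (trans (cong suc (sym (even-2* (b′ + r)))) (sym (odd-even (b′ + r))))

  A-odd : ∀ n → A (odd n) ≈S zeroS
  A-odd n m = trans (cong (λ z → A z m) (trans (odd-even n) (cong suc (even-2* n)))) (serA-odd b c n m)

  A-D : ∀ L p q → A (q + p) ≈S (sm L (λ l → serB b c p l ⊛ serY b c l q) ⊕ serD b c p q L)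
  A-D L p q m = trans (geodesic-split b c p q L m) (cong (λ z → z +ℤ serD b c p q L m) (ΣS-upTo L (λ l → serB b c p l ⊛ serY b c l q) m))

  A-B : ∀ p q → A (q + p) ≈S (sm q (λ l → serB b c p l ⊛ serY b c l q) ⊕ serB b c p q)
  A-B p q m = trans (A-D q p q m) (cong (λ z → sm q (λ l → serB b c p l ⊛ serY b c l q) m +ℤ z) (geodesic-end b c p q m))

  loops : ∀ n → ΣS (map (λ i → A i ⊛ A (n ∸ suc i)) (upTo n)) ≈S cvt A n
  loops zero m = refl
  loops (suc N) m = trans (ΣS-upTo (suc N) (λ i → A i ⊛ A (N ∸ i)) m) (sym (cv-sm N A A m))

  A-step : ∀ n → A (suc n) ≈S (cvt A n ⊕ W (suc n))
  A-step n m = trans (tutte-loop b c n m) (cong (λ z → z +ℤ W (suc n) m) (loops n m))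

  W-sum : ∀ n → W (suc n) ≈S sm k (λ r → x r ⊛ D n r)
  W-sum n m = trans (tutte-split b (s≤s z≤n) c n m) (ΣS-allFin k (λ r → varS r ⊛ serD b c n (dg b (toℕ r) ∸ 1) (suc c)) (λ r → x r ⊛ D n r)
    (λ r m → cong₂ (λ y z → (y ⊛ serD b c n z (suc c)) m) (sym (x-fin r)) (dg-odd (toℕ r))) m)

  -- After removal of the root edge at most 2b - 3 boundary sides would join its ends, while a
  -- distance of 2b - 1 is required.
  W-zero : ∀ t → t < b′ → W (even (suc t)) ≈S zeroS
  W-zero t lt m = trans (W-sum (suc (even t)) m) (PathAlgebra.sm-zero (serRing k) k {λ r → x r ⊛ D (suc (even t)) r} (λ r _ → vanish {x r} {D (suc (even t)) r} (serD-zero b c (suc (even t)) (odd (b′ + r)) (even-cancel lt))) m)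

  module Red = Reduction A (serB b c) (serY b c) D W x x-k A-odd A-B (λ n r → A-D (suc c) n (odd (b′ + r))) A-step W-sum

  opaque
    g : ℕ → Ser k
    g = Red.g

    A-tutte : TutteEq k (suc (b′ + k)) g A
    A-tutte = serA-0 b c , Red.tutte

    zc-⊛ : ∀ {G F : Ser k} → ZeroConst G → ZeroConst (G ⊛ F)
    zc-⊛ {G} {F} z = trans (agree-⊛₀ {d = 0} {G} {zeroS} {F} {F} z refl (λ m lt → trans (cong G (deg-0 m (ℕP.n<1⇒n≡0 lt))) z) (λ _ ()) (zeroV k) (s≤s (≤-reflexive (deg-zeroV k)))) (⊛-zeroˡ F (zeroV k))
      where
      deg-zeroV : ∀ k → deg (zeroV k) ≡ 0
      deg-zeroV zero = refl
      deg-zeroV (suc k) = deg-zeroV k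

    zc-sm : ∀ {F : ℕ → Ser k} n → (∀ i → ZeroConst (F i)) → ZeroConst (sm n F)
    zc-sm zero h = refl
    zc-sm (suc n) h = cong₂ _+ℤ_ (h 0) (zc-sm n (h ∘ suc))

    g-zero : ∀ i → ZeroConst (g i)
    g-zero i = both (i <ᵇ b′)
      where
      both : ∀ β → ZeroConst (if β then Red.X (odd i) else x (i ∸ b′))
      both true = zc-sm {λ r → x r ⊛ negS (proj₁ (Red.el r) (odd i))} k (λ r → zc-⊛ {x r} {negS (proj₁ (Red.el r) (odd i))} (x-zero r))
      both false = x-zero (i ∸ b′)

    g-high : ∀ r → g (b′ + r) ≡ x r
    g-high = Red.g-high

  -- The equation for V_0 in terms of itself. The weights have no constant term, so `Φ` gains a
  -- degree and has a fixed point.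
  Φ : Ser k → Ser k
  Φ ρ = sm (suc (b′ + k)) (λ i → g i ⊛ (nat (tc i 0) ⊛ ((oneS ⊕ ρ) ^ᵣ suc (i + 0))))

  opaque
    fix : Σ (Ser k) λ ρ → ρ ≈S Φ ρ
    fix = fixpoint Φ (λ d {P} {Q} h → agree-sm k (suc (b′ + k)) (λ i _ → agree-⊛₀ {G = g i} {g i} {nat (tc i 0) ⊛ ((oneS ⊕ P) ^ᵣ suc (i + 0))} {nat (tc i 0) ⊛ ((oneS ⊕ Q) ^ᵣ suc (i + 0))} (g-zero i) (g-zero i) agree-refl
      (agree-⊛ {A = nat (tc i 0)} {nat (tc i 0)} {(oneS ⊕ P) ^ᵣ suc (i + 0)} {(oneS ⊕ Q) ^ᵣ suc (i + 0)} agree-refl (agree-pow k (suc (i + 0)) {oneS ⊕ P} {oneS ⊕ Q} (agree-⊕ {A = oneS} {oneS} {P} {Q} agree-refl h)))))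

  R : Ser k
  R = oneS ⊕ proj₁ fix

  module Sol = Solved R g (λ m → cong (λ z → oneS m +ℤ z) (proj₂ fix m))

  opaque
    Vs : ℕ → Ser k
    Vs = Sol.v

    -- The map series and the explicit series solve the same Tutte equation.
    A≈f : ∀ n → A n ≈S Sol.T.f n
    A≈f = tutte-unique k (suc (b′ + k)) g g-zero A Sol.T.f A-tutte (Sol.f-0 , Sol.f-tutte)

  module Val = Sol.Values A W A≈f A-step W-zero

  opaque
    unfolding Vs

    pow-eq : ∀ n {P Q : Ser k} → P ≈S Q → powS P n ≈S (Q ^ᵣ n)
    pow-eq zero e = ≈-refl {oneS}
    pow-eq (suc n) {P} {Q} e = ·-cong {P} {Q} {powS P n} {Q ^ᵣ n} e (pow-eq n e)

    nat-const : ∀ n → nat n ≈S constS (+ n)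
    nat-const zero m = zer (isZeroMono m)
      where
      zer : ∀ β → + 0 ≡ (if β then + 0 else + 0)
      zer true = refl
      zer false = refl
    nat-const (suc n) m = trans (cong (λ z → oneS m +ℤ z) (nat-const n m)) (two (isZeroMono m))
      where
      two : ∀ β → (if β then + 1 else + 0) +ℤ (if β then + n else + 0) ≡ (if β then + suc n else + 0)
      two true = refl
      two false = refl

    V-low : ∀ t → t < b → Vs t ≈S hS t (hArgs b Vs)
    V-low t lt = quad⇒hS b Vs (≈-refl {oneS}) (λ s ls → Val.v-low s (≤-pred ls)) t t ≤-refl lt

    V-high : ∀ l → b′ ≤ l → Vs (suc l) ≈S rhsHigh b Vs (suc l)
    V-high l le m = trans (Sol.v-high (λ m → trans (cong (λ z → z m) (g-high k)) (x-k m)) l le m) (sym (ΣS-allFin k F (Sol.term l) high m))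
      where
      F : Fin k → Ser k
      F r = varS r ⊛ (constS (binomℤ (2 * (b + toℕ r) ∸ 1) ((+ (b + toℕ r)) -ℤ (+ suc l))) ⊛ powS (oneS ⊕ Vs 1) (b + toℕ r + suc l ∸ 1))
      high : ∀ r → F r ≈S Sol.term l (toℕ r)
      high r = ·-cong {varS r} {g i} {C₁ ⊛ P₁} {C₂ ⊛ P₂} (λ m → cong (λ z → z m) (sym (trans (g-high (toℕ r)) (x-fin r))))
        (·-cong {C₁} {C₂} {P₁} {P₂} (λ m → trans (cong (λ z → constS z m) bin) (sym (nat-const (tc i l) m)))
          (λ m → trans (pow-eq (b + toℕ r + suc l ∸ 1) {oneS ⊕ Vs 1} {R} Sol.one+v₁ m) (cong (λ z → (R ^ᵣ z) m) (+-suc i l))))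
        where
        i : ℕ
        i = b′ + toℕ r
        C₁ C₂ P₁ P₂ : Ser k
        C₁ = constS (binomℤ (2 * (b + toℕ r) ∸ 1) ((+ (b + toℕ r)) -ℤ (+ suc l)))
        C₂ = nat (tc i l)
        P₁ = powS (oneS ⊕ Vs 1) (b + toℕ r + suc l ∸ 1)
        P₂ = R ^ᵣ suc (i + l)
        bin : binomℤ (2 * (b + toℕ r) ∸ 1) ((+ suc i) -ℤ (+ suc l)) ≡ + tc i l
        bin = trans (binomℤ-bc (2 * suc i ∸ 1) (suc i) (suc l)) (cong +_ (trans (cong (λ z → bc (z ∸ 1) i l) (ℕP.*-suc 2 i)) (sym (tc-bc i l))))

    V-zero : ∀ t → 1 ≤ t → t ≤ suc b → Vs t (Vec.tabulate (λ _ → 0)) ≡ + 0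
    V-zero (suc l) _ _ = trans (cong (Sol.v (suc l)) (zeroV-tab {k})) (trans (Sol.U-V l (zeroV k)) (zc-sm {λ i → g i ⊛ (nat (tc i l) ⊛ (R ^ᵣ suc (i + l)))} (suc (b′ + k)) (λ i → zc-⊛ {g i} {nat (tc i l) ⊛ (R ^ᵣ suc (i + l))} (g-zero i))))

    formula-W : formula b Vs ≈S W (even b)
    formula-W m = lem (Vs b m) _ (W (even b) m) (trans (Val.v-W m) (cong (λ z → z +ℤ W (even b) m) (sym (ΣS-upTo b (λ t → Vs t ⊛ Vs (suc b ∸ t)) m))))
      where
      lem : ∀ u s e → u ≡ s +ℤ e → u -ℤ s ≡ e
      lem u s e h = trans (cong (λ z → z -ℤ s) h) (alg s e)
        where
        alg : ∀ s e → (s +ℤ e) -ℤ s ≡ e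
        alg = ℤR.solve-∀

  solution : IsSolution b Vs
  solution = V-low , V-high b′ ≤-refl , V-high b (n≤1+n b′) , V-zero

-- Reading the Boolean definitions

∧-elim : ∀ {x y} → x ∧ y ≡ true → x ≡ true × y ≡ true
∧-elim {true} {true} _ = refl , refl

∧-intro : ∀ {x y} → x ≡ true → y ≡ true → x ∧ y ≡ true
∧-intro refl refl = refl

∨-elim : ∀ {x y} → x ∨ y ≡ true → x ≡ true ⊎ y ≡ true
∨-elim {true} _ = inj₁ refl
∨-elim {false} e = inj₂ e

∨-introʳ : ∀ x {y} → y ≡ true → x ∨ y ≡ true
∨-introʳ true _ = refl
∨-introʳ false e = e

not-elim : ∀ {x} → not x ≡ true → x ≢ true
not-elim {false} _ ()

not-intro : ∀ {x} → x ≢ true → not x ≡ true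
not-intro {true} n = ⊥-elim (n refl)
not-intro {false} _ = refl

⇒-elim : ∀ {x y} → not x ∨ y ≡ true → x ≡ true → y ≡ true
⇒-elim {true} e refl = e

⇒-intro : ∀ x {y} → (x ≡ true → y ≡ true) → not x ∨ y ≡ true
⇒-intro true f = f refl
⇒-intro false f = refl

all-elim : {A : Set} (p : A → Bool) (xs : List A) → all p xs ≡ true → ∀ {x} → x ∈ xs → p x ≡ true
all-elim p (x ∷ xs) e (here refl) = proj₁ (∧-elim e)
all-elim p (x ∷ xs) e (there m) = all-elim p xs (proj₂ (∧-elim {p x} e)) m

all-intro : {A : Set} (p : A → Bool) (xs : List A) → (∀ {x} → x ∈ xs → p x ≡ true) → all p xs ≡ true
all-intro p [] h = refl
all-intro p (x ∷ xs) h = ∧-intro (h (here refl)) (all-intro p xs (h ∘ there))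

any-elim : {A : Set} (p : A → Bool) (xs : List A) → any p xs ≡ true → Σ A λ x → x ∈ xs × p x ≡ true
any-elim p (x ∷ xs) e with p x in eq
... | true = x , here refl , eq
... | false with any-elim p xs e
...   | y , m , e′ = y , there m , e′

any-intro : {A : Set} (p : A → Bool) (xs : List A) {x : A} → x ∈ xs → p x ≡ true → any p xs ≡ true
any-intro p (x ∷ xs) (here refl) e rewrite e = refl
any-intro p (y ∷ xs) (there m) e = ∨-introʳ (p y) (any-intro p xs m e)

all-false : {A : Set} (p : A → Bool) (xs : List A) → all p xs ≡ false → Σ A λ x → x ∈ xs × p x ≡ false
all-false p (x ∷ xs) e with p x in eq
... | false = x , here refl , eq
... | true with all-false p xs e
...   | y , m , e′ = y , there m , e′

==-sound : {d : ℕ} {i j : Fin d} → (i == j) ≡ true → i ≡ j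
==-sound e = FinP.toℕ-injective (≡ᵇ-sound e)

==-true : {d : ℕ} {i j : Fin d} → i ≡ j → (i == j) ≡ true
==-true {i = i} refl = ≡ᵇ-true {toℕ i} refl

<ᵇ-sound : ∀ {m n} → (m <ᵇ n) ≡ true → m < n
<ᵇ-sound {zero} {suc n} _ = s≤s z≤n
<ᵇ-sound {suc m} {suc n} e = s≤s (<ᵇ-sound e)

≤ᵇ-sound : ∀ {m n} → (m ≤ᵇ n) ≡ true → m ≤ n
≤ᵇ-sound {zero} _ = z≤n
≤ᵇ-sound {suc m} e = <ᵇ-sound e

≤ᵇ-true : ∀ {m n} → m ≤ n → (m ≤ᵇ n) ≡ true
≤ᵇ-true {zero} _ = refl
≤ᵇ-true {suc m} le = <ᵇ-yes le

card-count : {A : Set} (p : A → Bool) {xs : List A} → Unique xs → (∀ x → x ∈ xs) → HasCard (λ x → p x ≡ true) (count p xs)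
card-count p {xs} u all∈ = filter P? xs , UP.filter⁺ P? u , (λ m → proj₂ (∈-filter⁻ P? {xs = xs} m)) , (λ e → ∈-filter⁺ P? (all∈ _) e) , len xs
  where
  P? : ∀ x → Dec (p x ≡ true)
  P? x = BoolP._≟_ (p x) true
  len : ∀ xs → length (filter P? xs) ≡ count p xs
  len [] = refl
  len (x ∷ xs) with p x
  ... | true = cong suc (len xs)
  ... | false = len xs

card-list : {A : Set} {xs : List A} → Unique xs → HasCard (λ x → x ∈ xs) (length xs)
card-list {xs = xs} u = xs , u , id , id , refl

least : (P : ℕ → Set) → (∀ n → Dec (P n)) → ∀ n → (∀ s → s < n → ¬ P s) ⊎ (Σ ℕ λ m → m < n × P m × (∀ s → s < m → ¬ P s))
least P P? zero = inj₁ (λ _ ())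
least P P? (suc n) with least P P? n
... | inj₂ (m , lt , p , h) = inj₂ (m , ≤-trans lt (n≤1+n n) , p , h)
... | inj₁ h with P? n
...   | yes p = inj₂ (n , ≤-refl , p , h)
...   | no np = inj₁ λ s lt → case ℕP.m≤n⇒m<n∨m≡n (≤-pred lt) of λ where
  (inj₁ l) → h s l
  (inj₂ refl) → np

app-compose : {d : ℕ} (g f : Perm d) (i : Fin d) → app (compose g f) i ≡ app g (app f i)
app-compose g f i = VecP.lookup∘tabulate (λ i → app g (app f i)) i

module _ {d : ℕ} (s a : Perm d) (S : Vec Bool d) where
  rootB stepB : Fin d → Bool
  rootB i = (toℕ i ≡ᵇ 0) ∧ lookup S i
  stepB i = not (lookup S i) ∨ (lookup S (app s i) ∧ lookup S (app a i))

  closedB : Bool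
  closedB = (any rootB (allFin d) ∨ (d ≡ᵇ 0)) ∧ all stepB (allFin d)

  closedB-elim : closedB ≡ true → ((Σ (Fin d) λ i → toℕ i ≡ 0 × lookup S i ≡ true) ⊎ d ≡ 0) × (∀ {i} → lookup S i ≡ true → lookup S (app s i) ≡ true × lookup S (app a i) ≡ true)
  closedB-elim cl with ∧-elim {any rootB (allFin d) ∨ (d ≡ᵇ 0)} cl
  ... | e , e′ = start (∨-elim {any rootB (allFin d)} e) , λ {i} h → ∧-elim {lookup S (app s i)} (⇒-elim {lookup S i} (all-elim stepB (allFin d) e′ (∈-allFin i)) h)
    where
    start : any rootB (allFin d) ≡ true ⊎ (d ≡ᵇ 0) ≡ true → (Σ (Fin d) λ i → toℕ i ≡ 0 × lookup S i ≡ true) ⊎ d ≡ 0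
    start (inj₂ z) = inj₂ (≡ᵇ-sound z)
    start (inj₁ e) with any-elim rootB (allFin d) e
    ... | i , _ , e′ with ∧-elim {toℕ i ≡ᵇ 0} e′
    ...   | e₁ , e₂ = inj₁ (i , ≡ᵇ-sound e₁ , e₂)

  closedB-intro : (i : Fin d) → toℕ i ≡ 0 → lookup S i ≡ true → (∀ {i} → lookup S i ≡ true → lookup S (app s i) ≡ true × lookup S (app a i) ≡ true) → closedB ≡ true
  closedB-intro i z e h = ∧-intro (cong (λ x → x ∨ (d ≡ᵇ 0)) (any-intro rootB (allFin d) (∈-allFin i) (∧-intro (≡ᵇ-true z) e)))
    (all-intro stepB (allFin d) (λ {j} _ → ⇒-intro (lookup S j) (λ e → ∧-intro (proj₁ (h e)) (proj₂ (h e)))))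

∈-allVecs : {A : Set} {xs : List A} {l : ℕ} (v : Vec A l) → (∀ r → lookup v r ∈ xs) → v ∈ allVecs xs l
∈-allVecs [] h = here refl
∈-allVecs {xs = xs} {suc l} (x ∷ v) h = ∈-concatMap (λ y → map (y ∷_) (allVecs xs l)) (h zero) (∈-map⁺ (x ∷_) (∈-allVecs v (λ r → h (suc r))))

connectedB-intro : {d : ℕ} (s a : Perm d) → (∀ S → closedB s a S ≡ true → ∀ i → lookup S i ≡ true) → connectedB s a ≡ true
connectedB-intro {d} s a h = all-intro (λ S → not (closedB s a S) ∨ all (lookup S) (allFin d)) (allVecs (true ∷ false ∷ []) d)
  (λ {S} _ → ⇒-intro (closedB s a S) (λ cl → all-intro (lookup S) (allFin d) (λ {i} _ → h S cl i)))

connectedB-elim : {d : ℕ} (s a : Perm d) → connectedB s a ≡ true → ∀ S → closedB s a S ≡ true → ∀ i → lookup S i ≡ true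
connectedB-elim {d} s a e S cl i = all-elim (lookup S) (allFin d) (⇒-elim {closedB s a S} (all-elim (λ S → not (closedB s a S) ∨ all (lookup S) (allFin d)) (allVecs (true ∷ false ∷ []) d) e
  (∈-allVecs S (λ r → bool∈ (lookup S r)))) cl) (∈-allFin i)
  where
  bool∈ : ∀ β → β ∈ true ∷ false ∷ []
  bool∈ true = here refl
  bool∈ false = there (here refl)

module _ {d : ℕ} (f : Perm d) where
  private
    injB : Fin d → Fin d → Bool
    injB i j = not (app f i == app f j) ∨ (i == j)

  isBij-intro : (∀ {i j} → app f i ≡ app f j → i ≡ j) → isBij f ≡ true
  isBij-intro h = all-intro (λ i → all (injB i) (allFin d)) (allFin d) (λ {i} _ → all-intro (injB i) (allFin d) (λ {j} _ → ⇒-intro (app f i == app f j) (λ e → ==-true (h (==-sound e)))))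

  isBij-elim : isBij f ≡ true → ∀ {i j} → app f i ≡ app f j → i ≡ j
  isBij-elim e {i} {j} h = ==-sound (⇒-elim {app f i == app f j} (all-elim (injB i) (allFin d) (all-elim (λ i → all (injB i) (allFin d)) (allFin d) e (∈-allFin i)) (∈-allFin j)) (==-true h))

involution-intro : {d : ℕ} (a : Perm d) → (∀ i → app a (app a i) ≡ i) → (∀ i → app a i ≢ i) → isFPFInvolution a ≡ true
involution-intro {d} a h n = all-intro (λ i → (app a (app a i) == i) ∧ not (app a i == i)) (allFin d) (λ {i} _ → ∧-intro (==-true (h i)) (not-intro (λ e → n i (==-sound e))))

involution-elim : {d : ℕ} (a : Perm d) → isFPFInvolution a ≡ true → ∀ i → app a (app a i) ≡ i × app a i ≢ i
involution-elim {d} a e i with ∧-elim {app a (app a i) == i} (all-elim (λ i → (app a (app a i) == i) ∧ not (app a i == i)) (allFin d) e (∈-allFin i))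
... | e₁ , e₂ = ==-sound e₁ , λ eq → not-elim e₂ (==-true eq)

compose-inj : {d : ℕ} {s a : Perm d} → (∀ {i j} → app s i ≡ app s j → i ≡ j) → (∀ i → app a (app a i) ≡ i) → ∀ {i j} → app (compose a s) i ≡ app (compose a s) j → i ≡ j
compose-inj {s = s} {a} s-inj a-inv {i} {j} e = s-inj (trans (sym (a-inv (app s i))) (trans (cong (app a) (trans (sym (app-compose a s i)) (trans e (app-compose a s j)))) (a-inv (app s j))))

-- Cycles of a permutation

Reach : {d : ℕ} → Perm d → Fin d → Fin d → Set
Reach f i j = Σ ℕ λ n → iter f n i ≡ j

module Permutation {d : ℕ} (f : Perm d) (inj : ∀ {i j} → app f i ≡ app f j → i ≡ j) where

  iter-+ : ∀ m n i → iter f (m + n) i ≡ iter f m (iter f n i)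
  iter-+ zero n i = refl
  iter-+ (suc m) n i = cong (app f) (iter-+ m n i)

  iter-app : ∀ n i → iter f n (app f i) ≡ app f (iter f n i)
  iter-app zero i = refl
  iter-app (suc n) i = cong (app f) (iter-app n i)

  iter-inj : ∀ n {i j} → iter f n i ≡ iter f n j → i ≡ j
  iter-inj zero e = e
  iter-inj (suc n) e = iter-inj n (inj e)

  -- Two of the first d + 1 iterates coincide, and injectivity cancels the common part.
  returns : ∀ i → Σ ℕ λ t → t < d × iter f (suc t) i ≡ i
  returns i with FinP.pigeonhole {d} {suc d} ≤-refl (λ r → iter f (toℕ r) i)
  ... | r , q , lt , e = toℕ q ∸ suc (toℕ r) , ≤-trans (≤-reflexive gap′) (≤-trans (m∸n≤m (toℕ q) (toℕ r)) (≤-pred (FinP.toℕ<n q))) ,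
      sym (iter-inj (toℕ r) (trans e (trans (cong (λ z → iter f z i) (sym gap)) (iter-+ (toℕ r) _ i))))
    where
    gap : toℕ r + suc (toℕ q ∸ suc (toℕ r)) ≡ toℕ q
    gap = trans (+-suc (toℕ r) _) (m+[n∸m]≡n lt)
    gap′ : suc (toℕ q ∸ suc (toℕ r)) ≡ toℕ q ∸ toℕ r
    gap′ = trans (sym (m+n∸m≡n (toℕ r) _)) (cong (λ z → z ∸ toℕ r) gap)

  sur : ∀ i → Σ (Fin d) λ j → app f j ≡ i
  sur i with returns i
  ... | n , _ , e = iter f n i , e

  reach-refl : ∀ {i} → Reach f i i
  reach-refl = 0 , refl

  reach-trans : ∀ {i j k} → Reach f i j → Reach f j k → Reach f i k
  reach-trans {i} (m , refl) (n , refl) = n + m , iter-+ n m i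

  reach-step : ∀ {i} → Reach f i (app f i)
  reach-step = 1 , refl

  reach-back : ∀ {i} → Reach f (app f i) i
  reach-back {i} with returns i
  ... | t , _ , e = t , trans (iter-app t i) e

  reach-sym : ∀ {i j} → Reach f i j → Reach f j i
  reach-sym {i} (n , refl) = go n
    where
    go : ∀ n → Reach f (iter f n i) i
    go zero = reach-refl
    go (suc n) = reach-trans reach-back (go n)

  -- Subtracting the period, which is at most `d`, brings any exponent below `d`.
  reach-bounded : ∀ {i j} → Reach f i j → Σ ℕ λ n → n < d × iter f n i ≡ j
  reach-bounded {i} {j} (n , e) with returns i
  ... | t , t<d , r = go n n ≤-refl e
    where
    go : ∀ N n → n ≤ N → iter f n i ≡ j → Σ ℕ λ n → n < d × iter f n i ≡ j
    go N n le e with n <? d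
    ... | yes lt = n , lt , e
    go zero zero le e | no nlt = ⊥-elim (nlt (≤-trans (s≤s z≤n) t<d))
    go (suc N) n le e | no nlt = go N (n ∸ suc t) (≤-trans (ℕP.∸-monoˡ-≤ (suc t) le) (m∸n≤m N t))
      (trans (cong (iter f (n ∸ suc t)) (sym r)) (trans (sym (iter-+ (n ∸ suc t) (suc t) i)) (trans (cong (λ z → iter f z i) (ℕP.m∸n+n≡m (≤-trans t<d (≮⇒≥ nlt)))) e)))

  same-elim : ∀ {i j} → sameCycle f i j ≡ true → Reach f i j
  same-elim {i} {j} e with any-elim (λ t → iter f t i == j) (upTo d) e
  ... | t , _ , e′ = t , ==-sound e′

  same-intro : ∀ {i j} → Reach f i j → sameCycle f i j ≡ true
  same-intro {i} {j} r with reach-bounded r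
  ... | n , lt , e = any-intro (λ t → iter f t i == j) (upTo d) (∈-upTo⁺ lt) (==-true e)

  min-elim : ∀ {i} → isCycleMin f i ≡ true → ∀ {j} → Reach f i j → toℕ i ≤ toℕ j
  min-elim {i} e r with reach-bounded r
  ... | n , lt , refl = ≤ᵇ-sound (all-elim (λ t → toℕ i ≤ᵇ toℕ (iter f t i)) (upTo d) e (∈-upTo⁺ lt))

  min-unique : ∀ {i j} → isCycleMin f i ≡ true → isCycleMin f j ≡ true → Reach f i j → i ≡ j
  min-unique e e′ r = FinP.toℕ-injective (≤-antisym (min-elim e r) (min-elim e′ (reach-sym r)))

  find-min : ∀ N i → toℕ i ≤ N → Σ (Fin d) λ r → Reach f i r × isCycleMin f r ≡ true
  find-min N i le with isCycleMin f i in eq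
  ... | true = i , reach-refl , eq
  ... | false with all-false (λ t → toℕ i ≤ᵇ toℕ (iter f t i)) (upTo d) eq
  ...   | t , _ , e = step N le
    where
    lt : toℕ (iter f t i) < toℕ i
    lt = ≰⇒> (λ l → case trans (sym (≤ᵇ-true l)) e of λ ())
    step : ∀ N → toℕ i ≤ N → Σ (Fin d) λ r → Reach f i r × isCycleMin f r ≡ true
    step zero le = case ≤-trans lt le of λ ()
    step (suc N) le with find-min N (iter f t i) (≤-pred (≤-trans lt le))
    ... | r , p , m = r , reach-trans (t , refl) p , m

  opaque
    rep : Fin d → Fin d
    rep i = proj₁ (find-min (toℕ i) i ≤-refl)

    rep-reach : ∀ i → Reach f i (rep i)
    rep-reach i = proj₁ (proj₂ (find-min (toℕ i) i ≤-refl))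

    rep-min : ∀ i → isCycleMin f (rep i) ≡ true
    rep-min i = proj₂ (proj₂ (find-min (toℕ i) i ≤-refl))

  rep-cong : ∀ {i j} → Reach f i j → rep i ≡ rep j
  rep-cong {i} {j} r = min-unique (rep-min i) (rep-min j) (reach-trans (reach-sym (rep-reach i)) (reach-trans r (rep-reach j)))

  rep-eq : ∀ {i j} → rep i ≡ rep j → Reach f i j
  rep-eq {i} {j} e = reach-trans (rep-reach i) (subst (λ z → Reach f z j) (sym e) (reach-sym (rep-reach j)))

  rep-fix : ∀ {i} → isCycleMin f i ≡ true → rep i ≡ i
  rep-fix {i} e = sym (min-unique e (rep-min i) (rep-reach i))

  path : ℕ → Fin d → List (Fin d)
  path zero x = []
  path (suc t) x = x ∷ path t (app f x)

  path-seg : ∀ t x → Seg (app f) x (path t x) (iter f t x)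
  path-seg zero x = refl
  path-seg (suc t) x = refl , subst (Seg (app f) (app f x) (path t (app f x))) (iter-app t x) (path-seg t (app f x))

  ∈-path⁻ : ∀ t x {y} → y ∈ path t x → Σ ℕ λ s → s < t × iter f s x ≡ y
  ∈-path⁻ (suc t) x (here refl) = 0 , s≤s z≤n , refl
  ∈-path⁻ (suc t) x (there m) with ∈-path⁻ t (app f x) m
  ... | s , lt , e = suc s , s≤s lt , trans (sym (iter-app s x)) e

  path-unique : ∀ t x → (∀ s → suc s < t → iter f (suc s) x ≢ x) → Unique (path t x)
  path-unique zero x h = []
  path-unique (suc t) x h = All.tabulate (λ {y} m e → case ∈-path⁻ t (app f x) m of λ where
      (s , lt , e′) → h s (s≤s lt) (trans (sym (iter-app s x)) (trans e′ (sym e)))) ∷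
    path-unique t (app f x) (λ s lt e → h s (≤-trans lt (n≤1+n t)) (inj (trans (sym (iter-app (suc s) x)) e)))

  opaque
    orbit-of : ∀ i → Σ (List (Fin d)) λ c → IsCyc (app f) c × Unique c × Σ (List (Fin d)) λ r → c ≡ i ∷ r
    orbit-of i with least (λ t → iter f (suc t) i ≡ i) (λ t → FinP._≟_ (iter f (suc t) i) i) d | returns i
    ... | inj₁ h | t , lt , e = ⊥-elim (h t lt e)
    ... | inj₂ (t , lt , e , h) | _ = path (suc t) i , (i , subst (Seg (app f) i (path (suc t) i)) e (path-seg (suc t) i) , here refl) ,
      path-unique (suc t) i (λ s ls → h s (≤-pred ls)) , path t (app f i) , refl

  orbit : Fin d → List (Fin d)
  orbit i = proj₁ (orbit-of i)

  orbit-cyc : ∀ i → IsCyc (app f) (orbit i)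
  orbit-cyc i = proj₁ (proj₂ (orbit-of i))

  orbit-unique : ∀ i → Unique (orbit i)
  orbit-unique i = proj₁ (proj₂ (proj₂ (orbit-of i)))

  orbit-head : ∀ i → Σ (List (Fin d)) λ r → orbit i ≡ i ∷ r
  orbit-head i = proj₂ (proj₂ (proj₂ (orbit-of i)))

  cyc-reach : ∀ {c} → IsCyc (app f) c → ∀ {i j} → i ∈ c → j ∈ c → Reach f i j
  cyc-reach cy {i} i∈ j∈ = isCyc-all {S = Reach f i} (λ r → reach-trans r reach-step) cy i∈ reach-refl j∈

  reach-cyc : ∀ {c} → IsCyc (app f) c → ∀ {i j} → i ∈ c → Reach f i j → j ∈ c
  reach-cyc cy {i} i∈ (n , refl) = go n
    where
    go : ∀ n → iter f n i ∈ _
    go zero = i∈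
    go (suc n) = isCyc-closed cy (go n)

  ∈-orbit : ∀ i → i ∈ orbit i
  ∈-orbit i with orbit-head i
  ... | r , e = subst (i ∈_) (sym e) (here refl)

  length-cyc : ∀ {c} → IsCyc (app f) c → Unique c → ∀ {i} → i ∈ c → cycleLength f i ≡ length c
  length-cyc cy u {i} i∈ = card-unique (card-count (sameCycle f i) (UP.allFin⁺ d) ∈-allFin)
    (card-cong (λ j∈ → same-intro (cyc-reach cy i∈ j∈)) (λ e → reach-cyc cy i∈ (same-elim e)) (card-list u))

  minOf : Fin d → List (Fin d) → Fin d
  minOf z [] = z
  minOf z (x ∷ _) = rep x

  module Family (z : Fin d) (cs : List (List (Fin d))) (cyc : All (IsCyc (app f)) cs) (uq : Unique (concat cs)) where

    minOf-∈ : ∀ {c} → c ∈ cs → minOf z c ∈ c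
    minOf-∈ {[]} m with All.lookup cyc m
    ... | _ , _ , ()
    minOf-∈ {x ∷ r} m = reach-cyc (All.lookup cyc m) (here refl) (rep-reach x)

    minOf-min : ∀ {c} → c ∈ cs → isCycleMin f (minOf z c) ≡ true
    minOf-min {[]} m with All.lookup cyc m
    ... | _ , _ , ()
    minOf-min {x ∷ r} m = rep-min x

    mins-unique : Unique (map (minOf z) cs)
    mins-unique = go cs uq minOf-∈
      where
      go : ∀ cs → Unique (concat cs) → (∀ {c} → c ∈ cs → minOf z c ∈ c) → Unique (map (minOf z) cs)
      go [] _ _ = []
      go (c ∷ cs) u h = All.tabulate (λ {y} m e → case ∈-map⁻ (minOf z) m of λ where
          (c′ , c′∈ , refl) → unique-disjoint c u (h (here refl)) (subst (_∈ concat cs) (sym e) (∈-concat⁺′ (h (there c′∈)) c′∈)))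
        ∷ go cs (unique-++ʳ c u) (h ∘ there)

    min-in : ∀ {i c} → isCycleMin f i ≡ true → c ∈ cs → i ∈ c → i ∈ map (minOf z) cs
    min-in {i} {c} e c∈ i∈ = subst (_∈ map (minOf z) cs) (min-unique (minOf-min c∈) e (cyc-reach (All.lookup cyc c∈) (minOf-∈ c∈) i∈)) (∈-map⁺ (minOf z) c∈)

    -- Each cycle of the family contains exactly one cycle minimum, namely the representative of its
    -- letters.
    number : (∀ i → i ∈ concat cs) → numCycles f ≡ length cs
    number full = trans (card-unique (card-count (isCycleMin f) (UP.allFin⁺ d) ∈-allFin)
      (card-cong (λ m → case ∈-map⁻ (minOf z) m of λ where (c , c∈ , refl) → minOf-min c∈)
        (λ {i} e → case ∈-concat⁻′ cs (full i) of λ where (c , i∈ , c∈) → min-in e c∈ i∈) (card-list mins-unique))) (length-map (minOf z) cs)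

    lengths : map (cycleLength f) (map (minOf z) cs) ≡ map length cs
    lengths = trans (sym (map-∘ cs)) (LP.map-cong-local (All.tabulate (λ c∈ → length-cyc (All.lookup cyc c∈) (unique-concat cs uq c∈) (minOf-∈ c∈))))

atRoot : {d : ℕ} → Perm d → Fin d → Fin d → Bool
atRoot φ i j = (toℕ j ≡ᵇ 0) ∧ sameCycle φ i j

inner? : {d : ℕ} → Perm d → Perm d → Fin d → Bool
inner? {d} s a i = isCycleMin (compose a s) i ∧ not (any (atRoot (compose a s) i) (allFin d))

innerDec : {d : ℕ} (s a : Perm d) (i : Fin d) → Dec (inner? s a i ≡ true)
innerDec s a i = BoolP._≟_ (inner? s a i) true

-- The body of inner-go is found by unification: it is the recursion local to the definition of innerFaces.
mutual
  inner-go : {d : ℕ} → Perm d → Perm d → List (Fin d) → List (Fin d)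
  inner-go s a xs = _

  inner-unfold : {d : ℕ} (s a : Perm d) (xs : List (Fin d)) → xs ≡ allFin d → innerFaces s a ≡ inner-go s a xs
  inner-unfold {d} s a xs e with allFin d | e
  ... | .xs | refl = refl

innerFaces-filter : {d : ℕ} (s a : Perm d) → innerFaces s a ≡ filter (innerDec s a) (allFin d)
innerFaces-filter {d} s a = trans (inner-unfold s a (allFin d) refl) (go (allFin d))
  where
  go : ∀ xs → inner-go s a xs ≡ filter (innerDec s a) xs
  go [] = refl
  go (x ∷ xs) = step (inner? s a x) refl
    where
    step : ∀ β → inner? s a x ≡ β → (if inner? s a x then x ∷ inner-go s a xs else inner-go s a xs) ≡ filter (innerDec s a) (x ∷ xs)
    step true e rewrite e = cong (x ∷_) (go xs)
    step false e rewrite e = go xs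

inner-elim : {d : ℕ} (s a : Perm d) {i : Fin d} → i ∈ innerFaces s a → isCycleMin (compose a s) i ≡ true × (∀ j → toℕ j ≡ 0 → sameCycle (compose a s) i j ≢ true)
inner-elim {d} s a {i} m with ∈-filter⁻ (innerDec s a) {xs = allFin d} (subst (i ∈_) (innerFaces-filter s a) m)
... | _ , e with ∧-elim {isCycleMin (compose a s) i} e
...   | e₁ , e₂ = e₁ , λ j z h → not-elim e₂ (any-intro (atRoot (compose a s) i) (allFin d) (∈-allFin j) (∧-intro (≡ᵇ-true z) h))

inner-intro : {d : ℕ} (s a : Perm d) {i : Fin d} → isCycleMin (compose a s) i ≡ true → (∀ j → toℕ j ≡ 0 → sameCycle (compose a s) i j ≢ true) → i ∈ innerFaces s a
inner-intro {d} s a {i} e n = subst (i ∈_) (sym (innerFaces-filter s a)) (∈-filter⁺ (innerDec s a) (∈-allFin i) (∧-intro e (not-intro none)))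
  where
  none : any (atRoot (compose a s) i) (allFin d) ≢ true
  none e with any-elim (atRoot (compose a s) i) (allFin d) e
  ... | j , _ , e′ with ∧-elim {toℕ j ≡ᵇ 0} e′
  ...   | e₁ , e₂ = n j (≡ᵇ-sound e₁) e₂

innerFaces-unique : {d : ℕ} (s a : Perm d) → Unique (innerFaces s a)
innerFaces-unique {d} s a = subst Unique (sym (innerFaces-filter s a)) (UP.filter⁺ (innerDec s a) (UP.allFin⁺ d))

-- Girth equal to the outer degree

seg-map : {H H′ : Set} {φ : H → H} {φ′ : H′ → H′} (p : H → H′) → (∀ h → φ′ (p h) ≡ p (φ h)) → {x y : H} (w : List H) → Seg φ x w y → Seg φ′ (p x) (map p w) (p y)
seg-map p e [] refl = refl
seg-map {φ′ = φ′} p e {y = y} (x ∷ w) (refl , s) = refl , subst (λ z → Seg φ′ z (map p w) (p y)) (sym (e x)) (seg-map p e w s)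

isCyc-map : {H H′ : Set} {φ : H → H} {φ′ : H′ → H′} (p : H → H′) → (∀ h → φ′ (p h) ≡ p (φ h)) → {w : List H} → IsCyc φ w → IsCyc φ′ (map p w)
isCyc-map p e {w} (h , s , m) = p h , seg-map p e w s , ∈-map⁺ p m

-- In a `split` the rest of the boundary would join the ends of the root edge within `c` steps; so
-- only bridges occur and the map is a tree.
no-split : ∀ c t → WF t → Good c t → bd t ≤ suc c → ∀ c′ → Good c′ t
no-split c pt _ _ _ c′ = tt
no-split c (loop t u) (wt , wu) (gt , gu) le c′ = no-split c t wt gt (≤-trans (≤-trans (m≤m+n (bd t) (bd u)) (≤-trans (n≤1+n _) (n≤1+n _))) le′) c′ , no-split c u wu gu (≤-trans (≤-trans (m≤n+m (bd u) (bd t)) (≤-trans (n≤1+n _) (n≤1+n _))) le′) c′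
  where
  le′ : suc (suc (bd t + bd u)) ≤ suc c
  le′ = subst (_≤ suc c) (bd-loop t u) le
no-split c (split i t) (wt , it) (gt , ng) (s≤s le) c′ = ⊥-elim (ng (near-mono t (≤-trans (≤-reflexive (sym (length-map inj₂ (drop i (bw t))))) le) (near-sym t (drop i (bw t) , ≤-refl , proj₂ (chain-take (bw t) i (chain-bw t wt))))))

-- If the root edge is a bridge, then both sides have boundary length at most c and hence are trees.
cycle-split : ∀ c t → WF t → Good c t → bd t ≡ suc (suc c) → ∀ {h hs} → GCycle t (h ∷ hs) → IsSplit t
cycle-split c (split i t) _ _ _ _ = isSplit
cycle-split c (loop t u) (wt , wu) (gt , gu) e {h} {hs} ((v , ch) , _ , ap) = ⊥-elim (no-short-trail (length hs) (loop t u)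
  (no-split c t wt gt (≤-trans (m≤m+n _ _) (≤-trans (≤-reflexive e′) (n≤1+n c))) _ , no-split c u wu gu (≤-trans (m≤n+m _ (bd t)) (≤-trans (≤-reflexive e′) (n≤1+n c))) _) h hs ≤-refl ch ap)
  where
  e′ : bd t + bd u ≡ c
  e′ = suc-injective (suc-injective (trans (sym (bd-loop t u)) e))

-- The rest of the boundary is a walk of length c + 1 between the ends of the root edge. Simplified,
-- it closes a cycle of length at most c + 2, and goodness excludes a shorter one.
split-cycle : ∀ c t → WF t → Good c t → bd t ≡ suc (suc c) → IsSplit t → Σ (List (Half t)) λ hs → length hs ≡ suc (suc c) × GCycle t hs
split-cycle c (split i t) (wt , it) g e isSplit with near-sym t (drop i (bw t) , ≤-refl , proj₂ (chain-take (bw t) i (chain-bw t wt)))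
... | hs , le , ch with simplify t hs ch
...   | hs′ , le′ , sim = inj₁ false ∷ map inj₂ hs′ , cong suc (trans (length-map inj₂ hs′) (≤-antisym up (≰⇒> dn))) , gc
  where
  gc = close-cycle i t hs′ sim
  up : length hs′ ≤ suc c
  up = ≤-trans le′ (≤-trans le (≤-reflexive (trans (sym (length-map inj₂ (drop i (bw t)))) (suc-injective e))))
  dn : ¬ length hs′ ≤ c
  dn l = no-short-trail c (split i t) g (inj₁ false) (map inj₂ hs′) (≤-trans (≤-reflexive (length-map inj₂ hs′)) l) (proj₂ (proj₁ gc)) (proj₂ (proj₂ gc))

seg-shift : {H : Set} {φ : H → H} {x y : H} (r : List H) → Seg φ x (x ∷ r) y → map φ (x ∷ r) ≡ r ++ y ∷ []
seg-shift [] (_ , e) = cong [_] e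
seg-shift {φ = φ} {x} {y} (z ∷ r) (_ , refl , s) = cong (φ x ∷_) (seg-shift r (refl , s))

cyc-shift : {H : Set} {φ : H → H} {f : List H} → IsCyc φ f → map φ f ↭ f
cyc-shift {f = x ∷ r} (_ , (refl , s) , _) = ↭-trans (↭-reflexive (seg-shift r (refl , s))) (PP.++-comm r (x ∷ []))

-- On each cyclic word `nxt` is a rotation, so the images of all letters are again all letters
-- without repetition.
nxt-inj : ∀ t {h h′} → nxt t h ≡ nxt t h′ → h ≡ h′
nxt-inj t {h} {h′} e = map-unique⇒inj (nxt t) {bw t ++ concat (fcs t)} (unique-↭ (↭-sym perm) (letters-unique t)) (∈-letters t h) (∈-letters t h′) e
  where
  faces : ∀ fs → All (IsCyc (nxt t)) fs → map (nxt t) (concat fs) ↭ concat fs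
  faces [] [] = ↭-refl
  faces (f ∷ fs) (c ∷ cs) = ↭-trans (↭-reflexive (map-++ (nxt t) f (concat fs))) (PP.++⁺ (cyc-shift c) (faces fs cs))
  perm : map (nxt t) (bw t ++ concat (fcs t)) ↭ bw t ++ concat (fcs t)
  perm = faces (bw t ∷ fcs t) (nxt-bw t (proj₂ (proj₂ (bw-nonempty t h))) ∷ nxt-fcs t)

to-chain : {H V : Set} (o : H → V) (β : H → H) {l : ℕ} (hs : Vec H (suc l)) {v : V} →
  (∀ r q → toℕ q ≡ suc (toℕ r) → o (β (lookup hs r)) ≡ o (lookup hs q)) → (∀ r → toℕ r ≡ l → o (β (lookup hs r)) ≡ v) →
  Chain o β (o (lookup hs zero)) (Vec.toList hs) v
to-chain o β {zero} (x ∷ []) next last = refl , last zero refl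
to-chain o β {suc l} (x ∷ y ∷ hs) {v} next last = refl , subst (λ z → Chain o β z (y ∷ Vec.toList hs) v) (sym (next zero (suc zero) refl))
  (to-chain o β (y ∷ hs) (λ r q e → next (suc r) (suc q) (cong suc e)) (λ r e → last (suc r) (cong suc e)))

from-chain : {H V : Set} (o : H → V) (β : H → H) {l : ℕ} (hs : Vec H (suc l)) {u v : V} → Chain o β u (Vec.toList hs) v →
  o (lookup hs zero) ≡ u × (∀ r q → toℕ q ≡ suc (toℕ r) → o (β (lookup hs r)) ≡ o (lookup hs q)) × (∀ r → toℕ r ≡ l → o (β (lookup hs r)) ≡ v)
from-chain o β {zero} (x ∷ []) (e , refl) = e , (λ where zero zero ()) , λ where zero _ → refl
from-chain o β {suc l} (x ∷ y ∷ hs) (e , c) with from-chain o β (y ∷ hs) c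
... | e′ , next , last = e , (λ where
      zero zero ()
      zero (suc zero) _ → sym e′
      zero (suc (suc _)) ()
      (suc r) zero ()
      (suc r) (suc q) e → next r q (suc-injective e)) , λ where
    zero ()
    (suc r) e → last r (suc-injective e)

lookup-∈ : {A : Set} {l : ℕ} (v : Vec A l) (r : Fin l) → lookup v r ∈ Vec.toList v
lookup-∈ (x ∷ v) zero = here refl
lookup-∈ (x ∷ v) (suc r) = there (lookup-∈ v r)

∈-lookup⁻ : {A : Set} {l : ℕ} (v : Vec A l) {x : A} → x ∈ Vec.toList v → Σ (Fin l) λ r → lookup v r ≡ x
∈-lookup⁻ (x ∷ v) (here refl) = zero , refl
∈-lookup⁻ (x ∷ v) (there m) with ∈-lookup⁻ v m
... | r , e = suc r , e

pairs-elim : {A : Set} {R : A → A → Set} → (∀ {x y} → R x y → R y x) → {l : ℕ} (v : Vec A l) → AllPairs R (Vec.toList v) → ∀ r q → r ≢ q → R (lookup v r) (lookup v q)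
pairs-elim s (x ∷ v) p zero zero n = ⊥-elim (n refl)
pairs-elim s (x ∷ v) (a ∷ p) zero (suc q) n = All.lookup a (lookup-∈ v q)
pairs-elim s (x ∷ v) (a ∷ p) (suc r) zero n = s (All.lookup a (lookup-∈ v r))
pairs-elim s (x ∷ v) (a ∷ p) (suc r) (suc q) n = pairs-elim s v p r q (λ e → n (cong suc e))

pairs-intro : {A : Set} {R : A → A → Set} {l : ℕ} (v : Vec A l) → (∀ r q → r ≢ q → R (lookup v r) (lookup v q)) → AllPairs R (Vec.toList v)
pairs-intro [] h = []
pairs-intro {R = R} (x ∷ v) h = All.tabulate (λ m → case ∈-lookup⁻ v m of λ where (r , e) → subst (R x) e (h zero (suc r) (λ ()))) ∷
  pairs-intro v (λ r q n → h (suc r) (suc q) (λ e → n (FinP.suc-injective e)))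

-- Labelled maps that realize a term

-- The label `p h` names the corner at which side `h` starts, that is the corner following half-edge
-- `p h`; the half-edge of the side itself is `s (p h)`. This is why `a` corresponds to `opp` only
-- after conjugation by `s`.
record Realizes {d′ : ℕ} (s a : Perm (suc d′)) (t : Tm) (p : Half t → Fin (suc d′)) : Set where
  field
    wf     : WF t
    s-inj  : ∀ {i j} → app s i ≡ app s j → i ≡ j
    a-inv  : ∀ i → app a (app a i) ≡ i
    p-inj  : Inj p
    p-sur  : ∀ i → Σ (Half t) λ h → p h ≡ i
    p-nxt  : ∀ h → app a (app s (p h)) ≡ p (nxt t h)
    p-opp  : ∀ h → app s (p (opp t h)) ≡ app a (app s (p h))
    p-root : Σ (Half t) λ x → Σ (List (Half t)) λ r → bw t ≡ x ∷ r × p x ≡ zero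

module Realized {d′ : ℕ} {s a : Perm (suc d′)} {t : Tm} {p : Half t → Fin (suc d′)} (real : Realizes s a t p) where
  open Realizes real

  private
    d : ℕ
    d = suc d′

  φ : Perm d
  φ = compose a s

  φ-inj : ∀ {i j} → app φ i ≡ app φ j → i ≡ j
  φ-inj = compose-inj {s = s} {a} s-inj a-inv

  φ-p : ∀ h → app φ (p h) ≡ p (nxt t h)
  φ-p h = trans (app-compose a s (p h)) (p-nxt h)

  module σ = Permutation s s-inj
  module Φ = Permutation φ φ-inj

  q : Fin d → Half t
  q i = proj₁ (p-sur i)

  p-q : ∀ i → p (q i) ≡ i
  p-q i = proj₂ (p-sur i)

  q-p : ∀ h → q (p h) ≡ h
  q-p h = p-inj (p-q (p h))

  h₀ : Half t
  h₀ = proj₁ p-root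

  outer : List (Fin d)
  outer = map p (bw t)

  inner : List (List (Fin d))
  inner = map (map p) (fcs t)

  bw-cyc : IsCyc (nxt t) (bw t)
  bw-cyc = nxt-bw t (proj₁ (proj₂ (proj₂ p-root)))

  outer-cyc : IsCyc (app φ) outer
  outer-cyc = isCyc-map p φ-p bw-cyc

  inner-cyc : All (IsCyc (app φ)) inner
  inner-cyc = AllP.map⁺ (All.map (isCyc-map p φ-p) (nxt-fcs t))

  letters-eq : outer ++ concat inner ≡ map p (bw t ++ concat (fcs t))
  letters-eq = trans (cong (outer ++_) (LP.concat-map (fcs t))) (sym (map-++ p (bw t) (concat (fcs t))))

  letters-uq : Unique (outer ++ concat inner)
  letters-uq = subst Unique (sym letters-eq) (UP.map⁺ p-inj (letters-unique t))

  letters-full : ∀ i → i ∈ outer ++ concat inner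
  letters-full i = subst (i ∈_) (sym letters-eq) (subst (_∈ map p (bw t ++ concat (fcs t))) (p-q i) (∈-map⁺ p (∈-letters t (q i))))

  zero-outer : zero ∈ outer
  zero-outer with p-root
  ... | x , r , e , e′ = subst (_∈ outer) e′ (∈-map⁺ p (subst (x ∈_) (sym e) (here refl)))

  size : d ≡ 2 * edges t
  size = trans (trans (sym (LP.length-tabulate {n = d} id)) (card-unique (card-list (UP.allFin⁺ d)) (card-cong (λ _ → ∈-allFin _) (λ {i} _ → subst (_∈ map p (halves t)) (p-q i) (∈-map⁺ p (∈-halves t (q i)))) (card-list (UP.map⁺ p-inj (halves-unique t))))))
    (trans (length-map p (halves t)) (halves-length t))

  numCycles-φ : numCycles φ ≡ suc (length (degs t))
  numCycles-φ = trans (Φ.Family.number zero (outer ∷ inner) (outer-cyc ∷ inner-cyc) letters-uq letters-full)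
    (cong suc (trans (length-map (map p) (fcs t)) (trans (sym (length-map length (fcs t))) (cong length (degs-length t wf)))))

  cls : Half t → Fin d
  cls h = σ.rep (p h)

  cls-nxt : ∀ h → cls (nxt t h) ≡ cls (opp t h)
  cls-nxt h = sym (σ.rep-cong (1 , trans (p-opp h) (p-nxt h)))

  cyc-closed : ∀ {f} → IsCyc (nxt t) f → Closed cls (opp t) f
  cyc-closed {f} (h , sg , _) = cls h , seg-chain cls-nxt f sg

  -- Cycles of `s` label the sides consistently along all faces, so by `factor` each vertex of the
  -- term lies in a single cycle; `reach-org` gives the converse.
  cls-org : Σ (Vert t → Fin d) λ ḡ → ∀ h → cls h ≡ ḡ (org t h)
  cls-org = proj₁ fac , proj₂ (proj₂ fac)
    where
    fac : Σ (Vert t → Fin d) λ ḡ → ḡ (root t) ≡ proj₁ (cyc-closed bw-cyc) × (∀ h → cls h ≡ ḡ (org t h))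
    fac = factor t wf cls (proj₂ (cyc-closed bw-cyc)) (All.map cyc-closed (nxt-fcs t))

  org-reach : ∀ {h h′} → org t h ≡ org t h′ → Reach s (p h) (p h′)
  org-reach {h} {h′} e = σ.rep-eq (trans (proj₂ cls-org h) (trans (cong (proj₁ cls-org) e) (sym (proj₂ cls-org h′))))

  s-p : ∀ h → app s (p h) ≡ p (nxt t (opp t h))
  s-p h = trans (cong (λ z → app s (p z)) (sym (opp-opp t h))) (trans (p-opp (opp t h)) (p-nxt (opp t h)))

  org-step : ∀ i → org t (q (app s i)) ≡ org t (q i)
  org-step i = trans (cong (org t) (trans (cong q (trans (cong (app s) (sym (p-q i))) (s-p (q i)))) (q-p _))) (trans (org-nxt t wf (opp t (q i))) (cong (org t) (opp-opp t (q i))))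

  org-iter : ∀ {i j} → Reach s i j → org t (q i) ≡ org t (q j)
  org-iter {i} (n , refl) = sym (go n)
    where
    go : ∀ n → org t (q (iter s n i)) ≡ org t (q i)
    go zero = refl
    go (suc n) = trans (org-step (iter s n i)) (go n)

  reach-org : ∀ {h h′} → Reach s (p h) (p h′) → org t h ≡ org t h′
  reach-org {h} {h′} r = trans (cong (org t) (sym (q-p h))) (trans (org-iter r) (cong (org t) (q-p h′)))

  numCycles-s : numCycles s ≡ length (verts t)
  numCycles-s = card-unique (card-image {Q = λ v → v ∈ verts t} (card-count (isCycleMin s) (UP.allFin⁺ d) ∈-allFin) (λ i _ → org t (q i)) (λ i _ → ∈-verts t _)
      (λ i mi j mj e → σ.min-unique mi mj (subst₂ (Reach s) (p-q i) (p-q j) (org-reach e)))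
      (λ v _ → case org-onto t h₀ v of λ where
        (h , refl) → cls h , σ.rep-min (p h) , λ _ → trans (sym (org-iter (σ.rep-reach (p h)))) (cong (org t) (q-p h))))
    (card-list (verts-unique t))

  euler-map : numCycles s + numCycles φ ≡ edges t + 2
  euler-map = trans (cong₂ _+_ numCycles-s numCycles-φ) (trans (+-suc (length (verts t)) _) (trans (cong suc (euler t)) (+-comm 2 (edges t))))

  s-sur : ∀ i → Σ (Fin d) λ j → app s j ≡ i
  s-sur = σ.sur

  a-fpf : ∀ i → app a i ≢ i
  a-fpf i e with s-sur i
  ... | j , refl = opp-≢ t (q j) (p-inj (s-inj (trans (p-opp (q j)) (trans (cong (λ z → app a (app s z)) (p-q j)) (trans e (cong (app s) (sym (p-q j))))))))

  connected : connectedB s a ≡ true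
  connected = connectedB-intro s a everywhere
    where
    module _ (S : Vec Bool d) (cl : closedB s a S ≡ true) where
      In : Fin d → Set
      In i = lookup S i ≡ true
      cl′ = closedB-elim s a S cl
      start : In zero
      start = from (proj₁ cl′)
        where
        from : (Σ (Fin d) λ i → toℕ i ≡ 0 × In i) ⊎ d ≡ 0 → In zero
        from (inj₁ (i , z , e)) = subst In (FinP.toℕ-injective {i = i} {zero} z) e
      step : ∀ {i} → In i → In (app s i) × In (app a i)
      step = proj₂ cl′
      reach : ∀ {i j} → Reach s i j → In i → In j
      reach {i} (n , refl) h = go n
        where
        go : ∀ n → In (iter s n i)
        go zero = h
        go (suc n) = proj₁ (step (go n))
      nx : ∀ {h} → In (p h) → In (p (nxt t h))
      nx {h} e = subst In (p-nxt h) (proj₂ (step (proj₁ (step e))))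
      op : ∀ {h} → In (p h) → In (p (opp t h))
      op {h} e = reach (σ.reach-sym (1 , refl)) (subst In (sym (p-opp h)) (proj₂ (step (proj₁ (step e)))))
      bwIn : ∀ {h} → h ∈ bw t → In (p h)
      bwIn h∈ = isCyc-all {S = λ h → In (p h)} nx bw-cyc (subst (h₀ ∈_) (sym (proj₁ (proj₂ (proj₂ p-root)))) (here refl)) (subst In (sym (proj₂ (proj₂ (proj₂ p-root)))) start) h∈
      everywhere : ∀ i → In i
      everywhere i with BoolP._≟_ (lookup S i) true
      ... | yes e = e
      -- The complement of `S`, transported to sides, is closed under `opp` and along faces and
      -- misses the boundary.
      ... | no ne = ⊥-elim (unreached t {λ h → ¬ In (p h)} (λ {h} n e → n (subst (λ z → In (p z)) (opp-opp t h) (op e)))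
          (λ {f} f∈ h∈ h′∈ n e → n (isCyc-all {S = λ h → In (p h)} nx (All.lookup (nxt-fcs t) f∈) h′∈ e h∈))
          (λ h∈ n → n (bwIn h∈)) (q i) (λ e → ne (trans (cong (lookup S) (sym (p-q i))) e)))

  root-degree : rootFaceDegree s a ≡ bd t
  root-degree = trans (Φ.length-cyc outer-cyc (unique-++ˡ outer letters-uq) zero-outer) (length-map p (bw t))

  module Inner = Φ.Family zero inner inner-cyc (unique-++ʳ outer letters-uq)

  inner-lengths : map (cycleLength φ) (innerFaces s a) ↭ degs t
  inner-lengths = ↭-trans (PP.map⁺ (cycleLength φ) (unique-same-↭ (innerFaces-unique s a) Inner.mins-unique to from)) (↭-reflexive (trans Inner.lengths
      (trans (sym (map-∘ (fcs t))) (trans (map-cong (λ f → length-map p f) (fcs t)) (degs-length t wf)))))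
    where
    to : ∀ {i} → i ∈ innerFaces s a → i ∈ map (Φ.minOf zero) inner
    to {i} m with inner-elim s a m | ∈-++⁻ outer (letters-full i)
    ... | e , n | inj₁ o = ⊥-elim (n zero refl (Φ.same-intro (Φ.cyc-reach outer-cyc o zero-outer)))
    ... | e , n | inj₂ i∈ with ∈-concat⁻′ inner i∈
    ...   | c , i∈c , c∈ = Inner.min-in e c∈ i∈c
    from : ∀ {i} → i ∈ map (Φ.minOf zero) inner → i ∈ innerFaces s a
    from m with ∈-map⁻ (Φ.minOf zero) m
    ... | c , c∈ , refl = inner-intro s a (Inner.minOf-min c∈) λ where
      zero _ e → unique-disjoint outer letters-uq zero-outer (∈-concat⁺′ (Φ.reach-cyc (All.lookup inner-cyc c∈) (Inner.minOf-∈ c∈) (Φ.same-elim e)) c∈)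
      (suc _) ()

nextB : {l : ℕ} → Fin l → Fin l → Bool
nextB {l} r q = (toℕ q ≡ᵇ suc (toℕ r)) ∨ ((toℕ q ≡ᵇ 0) ∧ (suc (toℕ r) ≡ᵇ l))

module _ {d l : ℕ} (s a : Perm d) (hs : Vec (Fin d) l) where
  private
    h : Fin l → Fin d
    h = lookup hs
    linkB : Fin l → Fin l → Bool
    linkB r q = not (nextB r q) ∨ sameCycle s (app a (h r)) (h q)
    apartB : Fin l → Fin l → Bool
    apartB r q = (r == q) ∨ (not (h q == h r) ∧ not (h q == app a (h r)) ∧ not (sameCycle s (h r) (h q)))

  isGraphCycle-intro : (∀ r q → nextB r q ≡ true → sameCycle s (app a (h r)) (h q) ≡ true) →
    (∀ r q → r ≢ q → h q ≢ h r × h q ≢ app a (h r) × sameCycle s (h r) (h q) ≢ true) → isGraphCycle s a hs ≡ true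
  isGraphCycle-intro f g = ∧-intro (all-intro (λ r → all (linkB r) (allFin l)) (allFin l) (λ {r} _ → all-intro (linkB r) (allFin l) (λ {q} _ → ⇒-intro (nextB r q) (f r q))))
    (all-intro (λ r → all (apartB r) (allFin l)) (allFin l) (λ {r} _ → all-intro (apartB r) (allFin l) (λ {q} _ → ap r q)))
    where
    ap : ∀ r q → apartB r q ≡ true
    ap r q with r == q in eq
    ... | true = refl
    ... | false with g r q (λ e → case trans (sym (==-true e)) eq of λ ())
    ...   | n₁ , n₂ , n₃ = ∧-intro (not-intro (λ e → n₁ (==-sound e))) (∧-intro (not-intro (λ e → n₂ (==-sound e))) (not-intro n₃))

  isGraphCycle-elim : isGraphCycle s a hs ≡ true → (∀ r q → nextB r q ≡ true → sameCycle s (app a (h r)) (h q) ≡ true) ×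
    (∀ r q → r ≢ q → h q ≢ h r × h q ≢ app a (h r) × sameCycle s (h r) (h q) ≢ true)
  isGraphCycle-elim e = (λ r q → ⇒-elim {nextB r q} (all-elim (linkB r) (allFin l) (all-elim (λ r → all (linkB r) (allFin l)) (allFin l) (proj₁ e′) (∈-allFin r)) (∈-allFin q))) ,
      λ r q n → ap r q n (∨-elim {r == q} (all-elim (apartB r) (allFin l) (all-elim (λ r → all (apartB r) (allFin l)) (allFin l) (proj₂ e′) (∈-allFin r)) (∈-allFin q)))
    where
    e′ : all (λ r → all (linkB r) (allFin l)) (allFin l) ≡ true × all (λ r → all (apartB r) (allFin l)) (allFin l) ≡ true
    e′ = ∧-elim {all (λ r → all (linkB r) (allFin l)) (allFin l)} e
    ap : ∀ r q → r ≢ q → (r == q) ≡ true ⊎ (not (h q == h r) ∧ not (h q == app a (h r)) ∧ not (sameCycle s (h r) (h q))) ≡ true → h q ≢ h r × h q ≢ app a (h r) × sameCycle s (h r) (h q) ≢ true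
    ap r q n (inj₁ e) = ⊥-elim (n (==-sound e))
    ap r q n (inj₂ e) with ∧-elim {not (h q == h r)} e
    ... | e₁ , e″ with ∧-elim {not (h q == app a (h r))} e″
    ...   | e₂ , e₃ = (λ x → not-elim e₁ (==-true x)) , (λ x → not-elim e₂ (==-true x)) , not-elim e₃

hasCycle-elim : {d l : ℕ} (s a : Perm d) → hasCycleOfLength s a l ≡ true → Σ (Vec (Fin d) l) λ hs → isGraphCycle s a hs ≡ true
hasCycle-elim {d} {l} s a e with any-elim (isGraphCycle s a) (allVecs (allFin d) l) e
... | hs , _ , e′ = hs , e′

hasCycle-intro : {d l : ℕ} (s a : Perm d) (hs : Vec (Fin d) l) → isGraphCycle s a hs ≡ true → hasCycleOfLength s a l ≡ true
hasCycle-intro {d} {l} s a hs e = any-intro (isGraphCycle s a) (allVecs (allFin d) l) (∈-allVecs hs (λ r → ∈-allFin _)) e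

hasGirth-elim : {d : ℕ} (s a : Perm d) (g : ℕ) → hasGirth s a g ≡ true → hasCycleOfLength s a g ≡ true × (∀ l → suc l < g → hasCycleOfLength s a (suc l) ≢ true)
hasGirth-elim s a g e with ∧-elim {hasCycleOfLength s a g} e
... | e₁ , e₂ = e₁ , λ l lt → not-elim (all-elim (λ l → not (hasCycleOfLength s a l)) (map suc (upTo (g ∸ 1))) e₂ (∈-map⁺ suc (∈-upTo⁺ (ℕP.∸-monoˡ-≤ 1 lt))))

hasGirth-intro : {d : ℕ} (s a : Perm d) (g : ℕ) → hasCycleOfLength s a g ≡ true → (∀ l → suc l < g → hasCycleOfLength s a (suc l) ≢ true) → hasGirth s a g ≡ true
hasGirth-intro s a g e h = ∧-intro e (all-intro (λ l → not (hasCycleOfLength s a l)) (map suc (upTo (g ∸ 1))) λ m → case ∈-map⁻ suc m of λ where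
    (l , l∈ , refl) → not-intro (h l (lt g (∈-upTo⁻ l∈))))
  where
  lt : ∀ g {l} → l < g ∸ 1 → suc l < g
  lt (suc g) p = s≤s p

module Girth {d′ : ℕ} {s a : Perm (suc d′)} {t : Tm} {p : Half t → Fin (suc d′)} (real : Realizes s a t p) where
  open Realizes real
  open Realized real using (module σ; q; p-q; q-p; org-reach; reach-org; s-sur)

  private
    d : ℕ
    d = suc d′

  Separate : Fin d → Fin d → Set
  Separate x y = y ≢ x × y ≢ app a x × sameCycle s x y ≢ true

  -- The half-edge of a side, in terms of which the cycles of the definition are expressed.
  hal : Half t → Fin d
  hal h = app s (p h)

  hal-inj : Inj hal
  hal-inj e = p-inj (s-inj e)

  lah : Fin d → Half t
  lah i = q (proj₁ (s-sur i))

  hal-lah : ∀ i → hal (lah i) ≡ i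
  hal-lah i = trans (cong (app s) (p-q _)) (proj₂ (s-sur i))

  hal-opp : ∀ h → app a (hal h) ≡ hal (opp t h)
  hal-opp h = sym (p-opp h)

  same-org : ∀ {h h′} → sameCycle s (hal h) (hal h′) ≡ true → org t h ≡ org t h′
  same-org e = reach-org (σ.reach-trans σ.reach-step (σ.reach-trans (σ.same-elim e) σ.reach-back))

  org-same : ∀ {h h′} → org t h ≡ org t h′ → sameCycle s (hal h) (hal h′) ≡ true
  org-same e = σ.same-intro (σ.reach-trans σ.reach-back (σ.reach-trans (org-reach e) σ.reach-step))

  gcycle-elim : ∀ {l} (hs : Vec (Half t) (suc l)) → isGraphCycle s a (Vec.map hal hs) ≡ true → GCycle t (Vec.toList hs)
  gcycle-elim {l} hs e = (org t (lookup hs zero) , to-chain (org t) (opp t) hs (λ r q eq → next r q (cong (λ z → z ∨ ((toℕ q ≡ᵇ 0) ∧ (suc (toℕ r) ≡ᵇ suc l))) (≡ᵇ-true eq)))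
        (λ r eq → next r zero (≡ᵇ-true eq))) ,
      AllPairsP.map⁺ (pairs-intro hs (λ r q n eq → proj₂ (proj₂ (apart r q n)) (org-same eq))) ,
      pairs-intro hs (λ r q n → (λ eq → proj₁ (apart r q n) (cong hal (sym eq))) , λ eq → proj₁ (proj₂ (apart r q n)) (trans (cong hal (sym eq)) (sym (hal-opp _))))
    where
    el = isGraphCycle-elim s a (Vec.map hal hs) e
    lk : ∀ r → lookup (Vec.map hal hs) r ≡ hal (lookup hs r)
    lk r = VecP.lookup-map r hal hs
    next : ∀ r q → nextB r q ≡ true → org t (opp t (lookup hs r)) ≡ org t (lookup hs q)
    next r q e = same-org (subst₂ (λ x y → sameCycle s x y ≡ true) (trans (cong (app a) (lk r)) (hal-opp _)) (lk q) (proj₁ el r q e))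
    apart : ∀ r q → r ≢ q → Separate (hal (lookup hs r)) (hal (lookup hs q))
    apart r q n = subst₂ Separate (lk r) (lk q) (proj₂ el r q n)

  gcycle-intro : ∀ {l} (hs : Vec (Half t) (suc l)) → GCycle t (Vec.toList hs) → isGraphCycle s a (Vec.map hal hs) ≡ true
  gcycle-intro {l} hs ((v , ch) , uq , ap) = isGraphCycle-intro s a (Vec.map hal hs)
      (λ r q e → subst₂ (λ x y → sameCycle s x y ≡ true) (sym (trans (cong (app a) (lk r)) (hal-opp _))) (sym (lk q)) (org-same (next r q (∨-elim {toℕ q ≡ᵇ suc (toℕ r)} e))))
      (λ r q n → subst₂ Separate (sym (lk r)) (sym (lk q)) (apart r q n))
    where
    lk : ∀ r → lookup (Vec.map hal hs) r ≡ hal (lookup hs r)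
    lk r = VecP.lookup-map r hal hs
    fc = from-chain (org t) (opp t) hs ch
    next : ∀ r q → (toℕ q ≡ᵇ suc (toℕ r)) ≡ true ⊎ ((toℕ q ≡ᵇ 0) ∧ (suc (toℕ r) ≡ᵇ suc l)) ≡ true → org t (opp t (lookup hs r)) ≡ org t (lookup hs q)
    next r q (inj₁ e) = proj₁ (proj₂ fc) r q (≡ᵇ-sound e)
    next r q (inj₂ e) with ∧-elim {toℕ q ≡ᵇ 0} e
    ... | e₁ , e₂ = trans (proj₂ (proj₂ fc) r (≡ᵇ-sound e₂)) (trans (sym (proj₁ fc)) (cong (λ z → org t (lookup hs z)) (sym (FinP.toℕ-injective {i = q} {zero} (≡ᵇ-sound e₁)))))
    apart : ∀ r q → r ≢ q → Separate (hal (lookup hs r)) (hal (lookup hs q))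
    apart r q n = (λ e → proj₁ ar (sym (hal-inj e))) , (λ e → proj₂ ar (sym (hal-inj (trans e (hal-opp _))))) ,
        λ e → pairs-elim {R = λ x y → org t x ≢ org t y} (λ n e → n (sym e)) hs (allPairs-map⁻ (Vec.toList hs) uq) r q n (same-org e)
      where
      ar = pairs-elim (apart-sym t) hs ap r q n

  cycle-elim : ∀ {l} → hasCycleOfLength s a (suc l) ≡ true → Σ (Half t) λ h → Σ (List (Half t)) λ hs → length hs ≡ l × GCycle t (h ∷ hs)
  cycle-elim {l} e with hasCycle-elim {l = suc l} s a e
  ... | v , e′ = case subst (λ z → isGraphCycle s a z ≡ true) (sym (trans (sym (VecP.map-∘ hal lah v)) (trans (VecP.map-cong hal-lah v) (VecP.map-id v)))) e′ of (list (Vec.map lah v))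
    where
    list : (hs : Vec (Half t) (suc l)) → isGraphCycle s a (Vec.map hal hs) ≡ true → Σ (Half t) λ h → Σ (List (Half t)) λ hs → length hs ≡ l × GCycle t (h ∷ hs)
    list (h ∷ hs) e = h , Vec.toList hs , VecP.length-toList hs , gcycle-elim (h ∷ hs) e

  cycle-intro : ∀ {h hs} → GCycle t (h ∷ hs) → hasCycleOfLength s a (suc (length hs)) ≡ true
  cycle-intro {h} {hs} g = hasCycle-intro s a (Vec.map hal (Vec.fromList (h ∷ hs))) (gcycle-intro (Vec.fromList (h ∷ hs)) (subst (GCycle t) (sym (VecP.toList∘fromList (h ∷ hs))) g))

  -- A cycle that violates `Good` would be shorter than the girth, and a cycle of length c + 2 rules
  -- out a bridge as root edge.
  girth-elim : ∀ c → bd t ≡ suc (suc c) → hasGirth s a (suc (suc c)) ≡ true → Good c t × IsSplit t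
  girth-elim c bt e = good , sp
    where
    he = hasGirth-elim s a (suc (suc c)) e
    good : Good c t
    good with Good? c t
    ... | yes g = g
    ... | no ng with short-cycle c t ng
    ...   | h , hs , le , gc = ⊥-elim (proj₂ he (length hs) (s≤s (s≤s le)) (cycle-intro gc))
    sp : IsSplit t
    sp with cycle-elim {suc c} (proj₁ he)
    ... | h , hs , _ , gc = cycle-split c t wf good bt gc

  girth-intro : ∀ c → bd t ≡ suc (suc c) → Good c t → IsSplit t → hasGirth s a (suc (suc c)) ≡ true
  girth-intro c bt g sp = hasGirth-intro s a (suc (suc c)) (ex (split-cycle c t wf g bt sp)) none
    where
    ex : (Σ (List (Half t)) λ hs → length hs ≡ suc (suc c) × GCycle t hs) → hasCycleOfLength s a (suc (suc c)) ≡ true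
    ex (h ∷ hs , e , gc) = subst (λ z → hasCycleOfLength s a z ≡ true) e (cycle-intro gc)
    none : ∀ l → suc l < suc (suc c) → hasCycleOfLength s a (suc l) ≢ true
    none l (s≤s (s≤s le)) e with cycle-elim {l} e
    ... | h , hs , refl , (_ , ch) , _ , ap = no-short-trail c t g h hs le ch ap

-- Counting labelled maps by terms and labellings

-- The number `d` of half-edges is a parameter of its own, so that it can be matched as a successor;
-- for `goodMap` it is `2 * edgesOf b m`.
record GoodMap {d k : ℕ} (b n : ℕ) (m : Vec ℕ k) (s a : Perm d) : Set where
  field
    bij        : isBij s ≡ true
    involution : isFPFInvolution a ≡ true
    connected  : connectedB s a ≡ true
    planar     : numCycles s + numCycles (compose a s) ≡ n + 2
    girth      : hasGirth s a (2 * b) ≡ true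
    outer      : rootFaceDegree s a ≡ 2 * b
    faces      : Wt b m (map (cycleLength (compose a s)) (innerFaces s a))

count-map : {A B : Set} (p : B → Bool) (f : A → B) (xs : List A) → count p (map f xs) ≡ count (λ x → p (f x)) xs
count-map p f [] = refl
count-map p f (x ∷ xs) with p (f x)
... | true = cong suc (count-map p f xs)
... | false = count-map p f xs

degB : {d k : ℕ} → ℕ → Perm d → Fin d → Fin k → Bool
degB b φ i r = cycleLength φ i ≡ᵇ 2 * (b + toℕ r)

countB : {d k : ℕ} → ℕ → Vec ℕ k → Perm d → Perm d → Fin k → Bool
countB b m s a r = count (λ i → degB b (compose a s) i r) (innerFaces s a) ≡ᵇ lookup m r

goodMap-elim : {k : ℕ} (b : ℕ) (m : Vec ℕ k) (s a : Perm (2 * edgesOf b m)) → goodMap b m s a ≡ true → GoodMap b (edgesOf b m) m s a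
goodMap-elim {k} b m s a e with ∧-elim {isPlanarMap (edgesOf b m) s a} e
... | e₁ , r₁ with ∧-elim {hasGirth s a (2 * b)} r₁
...   | e₂ , r₂ with ∧-elim {rootFaceDegree s a ≡ᵇ 2 * b} r₂
...     | e₃ , r₃ with ∧-elim {all (countB b m s a) (allFin k)} r₃
...       | e₄ , e₅ with ∧-elim {isBij s} e₁
...         | f₁ , g₁ with ∧-elim {isFPFInvolution a} g₁
...           | f₂ , g₂ with ∧-elim {connectedB s a} g₂
...             | f₃ , f₄ = record { bij = f₁ ; involution = f₂ ; connected = f₃ ; planar = ≡ᵇ-sound f₄ ; girth = e₂ ; outer = ≡ᵇ-sound e₃ ; faces = mkWt
  (AllP.map⁺ (All.tabulate (λ {i} m → case any-elim (degB b (compose a s) i) (allFin k) (all-elim (λ i → any (degB b (compose a s) i) (allFin k)) (innerFaces s a) e₅ m) of λ where (r , _ , e) → r , ≡ᵇ-sound e)))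
  (λ r → trans (sym (≡ᵇ-sound (all-elim (countB b m s a) (allFin k) e₄ (∈-allFin r)))) (sym (count-map (isDg b r) (cycleLength (compose a s)) (innerFaces s a)))) }

goodMap-intro : {k : ℕ} (b : ℕ) (m : Vec ℕ k) (s a : Perm (2 * edgesOf b m)) → GoodMap b (edgesOf b m) m s a → goodMap b m s a ≡ true
goodMap-intro {k} b m s a g = ∧-intro (∧-intro bij (∧-intro involution (∧-intro connected (≡ᵇ-true planar)))) (∧-intro girth (∧-intro (≡ᵇ-true outer) (∧-intro
  (all-intro (countB b m s a) (allFin k) (λ {r} _ → ≡ᵇ-true (trans (sym (count-map (isDg b r) (cycleLength (compose a s)) (innerFaces s a))) (sym (Wt.counts faces r)))))
  (all-intro (λ i → any (degB b (compose a s) i) (allFin k)) (innerFaces s a) (λ {i} i∈ → case All.lookup (Wt.allowed faces) (∈-map⁺ (cycleLength (compose a s)) i∈) of λ where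
    (r , e) → any-intro (degB b (compose a s) i) (allFin k) (∈-allFin r) (≡ᵇ-true e))))))
  where open GoodMap g

module _ {d′ k : ℕ} {b c n : ℕ} {m : Vec ℕ k} {s a : Perm (suc d′)} {t : Tm} {p : Half t → Fin (suc d′)} (real : Realizes s a t p) (bc : 2 * b ≡ suc (suc c)) where
  open Realizes real using (wf)
  private
    module R = Realized real
    module G = Girth real

  good-class : GoodMap b n m s a → InClass b (PS c (2 * b)) m t
  good-class g = ((wf , proj₁ gs) , bt , proj₂ gs) , wt-↭ R.inner-lengths faces
    where
    open GoodMap g
    bt : bd t ≡ 2 * b
    bt = trans (sym R.root-degree) outer
    gs : Good c t × IsSplit t
    gs = G.girth-elim c (trans bt bc) (subst (λ z → hasGirth s a z ≡ true) bc girth)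

  class-good : suc d′ ≡ 2 * n → InClass b (PS c (2 * b)) m t → GoodMap b n m s a
  class-good en (((_ , g) , bt , sp) , w) = record
    { bij = isBij-intro s (Realizes.s-inj real) ; involution = involution-intro a (Realizes.a-inv real) R.a-fpf ; connected = R.connected
    ; planar = trans R.euler-map (cong (_+ 2) (ℕP.*-cancelˡ-≡ (edges t) n 2 (trans (sym R.size) en)))
    ; girth = subst (λ z → hasGirth s a z ≡ true) (sym bc) (G.girth-intro c (trans bt bc) g sp)
    ; outer = trans R.root-degree bt
    ; faces = wt-↭ (↭-sym R.inner-lengths) w }

-- The labelling determines both permutations: `s` acts as `nxt` after `opp`, and `a` after `s` acts
-- as `nxt`.
realizes-inj : {d′ : ℕ} {s a s′ a′ : Perm (suc d′)} {t : Tm} {p p′ : Half t → Fin (suc d′)} → Realizes s a t p → Realizes s′ a′ t p′ → (∀ h → p h ≡ p′ h) → s ≡ s′ × a ≡ a′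
realizes-inj {s = s} {a} {s′} {a′} {t} {p} {p′} r r′ e = lookup-ext same , lookup-ext samea
  where
  module R = Realized r
  module R′ = Realized r′
  same : ∀ i → app s i ≡ app s′ i
  same i = trans (cong (app s) (sym (R.p-q i))) (trans (R.s-p (R.q i)) (trans (e _) (trans (sym (R′.s-p (R.q i))) (cong (app s′) (trans (sym (e (R.q i))) (R.p-q i))))))
  samea : ∀ i → app a i ≡ app a′ i
  samea i with R.s-sur i
  ... | j , refl = trans (cong (λ z → app a (app s z)) (sym (R.p-q j))) (trans (Realizes.p-nxt r (R.q j)) (trans (e _) (trans (sym (Realizes.p-nxt r′ (R.q j)))
      (trans (cong (λ z → app a′ (app s′ z)) (trans (sym (e (R.q j))) (R.p-q j))) (cong (app a′) (sym (same j)))))))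

-- Both boundaries are the face cycle of label 0 read from 0, so rigidity of embeddings applies.
realizes-unique : {d′ : ℕ} {s a : Perm (suc d′)} {t t′ : Tm} {p : Half t → Fin (suc d′)} {p′ : Half t′ → Fin (suc d′)} → Realizes s a t p → Realizes s a t′ p′ →
  Σ (t ≡ t′) λ e → ∀ h → p h ≡ p′ (subst Half e h)
realizes-unique {d′} {s} {a} {t} {t′} {p} {p′} r r′ = emb-unique {φ = app R.φ} {β} t t′ (Realizes.wf r) (Realizes.wf r′) p p′ (Realizes.p-inj r) (Realizes.p-inj r′)
    (λ h → Realizes.s-inj r (trans (proj₂ (R.s-sur _)) (sym (Realizes.p-opp r h)))) (λ h → Realizes.s-inj r (trans (proj₂ (R.s-sur _)) (sym (Realizes.p-opp r′ h))))
    (AllP.map⁻ R.inner-cyc) (AllP.map⁻ R′.inner-cyc) (boundary R.outer R′.outer (starts r) (starts r′) R.outer-cyc R′.outer-cyc (unique-++ˡ R.outer R.letters-uq) (unique-++ˡ R′.outer R′.letters-uq))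
  where
  module R = Realized r
  module R′ = Realized r′
  -- The conjugate of `a` by `s`, which is what `opp` becomes on labels.
  β : Fin (suc d′) → Fin (suc d′)
  β i = proj₁ (R.s-sur (app a (app s i)))
  starts : ∀ {t p} → Realizes s a t p → Σ (List (Fin (suc d′))) λ w → map p (bw t) ≡ zero ∷ w
  starts {p = p} r with Realizes.p-root r
  ... | x , w , e , e′ = map p w , trans (cong (map p) e) (cong (_∷ map p w) e′)
  boundary : ∀ w w′ → (Σ (List (Fin (suc d′))) λ u → w ≡ zero ∷ u) → (Σ (List (Fin (suc d′))) λ u → w′ ≡ zero ∷ u) → IsCyc (app R.φ) w → IsCyc (app R.φ) w′ → Unique w → Unique w′ → w ≡ w′
  boundary _ _ (u , refl) (u′ , refl) (_ , (refl , sg) , _) (_ , (refl , sg′) , _) (n ∷ _) (n′ ∷ _) =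
    cong (zero ∷_) (seg-unique u u′ sg sg′ (λ m → All.lookup n m refl) (λ m → All.lookup n′ m refl))

halves-head : ∀ t {x r} → bw t ≡ x ∷ r → Σ (List (Half t)) λ r′ → halves t ≡ x ∷ r′
halves-head (loop t u) refl = _ , refl
halves-head (split i t) refl = _ , refl

assoc : {A B : Set} → DecidableEquality A → B → List A → List B → A → B
assoc _≟_ z [] _ a = z
assoc _≟_ z (x ∷ xs) [] a = z
assoc _≟_ z (x ∷ xs) (y ∷ ys) a with a ≟ x
... | yes _ = y
... | no _ = assoc _≟_ z xs ys a

assoc-map : {A B : Set} (_≟_ : DecidableEquality A) (z : B) (xs : List A) (ys : List B) → Unique xs → length xs ≡ length ys → map (assoc _≟_ z xs ys) xs ≡ ys
assoc-map _≟_ z [] [] _ _ = refl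
assoc-map {A} {B} _≟_ z (x ∷ xs) (y ∷ ys) (n ∷ u) e = cong₂ _∷_ first (trans (LP.map-cong-local (All.map rest n)) (assoc-map _≟_ z xs ys u (suc-injective e)))
  where
  first : assoc _≟_ z (x ∷ xs) (y ∷ ys) x ≡ y
  first with x ≟ x
  ... | yes _ = refl
  ... | no ne = ⊥-elim (ne refl)
  rest : ∀ {a} → x ≢ a → assoc _≟_ z (x ∷ xs) (y ∷ ys) a ≡ assoc _≟_ z xs ys a
  rest {a} ne with a ≟ x
  ... | yes e = ⊥-elim (ne (sym e))
  ... | no _ = refl

map-eq-∈ : {A B : Set} {f g : A → B} {xs : List A} → map f xs ≡ map g xs → ∀ {x} → x ∈ xs → f x ≡ g x
map-eq-∈ {xs = x ∷ xs} e (here refl) = proj₁ (∷-injective e)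
map-eq-∈ {xs = x ∷ xs} e (there m) = map-eq-∈ (proj₂ (∷-injective e)) m

-- A permutation of x ∷ xs is a permutation of xs with x inserted at one of the length xs + 1
-- positions.
card-perms : {A : Set} {xs : List A} → Unique xs → HasCard (λ l → l ↭ xs) (length xs !)
card-perms {xs = []} _ = card-1 [] ↭-refl (λ e → PP.↭-empty-inv e)
card-perms {A} {x ∷ xs} (n ∷ u) = card-image {Q = λ l → l ↭ x ∷ xs} (card-× (subst (HasCard (λ j → j ∈ upTo (suc (length xs)))) (LP.length-upTo (suc (length xs))) (card-list (UP.upTo⁺ (suc (length xs))))) (card-perms u))
    (λ jl _ → ins (proj₁ jl) (proj₂ jl)) (λ where (j , l) (_ , e) → ↭-trans (PP.shift x (take j l) (drop j l)) (prep x (↭-trans (↭-reflexive (take++drop≡id j l)) e)))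
    inj sur
  where
  ins : ℕ → List A → List A
  ins j l = take j l ++ x ∷ drop j l
  fresh : ∀ {l} → l ↭ xs → ∀ {ys} → (∀ {z} → z ∈ ys → z ∈ l) → x ∉ ys
  fresh e sub m = All.lookup n (PP.∈-resp-↭ e (sub m)) refl
  take-⊆ : ∀ j (l : List A) {z} → z ∈ take j l → z ∈ l
  take-⊆ j l m = subst (_ ∈_) (take++drop≡id j l) (∈-++⁺ˡ m)
  inj : ∀ jl (q : proj₁ jl ∈ upTo (suc (length xs)) × proj₂ jl ↭ xs) jl′ (q′ : proj₁ jl′ ∈ upTo (suc (length xs)) × proj₂ jl′ ↭ xs) → ins (proj₁ jl) (proj₂ jl) ≡ ins (proj₁ jl′) (proj₂ jl′) → jl ≡ jl′
  inj (j , l) (j∈ , e) (j′ , l′) (j′∈ , e′) eq with split-unique (take j l) (take j′ l′) (fresh e (take-⊆ j l)) (fresh e′ (take-⊆ j′ l′)) eq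
  ... | e₁ , e₂ = cong₂ _,_ (trans (sym (len j l j∈ e)) (trans (cong length e₁) (len j′ l′ j′∈ e′))) (trans (sym (take++drop≡id j l)) (trans (cong₂ _++_ e₁ e₂) (take++drop≡id j′ l′)))
    where
    len : ∀ j l → j ∈ upTo (suc (length xs)) → l ↭ xs → length (take j l) ≡ j
    len j l j∈ e = trans (length-take j l) (ℕP.m≤n⇒m⊓n≡m (≤-trans (≤-pred (∈-upTo⁻ j∈)) (≤-reflexive (sym (PP.↭-length e)))))
  sur : ∀ l → l ↭ x ∷ xs → Σ (ℕ × List A) λ jl → (proj₁ jl ∈ upTo (suc (length xs)) × proj₂ jl ↭ xs) × (∀ _ → ins (proj₁ jl) (proj₂ jl) ≡ l)
  sur l e with ∈-∃++ (PP.∈-resp-↭ (↭-sym e) (here refl))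
  ... | as , bs , refl = (length as , as ++ bs) , (∈-upTo⁺ (s≤s (≤-trans (m≤m+n (length as) (length bs)) (≤-reflexive (trans (sym (length-++ as)) (PP.↭-length e′))))) , e′) ,
      λ _ → cong₂ (λ y z → y ++ x ∷ z) (take-length as bs) (drop-length as bs)
    where
    e′ : as ++ bs ↭ xs
    e′ = PP.drop-∷ (↭-trans (↭-sym (PP.shift x as bs)) e)

module Build {d′ : ℕ} (t : Tm) (wf : WF t) (p : Half t → Fin (suc d′)) (p-inj : Inj p) (p-sur : ∀ i → Σ (Half t) λ h → p h ≡ i)
  (p-root : Σ (Half t) λ x → Σ (List (Half t)) λ r → bw t ≡ x ∷ r × p x ≡ zero) where

  private
    d : ℕ
    d = suc d′

  q : Fin d → Half t
  q i = proj₁ (p-sur i)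

  q-p : ∀ h → q (p h) ≡ h
  q-p h = p-inj (proj₂ (p-sur (p h)))

  q-inj : ∀ {i j} → q i ≡ q j → i ≡ j
  q-inj {i} {j} e = trans (sym (proj₂ (p-sur i))) (trans (cong p e) (proj₂ (p-sur j)))

  φ : Perm d
  φ = Vec.tabulate (λ i → p (nxt t (q i)))

  φ-app : ∀ i → app φ i ≡ p (nxt t (q i))
  φ-app i = VecP.lookup∘tabulate (λ i → p (nxt t (q i))) i

  φ-inj : ∀ {i j} → app φ i ≡ app φ j → i ≡ j
  φ-inj {i} {j} e = q-inj (nxt-inj t (p-inj (trans (sym (φ-app i)) (trans e (φ-app j)))))

  prv : ∀ h → Σ (Half t) λ h′ → nxt t h′ ≡ h
  prv h = back (Permutation.returns φ φ-inj (p h))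
    where
    back : (Σ ℕ λ n → n < d × iter φ (suc n) (p h) ≡ p h) → Σ (Half t) λ h′ → nxt t h′ ≡ h
    back (n , _ , e) = q (iter φ n (p h)) , p-inj (trans (sym (φ-app (iter φ n (p h)))) e)

  -- The formulas for `s` and `a` are forced by `Realizes`: since `a` is an involution, `p-nxt` and
  -- `p-opp` give `s (p h) ≡ p (nxt t (opp t h))`, and then `a` sends `p (nxt t h)` to the same
  -- label.
  s : Perm d
  s = Vec.tabulate (λ i → p (nxt t (opp t (q i))))

  a : Perm d
  a = Vec.tabulate (λ i → p (nxt t (opp t (proj₁ (prv (q i))))))

  s-app : ∀ h → app s (p h) ≡ p (nxt t (opp t h))
  s-app h = trans (VecP.lookup∘tabulate (λ i → p (nxt t (opp t (q i)))) (p h)) (cong (λ z → p (nxt t (opp t z))) (q-p h))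

  a-app : ∀ h → app a (p (nxt t h)) ≡ p (nxt t (opp t h))
  a-app h = trans (VecP.lookup∘tabulate (λ i → p (nxt t (opp t (proj₁ (prv (q i)))))) (p (nxt t h))) (cong (λ z → p (nxt t (opp t z))) (nxt-inj t (trans (proj₂ (prv _)) (q-p (nxt t h)))))

  opp-inj : ∀ {h h′} → opp t h ≡ opp t h′ → h ≡ h′
  opp-inj {h} {h′} e = trans (sym (opp-opp t h)) (trans (cong (opp t) e) (opp-opp t h′))

  a-s : ∀ h → app a (app s (p h)) ≡ p (nxt t h)
  a-s h = trans (cong (app a) (s-app h)) (trans (a-app (opp t h)) (cong (λ z → p (nxt t z)) (opp-opp t h)))

  a-inv : ∀ i → app a (app a i) ≡ i
  a-inv i = subst (λ z → app a (app a z) ≡ z) (trans (cong p (proj₂ (prv (q i)))) (proj₂ (p-sur i)))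
    (trans (cong (app a) (a-app h)) (trans (a-app (opp t h)) (cong (λ z → p (nxt t z)) (opp-opp t h))))
    where
    h : Half t
    h = proj₁ (prv (q i))

  s-inj : ∀ {i j} → app s i ≡ app s j → i ≡ j
  s-inj {i} {j} e = trans (sym (proj₂ (p-sur i))) (trans (cong p (opp-inj (nxt-inj t (p-inj (trans (sym (s-app (q i))) (trans (cong (app s) (proj₂ (p-sur i))) (trans e (trans (cong (app s) (sym (proj₂ (p-sur j)))) (s-app (q j))))))))) ) (proj₂ (p-sur j)))

  built : Realizes s a t p
  built = record { wf = wf ; s-inj = λ {i} {j} → s-inj {i} {j} ; a-inv = a-inv ; p-inj = λ {h} {h′} → p-inj {h} {h′} ; p-sur = p-sur ; p-nxt = a-s
    ; p-opp = λ h → trans (s-app (opp t h)) (trans (cong (λ z → p (nxt t z)) (opp-opp t h)) (sym (a-s h))) ; p-root = p-root }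

-- `halves t` begins with the root side, which therefore receives label 0; the other labels are
-- free.
labelling : {d′ : ℕ} (t : Tm) → WF t → length (halves t) ≡ suc d′ → (L : List (Fin (suc d′))) → zero ∷ L ↭ allFin (suc d′) →
  Σ (Perm (suc d′)) λ s → Σ (Perm (suc d′)) λ a → Σ (Half t → Fin (suc d′)) λ p → Realizes s a t p × map p (halves t) ≡ zero ∷ L
labelling {d′} t wf len L pm = Build.s t wf p p-inj p-sur root′ , Build.a t wf p p-inj p-sur root′ , p , Build.built t wf p p-inj p-sur root′ , im
  where
  d : ℕ
  d = suc d′
  p : Half t → Fin d
  p = assoc (Half-≟ t) zero (halves t) (zero ∷ L)
  im : map p (halves t) ≡ zero ∷ L
  im = assoc-map (Half-≟ t) zero (halves t) (zero ∷ L) (halves-unique t) (trans len (trans (sym (LP.length-tabulate {n = d} id)) (sym (PP.↭-length pm))))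
  p-inj : Inj p
  p-inj {h} {h′} = map-unique⇒inj p {halves t} (subst Unique (sym im) (unique-↭ (↭-sym pm) (UP.allFin⁺ d))) (∈-halves t h) (∈-halves t h′)
  p-sur : ∀ i → Σ (Half t) λ h → p h ≡ i
  p-sur i with ∈-map⁻ p (subst (i ∈_) (sym im) (PP.∈-resp-↭ (↭-sym pm) (∈-allFin i)))
  ... | h , _ , e = h , sym e
  h₀ : Half t
  h₀ = proj₁ (p-sur zero)
  root′ : Σ (Half t) λ x → Σ (List (Half t)) λ r → bw t ≡ x ∷ r × p x ≡ zero
  root′ with bw-nonempty t h₀
  ... | x , r , e with halves-head t e
  ...   | r′ , e′ = x , r , e , proj₁ (∷-injective (trans (sym (cong (map p) e′)) im))

unique-orbits : {A : Set} (f : A → List A) (xs : List A) → (∀ x → Unique (f x)) → Unique xs → (∀ {x y z} → x ∈ xs → y ∈ xs → z ∈ f x → z ∈ f y → x ≡ y) → Unique (concat (map f xs))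
unique-orbits f [] uf _ _ = []
unique-orbits f (x ∷ xs) uf (n ∷ u) h = UP.++⁺ (uf x) (unique-orbits f xs uf u (λ x∈ y∈ → h (there x∈) (there y∈))) λ where
  (m , m′) → case ∈-concat⁻′ (map f xs) m′ of λ where
    (_ , m₁ , m₂) → case ∈-map⁻ f m₂ of λ where (y , y∈ , refl) → All.lookup n y∈ (h (here refl) (there y∈) m m₁)

module Decode {d′ n : ℕ} {s a : Perm (suc d′)} (s-inj : ∀ {i j} → app s i ≡ app s j → i ≡ j) (a-inv : ∀ i → app a (app a i) ≡ i) (a-fpf : ∀ i → app a i ≢ i)
  (con : connectedB s a ≡ true) (χ₀ : numCycles s + numCycles (compose a s) ≡ n + 2) (size : suc d′ ≡ 2 * n) where

  private
    d : ℕ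
    d = suc d′

  φ : Perm d
  φ = compose a s

  φ-inj : ∀ {i j} → app φ i ≡ app φ j → i ≡ j
  φ-inj = compose-inj {s = s} {a} s-inj a-inv

  module σ = Permutation s s-inj
  module Φ = Permutation φ φ-inj

  s-sur : ∀ i → Σ (Fin d) λ j → app s j ≡ i
  s-sur = σ.sur

  β : Fin d → Fin d
  β i = proj₁ (s-sur (app a (app s i)))

  s-β : ∀ i → app s (β i) ≡ app a (app s i)
  s-β i = proj₂ (s-sur (app a (app s i)))

  φ-β : ∀ i → app φ (β i) ≡ app s i
  φ-β i = trans (app-compose a s (β i)) (trans (cong (app a) (s-β i)) (a-inv (app s i)))

  w : List (Fin d)
  w = Φ.orbit zero

  fs : List (List (Fin d))
  fs = map Φ.orbit (innerFaces s a)

  fs-cyc : All (IsCyc (app φ)) fs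
  fs-cyc = AllP.map⁺ (All.tabulate (λ {i} _ → Φ.orbit-cyc i))

  orbit-reach : ∀ {i j} → j ∈ Φ.orbit i → Reach φ i j
  orbit-reach {i} m = Φ.cyc-reach (Φ.orbit-cyc i) (Φ.∈-orbit i) m

  all-uq : Unique (w ++ concat fs)
  all-uq = UP.++⁺ (Φ.orbit-unique zero) (unique-orbits Φ.orbit (innerFaces s a) Φ.orbit-unique (innerFaces-unique s a)
      (λ x∈ y∈ m m′ → Φ.min-unique (proj₁ (inner-elim s a x∈)) (proj₁ (inner-elim s a y∈)) (Φ.reach-trans (orbit-reach m) (Φ.reach-sym (orbit-reach m′))))) λ where
    (m , m′) → case ∈-concat⁻′ fs m′ of λ where
      (_ , m₁ , m₂) → case ∈-map⁻ Φ.orbit m₂ of λ where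
        (i , i∈ , refl) → proj₂ (inner-elim s a i∈) zero refl (Φ.same-intro (Φ.reach-trans (orbit-reach m₁) (Φ.reach-sym (orbit-reach m))))

  all-full : ∀ i → i ∈ w ++ concat fs
  all-full i = cases (BoolP._≟_ (sameCycle φ (Φ.rep i) zero) true)
    where
    back : ∀ {j} → Reach φ j (Φ.rep i) → Reach φ j i
    back r = Φ.reach-trans r (Φ.reach-sym (Φ.rep-reach i))
    cases : Dec (sameCycle φ (Φ.rep i) zero ≡ true) → i ∈ w ++ concat fs
    cases (yes e) = ∈-++⁺ˡ (Φ.reach-cyc (Φ.orbit-cyc zero) (Φ.∈-orbit zero) (back (Φ.reach-sym (Φ.same-elim e))))
    cases (no ne) = ∈-++⁺ʳ w (∈-concat⁺′ (Φ.reach-cyc (Φ.orbit-cyc (Φ.rep i)) (Φ.∈-orbit (Φ.rep i)) (back Φ.reach-refl))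
      (∈-map⁺ Φ.orbit (inner-intro s a (Φ.rep-min i) λ where
        zero _ e → ne e
        (suc _) ())))

  LL-eq : LL (w ∷ []) fs ≡ w ++ concat fs
  LL-eq = cong (_++ concat fs) (++-identityʳ w)

  mins : List (Fin d)
  mins = proj₁ (card-count (isCycleMin s) (UP.allFin⁺ d) ∈-allFin)

  -- The complement of a union of inner faces closed under `β` is closed under both permutations and
  -- contains 0, so connectedness makes it everything.
  separate : ∀ gs → All (λ f → IsCyc (app φ) f × f ∈ fs) gs → ClosedUnder β (concat gs) → ∀ i → i ∉ concat gs
  separate gs cy cl i i∈ = case trans (sym (lk i)) (everywhere i) of off (any? (FinP._≟_ i) (concat gs)) i∈
    where
    L? : ∀ i → Dec (i ∈ concat gs)
    L? i = any? (FinP._≟_ i) (concat gs)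
    S : Vec Bool d
    S = Vec.tabulate (λ i → not (does (L? i)))
    lk : ∀ i → lookup S i ≡ not (does (L? i))
    lk i = VecP.lookup∘tabulate (λ i → not (does (L? i))) i
    off : ∀ {P : Set} (x : Dec P) → P → not (does x) ≡ true → ⊥
    off (yes _) _ ()
    off (no n) p _ = n p
    out : ∀ {i} → lookup S i ≡ true → i ∉ concat gs
    out {i} e m = off (L? i) m (trans (sym (lk i)) e)
    on : ∀ {P : Set} (x : Dec P) → ¬ P → not (does x) ≡ true
    on (yes p) n = ⊥-elim (n p)
    on (no _) _ = refl
    inS : ∀ {i} → i ∉ concat gs → lookup S i ≡ true
    inS {i} n = trans (lk i) (on (L? i) n)
    φ-cl : ∀ {i} → i ∈ concat gs → app φ i ∈ concat gs
    φ-cl m with ∈-concat⁻′ gs m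
    ... | f , m₁ , m₂ = ∈-concat⁺′ (isCyc-closed (proj₁ (All.lookup cy m₂)) m₁) m₂
    s-cl : ∀ {i} → i ∈ concat gs → app s i ∈ concat gs
    s-cl {i} m = subst (_∈ concat gs) (φ-β i) (φ-cl (cl m))
    reach-cl : ∀ {i j} → Reach s i j → i ∈ concat gs → j ∈ concat gs
    reach-cl {i} (n , refl) m = go n
      where
      go : ∀ n → iter s n i ∈ concat gs
      go zero = m
      go (suc n) = s-cl (go n)
    a-cl : ∀ {i} → i ∈ concat gs → app a i ∈ concat gs
    a-cl {i} m with s-sur i
    ... | j , refl = subst (_∈ concat gs) (app-compose a s j) (φ-cl (reach-cl σ.reach-back m))
    zero-out : zero ∉ concat gs
    zero-out m with ∈-concat⁻′ gs m
    ... | f , m₁ , m₂ = unique-disjoint w all-uq (Φ.∈-orbit zero) (∈-concat⁺′ m₁ (proj₂ (All.lookup cy m₂)))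
    everywhere : ∀ i → lookup S i ≡ true
    everywhere = connectedB-elim s a con S (closedB-intro s a S zero refl (inS zero-out)
      (λ {i} e → inS (λ m → out e (reach-cl σ.reach-back m)) , inS (λ m → out e (subst (_∈ concat gs) (a-inv i) (a-cl m)))))

  -- The exploration sees the labelled map through its face permutation and the conjugate of `a` by
  -- `s`; the vertices are the cycles of `s`, named by their least elements.
  planar : Planar (app φ) β w fs
  planar = record
    { β-inv = λ i → s-inj (trans (s-β (β i)) (trans (cong (app a) (s-β i)) (a-inv (app s i))))
    ; β-fpf = λ i e → a-fpf (app s i) (trans (sym (s-β i)) (cong (app s) e))
    ; cyc = fs-cyc ; cycʷ = proj₁ (Φ.orbit-cyc zero) , proj₁ (proj₂ (Φ.orbit-cyc zero))
    ; uniq = subst Unique (sym LL-eq) all-uq ; full = λ i → subst (i ∈_) (sym LL-eq) (all-full i)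
    ; conn = λ where
        [] _ _ → refl
        gs@(_ ∷ _) cy@(((h , _ , h∈) , _) ∷ _) cl → ⊥-elim (separate gs cy cl h (∈-++⁺ˡ h∈))
    ; V = Fin d ; o = σ.rep
    ; o-eq = λ i → sym (σ.rep-cong (1 , trans (s-β i) (sym (app-compose a s i))))
    ; vs = mins ; vs-uniq = proj₁ (proj₂ mc) ; vs-hit = λ {v} m → v , σ.rep-fix (proj₁ (proj₂ (proj₂ mc)) m)
    ; n = n
    ; n-eq = trans (cong length LL-eq) (trans (card-unique (card-list all-uq) (card-cong (λ _ → all-full _) (λ {i} _ → ∈-allFin i) (card-list (UP.allFin⁺ d)))) (trans (LP.length-tabulate {n = d} id) size))
    ; χ = trans (cong₂ _+_ (proj₂ (proj₂ (proj₂ (proj₂ mc)))) (sym (Φ.Family.number zero (w ∷ fs) (Φ.orbit-cyc zero ∷ fs-cyc) all-uq all-full))) χ₀ }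
    where
    mc = card-count (isCycleMin s) (UP.allFin⁺ d) ∈-allFin

  from-emb : ∀ {t U} → Emb (app φ) β t w U → U ↭ LL (w ∷ []) fs → Σ Tm λ t → Σ (Half t → Fin d) λ p → Realizes s a t p
  from-emb {t} {U} (emb p wf im bdy p-opp inner) pm = t , p , record
      { wf = wf ; s-inj = λ {i} {j} → s-inj {i} {j} ; a-inv = a-inv ; p-inj = λ {h} {h′} → map-unique⇒inj p {halves t} uq (∈-halves t h) (∈-halves t h′) ; p-sur = sur
      ; p-nxt = λ h → trans (sym (app-compose a s (p h))) (nx h (cycle-of t h))
      ; p-opp = λ h → trans (cong (app s) (sym (p-opp h))) (s-β (p h)) ; p-root = rt (bw-nonempty t (proj₁ (sur zero))) }
    where
    uq : Unique (map p (halves t))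
    uq = subst Unique (sym im) (unique-↭ (↭-sym pm) (subst Unique (sym LL-eq) all-uq))
    sur : ∀ i → Σ (Half t) λ h → p h ≡ i
    sur i with ∈-map⁻ p (subst (i ∈_) (sym im) (PP.∈-resp-↭ (↭-sym pm) (subst (i ∈_) (sym LL-eq) (all-full i))))
    ... | h , _ , e = h , sym e
    nx : ∀ h → (Σ (List (Half t)) λ f → IsCyc (nxt t) f × h ∈ f × f ∈ bw t ∷ fcs t) → app φ (p h) ≡ p (nxt t h)
    nx h (f , cy , h∈ , here refl) = cyc-comm p cy (zero′ , subst (λ z → Seg (app φ) zero′ z zero′) (sym bdy) (proj₁ (proj₂ (Φ.orbit-cyc zero)))) h∈
      where
      zero′ : Fin d
      zero′ = proj₁ (Φ.orbit-cyc zero)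
    nx h (f , cy , h∈ , there f∈) = cyc-comm p cy (proj₁ (All.lookup inner f∈) , proj₁ (proj₂ (All.lookup inner f∈))) h∈
    rt : (Σ (Half t) λ x → Σ (List (Half t)) λ r → bw t ≡ x ∷ r) → Σ (Half t) λ x → Σ (List (Half t)) λ r → bw t ≡ x ∷ r × p x ≡ zero
    rt (x , r , e) = x , r , e , proj₁ (∷-injective (trans (sym (cong (map p) e)) (trans bdy (proj₂ (Φ.orbit-head zero)))))

  decoded : Σ Tm λ t → Σ (Half t → Fin d) λ p → Realizes s a t p
  decoded = from-emb (proj₁ (proj₂ (proj₂ dec))) (proj₁ (proj₂ (proj₂ (proj₂ dec))))
    where
    dec : Σ Tm λ t → Σ (List (Fin d)) λ U → Emb (app φ) β t w U × U ↭ LL (w ∷ []) fs × degs t ↭ map length fs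
    dec = decode planar

allVecs-unique : {A : Set} {xs : List A} → Unique xs → ∀ l → Unique (allVecs xs l)
allVecs-unique u zero = [] ∷ []
allVecs-unique {xs = xs} u (suc l) = unique-concatMap (λ x → map (x ∷_) (allVecs xs l)) xs u (λ x → UP.map⁺ (λ e → VecP.∷-injectiveʳ e) (allVecs-unique u l))
  λ m m′ → case ∈-map⁻ (_ ∷_) m of λ where
    (_ , _ , refl) → case ∈-map⁻ (_ ∷_) m′ of λ where (_ , _ , e) → VecP.∷-injectiveˡ e

card-labelled : {k : ℕ} (b : ℕ) (m : Vec ℕ k) → HasCard (λ (sa : Perm (2 * edgesOf b m) × Perm (2 * edgesOf b m)) → GoodMap b (edgesOf b m) m (proj₁ sa) (proj₂ sa)) (labelledCount b m)
card-labelled b m = card-cong (λ {sa} → goodMap-elim b m (proj₁ sa) (proj₂ sa)) (λ {sa} → goodMap-intro b m (proj₁ sa) (proj₂ sa))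
  (card-count (λ sa → goodMap b m (proj₁ sa) (proj₂ sa)) (pairs-unique (allVecs (allFin d) d) (allVecs-unique (UP.allFin⁺ d) d)) (λ where (s , a) → ∈-concatMap (λ s → map (s ,_) (allVecs (allFin d) d)) (all∈ s) (∈-map⁺ (s ,_) (all∈ a))))
  where
  d : ℕ
  d = 2 * edgesOf b m
  all∈ : ∀ v → v ∈ allVecs (allFin d) d
  all∈ v = ∈-allVecs v (λ r → ∈-allFin _)
  pairs-unique : {A : Set} (xs : List A) → Unique xs → Unique (concatMap (λ s → map (s ,_) xs) xs)
  pairs-unique xs u = unique-concatMap (λ s → map (s ,_) xs) xs u (λ s → UP.map⁺ (λ where refl → refl) u)
    λ m m′ → case ∈-map⁻ (_ ,_) m of λ where
      (_ , _ , refl) → case ∈-map⁻ (_ ,_) m′ of λ where (_ , _ , refl) → refl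

labels : {d′ : ℕ} {s a : Perm (suc d′)} {t : Tm} {p : Half t → Fin (suc d′)} → Realizes s a t p →
  Σ (List (Fin (suc d′))) λ L → map p (halves t) ≡ zero ∷ L × L ↭ tabulate suc
labels {d′} {t = t} {p} r = go (Realizes.p-root r)
  where
  go : (Σ (Half t) λ x → Σ (List (Half t)) λ r → bw t ≡ x ∷ r × p x ≡ zero) → Σ (List (Fin (suc d′))) λ L → map p (halves t) ≡ zero ∷ L × L ↭ tabulate suc
  go (x , w , e , e′) with halves-head t e
  ... | w′ , e″ = map p w′ , im , PP.drop-∷ (subst (_↭ allFin (suc d′)) im (unique-same-↭ (UP.map⁺ (Realizes.p-inj r) (halves-unique t)) (UP.allFin⁺ (suc d′)) (λ _ → ∈-allFin _)
      (λ {i} _ → subst (_∈ map p (halves t)) (proj₂ (Realizes.p-sur r i)) (∈-map⁺ p (∈-halves t _)))))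
    where
    im : map p (halves t) ≡ zero ∷ map p w′
    im = trans (cong (map p) e″) (cong (_∷ map p w′) e′)

decode-inj : {d′ : ℕ} {s a s′ a′ : Perm (suc d′)} {t t′ : Tm} {p : Half t → Fin (suc d′)} {p′ : Half t′ → Fin (suc d′)} (r : Realizes s a t p) (r′ : Realizes s′ a′ t′ p′) →
  t ≡ t′ → proj₁ (labels r) ≡ proj₁ (labels r′) → (s , a) ≡ (s′ , a′)
decode-inj {t = t} r r′ refl e with realizes-inj r r′ (λ h → map-eq-∈ {xs = halves t} (trans (proj₁ (proj₂ (labels r))) (trans (cong (zero ∷_) e) (sym (proj₁ (proj₂ (labels r′)))))) (∈-halves t h))
... | refl , refl = refl

label-inj : {d′ : ℕ} {s a s′ a′ : Perm (suc d′)} {t t′ : Tm} {p : Half t → Fin (suc d′)} {p′ : Half t′ → Fin (suc d′)} → Realizes s a t p → Realizes s′ a′ t′ p′ → (s , a) ≡ (s′ , a′) →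
  ∀ {L L′} → map p (halves t) ≡ zero ∷ L → map p′ (halves t′) ≡ zero ∷ L′ → (t , L) ≡ (t′ , L′)
label-inj r r′ refl e e′ = go (realizes-unique r r′) e e′
  where
  go : ∀ {d′ t t′} {p : Half t → Fin (suc d′)} {p′ : Half t′ → Fin (suc d′)} → (Σ (t ≡ t′) λ e → ∀ h → p h ≡ p′ (subst Half e h)) →
    ∀ {L L′} → map p (halves t) ≡ zero ∷ L → map p′ (halves t′) ≡ zero ∷ L′ → (t , L) ≡ (t′ , L′)
  go {t = t} (refl , h) e e′ = cong (t ,_) (proj₂ (∷-injective (trans (sym e) (trans (map-cong h (halves t)) e′))))

opaque
  decodeGood : ∀ {k b n d′} {m : Vec ℕ k} {s a : Perm (suc d′)} → suc d′ ≡ 2 * n → GoodMap b n m s a → Σ Tm λ t → Σ (Half t → Fin (suc d′)) λ p → Realizes s a t p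
  decodeGood {n = n} {s = s} {a} de g = Decode.decoded {n = n} {s} {a} (isBij-elim s bij) (λ i → proj₁ (involution-elim a involution i)) (λ i → proj₂ (involution-elim a involution i)) connected planar de
    where open GoodMap g

  labelClass : ∀ {k b c d′} {m : Vec ℕ k} → suc d′ ≡ 2 * edgesOf b m → ∀ t → InClass b (PS c (2 * b)) m t → (L : List (Fin (suc d′))) → L ↭ tabulate suc →
    Σ (Perm (suc d′)) λ s → Σ (Perm (suc d′)) λ a → Σ (Half t → Fin (suc d′)) λ p → Realizes s a t p × map p (halves t) ≡ zero ∷ L
  labelClass {b = b} {d′ = d′} {m} de t (((wf , _) , bt , _) , w) L pm = labelling t wf size L (prep zero pm)
    where
    size : length (halves t) ≡ suc d′
    size = trans (halves-length t) (trans (sym (handshake t wf)) (trans (cong₂ _+_ bt (wt-sum m (degs t) w)) (trans (sym (ℕP.*-distribˡ-+ 2 b _)) (sym de))))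

-- A rooted map has no automorphisms, so it has (d - 1)! labellings with root label 0.
labelled-rooted : ∀ {k} b c (m : Vec ℕ k) d → 2 * b ≡ suc (suc c) → d ≡ 2 * edgesOf b m → ∀ {N M} → HasCard (InClass b (PS c (2 * b)) m) N →
  HasCard (λ (sa : Perm d × Perm d) → GoodMap b (edgesOf b m) m (proj₁ sa) (proj₂ sa)) M → M ≡ N * (d ∸ 1) !
labelled-rooted {k} b c m zero bc de hN hM = ⊥-elim (none b (trans de refl) bc)
  where
  none : ∀ b → 0 ≡ 2 * edgesOf b m → 2 * b ≡ suc (suc c) → ⊥
  none zero _ ()
  none (suc b) ()
labelled-rooted {k} b c m (suc d′) bc de {N} {M} hN hM = trans (card-≡ hM (card-× {P = InClass b (PS c (2 * b)) m} {Q = λ L → L ↭ tabulate suc} hN (card-perms {xs = tabulate suc} (AllPairs.tail (UP.allFin⁺ (suc d′)))))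
    (λ sa g → proj₁ (dec (proj₁ sa) (proj₂ sa) g) , proj₁ (labels (real sa g)))
    (λ sa g → good-class (real sa g) bc g , proj₂ (proj₂ (labels (real sa g))))
    (λ sa g sa′ g′ e → decode-inj (real sa g) (real sa′ g′) (cong proj₁ e) (cong proj₂ e))
    (λ tL q → proj₁ (lab tL q) , proj₁ (proj₂ (lab tL q)))
    (λ tL q → class-good (proj₁ (proj₂ (proj₂ (proj₂ (lab tL q))))) bc de (proj₁ q))
    (λ tL q tL′ q′ e → label-inj (proj₁ (proj₂ (proj₂ (proj₂ (lab tL q))))) (proj₁ (proj₂ (proj₂ (proj₂ (lab tL′ q′))))) e (proj₂ (proj₂ (proj₂ (proj₂ (lab tL q))))) (proj₂ (proj₂ (proj₂ (proj₂ (lab tL′ q′)))))))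
  (cong (λ z → N * z !) (LP.length-tabulate {n = d′} suc))
  where
  n : ℕ
  n = edgesOf b m
  dec : ∀ s a → GoodMap b n m s a → Σ Tm λ t → Σ (Half t → Fin (suc d′)) λ p → Realizes s a t p
  dec s a = decodeGood de
  lab : (tL : Tm × List (Fin (suc d′))) → InClass b (PS c (2 * b)) m (proj₁ tL) × proj₂ tL ↭ tabulate suc →
    Σ (Perm (suc d′)) λ s → Σ (Perm (suc d′)) λ a → Σ (Half (proj₁ tL) → Fin (suc d′)) λ p → Realizes s a (proj₁ tL) p × map p (halves (proj₁ tL)) ≡ zero ∷ proj₂ tL
  lab (t , L) (q , pm) = labelClass de t q L pm
  real : ∀ sa (g : GoodMap b n m (proj₁ sa) (proj₂ sa)) → Realizes (proj₁ sa) (proj₂ sa) (proj₁ (dec (proj₁ sa) (proj₂ sa) g)) (proj₁ (proj₂ (dec (proj₁ sa) (proj₂ sa) g)))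
  real sa g = proj₂ (proj₂ (dec (proj₁ sa) (proj₂ sa) g))

labelledCount-serE : ∀ {k} b c (m : Vec ℕ k) → 2 * b ≡ suc (suc c) → (+ ((2 * edgesOf b m ∸ 1) !)) *ℤ serE b c (2 * b) m ≡ + labelledCount b m
labelledCount-serE b c m bc with isE b c (2 * b) m
... | N , h , e = trans (cong (λ z → (+ ((2 * edgesOf b m ∸ 1) !)) *ℤ z) e) (trans (sym (ℤP.pos-* ((2 * edgesOf b m ∸ 1) !) N))
  (cong +_ (trans (*-comm ((2 * edgesOf b m ∸ 1) !) N) (sym (labelled-rooted b c m (2 * edgesOf b m) bc refl h (card-labelled b m))))))

theorem6p2 : (b : ℕ) → 1 ≤ b → (k : ℕ) →
    Σ (ℕ → Ser k) (λ V →
        IsSolution b V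
      × (∀ (W : ℕ → Ser k) → IsSolution b W → ∀ t → t ≤ suc b → ∀ m → W t m ≡ V t m)
      × (∀ (m : Vec ℕ k) →
           (+ ((2 * edgesOf b m ∸ 1) !)) *ℤ formula b V m ≡ + labelledCount b m))
theorem6p2 (suc b′) _ k = Vs , solution , (λ W w → solution-unique (suc b′) W Vs w solution) , λ m →
    trans (cong (λ z → (+ ((2 * edgesOf (suc b′) m ∸ 1) !)) *ℤ z) (trans (formula-W m) (cong (λ z → serE (suc b′) (even b′) z m) (even-2* (suc b′)))))
      (labelledCount-serE (suc b′) (even b′) m (sym (even-2* (suc b′))))
  where open Algebra b′ k
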